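{- Let $\kappa_1,\kappa_2,\dots$ and $\kappa_{i,j}$ ($i,j\ge1$) be formal indeterminates, $X(y)=\frac{1}{y}+\sum_{i\ge1}\kappa_iy^{i-1}$ and $X(y_1,y_2)=\sum_{i,j\ge1}\kappa_{i,j}y_1^{i-1}y_2^{j-1}$. Let $W^{(0)}_{par,2}(x_1,x_2)=\sum_{i,j\ge1}m^{(0)}_{i,j}x_1^{ -i-1}x_2^{ -j-1}$ be the generating series of connected partitions of cylinder type defined in the context. Then, as formal series in $y_1,y_2$, \begin{align*} W^{(0)}_{par,2}(X(y_1),X(y_2))=&\frac{X(y_1,y_2)+\frac{1}{(y_1-y_2)^2}}{X'(y_1)X'(y_2)}-\frac{1}{(X(y_1)-X(y_2))^2}\\ &+\frac{\frac{1}{y_1y_2}\left(1-y_1\partial_{y_1}y_2\partial_{y_2}\right)\left(y_1y_2\frac{X(y_1)-X(y_2)}{y_1-y_2}+1\right)}{X'(y_1)X'(y_2)}. \end{align*}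
   Context: Fix $i,j\ge1$, let $A=\{1,\dots,i\}$ (first boundary) and $B=\{i+1,\dots,i+j\}$ (second boundary), and let $\tau\in\mathcal S_{i+j}$ be the permutation with the two cycles $(1,2,\dots,i)(i+1,\dots,i+j)$. Write $l(\sigma)$ for the number of cycles of a permutation. A permutation $\sigma\in\mathcal S_{i+j}$ is called annular non-crossing if at least one cycle of $\sigma$ meets both $A$ and $B$ and $l(\sigma)+l(\sigma^{ -1}\tau)=i+j$ (i.e. it has genus $0$ for the genus formula $2g=n+2-b-l(\sigma)-l(\sigma^{ -1}\tau)$ with $b=2$ boundaries). A set partition of $A\cup B$ is annular non-crossing if it is the set of (supports of) cycles of some annular non-crossing permutation. A partition of $A$ (resp. $B$) is non-crossing if it has genus $0$ (equivalently, is non-crossing with respect to the cyclic order of $A$, resp. $B$). Define \[ m^{(0)}_{i,j}=\sum_{\pi}\prod_{V\in\pi}\kappa_{|V|}\;+\;\sum_{(\pi_1,V_1,\pi_2,V_2)}\kappa_{|V_1|,|V_2|}\prod_{V\in\pi_1\setminus\{V_1\}}\kappa_{|V|}\prod_{V\in\pi_2\setminus\{V_2\}}\kappa_{|V|}, \] where the first sum is over annular non-crossing partitions $\pi$ of $A\cup B$, and the second is over non-crossing partitions $\pi_1$ of $A$ with a distinguished block $V_1\in\pi_1$ and non-crossing partitions $\pi_2$ of $B$ with a distinguished block $V_2\in\pi_2$ (the two distinguished blocks forming a single block of cylinder type, weighted $\kappa_{|V_1|,|V_2|}$). Since $1/X(y)$ is a power series in $y$ with leading term $y$, $W^{(0)}_{par,2}(X(y_1),X(y_2))$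 is a formal power series in $y_1,y_2$; $X'$ denotes the $y$-derivative. -}

module Defs where

open import Level using (Level)
open import Data.Bool using (Bool; true; false; _∧_; _∨_; not; if_then_else_)
open import Data.Nat using (ℕ; zero; suc; _+_; _*_; _∸_; _≡ᵇ_; _<ᵇ_; _≤ᵇ_)
open import Data.List using (List; []; _∷_; [_]; map; concatMap; upTo; length; foldr; filterᵇ)
open import Data.Bool.ListAction using (any; all)
open import Data.Product using (_×_; _,_; proj₁; proj₂)
open import Algebra.Bundles using (CommutativeRing)

-- Part 1. Finite combinatorics on {0,…,n-1}  (0-indexed: the paper's
-- element k+1 is our k).  A = {0,…,i-1}, B = {i,…,i+j-1}.

nth : List ℕ → ℕ → ℕ → ℕ
nth []       d _       = d
nth (x ∷ xs) d zero    = x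
nth (x ∷ xs) d (suc k) = nth xs d k

memb : ℕ → List ℕ → Bool
memb k xs = any (λ x → x ≡ᵇ k) xs

-- A permutation of {0,…,n-1} is represented by its list of images
-- [σ 0, σ 1, …, σ (n-1)].
Perm : Set
Perm = List ℕ

app : Perm → ℕ → ℕ
app σ k = nth σ k k

insertions : ℕ → List ℕ → List (List ℕ)
insertions x []       = [ [ x ] ]
insertions x (y ∷ ys) = (x ∷ y ∷ ys) ∷ map (y ∷_) (insertions x ys)

perms : List ℕ → List (List ℕ)
perms []       = [ [] ]
perms (x ∷ xs) = concatMap (insertions x) (perms xs)

allPerms : ℕ → List Perm
allPerms n = perms (upTo n)

iter : (ℕ → ℕ) → ℕ → ℕ → ℕ
iter f zero    k = k
iter f (suc t) k = f (iter f t k)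

inOrbit : ℕ → (ℕ → ℕ) → ℕ → ℕ → Bool
inOrbit n f k l = any (λ t → iter f t k ≡ᵇ l) (upTo n)

-- number of cycles l(f): count the elements that are the minimum of their cycle
numCycles : ℕ → (ℕ → ℕ) → ℕ
numCycles n f = length (filterᵇ (λ k → all (λ t → k ≤ᵇ iter f t k) (upTo n)) (upTo n))

invPerm : ℕ → Perm → ℕ → ℕ
invPerm n σ m = foldr (λ k r → if app σ k ≡ᵇ m then k else r) m (upTo n)

-- τ = (0 1 … i-1)(i i+1 … i+j-1)
tau : ℕ → ℕ → ℕ → ℕ
tau i j k =
  if k <ᵇ i
  then (if suc k <ᵇ i then suc k else 0)
  else (if suc k <ᵇ (i + j) then suc k else i)

invστ : ℕ → ℕ → Perm → ℕ → ℕ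
invστ i j σ k = invPerm (i + j) σ (tau i j k)

meetsBoth : ℕ → ℕ → Perm → Bool
meetsBoth i j σ =
  any (λ k → any (λ l → inOrbit (i + j) (app σ) k (i + l)) (upTo j)) (upTo i)

isAnnNCPerm : ℕ → ℕ → Perm → Bool
isAnnNCPerm i j σ =
  meetsBoth i j σ ∧
  (numCycles (i + j) (app σ) + numCycles (i + j) (invστ i j σ) ≡ᵇ i + j)

-- Set partitions of a list of (distinct) elements, as lists of blocks;
-- every set partition occurs exactly once.
addToEach : ℕ → List (List ℕ) → List (List (List ℕ))
addToEach x []       = []
addToEach x (b ∷ bs) = ((x ∷ b) ∷ bs) ∷ map (b ∷_) (addToEach x bs)

setPartitions : List ℕ → List (List (List ℕ))
setPartitions []       = [ [] ]
setPartitions (x ∷ xs) =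
  concatMap (λ p → ([ x ] ∷ p) ∷ addToEach x p) (setPartitions xs)

sameBlock : List (List ℕ) → ℕ → ℕ → Bool
sameBlock π k l = any (λ b → memb k b ∧ memb l b) π

boolEq : Bool → Bool → Bool
boolEq true  b = b
boolEq false b = not b

cyclesAre : ℕ → Perm → List (List ℕ) → Bool
cyclesAre n σ π =
  all (λ k → all (λ l → boolEq (sameBlock π k l) (inOrbit n (app σ) k l)) (upTo n)) (upTo n)

isAnnNCPartition : ℕ → ℕ → List (List ℕ) → Bool
isAnnNCPartition i j π =
  any (λ σ → isAnnNCPerm i j σ ∧ cyclesAre (i + j) σ π) (allPerms (i + j))

hasCrossing : List ℕ → List (List ℕ) → Bool
hasCrossing el π =
  any (λ p → any (λ q → any (λ r → any (λ s →
        (p <ᵇ q) ∧ (q <ᵇ r) ∧ (r <ᵇ s) ∧ sameBlock π p r ∧ sameBlock π q s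
        ∧ not (sameBlock π p q)) el) el) el) el

ncPartitions : List ℕ → List (List (List ℕ))
ncPartitions el = filterᵇ (λ π → not (hasCrossing el π)) (setPartitions el)

setA : ℕ → List ℕ
setA i = upTo i

setB : ℕ → ℕ → List ℕ
setB i j = map (i +_) (upTo j)

pointings : {a : Level} {X : Set a} → List X → List (X × List X)
pointings []       = []
pointings (x ∷ xs) = (x , xs) ∷ map (λ p → proj₁ p , x ∷ proj₂ p) (pointings xs)

-- Part 2. Everything over an arbitrary commutative ring R, in which the
-- indeterminates κ_n, κ_{n,m} take values.

module Over {c ℓ : Level} (R : CommutativeRing c ℓ) where
  open CommutativeRing R renaming (_+_ to _+R_; _*_ to _*R_)

  sumR : List Carrier → Carrier
  sumR = foldr _+R_ 0#

  prodR : List Carrier → Carrier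
  prodR = foldr _*R_ 1#

  natMul : ℕ → Carrier → Carrier
  natMul zero    x = 0#
  natMul (suc n) x = x +R natMul n x

  mCyl : (ℕ → Carrier) → (ℕ → ℕ → Carrier) → ℕ → ℕ → Carrier
  mCyl κ κ₂ i j =
    sumR (map (λ π → prodR (map (λ V → κ (length V)) π))
              (filterᵇ (isAnnNCPartition i j) (setPartitions (upTo (i + j)))))
    +R
    sumR (concatMap (λ π₁ → concatMap (λ π₂ →
           concatMap (λ P₁ → map (λ P₂ →
             κ₂ (length (proj₁ P₁)) (length (proj₁ P₂))
             *R prodR (map (λ V → κ (length V)) (proj₂ P₁))
             *R prodR (map (λ V → κ (length V)) (proj₂ P₂)))
           (pointings π₂)) (pointings π₁))
         (ncPartitions (setB i j))) (ncPartitions (setA i)))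

  -- formal power series in one variable y, and in two variables y₁, y₂
  -- (coefficient of y^n, resp. y₁^a y₂^b)
  PS1 : Set c
  PS1 = ℕ → Carrier

  PS2 : Set c
  PS2 = ℕ → ℕ → Carrier

  one1 : PS1
  one1 zero    = 1#
  one1 (suc n) = 0#

  _*₁_ : PS1 → PS1 → PS1
  (f *₁ g) n = sumR (map (λ k → f k *R g (n ∸ k)) (upTo (suc n)))

  pow1 : PS1 → ℕ → PS1
  pow1 f zero    = one1
  pow1 f (suc k) = f *₁ pow1 f k

  -- inverse of a series with constant term 1:  1/f = Σ_k (1 - f)^k
  inv1 : PS1 → PS1
  inv1 f n = sumR (map (λ k → pow1 (λ m → one1 m - f m) k n) (upTo (suc n)))

  infixl 6 _+₂_ _-₂_
  infixl 7 _*₂_ _*₁_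

  _+₂_ : PS2 → PS2 → PS2
  (f +₂ g) a b = f a b +R g a b

  _-₂_ : PS2 → PS2 → PS2
  (f -₂ g) a b = f a b - g a b

  _*₂_ : PS2 → PS2 → PS2
  (f *₂ g) a b =
    sumR (concatMap (λ k → map (λ l → f k l *R g (a ∸ k) (b ∸ l)) (upTo (suc b)))
                    (upTo (suc a)))

  mono : ℕ → ℕ → PS2
  mono p q a b = if (a ≡ᵇ p) ∧ (b ≡ᵇ q) then 1# else 0#

  inY₁ : PS1 → PS2
  inY₁ f a zero    = f a
  inY₁ f a (suc b) = 0#

  inY₂ : PS1 → PS2
  inY₂ f zero    b = f b
  inY₂ f (suc a) b = 0#

  -- Xt = y X(y) = 1 + Σ_{i≥1} κ_i y^i
  Xt : (ℕ → Carrier) → PS1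
  Xt κ zero    = 1#
  Xt κ (suc n) = κ (suc n)

  -- Xp = y² X'(y) = -1 + Σ_{i≥1} (i-1) κ_i y^i
  Xp : (ℕ → Carrier) → PS1
  Xp κ zero    = - 1#
  Xp κ (suc n) = natMul n (κ (suc n))

  -- 1/X(y) = y · (1/Xt(y))
  Xrec : (ℕ → Carrier) → PS1
  Xrec κ zero    = 0#
  Xrec κ (suc n) = inv1 (Xt κ) n

  -- W^{(0)}_{par,2}(X(y₁),X(y₂)) = Σ_{i,j≥1} m_{i,j} (1/X(y₁))^{i+1} (1/X(y₂))^{j+1};
  -- (1/X(y))^{i+1} has order i+1, so only i ≤ a, j ≤ b contribute to y₁^a y₂^b.
  Wpar2∘X : (ℕ → Carrier) → (ℕ → ℕ → Carrier) → PS2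
  Wpar2∘X κ κ₂ a b =
    sumR (concatMap (λ i → map (λ j →
            mCyl κ κ₂ i j *R pow1 (Xrec κ) (suc i) a *R pow1 (Xrec κ) (suc j) b)
          (map suc (upTo b))) (map suc (upTo a)))

  X₂ : (ℕ → ℕ → Carrier) → PS2
  X₂ κ₂ a b = κ₂ (suc a) (suc b)

  Δ : PS2
  Δ = mono 1 0 -₂ mono 0 1

  -- G = y₁y₂ (X(y₁) - X(y₂)) = y₂ Xt(y₁) - y₁ Xt(y₂)
  G : (ℕ → Carrier) → PS2
  G κ = (mono 0 1 *₂ inY₁ (Xt κ)) -₂ (mono 1 0 *₂ inY₂ (Xt κ))

  -- H = y₁y₂ (X(y₁) - X(y₂)) / (y₁ - y₂)
  --   = -1 + Σ_{n≥2} κ_n Σ_{a+b=n, a,b≥1} y₁^a y₂^b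
  H : (ℕ → Carrier) → PS2
  H κ zero    zero    = - 1#
  H κ zero    (suc b) = 0#
  H κ (suc a) zero    = 0#
  H κ (suc a) (suc b) = κ (suc a + suc b)

  -- (1 - y₁∂_{y₁} y₂∂_{y₂}) F
  θθ-op : PS2 → PS2
  θθ-op F a b = F a b - natMul (a * b) (F a b)

  -- Left side of the identity multiplied by
  --   M = y₁⁴y₂⁴ X'(y₁) X'(y₂) (y₁-y₂)² (X(y₁)-X(y₂))²
  --     = Xp(y₁) Xp(y₂) (y₁-y₂)² G²
  lhsCleared : (ℕ → Carrier) → (ℕ → ℕ → Carrier) → PS2
  lhsCleared κ κ₂ =
    Wpar2∘X κ κ₂ *₂ (inY₁ (Xp κ) *₂ inY₂ (Xp κ) *₂ (Δ *₂ Δ) *₂ (G κ *₂ G κ))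

  -- Right side of the identity multiplied by the same M, term by term:
  --   (X(y₁,y₂) + 1/(y₁-y₂)²)/(X'X') · M = y₁²y₂² G² ((y₁-y₂)² X(y₁,y₂) + 1)
  --   1/(X(y₁)-X(y₂))² · M               = y₁²y₂² (y₁-y₂)² Xp(y₁) Xp(y₂)
  --   [third term] · M  = y₁y₂ (y₁-y₂)² G² (1 - y₁∂y₂∂)(H + 1)
  rhsCleared : (ℕ → Carrier) → (ℕ → ℕ → Carrier) → PS2
  rhsCleared κ κ₂ =
    ((mono 2 2 *₂ (G κ *₂ G κ)) *₂ (((Δ *₂ Δ) *₂ X₂ κ₂) +₂ mono 0 0))
    -₂ ((mono 2 2 *₂ (Δ *₂ Δ)) *₂ (inY₁ (Xp κ) *₂ inY₂ (Xp κ)))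
    +₂ ((mono 1 1 *₂ ((Δ *₂ Δ) *₂ (G κ *₂ G κ))) *₂ θθ-op (H κ +₂ mono 0 0))

{-# OPTIONS --safe #-}
module Submission where

-- Every annular non-crossing partition arises from a block of A and a block of B by splitting their
-- union into spokes, the blocks meeting both circles; so m_{i,j} is the second sum alone, with κ_{p,q}
-- replaced by κ_{p,q} + s_{p,q}, where s_{p,q} weighs the splittings. To see this, an element x with
-- σ x = x or σ x = τ x is removed from a genus 0 permutation σ; when there is none, all cycles have
-- length two and join the circles. Sums over non-crossing partitions with a distinguished block are
-- derivatives of moments along κ + ε v, and inserting the elements one at a time makes their
-- generating series telescope. With d₁ = y₁∂₁, d₂ = y₂∂₂ and h = H + 1 the series of s_{p,q} is
-- h − d₁d₂h + d₂(d₁h / (1 − h)) = (1 − d₁d₂)h − d₁d₂ log H, and log H = log G − log Δ.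

open import Defs
open import Level using (Level; _⊔_)
open import Algebra.Bundles using (CommutativeRing; RawRing)
open import Data.Nat as ℕ using (ℕ; suc; zero; _≤_; _<_; z≤n; s≤s; _∸_; _≡ᵇ_; _<ᵇ_; _≤ᵇ_; pred; NonZero)
import Data.Nat.Properties as ℕP
open import Data.Product using (_×_; _,_; proj₁; proj₂; ∃; ∃-syntax)
open import Data.Maybe using (Maybe; just; nothing)
open import Relation.Nullary using (yes; no; ¬_; Dec)
open import Relation.Binary.PropositionalEquality as ≡ using (_≡_; _≢_; cong; cong₂; subst; subst₂)
import Algebra.Solver.Ring
import Algebra.Solver.Ring.NaturalCoefficients.Default
import Algebra.Solver.Ring.AlmostCommutativeRing as ACR
import Algebra.Properties.Monoid.Mult
import Algebra.Properties.Semiring.Mult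
open import Data.List using (List; []; _∷_; map; upTo; applyUpTo; concatMap; _++_; length; [_]; replicate; reverse; filterᵇ; foldr; concat)
open import Data.List.Properties using (map-upTo; map-++; ++-assoc; ++-identityʳ; length-++; unfold-reverse; reverse-involutive; reverse-map; ∷-injective; length-upTo; filter-++; upTo-∷ʳ; ++-conicalʳ; length-map; length-replicate; length-take; take++drop≡id; map-cong-local; ∷ʳ-injective; map-replicate; map-∘; concat-++; concatMap-cong)
open import Function using (_∘_; id)
open import Data.Bool using (Bool; true; false; _∧_; _∨_; not; T; if_then_else_)
open import Data.Bool.ListAction using (any; all)
import Data.Bool.Properties as BP
open import Data.Empty using (⊥-elim; ⊥)
open import Data.List.Membership.Propositional using (_∈_; _∉_; find; lose)
open import Data.List.Relation.Unary.Any as Any using (here; there)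
open import Function.Bundles using (Equivalence)
open import Data.Sum using (_⊎_; inj₁; inj₂)
open import Data.List.Relation.Unary.All as All using (All; []; _∷_)
open import Data.List.Relation.Unary.AllPairs as AP using ([]; _∷_; AllPairs)
open import Data.List.Relation.Unary.Unique.Propositional using (Unique)
open import Data.List.Relation.Binary.Permutation.Propositional as Perm using (_↭_; ↭-sym; ↭-refl; ↭-trans; ↭-reflexive)
import Data.List.Relation.Binary.Permutation.Propositional.Properties as PermP
import Data.List.Relation.Binary.Permutation.Setoid.Properties as PermS
open import Data.List.Membership.Propositional.Properties using (∈-∃++; ∈-++⁺ˡ; ∈-++⁺ʳ; ∈-++⁻; ∈-map⁻; ∈-map⁺; ∈-upTo⁺; ∈-upTo⁻; ∈-concat⁺′; ∈-concat⁻′)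
import Data.List.Relation.Binary.Sublist.Propositional.Properties as SubP
open import Data.Unit using (⊤; tt)
open import Data.Bool.Properties using (T?)
open import Data.Fin using (Fin; toℕ; fromℕ<)
import Data.Fin.Properties as FinP
import Data.List.Membership.Propositional.Properties as MemP
import Data.List.Relation.Unary.Unique.Propositional.Properties as UP
open import Relation.Binary.Definitions using (tri<; tri≈; tri>)
import Data.List.Relation.Unary.AllPairs.Properties as APP
open import Data.List.Relation.Binary.Sublist.Propositional.Properties using (++⁺)

-- Two obstacles shape the proof. A partition with a single spoke can be the cycle partition of
-- several genus 0 permutations, so partitions cannot be counted through permutations. Genus 0 is
-- therefore translated into a property of the two words of block colours read around the circles
-- (`AnnularNC`), which no longer mentions a permutation, and spoke partitions are counted by normal
-- forms of such words. This also explains the series of s: in d₂(d₁h / (1 - h)) the operator d₁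
-- chooses where the starting point of one circle cuts the first spoke, and d₂ how far the other
-- circle is turned. For a single spoke all these choices give the same partition, hence h in place
-- of d₁d₂h. The other obstacle is that the coefficient ring is arbitrary: there are no logarithms
-- and no division by integers. Quotients therefore occur only multiplied out. The factors K = -y²X′
-- stay next to W, and log H enters only through its second derivative, written with S = -1/H.

-- Coefficients are formal differences m − n of naturals, compared as integers;
-- with coefficients in R itself the normaliser could not see that 1 − 1 vanishes.
module Solver {c ℓ : Level} (R : CommutativeRing c ℓ) where
 open CommutativeRing R
 open Algebra.Properties.Monoid.Mult +-monoid using (×-homo-+; ×-homo-1) renaming (_×_ to _·_; ×-cong to ·-cong)
 open Algebra.Properties.Semiring.Mult semiring using (×1-homo-*)
 open import Algebra.Properties.Ring ring using (-‿distribˡ-*; -‿distribʳ-*; -‿+-comm; -0#≈0#; -‿involutive)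
 private
   acr = ACR.fromCommutativeRing R
   module S₀ = Algebra.Solver.Ring.NaturalCoefficients.Default commutativeSemiring

   coeff : RawRing _ _
   coeff = record
     { Carrier = ℕ × ℕ ; _≈_ = _≡_
     ; _+_ = λ { (a , b) (c , d) → a ℕ.+ c , b ℕ.+ d }
     ; _*_ = λ { (a , b) (c , d) → a ℕ.* c ℕ.+ b ℕ.* d , a ℕ.* d ℕ.+ b ℕ.* c }
     ; -_ = λ { (a , b) → b , a }
     ; 0# = 0 , 0 ; 1# = 1 , 0 }

   embed : ℕ → Carrier
   embed 0 = 0#
   embed 1 = 1#
   embed (suc (suc n)) = 1# + embed (suc n)

   embed≈ : ∀ n → embed n ≈ n · 1#
   embed≈ 0 = refl
   embed≈ 1 = sym (×-homo-1 1#)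
   embed≈ (suc (suc n)) = +-congˡ (embed≈ (suc n))

   -- The case split makes the constants 0 and 1 evaluate definitionally to 0# and 1#.
   val : ℕ × ℕ → Carrier
   val (a , 0) = embed a
   val (a , suc b) = embed a + - embed (suc b)

   val≈ : ∀ p → val p ≈ proj₁ p · 1# + - (proj₂ p · 1#)
   val≈ (a , 0) = trans (embed≈ a) (sym (trans (+-congˡ -0#≈0#) (+-identityʳ _)))
   val≈ (a , suc b) = +-cong (embed≈ a) (-‿cong (embed≈ (suc b)))

   hom+ : ∀ m n → (m ℕ.+ n) · 1# ≈ m · 1# + n · 1#
   hom+ m n = ×-homo-+ 1# m n

   hom+* : ∀ a b c d → (a ℕ.* b ℕ.+ c ℕ.* d) · 1# ≈ a · 1# * b · 1# + c · 1# * d · 1#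
   hom+* a b c d = trans (hom+ (a ℕ.* b) (c ℕ.* d)) (+-cong (×1-homo-* a b) (×1-homo-* c d))

   morphism : coeff ACR.-Raw-AlmostCommutative⟶ acr
   morphism = record
     { ⟦_⟧ = val
     ; +-homo = λ { (a , b) (c , d) → lift₂ (a , b) (c , d) (a ℕ.+ c , b ℕ.+ d) +-cong (trans (+-cong (hom+ a c) (trans (-‿cong (hom+ b d)) (sym (-‿+-comm _ _))))
       (S₀.solve 4 (λ a b c d → (a S₀.:+ c) S₀.:+ (b S₀.:+ d) S₀.:= (a S₀.:+ b) S₀.:+ (c S₀.:+ d))
         refl (a · 1#) (- (b · 1#)) (c · 1#) (- (d · 1#)))) }
     ; *-homo = λ { (a , b) (c , d) → lift₂ (a , b) (c , d) (a ℕ.* c ℕ.+ b ℕ.* d , a ℕ.* d ℕ.+ b ℕ.* c) *-cong (trans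
       (+-cong (trans (hom+* a c b d) (+-congˡ (neg*neg _ _)))
         (trans (-‿cong (hom+* a d b c))
           (trans (sym (-‿+-comm _ _)) (+-cong (-‿distribʳ-* _ _) (-‿distribˡ-* _ _)))))
       (S₀.solve 4 (λ a b c d → (a S₀.:* c S₀.:+ b S₀.:* d) S₀.:+ (a S₀.:* d S₀.:+ b S₀.:* c) S₀.:=
         (a S₀.:+ b) S₀.:* (c S₀.:+ d)) refl (a · 1#) (- (b · 1#)) (c · 1#) (- (d · 1#)))) }
     ; -‿homo = λ { (a , b) → trans (trans (val≈ (b , a)) (trans (+-comm _ _) (trans (+-congˡ (sym (-‿involutive _))) (-‿+-comm _ _))))
       (-‿cong (sym (val≈ (a , b)))) }
     ; 0-homo = refl
     ; 1-homo = refl }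
     where
     lift₂ : ∀ p q (r : ℕ × ℕ) {_∙_ : Carrier → Carrier → Carrier} →
       (∀ {x y u v} → x ≈ y → u ≈ v → x ∙ u ≈ y ∙ v) →
       proj₁ r · 1# + - (proj₂ r · 1#) ≈ (proj₁ p · 1# + - (proj₂ p · 1#)) ∙ (proj₁ q · 1# + - (proj₂ q · 1#)) →
       val r ≈ val p ∙ val q
     lift₂ p q r ∙-cong e = trans (val≈ r) (trans e (∙-cong (sym (val≈ p)) (sym (val≈ q))))

     neg*neg : ∀ x y → x * y ≈ - x * - y
     neg*neg x y = trans (sym (-‿involutive _)) (trans (-‿cong (-‿distribʳ-* x y)) (-‿distribˡ-* x (- y)))

   cross : ∀ a b c d → a + d ≈ c + b → a + - b ≈ c + - d
   cross a b c d e = begin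
     a + - b ≈⟨ +-identityʳ _ ⟨
     (a + - b) + 0# ≈⟨ +-congˡ (-‿inverseʳ d) ⟨
     (a + - b) + (d + - d) ≈⟨ S₀.solve 4 (λ a b d d' → (a S₀.:+ b) S₀.:+ (d S₀.:+ d') S₀.:= (a S₀.:+ d) S₀.:+ (b S₀.:+ d')) refl a (- b) d (- d) ⟩
     (a + d) + (- b + - d) ≈⟨ +-congʳ e ⟩
     (c + b) + (- b + - d) ≈⟨ S₀.solve 4 (λ c b b' d → (c S₀.:+ b) S₀.:+ (b' S₀.:+ d) S₀.:= (c S₀.:+ d) S₀.:+ (b S₀.:+ b')) refl c b (- b) (- d) ⟩
     (c + - d) + (b + - b) ≈⟨ +-congˡ (-‿inverseʳ b) ⟩
     (c + - d) + 0# ≈⟨ +-identityʳ _ ⟩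
     c + - d ∎
     where open import Relation.Binary.Reasoning.Setoid setoid

   dec : ∀ x y → Maybe (val x ≈ val y)
   dec (a , b) (c , d) with (a ℕ.+ d) ℕP.≟ (c ℕ.+ b)
   ... | no _ = nothing
   ... | yes e = just (trans (val≈ (a , b)) (trans (cross _ _ _ _ (trans (sym (hom+ a d)) (trans (·-cong e refl) (hom+ c b)))) (sym (val≈ (c , d)))))

 open Algebra.Solver.Ring coeff acr morphism dec public using (solve; _:=_; _:+_; _:*_; :-_; _:-_; con)

-- Finite sums and formal power series

module SumProperties {c ℓ : Level} (R : CommutativeRing c ℓ) where
 open CommutativeRing R hiding (zero)
 open Over R
 open Solver R

 sumR-cong : ∀ {a} {A : Set a} (f g : A → Carrier) xs → (∀ x → f x ≈ g x) → sumR (map f xs) ≈ sumR (map g xs)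
 sumR-cong f g [] e = refl
 sumR-cong f g (x ∷ xs) e = +-cong (e x) (sumR-cong f g xs e)

 sumR-++ : ∀ xs ys → sumR (xs ++ ys) ≈ sumR xs + sumR ys
 sumR-++ [] ys = sym (+-identityˡ _)
 sumR-++ (x ∷ xs) ys = trans (+-congˡ (sumR-++ xs ys)) (sym (+-assoc _ _ _))

 sumR-concatMap : ∀ {a} {A : Set a} (f : A → List Carrier) xs → sumR (concatMap f xs) ≈ sumR (map (sumR ∘ f) xs)
 sumR-concatMap f [] = refl
 sumR-concatMap f (x ∷ xs) = trans (sumR-++ (f x) _) (+-congˡ (sumR-concatMap f xs))

 sumR-+ : ∀ {a} {A : Set a} (f g : A → Carrier) xs →
   sumR (map (λ x → f x + g x) xs) ≈ sumR (map f xs) + sumR (map g xs)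
 sumR-+ f g [] = sym (+-identityˡ _)
 sumR-+ f g (x ∷ xs) = trans (+-congˡ (sumR-+ f g xs))
   (solve 4 (λ a b c d → (a :+ b) :+ (c :+ d) := (a :+ c) :+ (b :+ d)) refl _ _ _ _)

 sumR-0 : ∀ {a} {A : Set a} (f : A → Carrier) xs → (∀ x → f x ≈ 0#) → sumR (map f xs) ≈ 0#
 sumR-0 f [] e = refl
 sumR-0 f (x ∷ xs) e = trans (+-cong (e x) (sumR-0 f xs e)) (+-identityˡ _)

 sumR-*ˡ : ∀ {a} {A : Set a} k (f : A → Carrier) xs → k * sumR (map f xs) ≈ sumR (map (λ x → k * f x) xs)
 sumR-*ˡ k f [] = zeroʳ k
 sumR-*ˡ k f (x ∷ xs) = trans (distribˡ k _ _) (+-congˡ (sumR-*ˡ k f xs))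

 sumR-*ʳ : ∀ {a} {A : Set a} k (f : A → Carrier) xs → sumR (map f xs) * k ≈ sumR (map (λ x → f x * k) xs)
 sumR-*ʳ k f [] = zeroˡ k
 sumR-*ʳ k f (x ∷ xs) = trans (distribʳ k _ _) (+-congˡ (sumR-*ʳ k f xs))

 sumR-swap : ∀ {a b} {A : Set a} {B : Set b} (f : A → B → Carrier) xs ys →
   sumR (map (λ x → sumR (map (f x) ys)) xs) ≈ sumR (map (λ y → sumR (map (λ x → f x y) xs)) ys)
 sumR-swap f [] ys = sym (sumR-0 _ ys (λ _ → refl))
 sumR-swap f (x ∷ xs) ys = trans (+-congˡ (sumR-swap f xs ys)) (sym (sumR-+ _ _ ys))

 -- Splits off the first index, as `conv` does, so that sums and products of series unfold in step.
 Σ< : ℕ → (ℕ → Carrier) → Carrier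
 Σ< zero f = 0#
 Σ< (suc n) f = f 0 + Σ< n (f ∘ suc)

 sumR-applyUpTo : ∀ f n → sumR (applyUpTo f n) ≈ Σ< n f
 sumR-applyUpTo f zero = refl
 sumR-applyUpTo f (suc n) = +-congˡ (sumR-applyUpTo (f ∘ suc) n)

 sumR-upTo : ∀ f n → sumR (map f (upTo n)) ≈ Σ< n f
 sumR-upTo f n = trans (reflexive (cong sumR (map-upTo f n))) (sumR-applyUpTo f n)

 Σ<-cong : ∀ n {f g : ℕ → Carrier} → (∀ k → k < n → f k ≈ g k) → Σ< n f ≈ Σ< n g
 Σ<-cong zero e = refl
 Σ<-cong (suc n) e = +-cong (e 0 (s≤s z≤n)) (Σ<-cong n (λ k k<n → e (suc k) (s≤s k<n)))

 Σ<-0 : ∀ n {f : ℕ → Carrier} → (∀ k → k < n → f k ≈ 0#) → Σ< n f ≈ 0#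
 Σ<-0 zero e = refl
 Σ<-0 (suc n) e = trans (+-cong (e 0 (s≤s z≤n)) (Σ<-0 n (λ k k<n → e (suc k) (s≤s k<n)))) (+-identityˡ 0#)

 Σ<-last : ∀ n f → Σ< (suc n) f ≈ Σ< n f + f n
 Σ<-last zero f = +-comm (f 0) 0#
 Σ<-last (suc n) f = trans (+-congˡ (Σ<-last n (f ∘ suc))) (sym (+-assoc _ _ _))

 Σ<-*ˡ : ∀ n k f → k * Σ< n f ≈ Σ< n (λ i → k * f i)
 Σ<-*ˡ zero k f = zeroʳ k
 Σ<-*ˡ (suc n) k f = trans (distribˡ k _ _) (+-congˡ (Σ<-*ˡ n k (f ∘ suc)))

 natMul-cong : ∀ n {x y} → x ≈ y → natMul n x ≈ natMul n y
 natMul-cong zero e = refl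
 natMul-cong (suc n) e = +-cong e (natMul-cong n e)

 natMul-0 : ∀ n → natMul n 0# ≈ 0#
 natMul-0 zero = refl
 natMul-0 (suc n) = trans (+-identityˡ _) (natMul-0 n)

 natMul-+ : ∀ n x y → natMul n (x + y) ≈ natMul n x + natMul n y
 natMul-+ zero x y = sym (+-identityˡ 0#)
 natMul-+ (suc n) x y = trans (+-congˡ (natMul-+ n x y))
   (solve 4 (λ a b c d → (a :+ b) :+ (c :+ d) := (a :+ c) :+ (b :+ d)) refl _ _ _ _)

 natMul-*ˡ : ∀ n x y → natMul n (x * y) ≈ natMul n x * y
 natMul-*ˡ zero x y = sym (zeroˡ y)
 natMul-*ˡ (suc n) x y = trans (+-congˡ (natMul-*ˡ n x y)) (sym (distribʳ y _ _))

 natMul-*ʳ : ∀ n x y → natMul n (x * y) ≈ x * natMul n y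
 natMul-*ʳ zero x y = sym (zeroʳ x)
 natMul-*ʳ (suc n) x y = trans (+-congˡ (natMul-*ʳ n x y)) (sym (distribˡ x _ _))

 natMul-homo-+ : ∀ m n x → natMul (m ℕ.+ n) x ≈ natMul m x + natMul n x
 natMul-homo-+ zero n x = sym (+-identityˡ _)
 natMul-homo-+ (suc m) n x = trans (+-congˡ (natMul-homo-+ m n x)) (sym (+-assoc _ _ _))

 natMul-homo-* : ∀ m n x → natMul (m ℕ.* n) x ≈ natMul m (natMul n x)
 natMul-homo-* zero n x = refl
 natMul-homo-* (suc m) n x = trans (natMul-homo-+ n (m ℕ.* n) x) (+-congˡ (natMul-homo-* m n x))

module PowerSeries {c ℓ : Level} (R : CommutativeRing c ℓ) where
 open CommutativeRing R hiding (zero)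
 open Over R
 open Solver R
 open SumProperties R

 -- The Cauchy product, by recursion on the first factor.
 conv : PS1 → PS1 → PS1
 conv f g zero = f 0 * g 0
 conv f g (suc n) = f 0 * g (suc n) + conv (f ∘ suc) g n

 conv-cong : ∀ n {f f' g g'} → (∀ m → m ≤ n → f m ≈ f' m) → (∀ m → m ≤ n → g m ≈ g' m) → conv f g n ≈ conv f' g' n
 conv-cong zero e e' = *-cong (e 0 z≤n) (e' 0 z≤n)
 conv-cong (suc n) e e' = +-cong (*-cong (e 0 z≤n) (e' (suc n) ℕP.≤-refl))
   (conv-cong n (λ m l → e (suc m) (s≤s l)) (λ m l → e' m (ℕP.m≤n⇒m≤1+n l)))

 Σ-conv : ∀ f g n → Σ< (suc n) (λ k → f k * g (n ∸ k)) ≈ conv f g n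
 Σ-conv f g zero = +-identityʳ _
 Σ-conv f g (suc n) = +-congˡ (Σ-conv (f ∘ suc) g n)

 *₁≈conv : ∀ f g n → (f *₁ g) n ≈ conv f g n
 *₁≈conv f g n = trans (sumR-upTo _ (suc n)) (Σ-conv f g n)

 -- The recursion from the other end; comparing it with the defining recursion makes commutativity
 -- an induction.
 conv-sucʳ : ∀ f g n → conv f g (suc n) ≈ conv f (g ∘ suc) n + f (suc n) * g 0
 conv-sucʳ f g zero = refl
 conv-sucʳ f g (suc n) = trans (+-congˡ (conv-sucʳ (f ∘ suc) g n)) (sym (+-assoc _ _ _))

 conv-comm : ∀ f g n → conv f g n ≈ conv g f n
 conv-comm f g zero = *-comm _ _
 conv-comm f g (suc n) = trans (+-cong (*-comm _ _) (conv-comm (f ∘ suc) g n))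
   (trans (+-comm _ _) (sym (conv-sucʳ g f n)))

 conv-+ʳ : ∀ f g h n → conv f (λ m → g m + h m) n ≈ conv f g n + conv f h n
 conv-+ʳ f g h zero = distribˡ _ _ _
 conv-+ʳ f g h (suc n) = trans (+-cong (distribˡ _ _ _) (conv-+ʳ (f ∘ suc) g h n))
   (solve 4 (λ a b c d → (a :+ b) :+ (c :+ d) := (a :+ c) :+ (b :+ d)) refl _ _ _ _)

 conv-+ˡ : ∀ f g h n → conv (λ m → g m + h m) f n ≈ conv g f n + conv h f n
 conv-+ˡ f g h n = trans (conv-comm _ f n) (trans (conv-+ʳ f g h n) (+-cong (conv-comm f g n) (conv-comm f h n)))

 conv-scale : ∀ k f g n → conv (λ m → k * f m) g n ≈ k * conv f g n
 conv-scale k f g zero = *-assoc _ _ _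
 conv-scale k f g (suc n) = trans (+-cong (*-assoc _ _ _) (conv-scale k (f ∘ suc) g n)) (sym (distribˡ _ _ _))

 conv-assoc : ∀ f g h n → conv (conv f g) h n ≈ conv f (conv g h) n
 conv-assoc f g h zero = *-assoc _ _ _
 conv-assoc f g h (suc n) = trans (+-congˡ (trans (conv-+ˡ h (λ m → f 0 * g (suc m)) (conv (f ∘ suc) g) n)
   (+-cong (conv-scale (f 0) (g ∘ suc) h n) (conv-assoc (f ∘ suc) g h n))))
   (solve 5 (λ a b c d e → a :* b :* c :+ (a :* d :+ e) := a :* (b :* c :+ d) :+ e) refl _ _ _ _ _)

 conv-zeroˡ : ∀ g n → conv (λ _ → 0#) g n ≈ 0#
 conv-zeroˡ g zero = zeroˡ _
 conv-zeroˡ g (suc n) = trans (+-cong (zeroˡ _) (conv-zeroˡ g n)) (+-identityˡ _)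

 const : Carrier → PS1
 const k zero = k
 const k (suc n) = 0#

 -- The variable y of the power series, not the series X(y) of the theorem.
 X : PS1
 X zero = 0#
 X (suc zero) = 1#
 X (suc (suc n)) = 0#

 conv-const : ∀ k f n → conv (const k) f n ≈ k * f n
 conv-const k f zero = refl
 conv-const k f (suc n) = trans (+-congˡ (conv-zeroˡ f n)) (+-identityʳ _)

 conv-one : ∀ f n → conv one1 f n ≈ f n
 conv-one f zero = *-identityˡ _
 conv-one f (suc n) = trans (+-cong (*-identityˡ _) (conv-zeroˡ f n)) (+-identityʳ _)

 conv-X : ∀ f n → conv X f (suc n) ≈ f n
 conv-X f n = trans (+-cong (zeroˡ _) (trans (conv-cong n {g = f} e (λ _ _ → refl)) (conv-one f n))) (+-identityˡ _)
   where
   e : ∀ m → m ≤ n → X (suc m) ≈ one1 m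
   e zero _ = refl
   e (suc m) _ = refl

 infix 4 _≋_
 _≋_ : PS1 → PS1 → Set ℓ
 f ≋ g = ∀ n → f n ≈ g n

 *₁-cong : ∀ {f f' g g'} → f ≋ f' → g ≋ g' → f *₁ g ≋ f' *₁ g'
 *₁-cong {f} {f'} {g} {g'} e e' n =
   trans (*₁≈conv f g n) (trans (conv-cong n (λ m _ → e m) (λ m _ → e' m)) (sym (*₁≈conv f' g' n)))

 *₁-comm : ∀ f g → f *₁ g ≋ g *₁ f
 *₁-comm f g n = trans (*₁≈conv f g n) (trans (conv-comm f g n) (sym (*₁≈conv g f n)))

 *₁-assoc : ∀ f g h → (f *₁ g) *₁ h ≋ f *₁ (g *₁ h)
 *₁-assoc f g h n = begin
   ((f *₁ g) *₁ h) n ≈⟨ *₁≈conv _ h n ⟩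
   conv (f *₁ g) h n ≈⟨ conv-cong n (λ m _ → *₁≈conv f g m) (λ _ _ → refl) ⟩
   conv (conv f g) h n ≈⟨ conv-assoc f g h n ⟩
   conv f (conv g h) n ≈⟨ conv-cong n (λ _ _ → refl) (λ m _ → *₁≈conv g h m) ⟨
   conv f (g *₁ h) n ≈⟨ *₁≈conv f _ n ⟨
   (f *₁ (g *₁ h)) n ∎
   where open import Relation.Binary.Reasoning.Setoid setoid

 *₁-distribˡ : ∀ f g h → f *₁ (λ n → g n + h n) ≋ (λ n → (f *₁ g) n + (f *₁ h) n)
 *₁-distribˡ f g h n = trans (*₁≈conv f _ n) (trans (conv-+ʳ f g h n)
   (sym (+-cong (*₁≈conv f g n) (*₁≈conv f h n))))

 *₁-identityˡ : ∀ f → one1 *₁ f ≋ f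
 *₁-identityˡ f n = trans (*₁≈conv one1 f n) (conv-one f n)

 -- With series forming a ring again, all constructions can be iterated: series over series give two
 -- variables, and dual numbers over series give derivatives.
 PSRing : CommutativeRing c ℓ
 PSRing = record
   { Carrier = PS1 ; _≈_ = _≋_
   ; _+_ = λ f g n → f n + g n ; _*_ = _*₁_ ; -_ = λ f n → - f n
   ; 0# = λ _ → 0# ; 1# = one1
   ; isCommutativeRing = record
     { isRing = record
       { +-isAbelianGroup = record
         { isGroup = record
           { isMonoid = record
             { isSemigroup = record
               { isMagma = record
                 { isEquivalence = record
                   { refl = λ _ → refl ; sym = λ e n → sym (e n) ; trans = λ e e' n → trans (e n) (e' n) }
                 ; ∙-cong = λ e e' n → +-cong (e n) (e' n) }
               ; assoc = λ f g h n → +-assoc _ _ _ }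
             ; identity = (λ f n → +-identityˡ _) , (λ f n → +-identityʳ _) }
           ; inverse = (λ f n → -‿inverseˡ _) , (λ f n → -‿inverseʳ _)
           ; ⁻¹-cong = λ e n → -‿cong (e n) }
         ; comm = λ f g n → +-comm _ _ }
       ; *-cong = *₁-cong
       ; *-assoc = *₁-assoc
       ; *-identity = *₁-identityˡ , (λ f n → trans (*₁-comm f one1 n) (*₁-identityˡ f n))
       ; distrib = *₁-distribˡ ,
         (λ f g h n → trans (*₁-comm _ f n) (trans (*₁-distribˡ f g h n) (+-cong (*₁-comm f g n) (*₁-comm f h n)))) }
     ; *-comm = *₁-comm } }

 X*-zero : ∀ f → (X *₁ f) 0 ≈ 0#
 X*-zero f = trans (*₁≈conv X f 0) (zeroˡ _)

 X*-suc : ∀ f n → (X *₁ f) (suc n) ≈ f n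
 X*-suc f n = trans (*₁≈conv X f (suc n)) (conv-X f n)

 const* : ∀ k f n → (const k *₁ f) n ≈ k * f n
 const* k f n = trans (*₁≈conv _ f n) (conv-const k f n)

 -- The Euler operator y d/dy, which unlike d/dy leaves every coefficient at its index.
 θ : PS1 → PS1
 θ f n = natMul n (f n)

 θ-conv : ∀ f g n → natMul n (conv f g n) ≈ conv (θ f) g n + conv f (θ g) n
 θ-conv f g zero = sym (trans (+-cong (zeroˡ _) (zeroʳ _)) (+-identityˡ _))
 θ-conv f g (suc n) = begin
   natMul (suc n) (f 0 * g (suc n) + conv f' g n)
     ≈⟨ natMul-+ (suc n) _ _ ⟩
   natMul (suc n) (f 0 * g (suc n)) + (conv f' g n + natMul n (conv f' g n))
     ≈⟨ +-cong (natMul-*ʳ (suc n) _ _) (+-congˡ (θ-conv f' g n)) ⟩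
   f 0 * θ g (suc n) + (conv f' g n + (conv (θ f') g n + conv f' (θ g) n))
     ≈⟨ solve 5 (λ a b c d z → a :+ (b :+ (c :+ d)) := (con (0 , 0) :* z :+ (b :+ c)) :+ (a :+ d)) refl _ _ _ _ (g (suc n)) ⟩
   0# * g (suc n) + (conv f' g n + conv (θ f') g n) + (f 0 * θ g (suc n) + conv f' (θ g) n)
     ≈⟨ +-congʳ (+-congˡ (sym (conv-+ˡ g f' (θ f') n))) ⟩
   conv (θ f) g (suc n) + conv f (θ g) (suc n) ∎
   where
   open import Relation.Binary.Reasoning.Setoid setoid
   f' = f ∘ suc

 θ-* : ∀ f g → θ (f *₁ g) ≋ (λ n → (θ f *₁ g) n + (f *₁ θ g) n)
 θ-* f g n = trans (natMul-cong n (*₁≈conv f g n)) (trans (θ-conv f g n)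
   (sym (+-cong (*₁≈conv (θ f) g n) (*₁≈conv f (θ g) n))))

 -- A derivation of the coefficients extends to series. Over the ring of series in y₂ this yields
 -- the Leibniz rule for the derivative in the inner variable.
 coeffwise-* : (d : Carrier → Carrier) → (∀ {x y} → x ≈ y → d x ≈ d y) → (∀ x y → d (x + y) ≈ d x + d y) →
   (∀ x y → d (x * y) ≈ d x * y + x * d y) →
   ∀ f g → (λ n → d ((f *₁ g) n)) ≋ (λ n → ((d ∘ f) *₁ g) n + (f *₁ (d ∘ g)) n)
 coeffwise-* d d-cong d-+ d-* f g n = trans (d-cong (*₁≈conv f g n)) (trans (lem f n)
   (sym (+-cong (*₁≈conv (d ∘ f) g n) (*₁≈conv f (d ∘ g) n))))
   where
   lem : ∀ f n → d (conv f g n) ≈ conv (d ∘ f) g n + conv f (d ∘ g) n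
   lem f zero = d-* _ _
   lem f (suc n) = trans (d-+ _ _) (trans (+-cong (d-* _ _) (lem (f ∘ suc) n))
     (solve 4 (λ a b c d → (a :+ b) :+ (c :+ d) := (a :+ c) :+ (b :+ d)) refl _ _ _ _))

 -- Order of vanishing. It replaces every convergence argument: an infinite sum is cut where its
 -- terms no longer reach the coefficient considered.
 Ord : ℕ → PS1 → Set ℓ
 Ord n f = ∀ m → m < n → f m ≈ 0#

 Ord-conv : ∀ a b {f g} → Ord a f → Ord b g → ∀ n → n < a ℕ.+ b → conv f g n ≈ 0#
 Ord-conv zero b {f} of og zero l = trans (*-congˡ (og 0 l)) (zeroʳ _)
 Ord-conv zero b {f} of og (suc n) l = trans (+-cong (trans (*-congˡ (og (suc n) l)) (zeroʳ _))
   (Ord-conv zero b {f ∘ suc} (λ _ ()) og n (ℕP.<-trans (ℕP.n<1+n n) l))) (+-identityˡ _)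
 Ord-conv (suc a) b of og zero l = trans (*-congʳ (of 0 (s≤s z≤n))) (zeroˡ _)
 Ord-conv (suc a) b of og (suc n) (s≤s l) = trans (+-cong (trans (*-congʳ (of 0 (s≤s z≤n))) (zeroˡ _))
   (Ord-conv a b (λ m l' → of (suc m) (s≤s l')) og n l)) (+-identityˡ _)

 Ord-* : ∀ a b {f g} → Ord a f → Ord b g → Ord (a ℕ.+ b) (f *₁ g)
 Ord-* a b {f} {g} of og n l = trans (*₁≈conv f g n) (Ord-conv a b of og n l)

 Ord-pow : ∀ {f} → Ord 1 f → ∀ k → Ord k (pow1 f k)
 Ord-pow of zero m ()
 Ord-pow of (suc k) = Ord-* 1 k of (Ord-pow of k)

 *₁-cong-≤ : ∀ n {f f' g g'} → (∀ m → m ≤ n → f m ≈ f' m) → (∀ m → m ≤ n → g m ≈ g' m) → (f *₁ g) n ≈ (f' *₁ g') n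
 *₁-cong-≤ n {f} {f'} {g} {g'} e e' = trans (*₁≈conv f g n) (trans (conv-cong n e e') (sym (*₁≈conv f' g' n)))

 module _ (f : PS1) (f₀ : f 0 ≈ 1#) where
  private
    module P = CommutativeRing PSRing
    u : PS1
    u m = one1 m - f m
    ou : Ord 1 u
    ou zero _ = trans (+-congˡ (-‿cong f₀)) (-‿inverseʳ 1#)
    ou (suc m) (s≤s ())
    geo : ℕ → PS1
    geo zero = λ _ → 0#
    geo (suc N) = λ n → geo N n + pow1 u N n
    geo≈Σ : ∀ N n → geo N n ≈ Σ< N (λ k → pow1 u k n)
    geo≈Σ zero n = refl
    geo≈Σ (suc N) n = trans (+-congʳ (geo≈Σ N n)) (sym (Σ<-last N _))
    inv≈geo : ∀ d n → inv1 f n ≈ geo (suc (d ℕ.+ n)) n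
    inv≈geo zero n = trans (sumR-upTo _ (suc n)) (sym (geo≈Σ (suc n) n))
    inv≈geo (suc d) n = trans (inv≈geo d n) (sym (trans (+-congˡ (Ord-pow ou (suc d ℕ.+ n) n (s≤s (ℕP.m≤n+m n d)))) (+-identityʳ _)))
    tele : ∀ N → f *₁ geo N ≋ (λ n → one1 n - pow1 u N n)
    tele zero = P.trans (P.zeroʳ f) (P.sym (P.-‿inverseʳ one1))
    tele (suc N) = P.trans (P.distribˡ f (geo N) (pow1 u N)) (P.trans (P.+-congʳ {x = f *₁ pow1 u N} (tele N))
      (P.trans (P.+-congʳ {x = f *₁ pow1 u N} (P.+-congˡ {x = one1} (P.-‿cong (P.sym (P.*-identityˡ (pow1 u N))))))
        (PSol.solve 3 (λ o f p → (o PSol.:- o PSol.:* p) PSol.:+ f PSol.:* p PSol.:= o PSol.:- (o PSol.:- f) PSol.:* p)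
          (λ {_} → P.refl) one1 f (pow1 u N))))
      where
      module PSol = Solver PSRing

  -- In `inv1` the length of the geometric sum depends on the coefficient. Since u = 1 - f has order
  -- 1, one partial sum serves all coefficients up to n, and f times that partial sum telescopes to
  -- 1 minus a power of u.
  *-inv1 : f *₁ inv1 f ≋ one1
  *-inv1 n = begin
    (f *₁ inv1 f) n ≈⟨ *₁-cong-≤ n (λ _ _ → refl) agree ⟩
    (f *₁ geo (suc n)) n ≈⟨ tele (suc n) n ⟩
    one1 n - pow1 u (suc n) n ≈⟨ +-congˡ (-‿cong (Ord-pow ou (suc n) n ℕP.≤-refl)) ⟩
    one1 n - 0# ≈⟨ solve 1 (λ x → x :- con (0 , 0) := x) refl (one1 n) ⟩
    one1 n ∎
    where
    open import Relation.Binary.Reasoning.Setoid setoid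
    agree : ∀ m → m ≤ n → inv1 f m ≈ geo (suc n) m
    agree m l = trans (inv≈geo (n ∸ m) m) (reflexive (cong (λ k → geo (suc k) m) (ℕP.m∸n+n≡m l)))

-- From Boolean tests to propositions

module BooleanReflection where
 open ≡ using (refl)

 true≢false : true ≢ false
 true≢false ()

 ≡ᵇ-sound : ∀ {m n} → (m ≡ᵇ n) ≡ true → m ≡ n
 ≡ᵇ-sound {m} {n} e = ℕP.≡ᵇ⇒≡ m n (subst T (≡.sym e) _)

 ≡ᵇ-complete : ∀ {m n} → m ≡ n → (m ≡ᵇ n) ≡ true
 ≡ᵇ-complete {m} {n} e = Equivalence.to BP.T-≡ (ℕP.≡⇒≡ᵇ m n e)

 <ᵇ-sound : ∀ {m n} → (m <ᵇ n) ≡ true → m < n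
 <ᵇ-sound {m} {n} e = ℕP.<ᵇ⇒< m n (subst T (≡.sym e) _)

 <ᵇ-complete : ∀ {m n} → m < n → (m <ᵇ n) ≡ true
 <ᵇ-complete l = Equivalence.to BP.T-≡ (ℕP.<⇒<ᵇ l)

 ≤ᵇ-sound : ∀ {m n} → (m ≤ᵇ n) ≡ true → m ≤ n
 ≤ᵇ-sound {m} {n} e = ℕP.≤ᵇ⇒≤ m n (subst T (≡.sym e) _)

 ≤ᵇ-complete : ∀ {m n} → m ≤ n → (m ≤ᵇ n) ≡ true
 ≤ᵇ-complete l = Equivalence.to BP.T-≡ (ℕP.≤⇒≤ᵇ l)

 ∧-sound : ∀ {a b} → a ∧ b ≡ true → a ≡ true × b ≡ true
 ∧-sound {true} e = refl , e

 ∧-complete : ∀ {a b} → a ≡ true → b ≡ true → a ∧ b ≡ true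
 ∧-complete refl e = e

 not-sound : ∀ {a} → not a ≡ true → ¬ a ≡ true
 not-sound {false} _ ()

 not-complete : ∀ {a} → ¬ a ≡ true → not a ≡ true
 not-complete {true} h = ⊥-elim (h refl)
 not-complete {false} h = refl

 ≡false : ∀ {a} → ¬ a ≡ true → a ≡ false
 ≡false {true} h = ⊥-elim (h refl)
 ≡false {false} h = refl

 bool-ext : ∀ {a b} → (a ≡ true → b ≡ true) → (b ≡ true → a ≡ true) → a ≡ b
 bool-ext {true} {b} f g = ≡.sym (f refl)
 bool-ext {false} {true} f g = g refl
 bool-ext {false} {false} f g = refl

 ∨-right : ∀ u {v} → v ≡ true → u ∨ v ≡ true
 ∨-right true _ = refl
 ∨-right false e = e

 boolEq-sound : ∀ {a b} → boolEq a b ≡ true → a ≡ b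
 boolEq-sound {true} e = ≡.sym e
 boolEq-sound {false} {false} e = refl

 boolEq-complete : ∀ {a b} → a ≡ b → boolEq a b ≡ true
 boolEq-complete {true} refl = refl
 boolEq-complete {false} refl = refl

 module _ {a} {A : Set a} (p : A → Bool) where
  any-sound : ∀ xs → any p xs ≡ true → ∃ λ x → x ∈ xs × p x ≡ true
  any-sound (x ∷ xs) e with p x in eq
  ... | true = x , here refl , eq
  ... | false with any-sound xs e
  ... | y , y∈ , h = y , there y∈ , h

  any-complete : ∀ {xs x} → x ∈ xs → p x ≡ true → any p xs ≡ true
  any-complete (here refl) h rewrite h = refl
  any-complete {y ∷ _} (there x∈) h with p y
  ... | true = refl
  ... | false = any-complete x∈ h

  all-sound : ∀ {xs} → all p xs ≡ true → ∀ {x} → x ∈ xs → p x ≡ true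
  all-sound {y ∷ ys} e (here refl) = proj₁ (∧-sound e)
  all-sound {y ∷ ys} e (there x∈) = all-sound {ys} (proj₂ (∧-sound {p y} e)) x∈

  all-complete : ∀ xs → (∀ {x} → x ∈ xs → p x ≡ true) → all p xs ≡ true
  all-complete [] h = refl
  all-complete (x ∷ xs) h = ∧-complete (h (here refl)) (all-complete xs (λ y∈ → h (there y∈)))

 memb-sound : ∀ {k} xs → memb k xs ≡ true → k ∈ xs
 memb-sound xs e with any-sound _ xs e
 ... | x , x∈ , h = subst (_∈ xs) (≡ᵇ-sound h) x∈

 memb-complete : ∀ {k xs} → k ∈ xs → memb k xs ≡ true
 memb-complete {k} k∈ = any-complete _ k∈ (≡ᵇ-complete {k} refl)

 Blocks : Set
 Blocks = List (List ℕ)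

 SameBlock : Blocks → ℕ → ℕ → Set
 SameBlock π k l = ∃[ b ] (b ∈ π × k ∈ b × l ∈ b)

 sameBlock-sound : ∀ π {k l} → sameBlock π k l ≡ true → SameBlock π k l
 sameBlock-sound π {k} {l} e with any-sound _ π e
 ... | b , b∈ , h with ∧-sound {memb k b} h
 ... | h₁ , h₂ = b , b∈ , memb-sound b h₁ , memb-sound b h₂

 sameBlock-complete : ∀ {π k l} → SameBlock π k l → sameBlock π k l ≡ true
 sameBlock-complete (b , b∈ , h₁ , h₂) = any-complete _ b∈ (∧-complete (memb-complete h₁) (memb-complete h₂))

 -- The relation is a parameter because crossings are also compared with words of colours, where it
 -- is tied to equality of letters.
 Crossing : List ℕ → (ℕ → ℕ → Set) → Set
 Crossing el R = ∃[ p ] ∃[ q ] ∃[ r ] ∃[ s ] (p ∈ el × q ∈ el × r ∈ el × s ∈ el ×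
   p < q × q < r × r < s × R p r × R q s × ¬ R p q)

 hasCrossing-sound : ∀ el π → hasCrossing el π ≡ true → Crossing el (SameBlock π)
 hasCrossing-sound el π e
   with any-sound _ el e
 ... | p , p∈ , e₁ with any-sound _ el e₁
 ... | q , q∈ , e₂ with any-sound _ el e₂
 ... | r , r∈ , e₃ with any-sound _ el e₃
 ... | s , s∈ , e₄ with ∧-sound {p <ᵇ q} e₄
 ... | l₁ , e₅ with ∧-sound {q <ᵇ r} e₅
 ... | l₂ , e₆ with ∧-sound {r <ᵇ s} e₆
 ... | l₃ , e₇ with ∧-sound {sameBlock π p r} e₇
 ... | m₁ , e₈ with ∧-sound {sameBlock π q s} e₈
 ... | m₂ , e₉ = p , q , r , s , p∈ , q∈ , r∈ , s∈ , <ᵇ-sound l₁ , <ᵇ-sound l₂ , <ᵇ-sound l₃ ,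
   sameBlock-sound π m₁ , sameBlock-sound π m₂ , λ h → not-sound e₉ (sameBlock-complete h)

 hasCrossing-complete : ∀ el π → Crossing el (SameBlock π) → hasCrossing el π ≡ true
 hasCrossing-complete el π (p , q , r , s , p∈ , q∈ , r∈ , s∈ , l₁ , l₂ , l₃ , m₁ , m₂ , m₃) =
   any-complete _ p∈ (any-complete _ q∈ (any-complete _ r∈ (any-complete _ s∈
     (∧-complete (<ᵇ-complete l₁) (∧-complete (<ᵇ-complete l₂) (∧-complete (<ᵇ-complete l₃)
     (∧-complete (sameBlock-complete m₁) (∧-complete (sameBlock-complete m₂)
       (not-complete (λ h → m₃ (sameBlock-sound π h)))))))))))

 sameBlock-cong : ∀ {π π'} → (∀ {k l} → SameBlock π k l → SameBlock π' k l) →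
   (∀ {k l} → SameBlock π' k l → SameBlock π k l) → ∀ k l → sameBlock π k l ≡ sameBlock π' k l
 sameBlock-cong {π} {π'} f g k l = bool-ext (λ e → sameBlock-complete (f (sameBlock-sound π e)))
   (λ e → sameBlock-complete (g (sameBlock-sound π' e)))

 hasCrossing-cong : ∀ el {π π'} → (∀ {k l} → SameBlock π k l → SameBlock π' k l) →
   (∀ {k l} → SameBlock π' k l → SameBlock π k l) → hasCrossing el π ≡ hasCrossing el π'
 hasCrossing-cong el {π} {π'} f g = bool-ext
   (λ e → hasCrossing-complete el π' (transfer f g (hasCrossing-sound el π e)))
   (λ e → hasCrossing-complete el π (transfer g f (hasCrossing-sound el π' e)))
   where
   transfer : ∀ {R S : ℕ → ℕ → Set} → (∀ {k l} → R k l → S k l) → (∀ {k l} → S k l → R k l) →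
     Crossing el R → Crossing el S
   transfer f g (p , q , r , s , p∈ , q∈ , r∈ , s∈ , l₁ , l₂ , l₃ , m₁ , m₂ , m₃) =
     p , q , r , s , p∈ , q∈ , r∈ , s∈ , l₁ , l₂ , l₃ , f m₁ , f m₂ , λ h → m₃ (g h)

-- Counting cycles by deleting elements

module CycleCounting where
 open import Data.Nat using (_+_)
 open ≡ using (refl; sym; trans)

 -- Permutations are treated as injections of all of ℕ, so an element can be deleted from a cycle
 -- without renumbering the others.
 swap : ℕ → ℕ → ℕ → ℕ
 swap a b y with y ℕP.≟ a
 ... | yes _ = b
 ... | no _ with y ℕP.≟ b
 ... | yes _ = a
 ... | no _ = y

 swap-l : ∀ a b → swap a b a ≡ b
 swap-l a b with a ℕP.≟ a
 ... | yes _ = refl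
 ... | no h = ⊥-elim (h refl)

 swap-r : ∀ a b → swap a b b ≡ a
 swap-r a b with b ℕP.≟ a
 ... | yes e = e
 ... | no _ with b ℕP.≟ b
 ... | yes _ = refl
 ... | no h = ⊥-elim (h refl)

 swap-other : ∀ {a b y} → y ≢ a → y ≢ b → swap a b y ≡ y
 swap-other {a} {b} {y} h h' with y ℕP.≟ a
 ... | yes e = ⊥-elim (h e)
 ... | no _ with y ℕP.≟ b
 ... | yes e = ⊥-elim (h' e)
 ... | no _ = refl

 swap-id : ∀ a y → swap a a y ≡ y
 swap-id a y with y ℕP.≟ a
 ... | yes e = sym e
 ... | no _ with y ℕP.≟ a
 ... | yes e = sym e
 ... | no _ = refl

 swap-invol : ∀ a b y → swap a b (swap a b y) ≡ y
 swap-invol a b y with y ℕP.≟ a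
 ... | yes e = trans (swap-r a b) (sym e)
 ... | no h with y ℕP.≟ b
 ... | yes e = trans (swap-l a b) (sym e)
 ... | no h' = swap-other h h'

 swap-sym : ∀ a b y → swap a b y ≡ swap b a y
 swap-sym a b y = go (y ℕP.≟ a) (y ℕP.≟ b)
   where
   go : Dec (y ≡ a) → Dec (y ≡ b) → swap a b y ≡ swap b a y
   go (yes refl) _ = trans (swap-l y b) (sym (swap-r b y))
   go (no h) (yes refl) = trans (swap-r a y) (sym (swap-l y a))
   go (no h) (no h') = trans (swap-other h h') (sym (swap-other h' h))

 Inj : (ℕ → ℕ) → Set
 Inj f = ∀ {x y} → f x ≡ f y → x ≡ y

 swap-inj : ∀ a b → Inj (swap a b)
 swap-inj a b {x} {y} e = trans (sym (swap-invol a b x)) (trans (cong (swap a b) e) (swap-invol a b y))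

 swap-natural : ∀ {f : ℕ → ℕ} → Inj f → ∀ a b y → f (swap a b y) ≡ swap (f a) (f b) (f y)
 swap-natural {f} inj a b y with y ℕP.≟ a
 ... | yes refl = sym (swap-l (f y) (f b))
 ... | no h with y ℕP.≟ b
 ... | yes refl = sym (swap-r (f a) (f y))
 ... | no h' = sym (swap-other (h ∘ inj) (h' ∘ inj))

 -- Skips x in the cycle of f through x, and makes x a fixed point.
 del : ℕ → (ℕ → ℕ) → ℕ → ℕ
 del x f y = swap x (f x) (f y)

 del-inj : ∀ {x f} → Inj f → Inj (del x f)
 del-inj inj e = inj (swap-inj _ _ e)

 del-self : ∀ x f → del x f x ≡ x
 del-self x f = swap-r x (f x)

 del-skip : ∀ {x f y} → f y ≡ x → del x f y ≡ f x
 del-skip {x} {f} e = trans (cong (swap x (f x)) e) (swap-l x (f x))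

 del-other : ∀ {x f y} → Inj f → y ≢ x → f y ≢ x → del x f y ≡ f y
 del-other inj h h' = swap-other h' (h ∘ inj)

 fixed? : ℕ → (ℕ → ℕ) → ℕ
 fixed? x f with f x ℕP.≟ x
 ... | yes _ = 1
 ... | no _ = 0

 fixed-yes : ∀ {x f} → f x ≡ x → fixed? x f ≡ 1
 fixed-yes {x} {f} e with f x ℕP.≟ x
 ... | yes _ = refl
 ... | no h = ⊥-elim (h e)

 fixed-no : ∀ {x f} → f x ≢ x → fixed? x f ≡ 0
 fixed-no {x} {f} h with f x ℕP.≟ x
 ... | yes e = ⊥-elim (h e)
 ... | no _ = refl

 fixed-iff : ∀ {x f y g} → (f x ≡ x → g y ≡ y) → (g y ≡ y → f x ≡ x) → fixed? x f ≡ fixed? y g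
 fixed-iff {x} {f} {y} {g} h h' with f x ℕP.≟ x | g y ℕP.≟ y
 ... | yes _ | yes _ = refl
 ... | yes e | no k = ⊥-elim (k (h e))
 ... | no k | yes e = ⊥-elim (k (h' e))
 ... | no _ | no _ = refl

 -- The number of cycles of f on L, by removing the elements of L one at a time.
 cyc : List ℕ → (ℕ → ℕ) → ℕ
 cyc [] f = 0
 cyc (x ∷ L) f = fixed? x f + cyc L (del x f)

 cyc-ext : ∀ L {f g} → (∀ {y} → y ∈ L → f y ≡ g y) → cyc L f ≡ cyc L g
 cyc-ext [] e = refl
 cyc-ext (x ∷ L) e = cong₂ _+_ (fixed-iff (trans (sym (e (here refl)))) (trans (e (here refl))))
   (cyc-ext L (λ y∈ → cong₂ (swap x) (e (here refl)) (e (there y∈))))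

 swap-braid : ∀ {x y u v} → x ≢ y → x ≢ u → y ≢ v → u ≢ v → ∀ z →
   swap y (swap x u v) (swap x u z) ≡ swap x (swap y v u) (swap y v z)
 swap-braid {x} {y} {u} {v} x≢y x≢u y≢v u≢v z = go (y ℕP.≟ u) (x ℕP.≟ v)
   where
   disjoint : ∀ {x y u v} → x ≢ y → y ≢ u → u ≢ v → ∀ z → swap y (swap x u v) (swap x u z) ≡ swap x (swap y v u) (swap y v z)
   disjoint {x} {y} {u} {v} x≢y y≢u u≢v z =
     trans (cong (λ a → swap a (swap x u v) (swap x u z)) (sym (swap-other (x≢y ∘ sym) y≢u)))
       (trans (sym (swap-natural (swap-inj x u) y v z)) (cong (λ a → swap x a (swap y v z)) (sym (swap-other (y≢u ∘ sym) u≢v))))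
   go : Dec (y ≡ u) → Dec (x ≡ v) → swap y (swap x u v) (swap x u z) ≡ swap x (swap y v u) (swap y v z)
   go (no h) _ = disjoint x≢y h u≢v z
   go (yes _) (no h) = sym (disjoint (x≢y ∘ sym) h (u≢v ∘ sym) z)
   go (yes refl) (yes refl) = trans (cong (λ a → swap u a (swap x u z)) (swap-l x u)) (trans (swap-id u _)
     (trans (swap-sym x u z) (sym (trans (cong (λ a → swap x a (swap u x z)) (swap-l u x)) (swap-id x _)))))

 del-fixed : ∀ {x f} → f x ≡ x → ∀ y → del x f y ≡ f y
 del-fixed {x} {f} e y = trans (cong (λ a → swap x a (f y)) e) (swap-id x (f y))

 -- If x or y is fixed, its deletion changes nothing. Otherwise both orders multiply f by two
 -- transpositions, and the products agree by `swap-braid`.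
 del-comm : ∀ {x y f} → Inj f → x ≢ y → ∀ z → del y (del x f) z ≡ del x (del y f) z
 del-comm {x} {y} {f} inj x≢y z with f x ℕP.≟ x
 ... | yes e = trans (cong₂ (λ a b → swap y a b) (del-fixed {x} {f} e y) (del-fixed {x} {f} e z))
   (sym (del-fixed {x} {del y f} (trans (cong (swap y (f y)) e) (swap-other x≢y (λ h → x≢y (inj (trans e h))))) z))
 ... | no h with f y ℕP.≟ y
 ... | yes e = trans (del-fixed {y} {del x f} (trans (cong (swap x (f x)) e) (swap-other (x≢y ∘ sym) (λ k → x≢y (inj (sym (trans e k)))))) z)
   (sym (cong₂ (λ a b → swap x a b) (del-fixed {y} {f} e x) (del-fixed {y} {f} e z)))
 ... | no h' = swap-braid x≢y (h ∘ sym) (h' ∘ sym) (x≢y ∘ inj) (f z)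

 del-fixes : ∀ {x y f} → Inj f → x ≢ y → del x f y ≡ y → f y ≡ y ⊎ (f y ≡ x × f x ≡ y)
 del-fixes {x} {y} {f} inj x≢y e = go (f y ℕP.≟ x)
   where
   go : Dec (f y ≡ x) → f y ≡ y ⊎ (f y ≡ x × f x ≡ y)
   go (yes fy) = inj₂ (fy , trans (sym (del-skip {x} {f} fy)) e)
   go (no h) = inj₁ (trans (sym (del-other inj (x≢y ∘ sym) h)) e)

 fixed-comm : ∀ {x y f} → Inj f → x ≢ y → fixed? x f + fixed? y (del x f) ≡ fixed? y f + fixed? x (del y f)
 fixed-comm {x} {y} {f} inj x≢y with f x ℕP.≟ x
 ... | yes e = trans (cong suc (fixed-iff {y} (λ k → trans (sym (del-fixed e y)) k) (λ k → trans (del-fixed e y) k)))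
   (trans (ℕP.+-comm 1 (fixed? y f)) (cong (fixed? y f +_) (sym (fixed-yes {x}
     (trans (cong (swap y (f y)) e) (swap-other x≢y (λ k → x≢y (inj (trans e k)))))))))
 ... | no h with f y ℕP.≟ y
 ... | yes e = trans (fixed-yes {y} (trans (cong (swap x (f x)) e) (swap-other (x≢y ∘ sym) (λ k → x≢y (inj (sym (trans e k)))))))
   (cong suc (sym (fixed-no {x} (λ k → h (trans (sym (del-fixed e x)) k)))))
 ... | no h' = fixed-iff (both x≢y h') (both (x≢y ∘ sym) h)
   where
   both : ∀ {x y} → x ≢ y → f y ≢ y → del x f y ≡ y → del y f x ≡ x
   both x≢y h' e with del-fixes inj x≢y e
   ... | inj₁ k = ⊥-elim (h' k)
   ... | inj₂ (fy , fx) = trans (del-skip {_} {f} fx) fy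

 -- Makes `cyc` depend on the set of elements only, so that any element can be chosen to be deleted
 -- first.
 cyc-↭ : ∀ {L L' f} → Inj f → Unique L → L ↭ L' → cyc L f ≡ cyc L' f
 cyc-↭ inj u Perm.refl = refl
 cyc-↭ {f = f} inj (_ ∷ u) (Perm.prep x p) = cong (fixed? x f +_) (cyc-↭ (del-inj inj) u p)
 cyc-↭ {f = f} inj ((x≢y ∷ _) ∷ (_ ∷ u)) (Perm.swap {xs} {ys} x y p) =
   trans (sym (ℕP.+-assoc (fixed? x f) _ _)) (trans (cong₂ _+_ (fixed-comm inj x≢y)
     (trans (cyc-ext xs (λ {z} _ → del-comm inj x≢y z)) (cyc-↭ (del-inj (del-inj inj)) u p)))
     (ℕP.+-assoc (fixed? y f) _ _))
 cyc-↭ inj u (Perm.trans p q) = trans (cyc-↭ inj u p) (cyc-↭ inj (PermS.Unique-resp-↭ (≡.setoid ℕ) (Perm.↭⇒↭ₛ p) u) q)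

 fix : List ℕ → (ℕ → ℕ) → ℕ
 fix [] f = 0
 fix (x ∷ L) f = fixed? x f + fix L f

 -- Deleting x can create a fixed point only from a two-cycle through x, namely at `f x`; the last
 -- hypothesis keeps that point out of L.
 fix-del-other : ∀ {x f} L → Inj f → x ∉ L → (f (f x) ≡ x → f x ∉ L) → fix L (del x f) ≤ fix L f
 fix-del-other [] inj x∉ h = z≤n
 fix-del-other {x} {f} (y ∷ L) inj x∉ h = ℕP.+-mono-≤ le (fix-del-other L inj (x∉ ∘ there) (λ e → h e ∘ there))
   where
   le : fixed? y (del x f) ≤ fixed? y f
   le with del x f y ℕP.≟ y
   ... | no _ = z≤n
   ... | yes e with del-fixes inj (λ k → x∉ (here k)) e
   ... | inj₁ fy = ℕP.≤-reflexive (sym (fixed-yes fy))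
   ... | inj₂ (fy , fx) = ⊥-elim (h (trans (cong f fx) fy) (here fx))

 fix-del : ∀ {x f} L → Inj f → Unique L → x ∉ L → fix L (del x f) ≤ 1 + fix L f
 fix-del [] inj u x∉ = z≤n
 fix-del {x} {f} (y ∷ L) inj (y∉ ∷ u) x∉ with f x ℕP.≟ y
 ... | yes refl = ℕP.+-mono-≤ {v = fix L f} (le1 (f x)) (fix-del-other L inj (x∉ ∘ there) (λ _ k → All.lookup y∉ k refl))
   ⟨≤⟩ ℕP.+-monoʳ-≤ 1 (ℕP.m≤n+m (fix L f) (fixed? (f x) f))
   where
   le1 : ∀ z → fixed? z (del x f) ≤ 1
   le1 z with del x f z ℕP.≟ z
   ... | yes _ = ℕP.≤-refl
   ... | no _ = z≤n
   _⟨≤⟩_ = ℕP.≤-trans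
 ... | no h = ℕP.≤-trans (ℕP.+-mono-≤ le (fix-del L inj u (x∉ ∘ there)))
   (ℕP.≤-reflexive (ℕP.+-suc (fixed? y f) (fix L f)))
   where
   le : fixed? y (del x f) ≤ fixed? y f
   le with del x f y ℕP.≟ y
   ... | no _ = z≤n
   ... | yes e with del-fixes inj (λ k → x∉ (here k)) e
   ... | inj₁ fy = ℕP.≤-reflexive (sym (fixed-yes fy))
   ... | inj₂ (fy , fx) = ⊥-elim (h fx)

 unique-∉ : ∀ {x : ℕ} {L} → Unique (x ∷ L) → x ∉ L
 unique-∉ (h ∷ _) x∈ = All.lookup h x∈ refl

 -- A cycle that is not a fixed point uses at least two elements. In the induction a head that is
 -- not fixed adds nothing to `cyc`, and its deletion creates at most one fixed point, which is paid
 -- for by its own contribution to the length.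
 cyc-bound : ∀ L {f} → Inj f → Unique L → cyc L f + cyc L f ≤ length L + fix L f
 cyc-bound [] inj u = z≤n
 cyc-bound (x ∷ L) {f} inj (x∉ ∷ u) with f x ℕP.≟ x
 ... | yes e = begin
   suc c + suc c ≡⟨ cong suc (ℕP.+-suc c c) ⟩
   suc (suc (c + c)) ≤⟨ s≤s (s≤s (cyc-bound L (del-inj inj) u)) ⟩
   suc (suc (length L + fix L (del x f))) ≡⟨ cong (λ k → suc (suc (length L + k))) (fix-ext L) ⟩
   suc (suc (length L + fix L f)) ≡⟨ cong suc (ℕP.+-suc (length L) (fix L f)) ⟨
   suc (length L + suc (fix L f)) ∎
   where
   open ℕP.≤-Reasoning
   c = cyc L (del x f)
   fix-ext : ∀ L → fix L (del x f) ≡ fix L f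
   fix-ext [] = refl
   fix-ext (y ∷ L) = cong₂ _+_ (fixed-iff {y} (trans (sym (del-fixed e y))) (trans (del-fixed e y))) (fix-ext L)
 ... | no h = begin
   c + c ≤⟨ cyc-bound L (del-inj inj) u ⟩
   length L + fix L (del x f) ≤⟨ ℕP.+-monoʳ-≤ (length L) (fix-del L inj u (λ x∈ → All.lookup x∉ x∈ refl)) ⟩
   length L + suc (fix L f) ≡⟨ ℕP.+-suc (length L) (fix L f) ⟩
   suc (length L + fix L f) ∎
   where
   open ℕP.≤-Reasoning
   c = cyc L (del x f)

 fix-none : ∀ L {f} → (∀ {x} → x ∈ L → f x ≢ x) → fix L f ≡ 0
 fix-none [] h = refl
 fix-none (x ∷ L) h = cong₂ _+_ (fixed-no (h (here refl))) (fix-none L (h ∘ there))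

 cyc-free : ∀ L {f} → Inj f → Unique L → (∀ {x} → x ∈ L → f x ≢ x) → cyc L f + cyc L f ≤ length L
 cyc-free L inj u h = ℕP.≤-trans (cyc-bound L inj u)
   (ℕP.≤-reflexive (trans (cong (length L +_) (fix-none L h)) (ℕP.+-identityʳ (length L))))

 unique-↭ : ∀ {L L' : List ℕ} → L ↭ L' → Unique L → Unique L'
 unique-↭ p = PermS.Unique-resp-↭ (≡.setoid ℕ) (Perm.↭⇒↭ₛ p)

 bring-front : ∀ {a} {A : Set a} {x : A} {L} → x ∈ L → ∃[ L' ] (L ↭ x ∷ L')
 bring-front {x = x} x∈ with ∈-∃++ x∈
 ... | α , β , refl = α ++ β , PermP.shift x α β

 -- A cycle of length at least three makes the bound strict.
 cyc-free-strict : ∀ L {f x} → Inj f → Unique L → (∀ {x} → x ∈ L → f x ≢ x) → x ∈ L → f (f x) ≢ x →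
   cyc L f + cyc L f < length L
 cyc-free-strict L {f} {x} inj u h x∈ ffx with bring-front x∈
 ... | L' , p with unique-↭ p u
 ... | u'@(_ ∷ uL') = begin-strict
   cyc L f + cyc L f ≡⟨ cong₂ _+_ e e ⟩
   cyc L' (del x f) + cyc L' (del x f) ≤⟨ cyc-bound L' (del-inj inj) uL' ⟩
   length L' + fix L' (del x f) ≤⟨ ℕP.+-monoʳ-≤ (length L') (fix-del-other L' inj (unique-∉ u') (⊥-elim ∘ ffx)) ⟩
   length L' + fix L' f ≡⟨ cong (length L' +_) (fix-none L' (λ y∈ → h (PermP.∈-resp-↭ (↭-sym p) (there y∈)))) ⟩
   length L' + 0 ≡⟨ ℕP.+-identityʳ (length L') ⟩
   length L' <⟨ ℕP.n<1+n (length L') ⟩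
   suc (length L') ≡⟨ PermP.↭-length p ⟨
   length L ∎
   where
   open ℕP.≤-Reasoning
   e : cyc L f ≡ cyc L' (del x f)
   e = trans (cyc-↭ inj u p) (cong (_+ cyc L' (del x f)) (fixed-no (h x∈)))

 Orb : (ℕ → ℕ) → ℕ → ℕ → Set
 Orb f y z = ∃[ t ] (iter f t y ≡ z)

 iter-front : ∀ (f : ℕ → ℕ) t y → iter f (suc t) y ≡ iter f t (f y)
 iter-front f zero y = refl
 iter-front f (suc t) y = cong f (iter-front f t y)

 orb-step : ∀ {f y z} → Orb f (f y) z → Orb f y z
 orb-step {f} {y} (t , e) = suc t , trans (iter-front f t y) e

 orb-trans : ∀ {f x y z} → Orb f x y → Orb f y z → Orb f x z
 orb-trans {f} {x} {y} {z} (t , e) o = go t x e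
   where
   go : ∀ t x → iter f t x ≡ y → Orb f x z
   go zero x refl = o
   go (suc t) x e = orb-step {f} (go t (f x) (trans (sym (iter-front f t x)) e))

 module _ {x : ℕ} {f : ℕ → ℕ} (inj : Inj f) where
  orb-del⁻ : ∀ {y z} → y ≢ x → Orb (del x f) y z → Orb f y z
  orb-del⁻ {y} {z} h (t , e) = go t y h e (f y ℕP.≟ x)
    where
    go : ∀ t y → y ≢ x → iter (del x f) t y ≡ z → Dec (f y ≡ x) → Orb f y z
    go zero y h e _ = zero , e
    go (suc t) y h e (yes fy) = orb-step {f} (orb-step {f} (subst (λ w → Orb f (f w) z) (sym fy)
      (go t (f x) (λ fx → h (inj (trans fy (sym fx))))
        (trans (cong (iter (del x f) t) (sym (del-skip {x} {f} fy))) (trans (sym (iter-front (del x f) t y)) e)) (f (f x) ℕP.≟ x))))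
    go (suc t) y h e (no h') = orb-step {f} (go t (f y) h'
      (trans (cong (iter (del x f) t) (sym (del-other {x} {f} inj h h'))) (trans (sym (iter-front (del x f) t y)) e)) (f (f y) ℕP.≟ x))

  orb-del⁺ : ∀ {y z} → y ≢ x → z ≢ x → Orb f y z → Orb (del x f) y z
  orb-del⁺ {y} {z} h hz (t , e) = go t y h e (f y ℕP.≟ x)
    where
    step : ∀ {y} → Orb (del x f) (del x f y) z → Orb (del x f) y z
    step = orb-step {del x f}
    go : ∀ t y → y ≢ x → iter f t y ≡ z → Dec (f y ≡ x) → Orb (del x f) y z
    go zero y h e _ = zero , e
    go (suc zero) y h e (yes fy) = ⊥-elim (hz (trans (sym e) fy))
    -- The path enters x and leaves it again: two steps of f become one step of `del x f`.
    go (suc (suc t)) y h e (yes fy) = step (subst (λ w → Orb (del x f) w z) (sym (del-skip {x} {f} fy))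
      (go t (f x) (λ fx → h (inj (trans fy (sym fx))))
        (trans (cong (λ w → iter f t (f w)) (sym fy)) (trans (sym (iter-front f t (f y))) (trans (sym (iter-front f (suc t) y)) e)))
        (f (f x) ℕP.≟ x)))
    go (suc t) y h e (no h') = step (subst (λ w → Orb (del x f) w z) (sym (del-other {x} {f} inj h h'))
      (go t (f y) h' (trans (sym (iter-front f t y)) e) (f (f y) ℕP.≟ x)))

-- Colour words on two circles

module SpokeWords where
 open import Data.Nat using (_+_)
 open import Data.List.Relation.Binary.Sublist.Propositional as Sub using (_⊆_; _∷ʳ_; _∷_; [])
 open ≡ using (refl; sym; trans)
 open BooleanReflection
 open CycleCounting

 -- A circle has no first element. Generated by single moves of the first letter to the end, so that
 -- by `rot-closed` invariance has to be checked for one move only.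
 data Rot : List ℕ → List ℕ → Set where
   done : ∀ {w} → Rot w w
   step : ∀ {x u w} → Rot (u ++ [ x ]) w → Rot (x ∷ u) w

 rot-trans : ∀ {u v w} → Rot u v → Rot v w → Rot u w
 rot-trans done s = s
 rot-trans (step r) s = step (rot-trans r s)

 rot-++ : ∀ α β → Rot (α ++ β) (β ++ α)
 rot-++ [] β = subst (Rot β) (sym (++-identityʳ β)) done
 rot-++ (x ∷ α) β = step (subst₂ Rot (sym (++-assoc α β [ x ])) (++-assoc β [ x ] α) (rot-++ α (β ++ [ x ])))

 rot-sym : ∀ {u w} → Rot u w → Rot w u
 rot-sym done = done
 rot-sym (step {x} {u} r) = rot-trans (rot-sym r) (rot-++ u [ x ])

 rot-↭ : ∀ {u w} → Rot u w → u ↭ w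
 rot-↭ done = ↭-refl
 rot-↭ (step {x} {u} r) = ↭-trans (↭-sym (PermP.++-comm u [ x ])) (rot-↭ r)

 rot-closed : ∀ {P : List ℕ → Set} → (∀ {x u} → P (x ∷ u) → P (u ++ [ x ])) → ∀ {u w} → Rot u w → P u → P w
 rot-closed h done p = p
 rot-closed h (step r) p = rot-closed h r (h p)

 -- A run (c , p , q) stands for a through block of colour c with p + 1 consecutive elements
 -- on one circle and q + 1 consecutive elements on the other, which is read backwards.
 Run : Set
 Run = ℕ × ℕ × ℕ

 asc desc : List Run → List ℕ
 asc [] = []
 asc ((c , p , q) ∷ rs) = replicate (suc p) c ++ asc rs
 desc [] = []
 desc ((c , p , q) ∷ rs) = desc rs ++ replicate (suc q) c

 cols : List Run → List ℕ
 cols = map proj₁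

 -- The two circles bound the annulus with opposite orientations, so the same spokes are met in
 -- opposite cyclic orders. `nonempty` expresses that some block meets both circles.
 record Spokes (U V : List ℕ) : Set where
   constructor spokes
   field runs : List Run
         nonempty : runs ≢ []
         distinct : Unique (cols runs)
         rotU : Rot U (asc runs)
         rotV : Rot V (desc runs)

 asc-++ : ∀ rs ss → asc (rs ++ ss) ≡ asc rs ++ asc ss
 asc-++ [] ss = refl
 asc-++ ((c , p , q) ∷ rs) ss = trans (cong (replicate (suc p) c ++_) (asc-++ rs ss)) (sym (++-assoc (replicate (suc p) c) _ _))

 desc-++ : ∀ rs ss → desc (rs ++ ss) ≡ desc ss ++ desc rs
 desc-++ [] ss = sym (++-identityʳ _)
 desc-++ ((c , p , q) ∷ rs) ss = trans (cong (_++ replicate (suc q) c) (desc-++ rs ss)) (++-assoc (desc ss) _ _)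

 flip-runs : List Run → List Run
 flip-runs [] = []
 flip-runs ((c , p , q) ∷ rs) = flip-runs rs ++ [ (c , q , p) ]

 asc-flip : ∀ rs → asc (flip-runs rs) ≡ desc rs
 asc-flip [] = refl
 asc-flip ((c , p , q) ∷ rs) = trans (asc-++ (flip-runs rs) _) (cong₂ _++_ (asc-flip rs) (++-identityʳ _))

 desc-flip : ∀ rs → desc (flip-runs rs) ≡ asc rs
 desc-flip [] = refl
 desc-flip ((c , p , q) ∷ rs) = trans (desc-++ (flip-runs rs) _) (cong (replicate (suc p) c ++_) (desc-flip rs))

 cols-flip : ∀ rs → cols (flip-runs rs) ↭ cols rs
 cols-flip [] = ↭-refl
 cols-flip ((c , p , q) ∷ rs) = ↭-trans (↭-reflexive (map-++ proj₁ (flip-runs rs) _))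
   (↭-trans (PermP.++-comm (cols (flip-runs rs)) [ c ]) (Perm.prep c (cols-flip rs)))

 flip-nonempty : ∀ {rs} → rs ≢ [] → flip-runs rs ≢ []
 flip-nonempty {[]} h _ = h refl
 flip-nonempty {r ∷ rs} h e with flip-runs rs
 flip-nonempty {r ∷ rs} h () | []
 flip-nonempty {r ∷ rs} h () | _ ∷ _

 spokes-sym : ∀ {U V} → Spokes U V → Spokes V U
 spokes-sym (spokes rs ne u rU rV) = spokes (flip-runs rs) (flip-nonempty ne) (unique-↭ (↭-sym (cols-flip rs)) u)
   (subst (Rot _) (sym (asc-flip rs)) rV) (subst (Rot _) (sym (desc-flip rs)) rU)

 spokes-rot : ∀ {U U' V} → Rot U U' → Spokes U V → Spokes U' V
 spokes-rot r (spokes rs ne u rU rV) = spokes rs ne u (rot-trans (rot-sym r) rU) rV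

 -- Turns the unknown rotation of U into explicit data: the starting point of U cuts its first run
 -- into `e + 1` letters at the front and `o` letters at the end.
 record Headed (U V : List ℕ) : Set where
   constructor headed
   field b e o q : ℕ
         rest : List Run
         distinct : Unique (b ∷ cols rest)
         U≡ : U ≡ replicate (suc e) b ++ asc rest ++ replicate o b
         rotV : Rot V (desc ((b , e + o , q) ∷ rest))

 replicate-+ : ∀ m n (b : ℕ) → replicate m b ++ replicate n b ≡ replicate (m + n) b
 replicate-+ zero n b = refl
 replicate-+ (suc m) n b = cong (b ∷_) (replicate-+ m n b)

 replicate-snoc : ∀ n (b : ℕ) → replicate n b ++ [ b ] ≡ replicate (suc n) b
 replicate-snoc n b = trans (replicate-+ n 1 b) (cong (λ k → replicate k b) (ℕP.+-comm n 1))

 headed-step : ∀ {x u V} → Headed (x ∷ u) V → Headed (u ++ [ x ]) V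
 headed-step {V = V} (headed b (suc e) o q rest d refl rV) = headed b e (suc o) q rest d
   (cong (b ∷_) (trans (++-assoc (replicate e b) _ _) (cong (replicate e b ++_)
     (trans (++-assoc (asc rest) _ _) (cong (asc rest ++_) (replicate-snoc o b))))))
   (subst (λ k → Rot V (desc ((b , k , q) ∷ rest))) (sym (ℕP.+-suc e o)) rV)
 headed-step {V = V} (headed b zero o q [] d refl rV) = headed b o 0 q [] d
   (trans (replicate-snoc o b) (sym (++-identityʳ _)))
   (subst (λ k → Rot V (desc ((b , k , q) ∷ []))) (sym (ℕP.+-identityʳ o)) rV)
 -- The last front letter of run b moves to the end, so the starting point passes to the next run; b
 -- becomes the last run, and V is turned by its block of letters b.
 headed-step {V = V} (headed b zero o q ((c , p , q') ∷ rest) ((b≢ ∷ b∉) ∷ c∉ ∷ d) refl rV) =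
   headed c p 0 q' (rest ++ [ (b , o , q) ])
     (subst Unique (cong (c ∷_) (sym (map-++ proj₁ rest _)))
       (unique-↭ {b ∷ c ∷ cols rest} (↭-trans (Perm.swap b c ↭-refl) (Perm.prep c (↭-sym (PermP.++-comm (cols rest) [ b ]))))
         ((b≢ ∷ b∉) ∷ c∉ ∷ d)))
     (trans (cong (_++ [ b ]) (++-assoc (c ∷ replicate p c) (asc rest) _)) (trans (++-assoc (c ∷ replicate p c) _ _)
       (cong ((c ∷ replicate p c) ++_) (trans (++-assoc (asc rest) _ _)
         (trans (cong (asc rest ++_) (trans (replicate-snoc o b) (sym (++-identityʳ _))))
           (trans (sym (asc-++ rest _)) (sym (++-identityʳ _))))))))
     (rot-trans rV (subst (Rot _) (trans (sym (++-assoc (replicate (suc q) b) (desc rest) _))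
       (cong (_++ replicate (suc q') c) (sym (desc-++ rest _))))
       (rot-++ (desc rest ++ replicate (suc q') c) (replicate (suc q) b))))

 spokes⇒headed : ∀ {U V} → Spokes U V → Headed U V
 spokes⇒headed (spokes [] ne _ _ _) = ⊥-elim (ne refl)
 spokes⇒headed {V = V} (spokes ((c , p , q) ∷ rs) ne u rU rV) = rot-closed {λ W → Headed W V} headed-step (rot-sym rU)
   (headed c p 0 q rs u (cong (replicate (suc p) c ++_) (sym (++-identityʳ _)))
     (subst (λ k → Rot V (desc ((c , k , q) ∷ rs))) (sym (ℕP.+-identityʳ p)) rV))

 headed⇒spokes : ∀ {U V} → Headed U V → Spokes U V
 headed⇒spokes (headed b e o q rest d refl rV) = spokes ((b , e + o , q) ∷ rest) (λ ()) d
   (subst₂ Rot (++-assoc (replicate (suc e) b) _ _)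
     (trans (sym (++-assoc (replicate o b) _ _)) (cong (_++ asc rest) (trans (replicate-+ o (suc e) b)
       (cong (λ k → replicate k b) (ℕP.+-comm o (suc e))))))
     (rot-++ (replicate (suc e) b ++ asc rest) (replicate o b))) rV

 spokes-twin : ∀ {b u V} → Spokes (b ∷ u) V → Spokes (b ∷ b ∷ u) V
 spokes-twin s with spokes⇒headed s
 ... | headed b e o q rest d refl rV = headed⇒spokes (headed b (suc e) o q rest d refl rV)

 spokes-untwin : ∀ {b u V} → Spokes (b ∷ b ∷ u) V → Spokes (b ∷ u) V
 spokes-untwin s with spokes⇒headed s
 ... | headed b (suc e) o q rest d refl rV = headed⇒spokes (headed b e o q rest d refl rV)
 -- With a single run and only one letter at the front, the second b is the first letter of the part
 -- at the end.
 ... | headed b zero (suc o) q [] d refl rV = headed⇒spokes (headed b zero o q [] d refl rV)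
 ... | headed b zero o q ((.b , p , q') ∷ rest) ((b≢ ∷ _) ∷ _) refl rV = ⊥-elim (b≢ refl)

 NCWord : List ℕ → Set
 NCWord w = ∀ a b → a ≢ b → ¬ (a ∷ b ∷ a ∷ b ∷ [] ⊆ w)

 ⊆-snoc : ∀ {x : ℕ} {u} w → u ⊆ w ++ [ x ] → u ⊆ w ⊎ (∃[ u' ] (u ≡ u' ++ [ x ] × u' ⊆ w))
 ⊆-snoc [] (x ∷ʳ []) = inj₁ []
 ⊆-snoc [] (refl ∷ []) = inj₂ ([] , refl , [])
 ⊆-snoc (y ∷ w) (y ∷ʳ s) with ⊆-snoc w s
 ... | inj₁ t = inj₁ (y ∷ʳ t)
 ... | inj₂ (u' , e , t) = inj₂ (u' , e , y ∷ʳ t)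
 ⊆-snoc (y ∷ w) (refl ∷ s) with ⊆-snoc w s
 ... | inj₁ t = inj₁ (refl ∷ t)
 ... | inj₂ (u' , e , t) = inj₂ (y ∷ u' , cong (y ∷_) e , refl ∷ t)

 -- A pattern abab that uses the moved letter as its final b becomes baba in front.
 ncword-step : ∀ {x u} → NCWord (x ∷ u) → NCWord (u ++ [ x ])
 ncword-step {x} {u} h a b a≢b s with ⊆-snoc u s
 ... | inj₁ t = h a b a≢b (x ∷ʳ t)
 ... | inj₂ (.a ∷ .b ∷ .a ∷ [] , refl , t) = h x a (a≢b ∘ sym) (refl ∷ t)
 ... | inj₂ ([] , () , t)
 ... | inj₂ (_ ∷ [] , () , t)
 ... | inj₂ (_ ∷ _ ∷ [] , () , t)
 ... | inj₂ (_ ∷ _ ∷ _ ∷ _ ∷ [] , () , t)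
 ... | inj₂ (_ ∷ _ ∷ _ ∷ _ ∷ _ ∷ _ , () , t)

 ⊆-∈ : ∀ {x : ℕ} {u w} → x ∷ u ⊆ w → x ∈ w
 ⊆-∈ (y ∷ʳ s) = there (⊆-∈ s)
 ⊆-∈ (refl ∷ s) = here refl

 ⊆-tail : ∀ {x : ℕ} {u w} → x ∷ u ⊆ w → u ⊆ w
 ⊆-tail (y ∷ʳ s) = y ∷ʳ ⊆-tail s
 ⊆-tail (refl ∷ s) = _ ∷ʳ s

 ncword-fresh : ∀ {x u} → x ∉ u → NCWord u → NCWord (x ∷ u)
 ncword-fresh x∉ h a b a≢b (_ ∷ʳ s) = h a b a≢b s
 ncword-fresh x∉ h a b a≢b (refl ∷ s) = x∉ (⊆-∈ (⊆-tail s))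

 ncword-twin : ∀ {x u} → NCWord (x ∷ u) → NCWord (x ∷ x ∷ u)
 ncword-twin h a b a≢b (_ ∷ʳ s) = h a b a≢b s
 ncword-twin h a b a≢b (refl ∷ (_ ∷ʳ s)) = h a b a≢b (refl ∷ s)
 ncword-twin h a b a≢b (refl ∷ (refl ∷ s)) = a≢b refl

 ncword-⊆ : ∀ {u w} → u ⊆ w → NCWord w → NCWord u
 ncword-⊆ s h a b a≢b t = h a b a≢b (Sub.⊆-trans t s)

 restrict : List ℕ → List ℕ → List ℕ
 restrict V [] = []
 restrict V (a ∷ U) = if memb a V then a ∷ restrict V U else restrict V U

 -- Letters occurring in V are identified with each other.
 merge : List ℕ → ℕ → ℕ
 merge V a = if memb a V then 0 else suc a

 -- If all blocks meeting both circles are merged into one, each circle carries an ordinary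
 -- non-crossing partition of a disc with one distinguished block; the merged letters alone must
 -- form spokes.
 record AnnularNC (U V : List ℕ) : Set where
   constructor annularNC
   field ncU : NCWord (map (merge V) U)
         ncV : NCWord (map (merge U) V)
         through : Spokes (restrict V U) (restrict U V)

 memb-≡ : ∀ U U' {a} → (a ∈ U → a ∈ U') → (a ∈ U' → a ∈ U) → memb a U ≡ memb a U'
 memb-≡ U U' f g = bool-ext (λ e → memb-complete (f (memb-sound U e))) (λ e → memb-complete (g (memb-sound U' e)))

 merge-cong : ∀ U U' V → (∀ {a} → a ∈ V → memb a U ≡ memb a U') → map (merge U) V ≡ map (merge U') V
 merge-cong U U' [] h = refl
 merge-cong U U' (a ∷ V) h = cong₂ _∷_ (cong (λ b → if b then 0 else suc a) (h (here refl))) (merge-cong U U' V (h ∘ there))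

 restrict-cong : ∀ U U' V → (∀ {a} → a ∈ V → memb a U ≡ memb a U') → restrict U V ≡ restrict U' V
 restrict-cong U U' [] h = refl
 restrict-cong U U' (a ∷ V) h with memb a U | memb a U' | h (here refl)
 ... | true | true | refl = cong (a ∷_) (restrict-cong U U' V (h ∘ there))
 ... | false | false | refl = restrict-cong U U' V (h ∘ there)

 restrict-++ : ∀ V α β → restrict V (α ++ β) ≡ restrict V α ++ restrict V β
 restrict-++ V [] β = refl
 restrict-++ V (a ∷ α) β with memb a V
 ... | true = cong (a ∷_) (restrict-++ V α β)
 ... | false = restrict-++ V α β

 annular-sym : ∀ {U V} → AnnularNC U V → AnnularNC V U
 annular-sym (annularNC u v t) = annularNC v u (spokes-sym t)

 annular-congV : ∀ {U U' V} → (∀ {a} → a ∈ V → memb a U ≡ memb a U') → NCWord (map (merge V) U') →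
   Spokes (restrict V U') (restrict U V) → AnnularNC U V → AnnularNC U' V
 annular-congV {U} {U'} {V} h nc s (annularNC u v t) = annularNC nc (subst NCWord (merge-cong U U' V h) v)
   (subst (Spokes (restrict V U')) (restrict-cong U U' V h) s)

 annular-step : ∀ {x u V} → AnnularNC (x ∷ u) V → AnnularNC (u ++ [ x ]) V
 annular-step {x} {u} {V} Q@(annularNC nu nv t) = annular-congV (λ _ → memb-≡ (x ∷ u) (u ++ [ x ]) f g)
   (subst NCWord (sym (map-++ (merge V) u [ x ])) (ncword-step nu))
   (subst (λ W → Spokes W (restrict (x ∷ u) V)) (sym (restrict-++ V u [ x ]))
     (spokes-rot (subst (λ W → Rot W (restrict V u ++ restrict V [ x ])) (sym (restrict-++ V [ x ] u)) (rot-++ (restrict V [ x ]) (restrict V u))) t)) Q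
   where
   f : ∀ {a} → a ∈ x ∷ u → a ∈ u ++ [ x ]
   f (here refl) = ∈-++⁺ʳ u (here refl)
   f (there a∈) = ∈-++⁺ˡ a∈
   g : ∀ {a} → a ∈ u ++ [ x ] → a ∈ x ∷ u
   g a∈ with ∈-++⁻ u a∈
   ... | inj₁ k = there k
   ... | inj₂ (here refl) = here refl

 annular-rot : ∀ {U U' V} → Rot U U' → AnnularNC U V → AnnularNC U' V
 annular-rot {V = V} r Q = rot-closed {λ W → AnnularNC W V} annular-step r Q

 annular-twin : ∀ {b u V} → AnnularNC (b ∷ u) V → AnnularNC (b ∷ b ∷ u) V
 annular-twin {b} {u} {V} Q@(annularNC nu nv t) = annular-congV (λ _ → memb-≡ (b ∷ u) (b ∷ b ∷ u) there (λ { (here e) → here e ; (there k) → k }))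
   (ncword-twin nu) (sp t) Q
   where
   sp : ∀ {W} → Spokes (restrict V (b ∷ u)) W → Spokes (restrict V (b ∷ b ∷ u)) W
   sp s with memb b V
   ... | true = spokes-twin s
   ... | false = s

 annular-untwin : ∀ {b u V} → AnnularNC (b ∷ b ∷ u) V → AnnularNC (b ∷ u) V
 annular-untwin {b} {u} {V} Q@(annularNC nu nv t) = annular-congV (λ _ → memb-≡ (b ∷ b ∷ u) (b ∷ u) (λ { (here e) → here e ; (there k) → k }) there)
   (ncword-⊆ (_ ∷ʳ Sub.⊆-refl) nu) (sp t) Q
   where
   sp : ∀ {W} → Spokes (restrict V (b ∷ b ∷ u)) W → Spokes (restrict V (b ∷ u)) W
   sp s with memb b V
   ... | true = spokes-untwin s
   ... | false = s

 restrict-skip : ∀ {a V} U → a ∉ V → restrict V (a ∷ U) ≡ restrict V U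
 restrict-skip {a} {V} U h with memb a V in eq
 ... | true = ⊥-elim (h (memb-sound V eq))
 ... | false = refl

 merge-inj : ∀ V a b → a ∉ V → merge V a ≡ merge V b → a ≡ b
 merge-inj V a b h e with memb a V in eq
 ... | true = ⊥-elim (h (memb-sound V eq))
 ... | false with memb b V
 ... | false = ℕP.suc-injective e
 merge-inj V a b h () | false | true

 annular-fresh : ∀ {x u V} → x ∉ u → x ∉ V → AnnularNC u V → AnnularNC (x ∷ u) V
 annular-fresh {x} {u} {V} x∉u x∉V Q@(annularNC nu nv t) =
   annular-congV (λ a∈ → memb-≡ u (x ∷ u) there (λ { (here refl) → ⊥-elim (x∉V a∈) ; (there k) → k }))
     (ncword-fresh (λ k → let (y , y∈ , e) = ∈-map⁻ (merge V) k in x∉u (subst (_∈ u) (sym (merge-inj V x y x∉V e)) y∈)) nu)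
     (subst (λ W → Spokes W (restrict u V)) (sym (restrict-skip u x∉V)) t) Q

 annular-unfresh : ∀ {x u V} → x ∉ V → AnnularNC (x ∷ u) V → AnnularNC u V
 annular-unfresh {x} {u} {V} x∉V Q@(annularNC nu nv t) =
   annular-congV (λ a∈ → memb-≡ (x ∷ u) u (λ { (here refl) → ⊥-elim (x∉V a∈) ; (there k) → k }) there)
     (ncword-⊆ (_ ∷ʳ Sub.⊆-refl) nu)
     (subst (λ W → Spokes W (restrict (x ∷ u) V)) (restrict-skip u x∉V) t) Q

 thin : List ℕ → List Run
 thin = map (λ c → c , 0 , 0)

 asc-thin : ∀ cs → asc (thin cs) ≡ cs
 asc-thin [] = refl
 asc-thin (c ∷ cs) = cong (c ∷_) (asc-thin cs)

 cols-thin : ∀ cs → cols (thin cs) ≡ cs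
 cols-thin [] = refl
 cols-thin (c ∷ cs) = cong (c ∷_) (cols-thin cs)

 desc-thin-↭ : ∀ cs → desc (thin cs) ↭ cs
 desc-thin-↭ [] = ↭-refl
 desc-thin-↭ (c ∷ cs) = ↭-trans (PermP.++-comm (desc (thin cs)) [ c ]) (Perm.prep c (desc-thin-↭ cs))

 restrict-all : ∀ V U → (∀ {a} → a ∈ U → a ∈ V) → restrict V U ≡ U
 restrict-all V [] h = refl
 restrict-all V (a ∷ U) h with memb a V in eq
 ... | true = cong (a ∷_) (restrict-all V U (h ∘ there))
 ... | false = ⊥-elim (true≢false (trans (sym (memb-complete {a} {V} (h (here refl)))) eq))

 merge-all : ∀ V U → (∀ {a} → a ∈ U → a ∈ V) → NCWord (map (merge V) U)
 merge-all V U h a b a≢b s = a≢b (trans (zero! (⊆-∈ s)) (sym (zero! (⊆-∈ (⊆-tail s)))))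
   where
   zero! : ∀ {z} → z ∈ map (merge V) U → z ≡ 0
   zero! z∈ with ∈-map⁻ (merge V) z∈
   ... | y , y∈ , e with memb y V in eq
   ... | true = e
   ... | false = ⊥-elim (true≢false (trans (sym (memb-complete {y} {V} (h y∈))) eq))

 annular-all : ∀ {U V} → (∀ {a} → a ∈ U → a ∈ V) → (∀ {a} → a ∈ V → a ∈ U) → Spokes U V → AnnularNC U V
 annular-all {U} {V} h h' s = annularNC (merge-all V U h) (merge-all U V h')
   (subst₂ Spokes (sym (restrict-all V U h)) (sym (restrict-all U V h')) s)

 -- Every annular non-crossing pair of words can be shortened unless it is a pure spoke diagram.
 data Reducible (U V : List ℕ) : Set where
   single : ∀ {x u} → Rot U (x ∷ u) → x ∉ u → x ∉ V → Reducible U V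
   twin : ∀ {x u} → Rot U (x ∷ x ∷ u) → Reducible U V

 first-occurrence : ∀ {a} γ → a ∈ γ → ∃[ γ₁ ] ∃[ γ₂ ] (γ ≡ γ₁ ++ a ∷ γ₂ × a ∉ γ₁)
 first-occurrence {a} (b ∷ γ) a∈ with a ℕP.≟ b
 first-occurrence {a} (b ∷ γ) a∈ | yes refl = [] , γ , refl , λ ()
 first-occurrence {a} (b ∷ γ) (here e) | no h = ⊥-elim (h e)
 first-occurrence {a} (b ∷ γ) (there a∈) | no h with first-occurrence γ a∈
 ... | γ₁ , γ₂ , e , a∉ = b ∷ γ₁ , γ₂ , cong (b ∷_) e , λ { (here e') → h e' ; (there k) → a∉ k }

 module _ (k : ℕ → ℕ) where
  ∈-⊆ : ∀ {b} w → b ∈ w → k b ∷ [] ⊆ map k w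
  ∈-⊆ (y ∷ w) (here refl) = refl ∷ SubP.[]⊆-universal _
  ∈-⊆ (y ∷ w) (there b∈) = k y ∷ʳ ∈-⊆ w b∈

  ⊆-skip : ∀ α {w u} → u ⊆ map k w → u ⊆ map k (α ++ w)
  ⊆-skip [] s = s
  ⊆-skip (y ∷ α) s = k y ∷ʳ ⊆-skip α s

  ⊆-pick : ∀ {b} α {w u} → b ∈ α → u ⊆ map k w → k b ∷ u ⊆ map k (α ++ w)
  ⊆-pick (y ∷ α) (here refl) s = refl ∷ ⊆-skip α s
  ⊆-pick (y ∷ α) (there b∈) s = k y ∷ʳ ⊆-pick α b∈ s

  -- A letter b inside an arc from a to an equal letter that occurred again behind the arc would
  -- give the pattern abab.
  arc-closed : ∀ {a a'} γ {ρ} → k a ≡ k a' → NCWord (map k (a ∷ γ ++ a' ∷ ρ)) → (∀ {b} → b ∈ γ → k a ≢ k b) →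
    ∀ {b} → b ∈ γ → b ∉ ρ
  arc-closed γ {ρ} e nc h b∈γ b∈ρ = nc _ _ (h b∈γ) (refl ∷ ⊆-pick γ b∈γ (e ∷ ∈-⊆ ρ b∈ρ))

  -- An innermost arc of a non-crossing word is an isolated letter or two equal neighbours.
  innermost : ∀ n γ {δ} → length γ ≤ n → γ ≢ [] →
    (∀ {a b} → a ∈ γ → k a ≡ k b → a ≡ b) → (∀ {a} → a ∈ γ → a ∉ δ) → NCWord (map k (γ ++ δ)) →
    ∃[ α ] ∃[ x ] ∃[ β ] (γ ≡ α ++ x ∷ β × ((x ∉ α × x ∉ β) ⊎ (∃[ β' ] (β ≡ x ∷ β'))))
  innermost n [] _ ne _ _ _ = ⊥-elim (ne refl)
  innermost (suc n) (a ∷ γ) {δ} (s≤s le) ne inj cl nc with memb a γ in eq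
  ... | false = [] , a , γ , refl , inj₁ ((λ ()) , λ a∈ → true≢false (trans (sym (memb-complete a∈)) eq))
  ... | true with first-occurrence γ (memb-sound γ eq)
  ... | [] , γ₂ , refl , _ = [] , a , a ∷ γ₂ , refl , inj₂ (γ₂ , refl)
  -- The arc from a to its next occurrence is again closed: its letters cannot recur behind it, so
  -- the search continues inside.
  ... | g ∷ γ₁ , γ₂ , refl , a∉ = extend (innermost n (g ∷ γ₁) {a ∷ γ₂ ++ δ} len (λ ()) (λ b∈ → inj (there (∈-++⁺ˡ b∈))) inner
    (ncword-⊆ (_ ∷ʳ Sub.⊆-refl) nc'))
    where
    nc' : NCWord (map k (a ∷ (g ∷ γ₁) ++ a ∷ γ₂ ++ δ))
    nc' = subst (λ w → NCWord (k a ∷ map k w)) (++-assoc (g ∷ γ₁) (a ∷ γ₂) δ) nc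
    len : length (g ∷ γ₁) ≤ n
    len = ℕP.≤-trans (ℕP.≤-trans (ℕP.m≤m+n (length (g ∷ γ₁)) (length (a ∷ γ₂))) (ℕP.≤-reflexive (sym (length-++ (g ∷ γ₁))))) le
    inner : ∀ {b} → b ∈ g ∷ γ₁ → b ∉ a ∷ γ₂ ++ δ
    inner b∈ (here refl) = a∉ b∈
    inner b∈ (there b∈') = arc-closed (g ∷ γ₁) refl nc' (λ c∈ e → a∉ (subst (_∈ g ∷ γ₁) (sym (inj (here refl) e)) c∈)) b∈ b∈'
    extend : ∃[ α ] ∃[ x ] ∃[ β ] (g ∷ γ₁ ≡ α ++ x ∷ β × ((x ∉ α × x ∉ β) ⊎ (∃[ β' ] (β ≡ x ∷ β')))) → _
    extend (α , x , β , e , inj₁ (x∉α , x∉β)) = a ∷ α , x , β ++ a ∷ γ₂ ,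
      cong (a ∷_) (trans (cong (_++ a ∷ γ₂) e) (++-assoc α _ _)) ,
      inj₁ ((λ { (here refl) → a∉ x∈ ; (there h) → x∉α h }) , after)
      where
      x∈ : x ∈ g ∷ γ₁
      x∈ = subst (x ∈_) (sym e) (∈-++⁺ʳ α (here refl))
      after : x ∉ β ++ a ∷ γ₂
      after h with ∈-++⁻ β h
      ... | inj₁ h' = x∉β h'
      ... | inj₂ h' = inner x∈ (∈-++⁺ˡ {xs = a ∷ γ₂} h')
    extend (α , x , β , e , inj₂ (β' , refl)) = a ∷ α , x , x ∷ β' ++ a ∷ γ₂ ,
      cong (a ∷_) (trans (cong (_++ a ∷ γ₂) e) (++-assoc α _ _)) , inj₂ (β' ++ a ∷ γ₂ , refl)

 -- A maximal stretch of letters absent from V, bounded by letters of V. When ρ is empty, t itself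
 -- bounds the gap from both sides.
 record Gap (V U : List ℕ) : Set where
   constructor gap
   field {t} : ℕ
         {γ ρ} : List ℕ
         t∈ : t ∈ V
         rotation : Rot U (t ∷ γ ++ ρ)
         γ≢[] : γ ≢ []
         γ-outside : ∀ {b} → b ∈ γ → b ∉ V
         ρ-start : ρ ≡ [] ⊎ (∃[ s ] ∃[ ρ' ] (ρ ≡ s ∷ ρ' × s ∈ V))

 memb-dec : ∀ a V → (a ∈ V) ⊎ (a ∉ V)
 memb-dec a V with memb a V in eq
 ... | true = inj₁ (memb-sound V eq)
 ... | false = inj₂ (λ a∈ → true≢false (trans (sym (memb-complete a∈)) eq))

 ⊆-dec : ∀ U V → (∀ {a} → a ∈ U → a ∈ V) ⊎ (∃[ a ] (a ∈ U × a ∉ V))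
 ⊆-dec [] V = inj₁ (λ ())
 ⊆-dec (a ∷ U) V with memb-dec a V | ⊆-dec U V
 ... | inj₂ h | _ = inj₂ (a , here refl , h)
 ... | inj₁ _ | inj₂ (b , b∈ , h) = inj₂ (b , there b∈ , h)
 ... | inj₁ h | inj₁ k = inj₁ (λ { (here refl) → h ; (there b∈) → k b∈ })

 StartsIn : List ℕ → List ℕ → Set
 StartsIn V ρ = ρ ≡ [] ⊎ (∃[ s ] ∃[ ρ' ] (ρ ≡ s ∷ ρ' × s ∈ V))

 starts-++ : ∀ {V} δ {α} → StartsIn V δ → StartsIn V α → StartsIn V (δ ++ α)
 starts-++ .[] (inj₁ refl) h = h
 starts-++ .(s ∷ ρ') {α} (inj₂ (s , ρ' , refl , s∈)) h = inj₂ (s , ρ' ++ α , refl , s∈)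

 span-outside : ∀ V w → ∃[ γ ] ∃[ δ ] (w ≡ γ ++ δ × (∀ {b} → b ∈ γ → b ∉ V) × StartsIn V δ)
 span-outside V [] = [] , [] , refl , (λ ()) , inj₁ refl
 span-outside V (y ∷ w) with memb-dec y V | span-outside V w
 ... | inj₁ y∈ | _ = [] , y ∷ w , refl , (λ ()) , inj₂ (y , w , refl , y∈)
 ... | inj₂ y∉ | γ , δ , refl , h , st = y ∷ γ , δ , refl , (λ { (here refl) → y∉ ; (there b∈) → h b∈ }) , st

 -- Walks around the circle from t. Each further letter of V takes over the role of t, and the old t
 -- joins α at the end, until a letter absent from V is met.
 find-gap : ∀ V {U t} w α → t ∈ V → StartsIn V α → (∃[ a ] (a ∈ w × a ∉ V)) → Rot U (t ∷ w ++ α) → Gap V U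
 find-gap V (y ∷ w) α t∈ st (a , a∈ , a∉) r with memb-dec y V
 find-gap V (y ∷ w) α t∈ st (a , a∈ , a∉) r | inj₂ y∉ with span-outside V w
 ... | γ , δ , refl , h , st' = gap {γ = y ∷ γ} t∈ (subst (λ z → Rot _ (_ ∷ y ∷ z)) (++-assoc γ δ α) r) (λ ())
   (λ { (here refl) → y∉ ; (there b∈) → h b∈ }) (starts-++ δ st' st)
 find-gap V (y ∷ w) α t∈ st (a , here refl , a∉) r | inj₁ y∈ = ⊥-elim (a∉ y∈)
 find-gap V {t = t} (y ∷ w) α t∈ st (a , there a∈ , a∉) r | inj₁ y∈ =
   find-gap V w (α ++ [ t ]) y∈ (starts-++ α st (inj₂ (t , [] , refl , t∈))) (a , a∈ , a∉)
     (rot-trans r (subst (Rot (t ∷ y ∷ w ++ α)) (cong (y ∷_) (++-assoc w α [ t ])) (rot-++ [ t ] (y ∷ w ++ α))))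

 merge-in : ∀ V {a} → a ∈ V → merge V a ≡ 0
 merge-in V {a} a∈ = cong (λ b → if b then 0 else suc a) (memb-complete a∈)

 merge-out : ∀ V {a} → a ∉ V → merge V a ≡ suc a
 merge-out V {a} a∉ = cong (λ b → if b then 0 else suc a) (≡false (λ e → a∉ (memb-sound V e)))

 -- Both letters bounding the gap are merged to 0, so the gap is an arc and none of its letters
 -- occurs elsewhere in U. What is isolated or doubled inside the gap is therefore so in the whole
 -- word.
 gap⇒reducible : ∀ {U V} → NCWord (map (merge V) U) → Gap V U → Reducible U V
 gap⇒reducible {U} {V} nc (gap {t} {γ} {ρ} t∈ r γ≢[] out st) = conclude
   (innermost k (length γ) γ ℕP.≤-refl γ≢[] (λ a∈ e → merge-inj V _ _ (out a∈) e) (closed ρ st nc') (ncword-⊆ (_ ∷ʳ Sub.⊆-refl) nc'))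
   where
   k = merge V
   nc' : NCWord (map k (t ∷ γ ++ ρ))
   nc' = rot-closed {λ W → NCWord (map k W)} (λ {x} {u} h → subst NCWord (sym (map-++ k u [ x ])) (ncword-step h)) r nc
   closed : ∀ ρ → StartsIn V ρ → NCWord (map k (t ∷ γ ++ ρ)) → ∀ {a} → a ∈ γ → a ∉ ρ
   closed .[] (inj₁ refl) nc a∈ ()
   closed .(s ∷ ρ') (inj₂ (s , ρ' , refl , s∈)) nc a∈ (here refl) = out a∈ s∈
   closed .(s ∷ ρ') (inj₂ (s , ρ' , refl , s∈)) nc a∈ (there a∈ρ) = arc-closed k γ (trans (merge-in V t∈) (sym (merge-in V s∈))) nc
     (λ b∈ e → ℕP.0≢1+n (trans (sym (merge-in V t∈)) (trans e (merge-out V (out b∈))))) a∈ a∈ρ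
   rot-to : ∀ α x β → γ ≡ α ++ x ∷ β → Rot U (x ∷ (β ++ ρ) ++ t ∷ α)
   rot-to α x β e = rot-trans r (subst (λ w → Rot (t ∷ w) (x ∷ (β ++ ρ) ++ t ∷ α))
     (trans (sym (++-assoc α (x ∷ β) ρ)) (cong (_++ ρ) (sym e))) (rot-++ (t ∷ α) (x ∷ β ++ ρ)))
   conclude : _ → Reducible U V
   conclude (α , x , β , e , inj₁ (x∉α , x∉β)) = single (rot-to α x β e) x∉ (out x∈)
     where
     x∈ : x ∈ γ
     x∈ = subst (x ∈_) (sym e) (∈-++⁺ʳ α (here refl))
     x∉ : x ∉ (β ++ ρ) ++ t ∷ α
     x∉ h with ∈-++⁻ (β ++ ρ) h
     ... | inj₂ (here refl) = out x∈ t∈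
     ... | inj₂ (there h') = x∉α h'
     ... | inj₁ h' with ∈-++⁻ β h'
     ... | inj₁ h'' = x∉β h''
     ... | inj₂ h'' = closed ρ st nc' x∈ h''
   conclude (α , x , β , e , inj₂ (β' , refl)) = twin (rot-to α x β e)

 restrict-∈ : ∀ V U {a} → a ∈ restrict V U → a ∈ U × a ∈ V
 restrict-∈ V (y ∷ U) a∈ with memb y V in eq
 restrict-∈ V (y ∷ U) (here refl) | true = here refl , memb-sound V eq
 restrict-∈ V (y ∷ U) (there a∈) | true = let (p , q) = restrict-∈ V U a∈ in there p , q
 restrict-∈ V (y ∷ U) a∈ | false = let (p , q) = restrict-∈ V U a∈ in there p , q

 outside⇒reducible : ∀ {U V} → AnnularNC U V → (∃[ a ] (a ∈ U × a ∉ V)) → Reducible U V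
 outside⇒reducible {U} {V} (annularNC nu _ (spokes [] ne _ _ _)) _ = ⊥-elim (ne refl)
 -- The colour of a spoke occurs on both circles, so the walk can start at it.
 outside⇒reducible {U} {V} (annularNC nu _ (spokes ((c , p , q) ∷ rs) _ _ rU _)) (a , a∈ , a∉)
   with restrict-∈ V U (PermP.∈-resp-↭ (↭-sym (rot-↭ rU)) (here refl))
 ... | c∈U , c∈V with ∈-∃++ c∈U
 ... | α , β , refl = gap⇒reducible nu (find-gap V (β ++ α) [] c∈V (inj₁ refl) (a , a∈' , a∉)
   (subst (λ w → Rot (α ++ c ∷ β) (c ∷ w)) (sym (++-identityʳ (β ++ α))) (rot-++ α (c ∷ β))))
   where
   a∈' : a ∈ β ++ α
   a∈' with ∈-++⁻ α a∈
   ... | inj₁ h = ∈-++⁺ʳ β h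
   ... | inj₂ (here refl) = ⊥-elim (a∉ c∈V)
   ... | inj₂ (there h) = ∈-++⁺ˡ h

 data Progress (U V : List ℕ) : Set where
   left : Reducible U V → Progress U V
   right : Reducible V U → Progress U V
   spoke : ∀ {cs} → cs ≢ [] → Unique cs → Rot U cs → Rot V (desc (thin cs)) → Progress U V

 data RunShape : List Run → Set where
   long-p : ∀ rs c p q ss → RunShape (rs ++ (c , suc p , q) ∷ ss)
   long-q : ∀ rs c p q ss → RunShape (rs ++ (c , p , suc q) ∷ ss)
   short : ∀ cs → RunShape (thin cs)

 run-shape : ∀ rs → RunShape rs
 run-shape [] = short []
 run-shape ((c , suc p , q) ∷ rs) = long-p [] c p q rs
 run-shape ((c , zero , suc q) ∷ rs) = long-q [] c zero q rs
 run-shape ((c , zero , zero) ∷ rs) with run-shape rs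
 ... | long-p rs' c' p q ss = long-p (_ ∷ rs') c' p q ss
 ... | long-q rs' c' p q ss = long-q (_ ∷ rs') c' p q ss
 ... | short cs = short (c ∷ cs)

 spokes⇒progress : ∀ {U V} → Spokes U V → Progress U V
 spokes⇒progress {U} {V} (spokes runs ne d rU rV) with run-shape runs
 ... | short cs = spoke (λ { refl → ne refl }) (subst Unique (cols-thin cs) d) (subst (Rot U) (asc-thin cs) rU) rV
 ... | long-p rs c p q ss = left (twin (rot-trans rU (subst (λ w → Rot w (c ∷ c ∷ (replicate p c ++ asc ss) ++ asc rs)) (sym (asc-++ rs _)) (rot-++ (asc rs) (c ∷ c ∷ _)))))
 ... | long-q rs c p q ss = right (twin (rot-trans rV (subst (λ w → Rot w (c ∷ c ∷ (replicate q c ++ desc rs) ++ desc ss))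
   (sym (trans (desc-++ rs ((c , p , suc q) ∷ ss)) (++-assoc (desc ss) (replicate (suc (suc q)) c) (desc rs))))
   (rot-++ (desc ss) (c ∷ c ∷ replicate q c ++ desc rs)))))

 progress : ∀ {U V} → AnnularNC U V → Progress U V
 progress {U} {V} Q with ⊆-dec U V | ⊆-dec V U
 ... | inj₂ h | _ = left (outside⇒reducible Q h)
 ... | inj₁ _ | inj₂ h = right (outside⇒reducible (annular-sym Q) h)
 ... | inj₁ h | inj₁ h' = spokes⇒progress (subst₂ Spokes (restrict-all V U h) (restrict-all U V h') (AnnularNC.through Q))

-- Deleting and inserting elements in genus 0

module PlanarCycles where
 open import Data.Nat using (_+_)
 open ≡ using (refl; sym; trans)
 open CycleCounting
 open SpokeWords

 Chain : (ℕ → ℕ) → ℕ → List ℕ → ℕ → Set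
 Chain τ a [] z = τ a ≡ z
 Chain τ a (b ∷ bs) z = τ a ≡ b × Chain τ b bs z

 Cyclic : (ℕ → ℕ) → List ℕ → Set
 Cyclic τ [] = ⊤
 Cyclic τ (x ∷ xs) = Chain τ x xs x

 chain-snoc : ∀ {τ} a bs {y z} → Chain τ a bs y → τ y ≡ z → Chain τ a (bs ++ [ y ]) z
 chain-snoc a [] refl e = refl , e
 chain-snoc a (b ∷ bs) (h , ch) e = h , chain-snoc b bs ch e

 cyclic-step : ∀ {τ x xs} → Cyclic τ (x ∷ xs) → Cyclic τ (xs ++ [ x ])
 cyclic-step {xs = []} ch = ch
 cyclic-step {xs = y ∷ xs} (e , ch) = chain-snoc y xs ch e

 cyclic-rot : ∀ {τ us ws} → Rot us ws → Cyclic τ us → Cyclic τ ws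
 cyclic-rot {τ} r = rot-closed {Cyclic τ} (λ {x} {u} → cyclic-step {τ} {x} {u}) r

 del-chain : ∀ {τ x} → Inj τ → ∀ a bs {y} → a ≢ x → y ≢ x → (∀ {b} → b ∈ bs → b ≢ x) →
   Chain τ a bs y → Chain (del x τ) a bs y
 del-chain {τ} {x} inj a [] h hy hb e = trans (del-other {x} {τ} inj h (λ k → hy (trans (sym e) k))) e
 del-chain {τ} {x} inj a (b ∷ bs) h hy hb (e , ch) =
   trans (del-other {x} {τ} inj h (λ k → hb (here refl) (trans (sym e) k))) e ,
   del-chain inj b bs (hb (here refl)) hy (hb ∘ there) ch

 del-chain-end : ∀ {τ x} → Inj τ → ∀ a bs → a ≢ x → (∀ {b} → b ∈ bs → b ≢ x) → Chain τ a bs x → Chain (del x τ) a bs (τ x)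
 del-chain-end {τ} {x} inj a [] h hb e = del-skip {x} {τ} e
 del-chain-end {τ} {x} inj a (b ∷ bs) h hb (e , ch) =
   trans (del-other {x} {τ} inj h (λ k → hb (here refl) (trans (sym e) k))) e ,
   del-chain-end inj b bs (hb (here refl)) (hb ∘ there) ch

 cyclic-del-head : ∀ {τ x} → Inj τ → ∀ β → x ∉ β → Cyclic τ (x ∷ β) → Cyclic (del x τ) β
 cyclic-del-head inj [] x∉ ch = tt
 cyclic-del-head {τ} {x} inj (b ∷ β) x∉ (e , ch) = subst (Chain (del x τ) b β) e
   (del-chain-end inj b β (λ k → x∉ (here (sym k))) (λ b∈ k → x∉ (there (subst (_∈ β) k b∈))) ch)

 cyclic-del-other : ∀ {τ x} → Inj τ → ∀ vs → x ∉ vs → Cyclic τ vs → Cyclic (del x τ) vs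
 cyclic-del-other inj [] x∉ ch = tt
 cyclic-del-other {τ} {x} inj (v ∷ vs) x∉ ch =
   del-chain inj v vs (λ k → x∉ (here (sym k))) (λ k → x∉ (here (sym k))) (λ b∈ k → x∉ (there (subst (_∈ vs) k b∈))) ch

 chain-closed : ∀ {τ} a bs {z} → Chain τ a bs z → ∀ {y} → y ∈ a ∷ bs → τ y ∈ bs ⊎ τ y ≡ z
 chain-closed a [] e (here refl) = inj₂ e
 chain-closed a (b ∷ bs) (e , ch) (here refl) = inj₁ (here e)
 chain-closed a (b ∷ bs) (e , ch) (there y∈) with chain-closed b bs ch y∈
 ... | inj₁ h = inj₁ (there h)
 ... | inj₂ h = inj₂ h

 cyclic-closed : ∀ {τ} us → Cyclic τ us → ∀ {y} → y ∈ us → τ y ∈ us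
 cyclic-closed (x ∷ xs) ch y∈ with chain-closed x xs ch y∈
 ... | inj₁ h = there h
 ... | inj₂ h = here h

 -- L carries the permutation σ of genus 0 with respect to τ, whose cycles are the colour classes of c.
 record Planar (c τ : ℕ → ℕ) (L : List ℕ) : Set where
   field σ σ⁻ : ℕ → ℕ
         left-inv : ∀ y → σ⁻ (σ y) ≡ y
         right-inv : ∀ y → σ (σ⁻ y) ≡ y
         support : ∀ {y} → y ∉ L → σ y ≡ y
         same⇒orb : ∀ {y z} → y ∈ L → z ∈ L → c y ≡ c z → Orb σ y z
         orb⇒same : ∀ {y z} → y ∈ L → z ∈ L → Orb σ y z → c y ≡ c z
         euler : cyc L σ + cyc L (σ⁻ ∘ τ) ≡ length L

   σ-inj : Inj σ
   σ-inj {x} {y} e = trans (sym (left-inv x)) (trans (cong σ⁻ e) (left-inv y))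

   σ⁻-inj : Inj σ⁻
   σ⁻-inj {x} {y} e = trans (sym (right-inv x)) (trans (cong σ e) (right-inv y))

   σ-closed : ∀ {y} → y ∈ L → σ y ∈ L
   σ-closed {y} y∈ with memb-dec (σ y) L
   ... | inj₁ h = h
   ... | inj₂ h = ⊥-elim (h (subst (_∈ L) (sym (σ-inj (support h))) y∈))

 planar-↭ : ∀ {c τ L L'} → Inj τ → Unique L → L ↭ L' → Planar c τ L → Planar c τ L'
 planar-↭ {L = L} {L'} injτ u p P = record
   { σ = σ ; σ⁻ = σ⁻ ; left-inv = left-inv ; right-inv = right-inv
   ; support = λ h → support (λ y∈ → h (PermP.∈-resp-↭ p y∈))
   ; same⇒orb = λ y∈ z∈ → same⇒orb (back y∈) (back z∈)
   ; orb⇒same = λ y∈ z∈ → orb⇒same (back y∈) (back z∈)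
   ; euler = trans (cong₂ _+_ (sym (cyc-↭ σ-inj u p)) (sym (cyc-↭ (injτ ∘ σ⁻-inj) u p))) (trans euler (PermP.↭-length p)) }
   where
   open Planar P
   back : ∀ {y} → y ∈ L' → y ∈ L
   back = PermP.∈-resp-↭ (↭-sym p)

 module _ {c τ : ℕ → ℕ} {x : ℕ} {M : List ℕ} (injτ : Inj τ) (τx≢x : τ x ≢ x) (x∉ : x ∉ M) where

  private
    ≢x : ∀ {y} → y ∈ M → y ≢ x
    ≢x y∈ refl = x∉ y∈

  module _ (P : Planar c τ (x ∷ M)) where
   open Planar P

   private
     outside : ∀ {y} → y ∉ M → y ≢ x → y ∉ x ∷ M
     outside h h' (here e) = h' e
     outside h h' (there y∈) = h y∈

   -- The fixed point x is one cycle of σ. It is not fixed by σ⁻¹τ, because `τ x` differs from x, so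
   -- that permutation loses no cycle; thus the number of cycles and the number of elements both
   -- drop by one.
   remove-single : σ x ≡ x → Planar c (del x τ) M
   remove-single σx = record
     { σ = σ ; σ⁻ = σ⁻ ; left-inv = left-inv ; right-inv = right-inv
     ; support = supp
     ; same⇒orb = λ y∈ z∈ → same⇒orb (there y∈) (there z∈)
     ; orb⇒same = λ y∈ z∈ → orb⇒same (there y∈) (there z∈)
     ; euler = ℕP.suc-injective (trans (cong₂ _+_ eσ (sym eφ)) euler) }
     where
     supp : ∀ {y} → y ∉ M → σ y ≡ y
     supp {y} h with y ℕP.≟ x
     ... | yes refl = σx
     ... | no k = support (outside h k)
     σ⁻x : σ⁻ x ≡ x
     σ⁻x = trans (cong σ⁻ (sym σx)) (left-inv x)
     eσ : suc (cyc M σ) ≡ cyc (x ∷ M) σ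
     eσ = sym (cong₂ _+_ (fixed-yes {x} {σ} σx) (cyc-ext M (λ {y} _ → del-fixed {x} {σ} σx y)))
     eφ : cyc (x ∷ M) (σ⁻ ∘ τ) ≡ cyc M (σ⁻ ∘ del x τ)
     eφ = cong₂ _+_ (fixed-no {x} {σ⁻ ∘ τ} (λ e → τx≢x (σ⁻-inj (trans e (sym σ⁻x)))))
       (cyc-ext M (λ {y} _ → trans (cong (λ a → swap a (σ⁻ (τ x)) (σ⁻ (τ y))) (sym σ⁻x)) (sym (swap-natural σ⁻-inj x (τ x) (τ y)))))

   -- Dual to `remove-single`: now x is a fixed point of σ⁻¹τ, while σ only loses an element of a
   -- longer cycle.
   remove-twin : σ x ≡ τ x → Planar c (del x τ) M
   remove-twin σx = record
     { σ = del x σ ; σ⁻ = σ⁻ ∘ swap x (σ x)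
     ; left-inv = λ y → trans (cong σ⁻ (swap-invol x (σ x) (σ y))) (left-inv y)
     ; right-inv = λ y → trans (cong (swap x (σ x)) (right-inv _)) (swap-invol x (σ x) y)
     ; support = supp
     ; same⇒orb = λ y∈ z∈ e → orb-del⁺ σ-inj (≢x y∈) (≢x z∈) (same⇒orb (there y∈) (there z∈) e)
     ; orb⇒same = λ y∈ z∈ o → orb⇒same (there y∈) (there z∈) (orb-del⁻ σ-inj (≢x y∈) o)
     ; euler = ℕP.suc-injective (trans (sym (ℕP.+-suc (cyc M (del x σ)) _)) (trans (cong₂ _+_ eσ eφ) euler)) }
     where
     supp : ∀ {y} → y ∉ M → del x σ y ≡ y
     supp {y} h with y ℕP.≟ x
     ... | yes refl = del-self x σ
     ... | no k = trans (del-other {x} {σ} σ-inj k (λ e → k (trans (sym (support (outside h k))) e))) (support (outside h k))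
     eσ : cyc M (del x σ) ≡ cyc (x ∷ M) σ
     eσ = sym (cong (_+ cyc M (del x σ)) (fixed-no {x} {σ} (λ e → τx≢x (trans (sym σx) e))))
     φx : σ⁻ (τ x) ≡ x
     φx = trans (cong σ⁻ (sym σx)) (left-inv x)
     eφ : suc (cyc M ((σ⁻ ∘ swap x (σ x)) ∘ del x τ)) ≡ cyc (x ∷ M) (σ⁻ ∘ τ)
     eφ = sym (cong₂ _+_ (fixed-yes {x} {σ⁻ ∘ τ} φx) (cyc-ext M (λ {y} _ → trans (del-fixed {x} {σ⁻ ∘ τ} φx y)
       (cong σ⁻ (sym (trans (cong (λ a → swap x a (swap x (τ x) (τ y))) σx) (swap-invol x (τ x) (τ y))))))))

  module _ (P : Planar c (del x τ) M) where
   open Planar P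

   private
     σx : σ x ≡ x
     σx = support x∉
     σ⁻x : σ⁻ x ≡ x
     σ⁻x = trans (cong σ⁻ (sym σx)) (left-inv x)

   insert-single : (∀ {y} → y ∈ M → c x ≢ c y) → Planar c τ (x ∷ M)
   insert-single fresh = record
     { σ = σ ; σ⁻ = σ⁻ ; left-inv = left-inv ; right-inv = right-inv
     ; support = λ h → support (h ∘ there)
     ; same⇒orb = s⇒o ; orb⇒same = o⇒s
     ; euler = trans (cong₂ _+_ eσ eφ) (cong suc euler) }
     where
     from-x : ∀ t → iter σ t x ≡ x
     from-x zero = refl
     from-x (suc t) = trans (cong σ (from-x t)) σx
     to-x : ∀ t y → iter σ t y ≡ x → y ≡ x
     to-x zero y e = e
     to-x (suc t) y e = to-x t y (σ-inj (trans e (sym σx)))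
     s⇒o : ∀ {y z} → y ∈ x ∷ M → z ∈ x ∷ M → c y ≡ c z → Orb σ y z
     s⇒o (here refl) (here refl) e = 0 , refl
     s⇒o (here refl) (there z∈) e = ⊥-elim (fresh z∈ e)
     s⇒o (there y∈) (here refl) e = ⊥-elim (fresh y∈ (sym e))
     s⇒o (there y∈) (there z∈) e = same⇒orb y∈ z∈ e
     o⇒s : ∀ {y z} → y ∈ x ∷ M → z ∈ x ∷ M → Orb σ y z → c y ≡ c z
     o⇒s (here refl) z∈ (t , e) = cong c (trans (sym (from-x t)) e)
     o⇒s (there y∈) (here refl) (t , e) = cong c (to-x t _ e)
     o⇒s (there y∈) (there z∈) o = orb⇒same y∈ z∈ o
     eσ : cyc (x ∷ M) σ ≡ suc (cyc M σ)
     eσ = cong₂ _+_ (fixed-yes {x} {σ} σx) (cyc-ext M (λ {y} _ → del-fixed {x} {σ} σx y))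
     eφ : cyc (x ∷ M) (σ⁻ ∘ τ) ≡ cyc M (σ⁻ ∘ del x τ)
     eφ = cong₂ _+_ (fixed-no {x} {σ⁻ ∘ τ} (λ e → τx≢x (σ⁻-inj (trans e (sym σ⁻x)))))
       (cyc-ext M (λ {y} _ → trans (cong (λ a → swap a (σ⁻ (τ x)) (σ⁻ (τ y))) (sym σ⁻x)) (sym (swap-natural σ⁻-inj x (τ x) (τ y)))))

   -- Multiplying σ by the transposition of x and `τ x` inserts x into the cycle of `τ x` directly
   -- before it, and turns x into a fixed point of σ⁻¹τ.
   insert-twin : τ x ∈ M → c x ≡ c (τ x) → Planar c τ (x ∷ M)
   insert-twin z∈M cx = record
     { σ = ρ ; σ⁻ = σ⁻ ∘ swap x z
     ; left-inv = λ y → trans (cong σ⁻ (swap-invol x z (σ y))) (left-inv y)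
     ; right-inv = λ y → trans (cong (swap x z) (right-inv _)) (swap-invol x z y)
     ; support = λ {y} h → trans (cong (swap x z) (support (h ∘ there)))
       (swap-other (λ e → h (here e)) (λ e → h (there (subst (_∈ M) (sym e) z∈M))))
     ; same⇒orb = s⇒o ; orb⇒same = o⇒s
     ; euler = trans (cong₂ _+_ eσ eφ) (trans (ℕP.+-suc (cyc M σ) _) (cong suc euler)) }
     where
     z = τ x
     ρ : ℕ → ℕ
     ρ y = swap x z (σ y)
     ρ-inj : Inj ρ
     ρ-inj e = σ-inj (swap-inj x z e)
     ρx : ρ x ≡ z
     ρx = trans (cong (swap x z) σx) (swap-l x z)
     delρ : ∀ y → del x ρ y ≡ σ y
     delρ y = trans (cong (λ a → swap x a (swap x z (σ y))) ρx) (swap-invol x z (σ y))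
     iter-ext : ∀ {f g : ℕ → ℕ} → (∀ y → f y ≡ g y) → ∀ t y → iter f t y ≡ iter g t y
     iter-ext e zero y = refl
     iter-ext {f} e (suc t) y = trans (cong f (iter-ext e t y)) (e _)
     orb⁺ : ∀ {y w} → y ∈ M → Orb σ y w → Orb ρ y w
     orb⁺ y∈ (t , e) = orb-del⁻ {x} {ρ} ρ-inj (≢x y∈) (t , trans (iter-ext delρ t _) e)
     orb⁻ : ∀ {y w} → y ∈ M → w ∈ M → Orb ρ y w → Orb σ y w
     orb⁻ y∈ w∈ o with orb-del⁺ {x} {ρ} ρ-inj (≢x y∈) (≢x w∈) o
     ... | t , e = t , trans (sym (iter-ext delρ t _)) e
     -- The old predecessor of z leads to x in the new permutation; this is how the rest of the
     -- cycle reaches x.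
     prev = σ⁻ z
     σprev : σ prev ≡ z
     σprev = right-inv z
     prev∈ : prev ∈ M
     prev∈ with memb-dec prev M
     ... | inj₁ h = h
     ... | inj₂ h = ⊥-elim (h (subst (_∈ M) (trans (sym σprev) (support h)) z∈M))
     ρprev : ρ prev ≡ x
     ρprev = trans (cong (swap x z) σprev) (swap-r x z)
     c-prev : c prev ≡ c x
     c-prev = trans (orb⇒same prev∈ z∈M (1 , σprev)) (sym cx)
     s⇒o : ∀ {y w} → y ∈ x ∷ M → w ∈ x ∷ M → c y ≡ c w → Orb ρ y w
     s⇒o (here refl) (here refl) e = 0 , refl
     s⇒o (here refl) (there w∈) e = orb-step {ρ} (subst (λ v → Orb ρ v _) (sym ρx) (orb⁺ z∈M (same⇒orb z∈M w∈ (trans (sym cx) e))))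
     s⇒o (there y∈) (here refl) e = orb-trans {ρ} (orb⁺ y∈ (same⇒orb y∈ prev∈ (trans e (sym c-prev)))) (1 , ρprev)
     s⇒o (there y∈) (there w∈) e = orb⁺ y∈ (same⇒orb y∈ w∈ e)
     from-x : ∀ {w} → w ∈ M → Orb ρ x w → Orb ρ z w
     from-x w∈ (zero , refl) = ⊥-elim (x∉ w∈)
     from-x w∈ (suc t , e) = t , trans (cong (iter ρ t) (sym ρx)) (trans (sym (iter-front ρ t x)) e)
     o⇒s : ∀ {y w} → y ∈ x ∷ M → w ∈ x ∷ M → Orb ρ y w → c y ≡ c w
     o⇒s (here refl) (here refl) o = refl
     o⇒s (here refl) (there w∈) o = trans cx (orb⇒same z∈M w∈ (orb⁻ z∈M w∈ (from-x w∈ o)))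
     o⇒s (there y∈) (here refl) (t , e) = trans (orb⇒same y∈ z∈M (orb⁻ y∈ z∈M (suc t , trans (cong ρ e) ρx))) (sym cx)
     o⇒s (there y∈) (there w∈) o = orb⇒same y∈ w∈ (orb⁻ y∈ w∈ o)
     eσ : cyc (x ∷ M) ρ ≡ cyc M σ
     eσ = cong₂ _+_ (fixed-no {x} {ρ} (λ e → τx≢x (trans (sym ρx) e))) (cyc-ext M (λ {y} _ → delρ y))
     φx : σ⁻ (swap x z (τ x)) ≡ x
     φx = trans (cong σ⁻ (swap-r x z)) σ⁻x
     eφ : cyc (x ∷ M) ((σ⁻ ∘ swap x z) ∘ τ) ≡ suc (cyc M (σ⁻ ∘ del x τ))
     eφ = cong₂ _+_ (fixed-yes {x} {(σ⁻ ∘ swap x z) ∘ τ} φx) (cyc-ext M (λ {y} _ → del-fixed {x} {(σ⁻ ∘ swap x z) ∘ τ} φx y))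

-- Genus 0 as a condition on colour words

module AnnularCharacterisation where
 open import Data.Nat using (_+_)
 open ≡ using (refl; sym; trans)
 open CycleCounting
 open SpokeWords
 open PlanarCycles

 rot-map : ∀ (f : ℕ → ℕ) {u w} → Rot u w → Rot (map f u) (map f w)
 rot-map f done = done
 rot-map f (step {x} {u} r) = step (subst (λ z → Rot z _) (map-++ f u [ x ]) (rot-map f r))

 rot-lift : ∀ (f : ℕ → ℕ) us {w} → Rot (map f us) w → ∃[ us' ] (Rot us us' × map f us' ≡ w)
 rot-lift f us r = go us r refl
   where
   go : ∀ us {u w} → Rot u w → map f us ≡ u → ∃[ us' ] (Rot us us' × map f us' ≡ w)
   go us done e = us , done , e
   go (x ∷ us) (step r) refl with go (us ++ [ x ]) r (map-++ f us [ x ])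
   ... | us' , r' , e = us' , step r' , e

 unique-++-disjoint : ∀ {us vs : List ℕ} → Unique (us ++ vs) → ∀ {x} → x ∈ us → x ∉ vs
 unique-++-disjoint {u ∷ us} (h ∷ _) (here refl) x∈ = All.lookup h (∈-++⁺ʳ us x∈) refl
 unique-++-disjoint {u ∷ us} (_ ∷ un) (there x∈us) x∈ = unique-++-disjoint un x∈us x∈

 unique-++ˡ : ∀ {us vs : List ℕ} → Unique (us ++ vs) → Unique us
 unique-++ˡ {[]} _ = []
 unique-++ˡ {u ∷ us} (h ∷ un) = All.tabulate (λ y∈ → All.lookup h (∈-++⁺ˡ y∈)) ∷ unique-++ˡ un

 unique-++ʳ : ∀ us {vs : List ℕ} → Unique (us ++ vs) → Unique vs
 unique-++ʳ [] u = u
 unique-++ʳ (_ ∷ us) (_ ∷ u) = unique-++ʳ us u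

 unique-map-inj : ∀ (f : ℕ → ℕ) {xs} → Unique xs → (∀ {x y} → x ∈ xs → y ∈ xs → f x ≡ f y → x ≡ y) → Unique (map f xs)
 unique-map-inj f [] inj = []
 unique-map-inj f (h ∷ u) inj = All.tabulate (λ a∈ e → let (y , y∈ , e') = ∈-map⁻ f a∈ in
   All.lookup h y∈ (inj (here refl) (there y∈) (trans e e'))) ∷ unique-map-inj f u (λ x∈ y∈ → inj (there x∈) (there y∈))

 module _ (c : ℕ → ℕ) where

  Connected : List ℕ → List ℕ → Set
  Connected us vs = ∃[ x ] ∃[ y ] (x ∈ us × y ∈ vs × c x ≡ c y)

  chain-unique : ∀ {τ : ℕ → ℕ} x bs bs' {a} → a ∉ bs → a ∉ bs' → Chain τ x bs a → Chain τ x bs' a → bs ≡ bs'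
  chain-unique x [] [] _ _ _ _ = refl
  chain-unique x [] (b' ∷ bs') _ h e (e' , _) = ⊥-elim (h (here (trans (sym e) e')))
  chain-unique x (b ∷ bs) [] h _ (e , _) e' = ⊥-elim (h (here (trans (sym e') e)))
  chain-unique x (b ∷ bs) (b' ∷ bs') h h' (e , ch) (e' , ch') with trans (sym e) e'
  ... | refl = cong (b ∷_) (chain-unique b bs bs' (h ∘ there) (h' ∘ there) ch ch')

  chain-unsnoc : ∀ {τ : ℕ → ℕ} a bs {y z} → Chain τ a (bs ++ [ y ]) z → Chain τ a bs y × τ y ≡ z
  chain-unsnoc a [] (e , e') = e , e'
  chain-unsnoc a (b ∷ bs) (e , ch) with chain-unsnoc b bs ch
  ... | ch' , e' = (e , ch') , e'

  rv : (ℕ → ℕ) → List ℕ → List ℕ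
  rv f [] = []
  rv f (x ∷ xs) = rv f xs ++ [ f x ]

  rv-∈ : ∀ f xs {y} → y ∈ rv f xs → ∃[ x ] (x ∈ xs × y ≡ f x)
  rv-∈ f (x ∷ xs) y∈ with ∈-++⁻ (rv f xs) y∈
  ... | inj₂ (here e) = x , here refl , e
  ... | inj₁ h with rv-∈ f xs h
  ... | x' , x'∈ , e = x' , there x'∈ , e

  ∈-rv : ∀ f xs {x} → x ∈ xs → f x ∈ rv f xs
  ∈-rv f (x ∷ xs) (here refl) = ∈-++⁺ʳ (rv f xs) (here refl)
  ∈-rv f (x ∷ xs) (there x∈) = ∈-++⁺ˡ (∈-rv f xs x∈)

  map-rv : ∀ f xs → (∀ {x} → x ∈ xs → c (f x) ≡ c x) → map c (rv f xs) ≡ desc (thin (map c xs))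
  map-rv f [] h = refl
  map-rv f (x ∷ xs) h = trans (map-++ c (rv f xs) [ f x ]) (cong₂ _++_ (map-rv f xs (h ∘ there)) (cong [_] (h (here refl))))

  -- Neither σ nor σ⁻¹τ has a fixed point, so each has at most half as many cycles as there are
  -- elements. Genus 0 forces equality, both are involutions, and together this says that σ reverses
  -- τ: it carries one circle backwards onto the other.
  spoke-diagram : ∀ {τ us vs} → Inj τ → Unique (us ++ vs) → Cyclic τ us → Cyclic τ vs → Connected us vs →
    (P : Planar c τ (us ++ vs)) →
    (∀ {x} → x ∈ us ++ vs → Planar.σ P x ≢ x × Planar.σ P x ≢ τ x) →
    AnnularNC (map c us) (map c vs)
  spoke-diagram {τ} {us} {vs} injτ un cu cv (x₀ , y₀ , x₀∈ , y₀∈ , c₀) P nofix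
    with ∈-∃++ x₀∈ | ∈-∃++ y₀∈
  ... | α , β₀ , refl | α' , δ₀ , refl = annular-all f g sp
    where
    open Planar P
    L = us ++ vs
    φ : ℕ → ℕ
    φ = σ⁻ ∘ τ
    φ-inj : Inj φ
    φ-inj e = injτ (σ⁻-inj e)
    φ-nofix : ∀ {x} → x ∈ L → φ x ≢ x
    φ-nofix {x} x∈ e = proj₂ (nofix x∈) (trans (cong σ (sym e)) (right-inv (τ x)))
    boundσ = cyc-free L σ-inj un (λ x∈ → proj₁ (nofix x∈))
    boundφ = cyc-free L φ-inj un φ-nofix
    too-small : ∀ {m n k} → m + n ≡ k → m + m < k → n + n ≤ k → ⊥
    too-small {m} {n} {k} e l l' = ℕP.<-irrefl refl (begin-strict
      k + k ≡⟨ cong₂ _+_ e e ⟨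
      (m + n) + (m + n) ≡⟨ solve 2 (λ m n → (m :+ n) :+ (m :+ n) := (m :+ m) :+ (n :+ n)) refl m n ⟩
      (m + m) + (n + n) <⟨ ℕP.+-mono-<-≤ l l' ⟩
      k + k ∎)
      where
      open ℕP.≤-Reasoning
      open import Data.Nat.Solver using (module +-*-Solver)
      open +-*-Solver
    σ-invol : ∀ {x} → x ∈ L → σ (σ x) ≡ x
    σ-invol {x} x∈ with σ (σ x) ℕP.≟ x
    ... | yes e = e
    ... | no h = ⊥-elim (too-small {cyc L σ} euler (cyc-free-strict L σ-inj un (λ x∈ → proj₁ (nofix x∈)) x∈ h) boundφ)
    φ-invol : ∀ {x} → x ∈ L → φ (φ x) ≡ x
    φ-invol {x} x∈ with φ (φ x) ℕP.≟ x
    ... | yes e = e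
    ... | no h = ⊥-elim (too-small {cyc L φ} (trans (ℕP.+-comm (cyc L φ) _) euler) (cyc-free-strict L φ-inj un φ-nofix x∈ h) boundσ)
    τ-closed : ∀ {x} → x ∈ L → τ x ∈ L
    τ-closed x∈ with ∈-++⁻ us x∈
    ... | inj₁ h = ∈-++⁺ˡ (cyclic-closed us cu h)
    ... | inj₂ h = ∈-++⁺ʳ us (cyclic-closed vs cv h)
    σ⁻≡σ : ∀ {x} → x ∈ L → σ⁻ x ≡ σ x
    σ⁻≡σ {x} x∈ = trans (cong σ⁻ (sym (σ-invol x∈))) (left-inv (σ x))
    -- The relation (σ⁻¹τ)² = 1 rewritten with σ⁻¹ = σ.
    back : ∀ {x} → x ∈ L → τ (σ (τ x)) ≡ σ x
    back {x} x∈ = trans (sym (right-inv _)) (cong σ (trans (cong (λ z → σ⁻ (τ z)) (sym (σ⁻≡σ (τ-closed x∈)))) (φ-invol x∈)))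
    orbit : ∀ t {x} → x ∈ L → iter σ t x ≡ x ⊎ iter σ t x ≡ σ x
    orbit zero x∈ = inj₁ refl
    orbit (suc t) x∈ with orbit t x∈
    ... | inj₁ e = inj₂ (cong σ e)
    ... | inj₂ e = inj₁ (trans (cong σ e) (σ-invol x∈))
    x₀∈L = ∈-++⁺ˡ {ys = vs} x₀∈
    y₀≡ : y₀ ≡ σ x₀
    y₀≡ with same⇒orb x₀∈L (∈-++⁺ʳ us y₀∈) c₀
    ... | t , e with orbit t x₀∈L
    ... | inj₁ e' = ⊥-elim (unique-++-disjoint un (subst (_∈ us) (trans (sym e') e) x₀∈) y₀∈)
    ... | inj₂ e' = trans (sym e) e'
    β = β₀ ++ α
    δ = δ₀ ++ α'
    rotus : Rot us (x₀ ∷ β)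
    rotus = rot-++ α (x₀ ∷ β₀)
    rotvs : Rot vs (y₀ ∷ δ)
    rotvs = rot-++ α' (y₀ ∷ δ₀)
    in-us : ∀ {x} → x ∈ x₀ ∷ β → x ∈ us
    in-us = PermP.∈-resp-↭ (↭-sym (rot-↭ rotus))
    in-vs : ∀ {x} → x ∈ y₀ ∷ δ → x ∈ vs
    in-vs = PermP.∈-resp-↭ (↭-sym (rot-↭ rotvs))
    in-L : ∀ {x} → x ∈ x₀ ∷ β → x ∈ L
    in-L x∈ = ∈-++⁺ˡ (in-us x∈)
    uniqueβ : Unique (x₀ ∷ β)
    uniqueβ = unique-↭ (rot-↭ rotus) (unique-++ˡ un)
    uniqueδ : Unique (y₀ ∷ δ)
    uniqueδ = unique-↭ (rot-↭ rotvs) (unique-++ʳ us un)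
    reversed : ∀ x bs → (∀ {y} → y ∈ x ∷ bs → y ∈ L) → Chain τ x bs x₀ → Chain τ (σ x₀) (rv σ bs) (σ x)
    reversed x [] h e = trans (cong (λ z → τ (σ z)) (sym e)) (back (h (here refl)))
    reversed x (b ∷ bs) h (e , ch) = chain-snoc (σ x₀) (rv σ bs) (reversed b bs (h ∘ there) ch)
      (trans (cong (λ z → τ (σ z)) (sym e)) (back (h (here refl))))
    -- The second circle and the reversed image of the first are both τ-paths from `y₀` back to
    -- `y₀`, and such a path is determined by its start.
    δ≡ : δ ≡ rv σ β
    δ≡ = chain-unique {τ} y₀ δ (rv σ β) (unique-∉ uniqueδ) y₀∉
      (cyclic-rot rotvs cv) (subst (λ y → Chain τ y (rv σ β) y) (sym y₀≡) (reversed x₀ β in-L (cyclic-rot rotus cu)))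
      where
      y₀∉ : y₀ ∉ rv σ β
      y₀∉ h with rv-∈ σ β h
      ... | x , x∈ , e = unique-∉ uniqueβ (subst (_∈ β) (sym (σ-inj (trans (sym y₀≡) e))) x∈)
    σ-in-vs : ∀ {x} → x ∈ x₀ ∷ β → σ x ∈ vs
    σ-in-vs (here refl) = subst (_∈ vs) y₀≡ y₀∈
    σ-in-vs (there x∈) = in-vs (there (subst (σ _ ∈_) (sym δ≡) (∈-rv σ β x∈)))
    c-σ : ∀ {x} → x ∈ L → c (σ x) ≡ c x
    c-σ x∈ = sym (orb⇒same x∈ (σ-closed x∈) (1 , refl))
    c-inj : ∀ {x y} → x ∈ x₀ ∷ β → y ∈ x₀ ∷ β → c x ≡ c y → x ≡ y
    c-inj x∈ y∈ e with same⇒orb (in-L x∈) (in-L y∈) e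
    ... | t , e' with orbit t (in-L x∈)
    ... | inj₁ k = trans (sym k) e'
    ... | inj₂ k = ⊥-elim (unique-++-disjoint un (in-us y∈) (subst (_∈ vs) (trans (sym k) e') (σ-in-vs x∈)))
    cs = map c (x₀ ∷ β)
    rotU : Rot (map c us) cs
    rotU = rot-map c rotus
    rotV : Rot (map c vs) (desc (thin cs))
    rotV = rot-trans (rot-map c rotvs) (subst₂ (λ a w → Rot (a ∷ w) (desc (thin cs)))
      (sym (trans (cong c y₀≡) (c-σ x₀∈L))) (sym (trans (cong (map c) δ≡) (map-rv σ β (λ x∈ → c-σ (in-L (there x∈)))))) (step done))
    sp : Spokes (map c us) (map c vs)
    sp = spokes (thin cs) (λ ()) (subst Unique (sym (cols-thin cs)) (unique-map-inj c uniqueβ c-inj))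
      (subst (Rot (map c us)) (sym (asc-thin cs)) rotU) rotV
    f : ∀ {a} → a ∈ map c us → a ∈ map c vs
    f a∈ = PermP.∈-resp-↭ (↭-trans (rot-↭ rotU) (↭-trans (↭-sym (desc-thin-↭ cs)) (↭-sym (rot-↭ rotV)))) a∈
    g : ∀ {a} → a ∈ map c vs → a ∈ map c us
    g a∈ = PermP.∈-resp-↭ (↭-trans (rot-↭ rotV) (↭-trans (desc-thin-↭ cs) (↭-sym (rot-↭ rotU)))) a∈

  search : ∀ (σ τ : ℕ → ℕ) L → (∃[ x ] (x ∈ L × (σ x ≡ x ⊎ σ x ≡ τ x))) ⊎ (∀ {x} → x ∈ L → σ x ≢ x × σ x ≢ τ x)
  search σ τ [] = inj₂ (λ ())
  search σ τ (x ∷ L) with σ x ℕP.≟ x | σ x ℕP.≟ τ x | search σ τ L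
  ... | yes e | _ | _ = inj₁ (x , here refl , inj₁ e)
  ... | no _ | yes e | _ = inj₁ (x , here refl , inj₂ e)
  ... | no _ | no _ | inj₁ (y , y∈ , h) = inj₁ (y , there y∈ , h)
  ... | no h | no h' | inj₂ k = inj₂ (λ { (here refl) → h , h' ; (there y∈) → k y∈ })

  move-front : ∀ {us vs β : List ℕ} {x} → Rot us (x ∷ β) → us ++ vs ↭ x ∷ (β ++ vs)
  move-front r = PermP.++⁺ʳ _ (rot-↭ r)

  AnnularGoal PlanarGoal : ℕ → Set
  AnnularGoal n = ∀ {τ us vs} → length us + length vs ≤ n → Inj τ → Unique (us ++ vs) → Cyclic τ us → Cyclic τ vs →
    Connected us vs → Planar c τ (us ++ vs) → AnnularNC (map c us) (map c vs)
  PlanarGoal n = ∀ {τ us vs} → length us + length vs ≤ n → Inj τ → Unique (us ++ vs) → Cyclic τ us → Cyclic τ vs →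
    AnnularNC (map c us) (map c vs) → Planar c τ (us ++ vs)

  annular-reduce : ∀ {n} → AnnularGoal n → ∀ {τ us vs x} → length us + length vs ≤ suc n → Inj τ → Unique (us ++ vs) →
    Cyclic τ us → Cyclic τ vs → Connected us vs → (P : Planar c τ (us ++ vs)) → x ∈ us →
    (Planar.σ P x ≡ x ⊎ Planar.σ P x ≡ τ x) → AnnularNC (map c us) (map c vs)
  annular-reduce {n} IH {τ} {us} {vs} {x} le injτ un cu cv (x₀ , y₀ , x₀∈ , y₀∈ , c₀) P x∈ red with ∈-∃++ x∈
  ... | α , β₀ , refl = annular-rot (rot-sym (rot-map c r)) (conclude β refl red)
    where
    open Planar P
    β = β₀ ++ α
    r : Rot us (x ∷ β)
    r = rot-++ α (x ∷ β₀)
    un' : Unique (x ∷ (β ++ vs))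
    un' = unique-↭ (move-front r) un
    P' : Planar c τ (x ∷ (β ++ vs))
    P' = planar-↭ injτ un (move-front r) P
    cu' : Cyclic τ (x ∷ β)
    cu' = cyclic-rot r cu
    x∈L = ∈-++⁺ˡ {ys = vs} x∈
    lost : σ x ≡ x → ∀ {y} → y ∈ us ++ vs → c x ≡ c y → y ≡ x
    lost e y∈ cy with same⇒orb x∈L y∈ cy
    ... | t , e' = trans (sym e') (fixed t)
      where
      fixed : ∀ t → iter σ t x ≡ x
      fixed zero = refl
      fixed (suc t) = trans (cong σ (fixed t)) e
    x∉vs : x ∉ vs
    x∉vs = unique-++-disjoint un x∈
    x∉β : x ∉ β ++ vs
    x∉β = unique-∉ un'
    x₀∈' : x₀ ≡ x ⊎ x₀ ∈ β
    x₀∈' with PermP.∈-resp-↭ (rot-↭ r) x₀∈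
    ... | here e = inj₁ e
    ... | there h = inj₂ h
    -- Here x would be its whole circle and its whole block, and nothing could join the two circles.
    not-both : σ x ≡ x → τ x ≡ x → ⊥
    not-both e e' with cyclic-shape β refl cu'
      where
      cyclic-shape : ∀ γ → γ ≡ β → Cyclic τ (x ∷ γ) → γ ≡ []
      cyclic-shape [] _ _ = refl
      cyclic-shape (b ∷ γ) eq (h , _) = ⊥-elim (x∉β (∈-++⁺ˡ (subst (x ∈_) eq (here (trans (sym e') h)))))
    ... | β≡[] with x₀∈'
    ... | inj₁ refl = x∉vs (subst (_∈ vs) (lost e (∈-++⁺ʳ us y₀∈) c₀) y₀∈)
    ... | inj₂ h with subst (x₀ ∈_) β≡[] h
    ... | ()
    τx≢x : τ x ≢ x
    τx≢x e = go red
      where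
      go : σ x ≡ x ⊎ σ x ≡ τ x → ⊥
      go (inj₁ h) = not-both h e
      go (inj₂ h) = not-both (trans h e) e
    le' : length β + length vs ≤ n
    le' = ℕ.s≤s⁻¹ (ℕP.≤-trans (ℕP.≤-reflexive (cong (_+ length vs) (sym (PermP.↭-length (rot-↭ r))))) le)
    unβ : Unique (β ++ vs)
    unβ with un'
    ... | _ ∷ u = u
    cuβ : Cyclic (del x τ) β
    cuβ = cyclic-del-head injτ β (λ h → x∉β (∈-++⁺ˡ h)) cu'
    cvβ : Cyclic (del x τ) vs
    cvβ = cyclic-del-other injτ vs x∉vs cv
    conclude : ∀ γ → γ ≡ β → (σ x ≡ x ⊎ σ x ≡ τ x) → AnnularNC (map c (x ∷ β)) (map c vs)
    conclude _ _ (inj₁ e) = annular-fresh (fresh (λ y∈ → PermP.∈-resp-↭ (↭-sym (move-front {vs = vs} r)) (there (∈-++⁺ˡ y∈))) (λ h → x∉β (∈-++⁺ˡ h)))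
      (fresh (∈-++⁺ʳ us) x∉vs) (IH le' (del-inj injτ) unβ cuβ cvβ conn (remove-single injτ τx≢x x∉β P' e))
      where
      fresh : ∀ {ws} → (∀ {y} → y ∈ ws → y ∈ us ++ vs) → x ∉ ws → c x ∉ map c ws
      fresh {ws} sub x∉ h with ∈-map⁻ c h
      ... | y , y∈ , e' = x∉ (subst (_∈ ws) (lost e (sub y∈) e') y∈)
      conn : Connected β vs
      conn with x₀∈'
      ... | inj₁ refl = ⊥-elim (x∉vs (subst (_∈ vs) (lost e (∈-++⁺ʳ us y₀∈) c₀) y₀∈))
      ... | inj₂ h = x₀ , y₀ , h , y₀∈ , c₀
    conclude [] eq (inj₂ e) = ⊥-elim (τx≢x (subst (λ γ → Cyclic τ (x ∷ γ)) (sym eq) cu'))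
    conclude (b ∷ γ) eq (inj₂ e) = subst (λ δ → AnnularNC (map c (x ∷ δ)) (map c vs)) eq
      (subst (λ a → AnnularNC (a ∷ c b ∷ map c γ) (map c vs)) (sym cx) (annular-twin
        (subst (λ δ → AnnularNC (map c δ) (map c vs)) (sym eq) (IH le' (del-inj injτ) unβ cuβ cvβ conn (remove-twin injτ τx≢x x∉β P' e)))))
      where
      τx≡b : τ x ≡ b
      τx≡b = proj₁ (subst (λ γ → Cyclic τ (x ∷ γ)) (sym eq) cu')
      b∈β : b ∈ β
      b∈β = subst (b ∈_) eq (here refl)
      b∈L : b ∈ us ++ vs
      b∈L = PermP.∈-resp-↭ (↭-sym (move-front {vs = vs} r)) (there (∈-++⁺ˡ b∈β))
      cx : c x ≡ c b
      cx = orb⇒same x∈L b∈L (1 , trans e τx≡b)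
      -- If x itself was the end of the connection, its neighbour b of the same colour takes its
      -- place.
      conn : Connected β vs
      conn with x₀∈'
      ... | inj₁ refl = b , y₀ , b∈β , y₀∈ , trans (sym cx) c₀
      ... | inj₂ h = x₀ , y₀ , h , y₀∈ , c₀

  -- Induction on the number of elements. Both conditions are symmetric in the circles, so an
  -- element of the second circle is removed after exchanging them.
  planar⇒annular : ∀ n → AnnularGoal n
  planar⇒annular zero {us = []} le injτ un cu cv (_ , _ , () , _) P
  planar⇒annular (suc n) {τ} {us} {vs} le injτ un cu cv conn@(x₀ , y₀ , x₀∈ , y₀∈ , c₀) P
    with search (Planar.σ P) τ (us ++ vs)
  ... | inj₂ h = spoke-diagram injτ un cu cv conn P h
  ... | inj₁ (x , x∈ , red) with ∈-++⁻ us x∈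
  ... | inj₁ h = annular-reduce (planar⇒annular n) le injτ un cu cv conn P h red
  ... | inj₂ h = annular-sym (annular-reduce (planar⇒annular n) (subst (_≤ suc n) (ℕP.+-comm (length us) (length vs)) le) injτ
    (unique-↭ (PermP.++-comm us vs) un) cv cu (y₀ , x₀ , y₀∈ , x₀∈ , sym c₀)
    (planar-↭ injτ un (PermP.++-comm us vs) P) h red)

  exchange exchange⁻ : List (ℕ × ℕ) → ℕ → ℕ
  exchange [] z = z
  exchange ((x , y) ∷ ps) z = swap x y (exchange ps z)
  exchange⁻ [] z = z
  exchange⁻ ((x , y) ∷ ps) z = exchange⁻ ps (swap x y z)

  members : List (ℕ × ℕ) → List ℕ
  members [] = []
  members ((x , y) ∷ ps) = x ∷ y ∷ members ps

  exchange-left : ∀ ps z → exchange⁻ ps (exchange ps z) ≡ z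
  exchange-left [] z = refl
  exchange-left ((x , y) ∷ ps) z = trans (cong (exchange⁻ ps) (swap-invol x y _)) (exchange-left ps z)

  exchange-right : ∀ ps z → exchange ps (exchange⁻ ps z) ≡ z
  exchange-right [] z = refl
  exchange-right ((x , y) ∷ ps) z = trans (cong (swap x y) (exchange-right ps _)) (swap-invol x y z)

  exchange-support : ∀ ps {z} → z ∉ members ps → exchange ps z ≡ z
  exchange-support [] h = refl
  exchange-support ((x , y) ∷ ps) h = trans (cong (swap x y) (exchange-support ps (λ z∈ → h (there (there z∈)))))
    (swap-other (λ e → h (here e)) (λ e → h (there (here e))))

  ∈-members : ∀ {ps : List (ℕ × ℕ)} {x y} → (x , y) ∈ ps → x ∈ members ps × y ∈ members ps
  ∈-members (here refl) = here refl , there (here refl)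
  ∈-members (there p∈) = let (a , b) = ∈-members p∈ in there (there a) , there (there b)

  exchange-pair : ∀ ps → Unique (members ps) → ∀ {x y} → (x , y) ∈ ps → exchange ps x ≡ y × exchange ps y ≡ x
  exchange-pair ((x , y) ∷ ps) ((_ ∷ x∉) ∷ (y∉ ∷ u)) (here refl) =
    trans (cong (swap x y) (exchange-support ps (λ h → All.lookup x∉ h refl))) (swap-l x y) ,
    trans (cong (swap x y) (exchange-support ps (λ h → All.lookup y∉ h refl))) (swap-r x y)
  exchange-pair ((x₀ , y₀) ∷ ps) ((_ ∷ x∉) ∷ (y∉ ∷ u)) (there p∈) with exchange-pair ps u p∈ | ∈-members p∈
  ... | e , e' | x∈ , y∈ = trans (cong (swap x₀ y₀) e) (swap-other (λ k → All.lookup x∉ y∈ (sym k)) (λ k → All.lookup y∉ y∈ (sym k))) ,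
    trans (cong (swap x₀ y₀) e') (swap-other (λ k → All.lookup x∉ x∈ (sym k)) (λ k → All.lookup y∉ x∈ (sym k)))

  -- Deleting x from the two-cycle of x and y leaves y fixed, so each pair contributes exactly one.
  cyc-pairs : ∀ ps {f} → Inj f → Unique (members ps) → (∀ {x y} → (x , y) ∈ ps → f x ≡ y × f y ≡ x) → cyc (members ps) f ≡ length ps
  cyc-pairs [] inj u h = refl
  cyc-pairs ((x , y) ∷ ps) {f} inj ((x≢y ∷ x∉) ∷ (y∉ ∷ u)) h = begin
    fixed? x f + (fixed? y (del x f) + cyc (members ps) (del y (del x f)))
      ≡⟨ cong₂ _+_ (fixed-no {x} {f} (λ e → x≢y (trans (sym e) fx))) (cong₂ _+_ (fixed-yes {y} {del x f} dy) (cyc-ext (members ps) rest)) ⟩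
    suc (cyc (members ps) f)
      ≡⟨ cong suc (cyc-pairs ps inj u (h ∘ there)) ⟩
    suc (length ps) ∎
    where
    open ≡.≡-Reasoning
    fx = proj₁ (h (here refl))
    fy = proj₂ (h (here refl))
    dy : del x f y ≡ y
    dy = trans (del-skip {x} {f} fy) fx
    rest : ∀ {z} → z ∈ members ps → del y (del x f) z ≡ f z
    rest {z} z∈ = trans (del-fixed {y} {del x f} dy z) (del-other {x} {f} inj (λ e → All.lookup x∉ z∈ (sym e))
      (λ e → All.lookup y∉ z∈ (sym (inj (trans e (sym fy))))))

  -- The two-cycles of σ⁻¹τ when σ exchanges the entries of each pair: an element of the first
  -- circle is matched with the partner of its successor, and the last one with `y₀`.
  shifted : ℕ → List (ℕ × ℕ) → ℕ → List (ℕ × ℕ)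
  shifted x [] y₀ = [ (x , y₀) ]
  shifted x ((x' , y') ∷ ps) y₀ = (x , y') ∷ shifted x' ps y₀

  shifted-↭ : ∀ x ps y₀ → members (shifted x ps y₀) ↭ x ∷ y₀ ∷ members ps
  shifted-↭ x [] y₀ = ↭-refl
  shifted-↭ x ((x' , y') ∷ ps) y₀ = Perm.prep x (↭-trans (Perm.prep y' (shifted-↭ x' ps y₀))
    (begin
      y' ∷ x' ∷ y₀ ∷ members ps ↭⟨ PermP.shift y' (x' ∷ y₀ ∷ []) (members ps) ⟨
      x' ∷ y₀ ∷ y' ∷ members ps ↭⟨ Perm.swap x' y₀ ↭-refl ⟩
      y₀ ∷ x' ∷ y' ∷ members ps ∎))
    where open Perm.PermutationReasoning

  shifted-length : ∀ x ps y₀ → length (shifted x ps y₀) ≡ suc (length ps)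
  shifted-length x [] y₀ = refl
  shifted-length x (_ ∷ ps) y₀ = cong suc (shifted-length _ ps y₀)

  fsts snds : List (ℕ × ℕ) → List ℕ
  fsts = map proj₁
  snds = map proj₂

  shifted-swap : ∀ {τ σ⁻ : ℕ → ℕ} {x₀ y₀} x y ps → σ⁻ x₀ ≡ y₀ → σ⁻ y ≡ x → (∀ {a b} → (a , b) ∈ ps → σ⁻ a ≡ b × σ⁻ b ≡ a) →
    Chain τ x (fsts ps) x₀ → Chain τ y₀ (rv id (snds ps)) y →
    ∀ {a b} → (a , b) ∈ shifted x ps y₀ → σ⁻ (τ a) ≡ b × σ⁻ (τ b) ≡ a
  shifted-swap {τ} {σ⁻} x y [] e₀ ey h ch ch' (here refl) = trans (cong σ⁻ ch) e₀ , trans (cong σ⁻ ch') ey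
  shifted-swap {τ} {σ⁻} {x₀} {y₀} x y ((x' , y') ∷ ps) e₀ ey h (e , ch) ch' p∈ with chain-unsnoc {τ} y₀ (rv id (snds ps)) ch'
  shifted-swap {τ} {σ⁻} x y ((x' , y') ∷ ps) e₀ ey h (e , ch) ch' (here refl) | ch'' , e' =
    trans (cong σ⁻ e) (proj₁ (h (here refl))) , trans (cong σ⁻ e') ey
  shifted-swap {τ} {σ⁻} x y ((x' , y') ∷ ps) e₀ ey h (e , ch) ch' (there p∈) | ch'' , e' =
    shifted-swap {τ} {σ⁻} x' y' ps e₀ (proj₂ (h (here refl))) (h ∘ there) ch ch'' p∈

  zip-colours : ∀ us ys → map c us ≡ map c ys → ∃[ ps ] (fsts ps ≡ us × snds ps ≡ ys × (∀ {a b} → (a , b) ∈ ps → c a ≡ c b))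
  zip-colours [] [] e = [] , refl , refl , λ ()
  zip-colours (u ∷ us) (y ∷ ys) e with ∷-injective e
  ... | e₁ , e₂ with zip-colours us ys e₂
  ... | ps , refl , refl , h = (u , y) ∷ ps , refl , refl , λ { (here refl) → e₁ ; (there p∈) → h p∈ }

  rv-reverse : ∀ xs → rv id xs ≡ reverse xs
  rv-reverse [] = refl
  rv-reverse (x ∷ xs) = trans (cong (_++ [ x ]) (rv-reverse xs)) (sym (unfold-reverse x xs))

  desc-thin-reverse : ∀ cs → desc (thin cs) ≡ reverse cs
  desc-thin-reverse [] = refl
  desc-thin-reverse (x ∷ cs) = trans (cong (_++ [ x ]) (desc-thin-reverse cs)) (sym (unfold-reverse x cs))

  members-↭ : ∀ ps → members ps ↭ fsts ps ++ rv id (snds ps)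
  members-↭ [] = ↭-refl
  members-↭ ((x , y) ∷ ps) = Perm.prep x (↭-trans (Perm.prep y (members-↭ ps))
    (↭-trans (↭-sym (PermP.shift y (fsts ps) (rv id (snds ps)))) (PermP.++⁺ˡ (fsts ps) (↭-sym (PermP.++-comm (rv id (snds ps)) [ y ])))))

  members-pair : ∀ ps {z} → z ∈ members ps → ∃[ x ] ∃[ y ] ((x , y) ∈ ps × (z ≡ x ⊎ z ≡ y))
  members-pair ((x , y) ∷ ps) (here e) = x , y , here refl , inj₁ e
  members-pair ((x , y) ∷ ps) (there (here e)) = x , y , here refl , inj₂ e
  members-pair (_ ∷ ps) (there (there z∈)) with members-pair ps z∈
  ... | x , y , p∈ , e = x , y , there p∈ , e

  colour-pair : ∀ ps → Unique (map c (fsts ps)) → ∀ {x y x' y'} → (x , y) ∈ ps → (x' , y') ∈ ps → c x ≡ c x' → (x , y) ≡ (x' , y')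
  colour-pair (_ ∷ ps) u (here refl) (here refl) e = refl
  colour-pair (_ ∷ ps) (h ∷ u) (here refl) (there p∈) e = ⊥-elim (All.lookup h (∈-map⁺ c (∈-map⁺ proj₁ p∈)) e)
  colour-pair (_ ∷ ps) (h ∷ u) (there p∈) (here refl) e = ⊥-elim (All.lookup h (∈-map⁺ c (∈-map⁺ proj₁ p∈)) (sym e))
  colour-pair (_ ∷ ps) (h ∷ u) (there p∈) (there p'∈) e = colour-pair ps u p∈ p'∈ e

  -- With k pairs, σ and σ⁻¹τ both consist of k two-cycles on the 2k elements, so the Euler relation
  -- holds.
  pairs-planar : ∀ {τ} p ps → Inj τ → Unique (members (p ∷ ps)) → Unique (map c (fsts (p ∷ ps))) →
    (∀ {a b} → (a , b) ∈ p ∷ ps → c a ≡ c b) →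
    Cyclic τ (fsts (p ∷ ps)) → Cyclic τ (rv id (snds (p ∷ ps))) → Planar c τ (members (p ∷ ps))
  pairs-planar {τ} (x₀ , y₀) ps injτ u uc cc cu cv = record
    { σ = σ ; σ⁻ = σ⁻ ; left-inv = exchange-left qs ; right-inv = exchange-right qs
    ; support = exchange-support qs ; same⇒orb = s⇒o ; orb⇒same = o⇒s
    ; euler = trans (cong₂ _+_ eσ eφ) (sym (len qs)) }
    where
    qs = (x₀ , y₀) ∷ ps
    σ = exchange qs
    σ⁻ = exchange⁻ qs
    σ-inj′ : Inj σ
    σ-inj′ {x} {y} e = trans (sym (exchange-left qs x)) (trans (cong σ⁻ e) (exchange-left qs y))
    σ⁻-inj′ : Inj σ⁻
    σ⁻-inj′ {x} {y} e = trans (sym (exchange-right qs x)) (trans (cong σ e) (exchange-right qs y))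
    pr : ∀ {a b} → (a , b) ∈ qs → σ a ≡ b × σ b ≡ a
    pr = exchange-pair qs u
    pr⁻ : ∀ {a b} → (a , b) ∈ qs → σ⁻ a ≡ b × σ⁻ b ≡ a
    pr⁻ p∈ with pr p∈
    ... | e , e' = trans (cong σ⁻ (sym e')) (exchange-left qs _) , trans (cong σ⁻ (sym e)) (exchange-left qs _)
    len : ∀ qs → length (members qs) ≡ length qs + length qs
    len [] = refl
    len (_ ∷ qs) = cong suc (trans (cong suc (len qs)) (sym (ℕP.+-suc (length qs) (length qs))))
    eσ : cyc (members qs) σ ≡ length qs
    eσ = cyc-pairs qs σ-inj′ u pr
    cv' : Chain τ y₀ (rv id (snds ps)) y₀
    cv' = cyclic-rot (rot-++ (rv id (snds ps)) [ y₀ ]) cv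
    sh = shifted x₀ ps y₀
    eφ : cyc (members qs) (σ⁻ ∘ τ) ≡ length qs
    eφ = trans (cyc-↭ (injτ ∘ σ⁻-inj′) u (↭-sym (shifted-↭ x₀ ps y₀)))
      (trans (cyc-pairs sh (injτ ∘ σ⁻-inj′) (unique-↭ (↭-sym (shifted-↭ x₀ ps y₀)) u)
        (shifted-swap {τ} {σ⁻} x₀ y₀ ps (proj₁ (pr⁻ (here refl))) (proj₂ (pr⁻ (here refl))) (λ p∈ → pr⁻ (there p∈)) cu cv'))
        (shifted-length x₀ ps y₀))
    s⇒o : ∀ {y z} → y ∈ members qs → z ∈ members qs → c y ≡ c z → Orb σ y z
    s⇒o y∈ z∈ e with members-pair qs y∈ | members-pair qs z∈
    ... | a , b , p∈ , ey | a' , b' , p'∈ , ez with colour-pair qs uc p∈ p'∈ (trans (col p∈ ey) (trans e (sym (col p'∈ ez))))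
      where
      col : ∀ {a b z} → (a , b) ∈ qs → z ≡ a ⊎ z ≡ b → c a ≡ c z
      col p∈ (inj₁ refl) = refl
      col p∈ (inj₂ refl) = cc p∈
    s⇒o y∈ z∈ e | a , b , p∈ , inj₁ refl | _ , _ , p'∈ , inj₁ refl | refl = 0 , refl
    s⇒o y∈ z∈ e | a , b , p∈ , inj₁ refl | _ , _ , p'∈ , inj₂ refl | refl = 1 , proj₁ (pr p∈)
    s⇒o y∈ z∈ e | a , b , p∈ , inj₂ refl | _ , _ , p'∈ , inj₁ refl | refl = 1 , proj₂ (pr p∈)
    s⇒o y∈ z∈ e | a , b , p∈ , inj₂ refl | _ , _ , p'∈ , inj₂ refl | refl = 0 , refl
    inv : ∀ t {y} → y ∈ members qs → iter σ t y ∈ members qs × c (iter σ t y) ≡ c y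
    inv zero y∈ = y∈ , refl
    inv (suc t) {y} y∈ with inv t y∈
    ... | i∈ , e with members-pair qs i∈
    ... | a , b , p∈ , inj₁ k = subst (_∈ members qs) (sym (trans (cong σ k) (proj₁ (pr p∈)))) (proj₂ (∈-members p∈)) ,
      trans (cong c (trans (cong σ k) (proj₁ (pr p∈)))) (trans (sym (cc p∈)) (trans (cong c (sym k)) e))
    ... | a , b , p∈ , inj₂ k = subst (_∈ members qs) (sym (trans (cong σ k) (proj₂ (pr p∈)))) (proj₁ (∈-members p∈)) ,
      trans (cong c (trans (cong σ k) (proj₂ (pr p∈)))) (trans (cc p∈) (trans (cong c (sym k)) e))
    o⇒s : ∀ {y z} → y ∈ members qs → z ∈ members qs → Orb σ y z → c y ≡ c z
    o⇒s y∈ z∈ (t , e) = trans (sym (proj₂ (inv t y∈))) (cong c e)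

  -- Each colour of `cs` occurs once on either circle. Reading the second circle backwards lines up
  -- its elements with those of the first, and σ exchanges the aligned elements.
  spokes-planar : ∀ {τ us vs cs} → Inj τ → Unique (us ++ vs) → Cyclic τ us → Cyclic τ vs → cs ≢ [] → Unique cs →
    Rot (map c us) cs → Rot (map c vs) (desc (thin cs)) → Planar c τ (us ++ vs)
  spokes-planar {τ} {us} {vs} {cs} injτ un cu cv ne ucs rU rV with rot-lift c us rU | rot-lift c vs rV
  ... | us' , ru , refl | vs' , rv' , ev with zip-colours us' (reverse vs')
    (sym (trans (reverse-map c vs') (trans (cong reverse (trans ev (desc-thin-reverse cs))) (reverse-involutive cs))))
  ... | [] , refl , es , cc = ⊥-elim (ne refl)
  ... | p ∷ ps , refl , es , cc = planar-↭ injτ uni (↭-sym perm)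
    (pairs-planar p ps injτ uni ucs cc (cyclic-rot ru cu) (subst (Cyclic τ) (sym rev) (cyclic-rot rv' cv)))
    where
    rev : rv id (snds (p ∷ ps)) ≡ vs'
    rev = trans (rv-reverse (snds (p ∷ ps))) (trans (cong reverse es) (reverse-involutive vs'))
    perm : us ++ vs ↭ members (p ∷ ps)
    perm = ↭-trans (PermP.++⁺ (rot-↭ ru) (rot-↭ rv')) (↭-trans (↭-reflexive (cong (fsts (p ∷ ps) ++_) (sym rev))) (↭-sym (members-↭ (p ∷ ps))))
    uni : Unique (members (p ∷ ps))
    uni = unique-↭ perm un

  rot-[] : ∀ {w} → Rot [] w → w ≡ []
  rot-[] done = refl

  annular-nonempty : ∀ {V} → ¬ AnnularNC [] V
  annular-nonempty (annularNC _ _ (spokes [] ne _ _ _)) = ne refl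
  annular-nonempty (annularNC _ _ (spokes (_ ∷ _) _ _ r _)) with rot-[] r
  ... | ()

  -- The shorter pair of words has a genus 0 permutation for `del x τ`, and x is put back as a fixed
  -- point or next to its twin.
  planar-extend : ∀ {n} → PlanarGoal n → ∀ {τ us vs} → length us + length vs ≤ suc n → Inj τ → Unique (us ++ vs) →
    Cyclic τ us → Cyclic τ vs → AnnularNC (map c us) (map c vs) → Reducible (map c us) (map c vs) → Planar c τ (us ++ vs)
  planar-extend {n} IH {τ} {us} {vs} le injτ un cu cv Q red = build red
    where
    module Front {x b β} (r : Rot us (x ∷ b ∷ β)) where
     un' : Unique (x ∷ (b ∷ β ++ vs))
     un' = unique-↭ (move-front r) un
     cu' : Cyclic τ (x ∷ b ∷ β)
     cu' = cyclic-rot r cu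
     x∉ : x ∉ b ∷ β ++ vs
     x∉ = unique-∉ un'
     τx≡b : τ x ≡ b
     τx≡b = proj₁ cu'
     τx≢x : τ x ≢ x
     τx≢x e = x∉ (here (trans (sym e) τx≡b))
     unβ : Unique (b ∷ β ++ vs)
     unβ with un'
     ... | _ ∷ u = u
     smaller : AnnularNC (map c (b ∷ β)) (map c vs) → Planar c (del x τ) (b ∷ β ++ vs)
     smaller = IH (ℕ.s≤s⁻¹ (ℕP.≤-trans (ℕP.≤-reflexive (cong (_+ length vs) (sym (PermP.↭-length (rot-↭ r))))) le))
       (del-inj injτ) unβ (cyclic-del-head injτ (b ∷ β) (λ h → x∉ (∈-++⁺ˡ h)) cu')
       (cyclic-del-other injτ vs (λ h → x∉ (∈-++⁺ʳ (b ∷ β) h)) cv)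
     finish : Planar c τ (x ∷ (b ∷ β ++ vs)) → Planar c τ (us ++ vs)
     finish = planar-↭ injτ un' (↭-sym (move-front r))
    build : Reducible (map c us) (map c vs) → Planar c τ (us ++ vs)
    build (single rU x∉u x∉V) with rot-lift c us rU
    -- A circle consisting of an isolated letter only would be empty after the removal, and an empty
    -- circle carries no spokes.
    ... | x ∷ [] , r , refl = ⊥-elim (annular-nonempty (annular-unfresh x∉V (annular-rot rU Q)))
    ... | x ∷ b ∷ β , r , refl = finish (insert-single injτ τx≢x x∉ (smaller (annular-unfresh x∉V (annular-rot rU Q))) fresh)
      where
      open Front r
      fresh : ∀ {y} → y ∈ b ∷ β ++ vs → c x ≢ c y
      fresh y∈ e with ∈-++⁻ (b ∷ β) y∈
      ... | inj₁ h = x∉u (subst (_∈ map c (b ∷ β)) (sym e) (∈-map⁺ c h))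
      ... | inj₂ h = x∉V (subst (_∈ map c vs) (sym e) (∈-map⁺ c h))
    build (twin rU) with rot-lift c us rU
    ... | x ∷ b ∷ β , r , e with ∷-injective e
    ... | refl , e' with ∷-injective e'
    ... | e'' , refl = finish (insert-twin injτ τx≢x x∉ (smaller (subst (λ a → AnnularNC (a ∷ map c β) (map c vs)) (sym e'')
      (annular-untwin (annular-rot rU Q))))
      (subst (_∈ b ∷ β ++ vs) (sym τx≡b) (here refl)) (trans (sym e'') (cong c (sym τx≡b))))
      where open Front r

  annular⇒planar : ∀ n → PlanarGoal n
  annular⇒planar n {τ} {us} {vs} le injτ un cu cv Q with progress Q
  annular⇒planar n {τ} {us} {vs} le injτ un cu cv Q | spoke ne u rU rV = spokes-planar injτ un cu cv ne u rU rV
  annular⇒planar zero {us = []} le injτ un cu cv Q | left _ = ⊥-elim (annular-nonempty Q)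
  annular⇒planar zero {us = []} le injτ un cu cv Q | right _ = ⊥-elim (annular-nonempty Q)
  annular⇒planar (suc n) le injτ un cu cv Q | left red = planar-extend (annular⇒planar n) le injτ un cu cv Q red
  annular⇒planar (suc n) {us = us} {vs} le injτ un cu cv Q | right red =
    planar-↭ injτ un' (PermP.++-comm vs us) (planar-extend (annular⇒planar n)
      (subst (_≤ suc n) (ℕP.+-comm (length us) (length vs)) le) injτ un' cv cu (annular-sym Q) red)
    where un' = unique-↭ (PermP.++-comm us vs) un

-- The permutation lists of the statement

module PermutationLists where
 open import Data.Nat using (_+_; _*_)
 open import Data.Nat.DivMod using (_%_; _/_; m≡m%n+[m/n]*n; m%n<n)
 open ≡ using (refl; sym; trans)
 open BooleanReflection
 open CycleCounting
 open SpokeWords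
 open PlanarCycles
 open AnnularCharacterisation

 iter-+ : ∀ (f : ℕ → ℕ) m n y → iter f (m + n) y ≡ iter f m (iter f n y)
 iter-+ f zero n y = refl
 iter-+ f (suc m) n y = cong f (iter-+ f m n y)

 iter-inj : ∀ {f} → Inj f → ∀ t → Inj (iter f t)
 iter-inj inj zero e = e
 iter-inj inj (suc t) e = iter-inj inj t (inj e)

 module Period {f : ℕ → ℕ} {n : ℕ} (inj : Inj f) (closed : ∀ {k} → k < n → f k < n) where

  iter-closed : ∀ t {y} → y < n → iter f t y < n
  iter-closed zero l = l
  iter-closed (suc t) l = closed (iter-closed t l)

  period : ∀ {y} → y < n → ∃[ d ] (suc d ≤ n × iter f (suc d) y ≡ y)
  -- Two of the first `n + 1` iterates coincide. Injectivity cancels the shorter power, so the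
  -- difference `suc d` of the exponents is a period.
  period {y} l with FinP.pigeonhole (ℕP.n<1+n n) (λ (t : Fin (suc n)) → fromℕ< (iter-closed (toℕ t) l))
  ... | a , b , a<b , e = d , ℕP.≤-trans (ℕP.m≤n+m (suc d) (toℕ a)) (subst (_≤ n) b≡ (ℕP.≤-pred (FinP.toℕ<n b))) ,
    iter-inj inj (toℕ a) (trans (sym (iter-+ f (toℕ a) (suc d) y)) (trans (cong (λ t → iter f t y) (sym b≡)) (sym e')))
    where
    d = toℕ b ∸ suc (toℕ a)
    b≡ : toℕ b ≡ toℕ a + suc d
    b≡ = trans (sym (ℕP.m+[n∸m]≡n a<b)) (sym (ℕP.+-suc (toℕ a) d))
    e' : iter f (toℕ a) y ≡ iter f (toℕ b) y
    e' = trans (sym (FinP.toℕ-fromℕ< _)) (trans (cong toℕ e) (FinP.toℕ-fromℕ< _))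

  -- `inOrbit` and `numCycles` try only exponents below n; reducing modulo a period of at most n
  -- shows that these suffice.
  orb-bounded : ∀ {y z} → y < n → Orb f y z → ∃[ t ] (t < n × iter f t y ≡ z)
  orb-bounded {y} l (t , e) with period l
  ... | d , d≤n , p = t % suc d , ℕP.<-≤-trans (m%n<n t (suc d)) d≤n , trans (sym reduce) e
    where
    loop : ∀ q → iter f (q * suc d) y ≡ y
    loop zero = refl
    loop (suc q) = trans (iter-+ f (suc d) (q * suc d) y) (trans (cong (iter f (suc d)) (loop q)) p)
    reduce : iter f t y ≡ iter f (t % suc d) y
    reduce = trans (cong (λ s → iter f s y) (m≡m%n+[m/n]*n t (suc d)))
      (trans (iter-+ f (t % suc d) _ y) (cong (iter f (t % suc d)) (loop (t / suc d))))

  inOrbit-sound : ∀ {k l} → inOrbit n f k l ≡ true → Orb f k l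
  inOrbit-sound e with any-sound _ (upTo n) e
  ... | t , _ , h = t , ≡ᵇ-sound h

  inOrbit-complete : ∀ {k l} → k < n → Orb f k l → inOrbit n f k l ≡ true
  inOrbit-complete {k} {l} k<n o with orb-bounded k<n o
  ... | t , t<n , e = any-complete (λ t → iter f t k ≡ᵇ l) (∈-upTo⁺ t<n) (≡ᵇ-complete e)

 CycleMin : (ℕ → ℕ) → ℕ → Set
 CycleMin f k = ∀ {z} → Orb f k z → k ≤ z

 upTo-snoc-↭ : ∀ n → upTo (suc n) ↭ n ∷ upTo n
 upTo-snoc-↭ n = ↭-trans (↭-reflexive (sym (upTo-∷ʳ n))) (PermP.++-comm (upTo n) [ n ])

 -- Deletes the largest element: it is the minimum of its cycle only when it is fixed, and its
 -- deletion changes no other cycle minimum. This matches the recursion of `cyc` from the last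
 -- element.
 count-minima : ∀ n {f} (P : ℕ → Bool) → Inj f → (∀ {k} → k < n → f k < n) →
   (∀ {k} → k < n → P k ≡ true → CycleMin f k) → (∀ {k} → k < n → CycleMin f k → P k ≡ true) →
   length (filterᵇ P (upTo n)) ≡ cyc (upTo n) f
 count-minima zero P inj closed s c = refl
 count-minima (suc n) {f} P inj closed s c = begin
   length (filterᵇ P (upTo (suc n))) ≡⟨ cong (length ∘ filterᵇ P) (upTo-∷ʳ n) ⟨
   length (filterᵇ P (upTo n ++ [ n ])) ≡⟨ cong length (filter-++ (T? ∘ P) (upTo n) [ n ]) ⟩
   length (filterᵇ P (upTo n) ++ filterᵇ P [ n ]) ≡⟨ length-++ (filterᵇ P (upTo n)) ⟩
   length (filterᵇ P (upTo n)) + length (filterᵇ P [ n ])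
     ≡⟨ cong₂ _+_ (count-minima n P (del-inj {n} {f} inj) closed' s' c') last ⟩
   cyc (upTo n) (del n f) + fixed? n f ≡⟨ ℕP.+-comm (cyc (upTo n) (del n f)) _ ⟩
   cyc (n ∷ upTo n) f ≡⟨ cyc-↭ inj (UP.upTo⁺ (suc n)) (upTo-snoc-↭ n) ⟨
   cyc (upTo (suc n)) f ∎
   where
   open ≡.≡-Reasoning
   up : ∀ {k} → k < n → k < suc n
   up = ℕP.m<n⇒m<1+n
   closed' : ∀ {k} → k < n → del n f k < n
   closed' {k} l = go (f k ℕP.≟ n)
     where
     go : Dec (f k ≡ n) → del n f k < n
     go (yes e) = subst (_< n) (sym (del-skip {n} {f} e)) (ℕP.≤∧≢⇒< (ℕP.≤-pred (closed (ℕP.n<1+n n)))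
       (λ e' → ℕP.<⇒≢ l (inj (trans e (sym e')))))
     go (no h) = subst (_< n) (sym (del-other {n} {f} inj (ℕP.<⇒≢ l) h)) (ℕP.≤∧≢⇒< (ℕP.≤-pred (closed (up l))) h)
   s' : ∀ {k} → k < n → P k ≡ true → CycleMin (del n f) k
   s' l e o = s (up l) e (orb-del⁻ inj (ℕP.<⇒≢ l) o)
   c' : ∀ {k} → k < n → CycleMin (del n f) k → P k ≡ true
   c' {k} l m = c (up l) (λ {z} o → min z o)
     where
     min : ∀ z → Orb f k z → k ≤ z
     min z o with z ℕP.≟ n
     ... | yes refl = ℕP.<⇒≤ l
     ... | no h = m (orb-del⁺ inj (ℕP.<⇒≢ l) h o)
   last : length (filterᵇ P [ n ]) ≡ fixed? n f
   last with P n in eq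
   ... | true = sym (fixed-yes {n} {f} (ℕP.≤-antisym (ℕP.≤-pred (closed (ℕP.n<1+n n))) (s (ℕP.n<1+n n) eq (1 , refl))))
   ... | false = sym (fixed-no {n} {f} (λ e → true≢false (trans (sym (c (ℕP.n<1+n n) (λ { (t , e') → ℕP.≤-reflexive (trans (sym (const t e)) e') }))) eq)))
     where
     const : ∀ t → f n ≡ n → iter f t n ≡ n
     const zero e = refl
     const (suc t) e = trans (cong f (const t e)) e

 numCycles-cyc : ∀ n {f} → Inj f → (∀ {k} → k < n → f k < n) → numCycles n f ≡ cyc (upTo n) f
 numCycles-cyc n {f} inj closed = count-minima n _ inj closed sound complete
   where
   open Period {f} {n} inj closed
   sound : ∀ {k} → k < n → all (λ t → k ≤ᵇ iter f t k) (upTo n) ≡ true → CycleMin f k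
   sound {k} l e o with orb-bounded l o
   ... | t , t<n , refl = ≤ᵇ-sound (all-sound (λ t → k ≤ᵇ iter f t k) {upTo n} e (∈-upTo⁺ t<n))
   complete : ∀ {k} → k < n → CycleMin f k → all (λ t → k ≤ᵇ iter f t k) (upTo n) ≡ true
   complete {k} l m = all-complete (λ t → k ≤ᵇ iter f t k) (upTo n) (λ {t} _ → ≤ᵇ-complete (m (t , refl)))

 nth-default : ∀ xs d k → length xs ≤ k → nth xs d k ≡ d
 nth-default [] d k l = refl
 nth-default (x ∷ xs) d (suc k) (s≤s l) = nth-default xs d k l

 nth-∈ : ∀ xs d k → k < length xs → nth xs d k ∈ xs
 nth-∈ (x ∷ xs) d zero l = here refl
 nth-∈ (x ∷ xs) d (suc k) (s≤s l) = there (nth-∈ xs d k l)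

 nth-inj : ∀ xs {d d'} k l → Unique xs → k < length xs → l < length xs → nth xs d k ≡ nth xs d' l → k ≡ l
 nth-inj (x ∷ xs) zero zero u _ _ e = refl
 nth-inj (x ∷ xs) {d' = d'} zero (suc l) (h ∷ u) _ (s≤s l<) e = ⊥-elim (All.lookup h (nth-∈ xs d' l l<) e)
 nth-inj (x ∷ xs) {d} (suc k) zero (h ∷ u) (s≤s k<) _ e = ⊥-elim (All.lookup h (nth-∈ xs d k k<) (sym e))
 nth-inj (x ∷ xs) (suc k) (suc l) (h ∷ u) (s≤s k<) (s≤s l<) e = cong suc (nth-inj xs k l u k< l< e)

 ∈-nth : ∀ {xs x} → x ∈ xs → ∃[ k ] (k < length xs × (∀ d → nth xs d k ≡ x))
 ∈-nth (here refl) = 0 , s≤s z≤n , λ _ → refl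
 ∈-nth (there x∈) with ∈-nth x∈
 ... | k , l , e = suc k , s≤s l , e

 module ListPerm {n : ℕ} {s : Perm} (s↭ : s ↭ upTo n) where
  len : length s ≡ n
  len = trans (PermP.↭-length s↭) (length-upTo n)

  uniq : Unique s
  uniq = unique-↭ (↭-sym s↭) (UP.upTo⁺ n)

  app-outside : ∀ {k} → n ≤ k → app s k ≡ k
  app-outside {k} l = nth-default s k k (subst (_≤ k) (sym len) l)

  app-< : ∀ {k} → k < n → app s k < n
  app-< {k} l = ∈-upTo⁻ (PermP.∈-resp-↭ s↭ (nth-∈ s k k (subst (k <_) (sym len) l)))

  app-inj : Inj (app s)
  app-inj {x} {y} e with x ℕP.<? n | y ℕP.<? n
  ... | yes lx | yes ly = nth-inj s x y uniq (subst (x <_) (sym len) lx) (subst (y <_) (sym len) ly) e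
  ... | yes lx | no ly = ⊥-elim (ly (subst (_< n) (trans e (app-outside (ℕP.≮⇒≥ ly))) (app-< lx)))
  ... | no lx | yes ly = ⊥-elim (lx (subst (_< n) (trans (sym e) (app-outside (ℕP.≮⇒≥ lx))) (app-< ly)))
  ... | no lx | no ly = trans (sym (app-outside (ℕP.≮⇒≥ lx))) (trans e (app-outside (ℕP.≮⇒≥ ly)))

  private
    preimage : ℕ → List ℕ → ℕ
    preimage m = foldr (λ k r → if app s k ≡ᵇ m then k else r) m

    preimage-hit : ∀ m ks {k} → k ∈ ks → app s k ≡ m → app s (preimage m ks) ≡ m
    preimage-hit m (k' ∷ ks) k∈ e with app s k' ≡ᵇ m in eq
    ... | true = ≡ᵇ-sound eq
    preimage-hit m (k' ∷ ks) (here refl) e | false = ⊥-elim (true≢false (trans (sym (≡ᵇ-complete e)) eq))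
    preimage-hit m (k' ∷ ks) (there k∈) e | false = preimage-hit m ks k∈ e

    preimage-miss : ∀ m ks → (∀ {k} → k ∈ ks → app s k ≢ m) → preimage m ks ≡ m
    preimage-miss m [] h = refl
    preimage-miss m (k' ∷ ks) h with app s k' ≡ᵇ m in eq
    ... | true = ⊥-elim (h (here refl) (≡ᵇ-sound eq))
    ... | false = preimage-miss m ks (h ∘ there)

  invPerm-right : ∀ m → app s (invPerm n s m) ≡ m
  invPerm-right m with m ℕP.<? n
  ... | no h = trans (cong (app s) (preimage-miss m (upTo n) (λ k∈ e → h (subst (_< n) e (app-< (∈-upTo⁻ k∈)))))) (app-outside (ℕP.≮⇒≥ h))
  ... | yes l with ∈-nth (PermP.∈-resp-↭ (↭-sym s↭) (∈-upTo⁺ l))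
  ... | k , k< , e = preimage-hit m (upTo n) (∈-upTo⁺ (subst (k <_) len k<)) (e k)

  invPerm-left : ∀ k → invPerm n s (app s k) ≡ k
  invPerm-left k = app-inj (invPerm-right (app s k))

 ∈-concatMap⁺ : ∀ {a b} {A : Set a} {B : Set b} (f : A → List B) {xs x y} → x ∈ xs → y ∈ f x → y ∈ concatMap f xs
 ∈-concatMap⁺ f x∈ y∈ = MemP.∈-concatMap⁺ f (lose x∈ y∈)

 ∈-concatMap⁻ : ∀ {a b} {A : Set a} {B : Set b} (f : A → List B) xs {y} → y ∈ concatMap f xs → ∃[ x ] (x ∈ xs × y ∈ f x)
 ∈-concatMap⁻ f xs y∈ = find (MemP.∈-concatMap⁻ f {xs = xs} y∈)

 insertions-↭ : ∀ x ys {zs} → zs ∈ insertions x ys → zs ↭ x ∷ ys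
 insertions-↭ x [] (here refl) = ↭-refl
 insertions-↭ x (y ∷ ys) (here refl) = ↭-refl
 insertions-↭ x (y ∷ ys) (there z∈) with ∈-map⁻ (y ∷_) z∈
 ... | w , w∈ , refl = ↭-trans (Perm.prep y (insertions-↭ x ys w∈)) (Perm.swap y x ↭-refl)

 ∈-insertions : ∀ x α β → α ++ x ∷ β ∈ insertions x (α ++ β)
 ∈-insertions x [] [] = here refl
 ∈-insertions x [] (y ∷ β) = here refl
 ∈-insertions x (a ∷ α) β = there (∈-map⁺ (a ∷_) (∈-insertions x α β))

 perms-↭ : ∀ xs {ys} → ys ∈ perms xs → ys ↭ xs
 perms-↭ [] (here refl) = ↭-refl
 perms-↭ (x ∷ xs) y∈ with ∈-concatMap⁻ (insertions x) (perms xs) y∈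
 ... | zs , zs∈ , h = ↭-trans (insertions-↭ x zs h) (Perm.prep x (perms-↭ xs zs∈))

 ∈-perms : ∀ xs {ys} → ys ↭ xs → ys ∈ perms xs
 ∈-perms [] p with PermP.↭-empty-inv p
 ... | refl = here refl
 ∈-perms (x ∷ xs) {ys} p with ∈-∃++ (PermP.∈-resp-↭ (↭-sym p) (here refl))
 ... | α , β , refl = ∈-concatMap⁺ (insertions x) (∈-perms xs (PermP.drop-mid α [] p)) (∈-insertions x α β)

 unique-same⇒↭ : ∀ {xs ys : List ℕ} → Unique xs → Unique ys → (∀ {z} → z ∈ xs → z ∈ ys) → (∀ {z} → z ∈ ys → z ∈ xs) → xs ↭ ys
 unique-same⇒↭ {[]} {[]} _ _ f g = ↭-refl
 unique-same⇒↭ {[]} {y ∷ ys} _ _ f g with g (here refl)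
 ... | ()
 unique-same⇒↭ {x ∷ xs} {ys} (h ∷ u) v f g with bring-front (f (here refl))
 ... | ys' , p with unique-↭ p v
 ... | h' ∷ v' = ↭-trans (Perm.prep x (unique-same⇒↭ u v'
   (λ z∈ → Any.tail (λ e → All.lookup h z∈ (sym e)) (PermP.∈-resp-↭ p (f (there z∈))))
   (λ z∈ → Any.tail (λ e → All.lookup h' z∈ (sym e)) (g (PermP.∈-resp-↭ (↭-sym p) (there z∈)))))) (↭-sym p)

 applyUpTo-+ : ∀ (f : ℕ → ℕ) i j → applyUpTo f (i + j) ≡ applyUpTo f i ++ applyUpTo (λ k → f (i + k)) j
 applyUpTo-+ f zero j = refl
 applyUpTo-+ f (suc i) j = cong (f 0 ∷_) (applyUpTo-+ (f ∘ suc) i j)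

 upTo-+ : ∀ i j → upTo (i + j) ≡ setA i ++ setB i j
 upTo-+ i j = trans (applyUpTo-+ id i j) (cong (upTo i ++_) (sym (map-upTo (i +_) j)))

 chain-applyUpTo : ∀ {τ} (f : ℕ → ℕ) m {z} → (∀ {k} → k < m → τ (f k) ≡ f (suc k)) → τ (f m) ≡ z →
   Chain τ (f 0) (applyUpTo (f ∘ suc) m) z
 chain-applyUpTo f zero h e = e
 chain-applyUpTo f (suc m) h e = h (s≤s z≤n) , chain-applyUpTo (f ∘ suc) m (λ l → h (s≤s l)) e

 cyclic-applyUpTo : ∀ {τ} (f : ℕ → ℕ) m → (∀ {k} → suc k < m → τ (f k) ≡ f (suc k)) → (∀ {k} → suc k ≡ m → τ (f k) ≡ f 0) →
   Cyclic τ (applyUpTo f m)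
 cyclic-applyUpTo f zero h e = tt
 cyclic-applyUpTo f (suc m) h e = chain-applyUpTo f m (λ l → h (s≤s l)) (e refl)

 -- With i and j variables, terms such as upTo (i + j) do not unfold.
 module Tau (i j : ℕ) .{{_ : NonZero i}} .{{_ : NonZero j}} where
  n : ℕ
  n = i + j

  data Position (k : ℕ) : Set where
    inA : suc k < i → Position k
    lastA : suc k ≡ i → Position k
    inB : i ≤ k → suc k < n → Position k
    lastB : suc k ≡ n → Position k
    out : n ≤ k → Position k

  position : ∀ k → Position k
  position k with ℕP.<-cmp (suc k) i | ℕP.<-cmp (suc k) n
  ... | tri< l _ _ | _ = inA l
  ... | tri≈ _ e _ | _ = lastA e
  ... | tri> _ _ l | tri< l' _ _ = inB (ℕP.≤-pred l) l'
  ... | tri> _ _ _ | tri≈ _ e _ = lastB e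
  ... | tri> _ _ _ | tri> _ _ l = out (ℕP.≤-pred l)

  -- τ extended by the identity outside {0,…,n-1}.
  τ : ℕ → ℕ
  τ k = if k <ᵇ n then tau i j k else k

  ≡ᵇ-false : ∀ {k m} → k ≢ m → (k ≡ᵇ m) ≡ false
  ≡ᵇ-false h = ≡false (h ∘ ≡ᵇ-sound)

  <ᵇ-false : ∀ {k m} → m ≤ k → (k <ᵇ m) ≡ false
  <ᵇ-false l = ≡false (λ e → ℕP.<⇒≱ (<ᵇ-sound e) l)

  i<n : i < n
  i<n = ℕP.m<m+n i (ℕ.>-nonZero⁻¹ j)

  τ-tau : ∀ {k} → k < n → τ k ≡ tau i j k
  τ-tau {k} l rewrite <ᵇ-complete l = refl

  τ-inA : ∀ {k} → suc k < i → τ k ≡ suc k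
  τ-inA {k} l rewrite <ᵇ-complete (ℕP.<-trans (ℕP.<-trans (ℕP.n<1+n k) l) i<n) | <ᵇ-complete (ℕP.<-trans (ℕP.n<1+n k) l) | <ᵇ-complete l = refl

  τ-lastA : ∀ {k} → suc k ≡ i → τ k ≡ 0
  τ-lastA e rewrite <ᵇ-complete (ℕP.<-trans (ℕP.≤-reflexive e) i<n) | <ᵇ-complete (ℕP.≤-reflexive e) | <ᵇ-false (ℕP.≤-reflexive (sym e)) = refl

  τ-inB : ∀ {k} → i ≤ k → suc k < n → τ k ≡ suc k
  τ-inB {k} l l' rewrite <ᵇ-complete (ℕP.<-trans (ℕP.n<1+n k) l') | <ᵇ-false l | <ᵇ-complete l' = refl

  τ-lastB : ∀ {k} → suc k ≡ n → τ k ≡ i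
  τ-lastB {k} e rewrite <ᵇ-complete (ℕP.≤-reflexive e) | <ᵇ-false (ℕP.≤-pred (subst (i <_) (sym e) i<n)) | <ᵇ-false (ℕP.≤-reflexive (sym e)) = refl

  τ-out : ∀ {k} → n ≤ k → τ k ≡ k
  τ-out l rewrite <ᵇ-false l = refl

  -- An explicit inverse reduces the injectivity of τ to one case distinction on a single element.
  τ⁻ : ℕ → ℕ
  τ⁻ k = if k ≡ᵇ 0 then pred i else if k ≡ᵇ i then pred n else if k <ᵇ n then pred k else k

  above : ∀ {k m} → n ≤ k → m < n → k ≢ m
  above l l' e = ℕP.<⇒≱ l' (subst (n ≤_) e l)

  τ⁻-τ : ∀ k → τ⁻ (τ k) ≡ k
  τ⁻-τ k with position k
  ... | inA l rewrite τ-inA l | ≡ᵇ-false (ℕP.<⇒≢ l) | <ᵇ-complete (ℕP.<-trans l i<n) = refl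
  ... | lastA e rewrite τ-lastA e = cong pred (sym e)
  ... | inB l l' rewrite τ-inB l l' | ≡ᵇ-false (ℕP.<⇒≢ (s≤s l) ∘ sym) | <ᵇ-complete l' = refl
  ... | lastB e rewrite τ-lastB e | ≡ᵇ-false (ℕ.≢-nonZero⁻¹ i) | ≡ᵇ-complete {i} refl = cong pred (sym e)
  ... | out l rewrite τ-out l | ≡ᵇ-false (above l (ℕP.≤-<-trans z≤n i<n)) | ≡ᵇ-false (above l i<n) | <ᵇ-false l = refl

  τ-inj : Inj τ
  τ-inj {x} {y} e = trans (sym (τ⁻-τ x)) (trans (cong τ⁻ e) (τ⁻-τ y))

  cyclicA : Cyclic τ (setA i)
  cyclicA = cyclic-applyUpTo id i τ-inA τ-lastA

  cyclicB : Cyclic τ (setB i j)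
  cyclicB = subst (Cyclic τ) (sym (map-upTo (i +_) j)) (cyclic-applyUpTo (i +_) j
    (λ {k} l → trans (τ-inB (ℕP.m≤m+n i k) (subst (_< n) (ℕP.+-suc i k) (ℕP.+-monoʳ-< i l))) (sym (ℕP.+-suc i k)))
    (λ {k} e → trans (τ-lastB (trans (sym (ℕP.+-suc i k)) (cong (i +_) e))) (sym (ℕP.+-identityʳ i))))

  uniqueAB : Unique (setA i ++ setB i j)
  uniqueAB = subst Unique (upTo-+ i j) (UP.upTo⁺ n)

  ∈A⇒< : ∀ {x} → x ∈ setA i → x < i
  ∈A⇒< = ∈-upTo⁻

  ∈B⇒≥ : ∀ {x} → x ∈ setB i j → i ≤ x
  ∈B⇒≥ x∈ with ∈-map⁻ (i +_) x∈
  ... | y , _ , refl = ℕP.m≤m+n i y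

  τ-< : ∀ {k} → k < n → τ k < n
  τ-< {k} l = ∈-upTo⁻ (subst (τ k ∈_) (sym (upTo-+ i j)) (closed (subst (k ∈_) (upTo-+ i j) (∈-upTo⁺ l))))
    where
    closed : ∀ {x} → x ∈ setA i ++ setB i j → τ x ∈ setA i ++ setB i j
    closed x∈ with ∈-++⁻ (setA i) x∈
    ... | inj₁ h = ∈-++⁺ˡ (cyclic-closed (setA i) cyclicA h)
    ... | inj₂ h = ∈-++⁺ʳ (setA i) (cyclic-closed (setB i j) cyclicB h)

  module Complement {s : Perm} (s↭ : s ↭ upTo n) where
   module S = ListPerm {n} {s} s↭
   module Pd = Period {app s} {n} S.app-inj S.app-<
   inv∘τ : ∀ {y} → y ∈ upTo n → invστ i j s y ≡ invPerm n s (τ y)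
   inv∘τ y∈ = cong (invPerm n s) (sym (τ-tau (∈-upTo⁻ y∈)))
   inv-inj : Inj (invPerm n s)
   inv-inj {x} {y} e = trans (sym (S.invPerm-right x)) (trans (cong (app s) e) (S.invPerm-right y))
   inv-< : ∀ {m} → m < n → invPerm n s m < n
   inv-< {m} l with invPerm n s m ℕP.<? n
   ... | yes h = h
   ... | no h = ⊥-elim (h (subst (_< n) (trans (sym (S.invPerm-right m)) (S.app-outside (ℕP.≮⇒≥ h))) l))
   -- `tau` sends every element from n on to i and is not injective on ℕ, so it is replaced by τ.
   -- The two agree below n, where all iterates that are counted stay.
   numφ : numCycles n (invστ i j s) ≡ cyc (upTo n) (invPerm n s ∘ τ)
   numφ = trans (numCycles-ext) (numCycles-cyc n (λ e → τ-inj (inv-inj e)) (λ l → inv-< (τ-< l)))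
     where
     iter-ext : ∀ t {k} → k < n → iter (invστ i j s) t k ≡ iter (invPerm n s ∘ τ) t k × iter (invPerm n s ∘ τ) t k < n
     iter-ext zero l = refl , l
     iter-ext (suc t) l with iter-ext t l
     ... | e , b = trans (cong (invστ i j s) e) (inv∘τ (∈-upTo⁺ b)) , inv-< (τ-< b)
     filter-cong : ∀ (P Q : ℕ → Bool) xs → (∀ {x} → x ∈ xs → P x ≡ Q x) → filterᵇ P xs ≡ filterᵇ Q xs
     filter-cong P Q [] h = refl
     filter-cong P Q (x ∷ xs) h with P x | Q x | h (here refl)
     ... | true | true | refl = cong (x ∷_) (filter-cong P Q xs (h ∘ there))
     ... | false | false | refl = filter-cong P Q xs (h ∘ there)
     numCycles-ext : numCycles n (invστ i j s) ≡ numCycles n (invPerm n s ∘ τ)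
     numCycles-ext = cong length (filter-cong _ _ (upTo n) (λ {k} k∈ → bool-ext
       (λ e → all-complete _ (upTo n) (λ {t} t∈ → subst (λ z → (k ≤ᵇ z) ≡ true) (proj₁ (iter-ext t (∈-upTo⁻ k∈))) (all-sound (λ t → k ≤ᵇ iter (invστ i j s) t k) {upTo n} e t∈)))
       (λ e → all-complete _ (upTo n) (λ {t} t∈ → subst (λ z → (k ≤ᵇ z) ≡ true) (sym (proj₁ (iter-ext t (∈-upTo⁻ k∈)))) (all-sound (λ t → k ≤ᵇ iter (invPerm n s ∘ τ) t k) {upTo n} e t∈)))))

  module _ {π : List (List ℕ)} {c : ℕ → ℕ}
   (same⇒c : ∀ {k l} → k < n → l < n → sameBlock π k l ≡ true → c k ≡ c l)
   (c⇒same : ∀ {k l} → k < n → l < n → c k ≡ c l → sameBlock π k l ≡ true) where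

   isAnn⇒annular : isAnnNCPartition i j π ≡ true → AnnularNC (map c (setA i)) (map c (setB i j))
   isAnn⇒annular e with any-sound _ (allPerms n) e
   ... | s , s∈ , h with ∧-sound {isAnnNCPerm i j s} h
   ... | h₁ , h₂ with ∧-sound {meetsBoth i j s} h₁
   ... | h₃ , h₄ with any-sound _ (upTo i) h₃
   ... | k , k∈ , h₅ with any-sound _ (upTo j) h₅
   ... | l , l∈ , h₆ = planar⇒annular c (length (setA i) + length (setB i j)) ℕP.≤-refl τ-inj uniqueAB cyclicA cyclicB
     (k , i + l , k∈ , ∈-map⁺ (i +_) l∈ , o⇒c k<n il<n (Pd.inOrbit-sound h₆))
     (subst (Planar c τ) (upTo-+ i j) planar)
     where
     s↭ : s ↭ upTo n
     s↭ = perms-↭ (upTo n) s∈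
     open Complement s↭
     k<n : k < n
     k<n = ℕP.<-trans (∈-upTo⁻ k∈) i<n
     il<n : i + l < n
     il<n = ℕP.+-monoʳ-< i (∈-upTo⁻ l∈)
     cycles : ∀ {k l} → k < n → l < n → boolEq (sameBlock π k l) (inOrbit n (app s) k l) ≡ true
     cycles {k} {l} lk ll = all-sound _ {upTo n} (all-sound (λ k → all (λ l → boolEq (sameBlock π k l) (inOrbit n (app s) k l)) (upTo n)) {upTo n} h₂ (∈-upTo⁺ lk)) (∈-upTo⁺ ll)
     o⇒c : ∀ {k l} → k < n → l < n → Orb (app s) k l → c k ≡ c l
     o⇒c lk ll o = same⇒c lk ll (trans (boolEq-sound (cycles lk ll)) (Pd.inOrbit-complete lk o))
     planar : Planar c τ (upTo n)
     planar = record
       { σ = app s ; σ⁻ = invPerm n s ; left-inv = S.invPerm-left ; right-inv = S.invPerm-right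
       ; support = λ {y} h → S.app-outside (ℕP.≮⇒≥ (λ l → h (∈-upTo⁺ l)))
       ; same⇒orb = λ y∈ z∈ e → Pd.inOrbit-sound (trans (sym (boolEq-sound (cycles (∈-upTo⁻ y∈) (∈-upTo⁻ z∈)))) (c⇒same (∈-upTo⁻ y∈) (∈-upTo⁻ z∈) e))
       ; orb⇒same = λ y∈ z∈ o → o⇒c (∈-upTo⁻ y∈) (∈-upTo⁻ z∈) o
       ; euler = trans (cong₂ _+_ (sym (numCycles-cyc n S.app-inj S.app-<)) (sym numφ)) (trans (≡ᵇ-sound h₄) (sym (length-upTo n))) }

   annular⇒isAnn : AnnularNC (map c (setA i)) (map c (setB i j)) → isAnnNCPartition i j π ≡ true
   annular⇒isAnn Q = any-complete (λ s → isAnnNCPerm i j s ∧ cyclesAre n s π) (∈-perms (upTo n) s↭)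
     (∧-complete (∧-complete meets (≡ᵇ-complete eulerᵇ)) cyclesᵇ)
     where
     P : Planar c τ (upTo n)
     P = subst (Planar c τ) (sym (upTo-+ i j))
       (annular⇒planar c (length (setA i) + length (setB i j)) ℕP.≤-refl τ-inj uniqueAB cyclicA cyclicB Q)
     open Planar P
     s : Perm
     s = map σ (upTo n)
     s-unique : Unique s
     s-unique = UP.map⁺ σ-inj (UP.upTo⁺ n)
     s↭ : s ↭ upTo n
     s↭ = unique-same⇒↭ s-unique (UP.upTo⁺ n) fwd bwd
       where
       fwd : ∀ {z} → z ∈ s → z ∈ upTo n
       fwd z∈ with ∈-map⁻ σ z∈
       ... | y , y∈ , refl = σ-closed y∈
       bwd : ∀ {z} → z ∈ upTo n → z ∈ s
       bwd {z} z∈ with memb-dec (σ⁻ z) (upTo n)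
       ... | inj₁ h = subst (_∈ s) (right-inv z) (∈-map⁺ σ h)
       ... | inj₂ h = ⊥-elim (h (subst (_∈ upTo n) (trans (sym (right-inv z)) (support h)) z∈))
     open Complement s↭
     nth-applyUpTo : ∀ (f : ℕ → ℕ) m {d} k → k < m → nth (applyUpTo f m) d k ≡ f k
     nth-applyUpTo f (suc m) zero l = refl
     nth-applyUpTo f (suc m) (suc k) (s≤s l) = nth-applyUpTo (f ∘ suc) m k l
     app≡σ : ∀ k → app s k ≡ σ k
     app≡σ k with k ℕP.<? n
     ... | yes l = trans (cong (λ xs → nth xs k k) (map-upTo σ n)) (nth-applyUpTo σ n k l)
     ... | no h = trans (S.app-outside (ℕP.≮⇒≥ h)) (sym (support (λ k∈ → h (∈-upTo⁻ k∈))))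
     iter≡ : ∀ t k → iter (app s) t k ≡ iter σ t k
     iter≡ zero k = refl
     iter≡ (suc t) k = trans (app≡σ _) (cong σ (iter≡ t k))
     orb→ : ∀ {k l} → Orb (app s) k l → Orb σ k l
     orb→ {k} (t , e) = t , trans (sym (iter≡ t k)) e
     orb← : ∀ {k l} → Orb σ k l → Orb (app s) k l
     orb← {k} (t , e) = t , trans (iter≡ t k) e
     inv≡ : ∀ m → invPerm n s m ≡ σ⁻ m
     inv≡ m = S.app-inj (trans (S.invPerm-right m) (sym (trans (app≡σ (σ⁻ m)) (right-inv m))))
     eulerᵇ : numCycles n (app s) + numCycles n (invστ i j s) ≡ n
     eulerᵇ = trans (cong₂ _+_ (trans (numCycles-cyc n S.app-inj S.app-<) (cyc-ext (upTo n) (λ {y} _ → app≡σ y)))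
       (trans numφ (cyc-ext (upTo n) (λ {y} _ → inv≡ (τ y))))) (trans euler (length-upTo n))
     cyclesᵇ : cyclesAre n s π ≡ true
     cyclesᵇ = all-complete _ (upTo n) (λ {k} k∈ → all-complete _ (upTo n) (λ {l} l∈ → boolEq-complete {sameBlock π k l} (bool-ext
       (λ e → Pd.inOrbit-complete (∈-upTo⁻ k∈) (orb← (same⇒orb k∈ l∈ (same⇒c (∈-upTo⁻ k∈) (∈-upTo⁻ l∈) e))))
       (λ e → c⇒same (∈-upTo⁻ k∈) (∈-upTo⁻ l∈) (orb⇒same k∈ l∈ (orb→ (Pd.inOrbit-sound e)))))))
     connected : ∃[ x ] ∃[ y ] (x ∈ setA i × y ∈ setB i j × c x ≡ c y)
     connected with AnnularNC.through Q
     ... | spokes [] ne _ _ _ = ⊥-elim (ne refl)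
     ... | spokes ((a , p , q) ∷ rs) _ _ rU _ with restrict-∈ (map c (setB i j)) (map c (setA i)) (PermP.∈-resp-↭ (↭-sym (rot-↭ rU)) (here refl))
     ... | a∈A , a∈B with ∈-map⁻ c a∈A | ∈-map⁻ c a∈B
     ... | x , x∈ , ex | y , y∈ , ey = x , y , x∈ , y∈ , trans (sym ex) ey
     meets : meetsBoth i j s ≡ true
     meets with connected
     ... | x , y , x∈ , y∈ , e with ∈-map⁻ (i +_) y∈
     ... | l , l∈ , refl = any-complete _ x∈ (any-complete (λ l → inOrbit n (app s) x (i + l)) l∈
       (Pd.inOrbit-complete x<n (orb← (same⇒orb (∈-upTo⁺ x<n) (∈-upTo⁺ (ℕP.+-monoʳ-< i (∈-upTo⁻ l∈))) e))))
       where
       x<n : x < n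
       x<n = ℕP.<-trans (∈-upTo⁻ x∈) i<n

-- Moments of non-crossing partitions and their derivatives

module Dual {c ℓ : Level} (S : CommutativeRing c ℓ) where
 open CommutativeRing S
 open Solver S

 -- A pair (a, a′) is a + εa′ with ε² = 0, so the second component of an identity is its derivative.
 DualRing : CommutativeRing c ℓ
 DualRing = record
   { Carrier = Carrier × Carrier
   ; _≈_ = λ { (a , a') (b , b') → a ≈ b × a' ≈ b' }
   ; _+_ = λ { (a , a') (b , b') → a + b , a' + b' }
   ; _*_ = λ { (a , a') (b , b') → a * b , a * b' + a' * b }
   ; -_ = λ { (a , a') → - a , - a' }
   ; 0# = 0# , 0# ; 1# = 1# , 0#
   ; isCommutativeRing = record
     { isRing = record
       { +-isAbelianGroup = record
         { isGroup = record
           { isMonoid = record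
             { isSemigroup = record
               { isMagma = record
                 { isEquivalence = record
                   { refl = refl , refl
                   ; sym = λ { (e , e') → sym e , sym e' }
                   ; trans = λ { (e , e') (d , d') → trans e d , trans e' d' } }
                 ; ∙-cong = λ { (e , e') (d , d') → +-cong e d , +-cong e' d' } }
               ; assoc = λ { _ _ _ → +-assoc _ _ _ , +-assoc _ _ _ } }
             ; identity = (λ _ → +-identityˡ _ , +-identityˡ _) , (λ _ → +-identityʳ _ , +-identityʳ _) }
           ; inverse = (λ _ → -‿inverseˡ _ , -‿inverseˡ _) , (λ _ → -‿inverseʳ _ , -‿inverseʳ _)
           ; ⁻¹-cong = λ { (e , e') → -‿cong e , -‿cong e' } }
         ; comm = λ _ _ → +-comm _ _ , +-comm _ _ }
       ; *-cong = λ { (e , e') (d , d') → *-cong e d , +-cong (*-cong e d') (*-cong e' d) }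
       ; *-assoc = λ { (a , a') (b , b') (d , d') → *-assoc a b d ,
         solve 6 (λ a a' b b' d d' → a :* b :* d' :+ (a :* b' :+ a' :* b) :* d :=
           a :* (b :* d' :+ b' :* d) :+ a' :* (b :* d)) refl a a' b b' d d' }
       ; *-identity = (λ { (a , a') → *-identityˡ a , solve 2 (λ a a' → con (1 , 0) :* a' :+ con (0 , 0) :* a := a') refl a a' })
         , (λ { (a , a') → *-identityʳ a , solve 2 (λ a a' → a :* con (0 , 0) :+ a' :* con (1 , 0) := a') refl a a' })
       ; distrib = (λ { (a , a') (b , b') (d , d') → distribˡ a b d ,
         solve 6 (λ a a' b b' d d' → a :* (b' :+ d') :+ a' :* (b :+ d) := (a :* b' :+ a' :* b) :+ (a :* d' :+ a' :* d)) refl a a' b b' d d' })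
         , (λ { (a , a') (b , b') (d , d') → distribʳ a b d ,
           solve 6 (λ a a' b b' d d' → (b :+ d) :* a' :+ (b' :+ d') :* a := (b :* a' :+ b' :* a) :+ (d :* a' :+ d' :* a)) refl a a' b b' d d' }) }
     ; *-comm = λ { (a , a') (b , b') → *-comm a b ,
       solve 4 (λ a a' b b' → a :* b' :+ a' :* b := b :* a' :+ b' :* a) refl a a' b b' } } }

-- A partial non-crossing partition is described by the stack of the sizes of those of its
-- blocks which can still be joined; joining a block closes all blocks above it in the stack.
module Stack {c ℓ : Level} (S : CommutativeRing c ℓ) (κ : ℕ → CommutativeRing.Carrier S) where
 open CommutativeRing S hiding (zero)
 open Over S
 open Solver S
 open SumProperties S

 weight : List ℕ → Carrier
 weight s = prodR (map κ s)

 -- Either the top block of the stack receives the element, or it is closed with its weight and a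
 -- deeper block receives it.
 joins : (List ℕ → Carrier) → List ℕ → Carrier
 joins T [] = 0#
 joins T (s ∷ st) = T (suc s ∷ st) + κ s * joins T st

 step : (List ℕ → Carrier) → List ℕ → Carrier
 step T st = T (1 ∷ st) + joins T st

 steps : ℕ → (List ℕ → Carrier) → List ℕ → Carrier
 steps zero T = T
 steps (suc n) T = step (steps n T)

 pow : Carrier → ℕ → Carrier
 pow x zero = 1#
 pow x (suc n) = x * pow x n

 joins-cong : ∀ {T T'} → (∀ s → T s ≈ T' s) → ∀ st → joins T st ≈ joins T' st
 joins-cong e [] = refl
 joins-cong e (s ∷ st) = +-cong (e _) (*-congˡ (joins-cong e st))

 step-cong : ∀ {T T'} → (∀ s → T s ≈ T' s) → ∀ st → step T st ≈ step T' st
 step-cong e st = +-cong (e _) (joins-cong e st)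

 joins-linear : ∀ k A B st → joins (λ s → k * (A s + B s)) st ≈ k * (joins A st + joins B st)
 joins-linear k A B [] = solve 1 (λ k → con (0 , 0) := k :* (con (0 , 0) :+ con (0 , 0))) refl k
 joins-linear k A B (s ∷ st) = trans (+-congˡ (*-congˡ (joins-linear k A B st)))
   (solve 6 (λ k a b x a' b' → k :* (a :+ b) :+ x :* (k :* (a' :+ b')) := k :* ((a :+ x :* a') :+ (b :+ x :* b')))
     refl k _ _ (κ s) _ _)

 step-linear : ∀ k A B st → step (λ s → k * (A s + B s)) st ≈ k * (step A st + step B st)
 step-linear k A B st = trans (+-congˡ (joins-linear k A B st))
   (solve 5 (λ k a b c d → k :* (a :+ b) :+ k :* (c :+ d) := k :* ((a :+ c) :+ (b :+ d))) refl k _ _ _ _)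

 module ClosedForm (y w : Carrier) (ψ : ℕ → Carrier) (ψ-rec : ∀ s → ψ s ≈ κ s + y * ψ (suc s))
  (w-eq : w * (1# + y * ψ 1) ≈ y) where

  -- Closed form for the series with terms w^(n+1) `steps n weight st`. An open block of size s
  -- enters through ψ s, the series of all weights that it can still reach; the hypothesis on w says
  -- w f(y) = y.
  total : List ℕ → Carrier
  total st = y * prodR (map ψ st)

  -- Telescoping sum: y ψ(s + 1) = ψ(s) − κ(s).
  joins-total : ∀ st → joins total st + weight st ≈ prodR (map ψ st)
  joins-total [] = +-identityˡ 1#
  joins-total (s ∷ st) = begin
    (y * (ψ (suc s) * Π) + κ s * joins total st) + κ s * weight st
      ≈⟨ solve 6 (λ y p q k j w → (y :* (p :* q) :+ k :* j) :+ k :* w := y :* p :* q :+ k :* (j :+ w)) refl _ _ _ _ _ _ ⟩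
    y * ψ (suc s) * Π + κ s * (joins total st + weight st)
      ≈⟨ +-congˡ (*-congˡ (joins-total st)) ⟩
    y * ψ (suc s) * Π + κ s * Π
      ≈⟨ solve 3 (λ a b p → a :* p :+ b :* p := (b :+ a) :* p) refl _ _ _ ⟩
    (κ s + y * ψ (suc s)) * Π ≈⟨ *-congʳ (sym (ψ-rec s)) ⟩
    ψ s * Π ∎
    where
    open import Relation.Binary.Reasoning.Setoid setoid
    Π = prodR (map ψ st)

  total-fixed : ∀ st → total st ≈ w * (weight st + step total st)
  total-fixed st = sym (begin
    w * (weight st + (y * (ψ 1 * Π) + joins total st))
      ≈⟨ solve 6 (λ w a y p q j → w :* (a :+ (y :* (p :* q) :+ j)) := w :* ((j :+ a) :+ y :* p :* q)) refl _ _ _ _ _ _ ⟩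
    w * ((joins total st + weight st) + y * ψ 1 * Π)
      ≈⟨ *-congˡ (+-congʳ (joins-total st)) ⟩
    w * (Π + y * ψ 1 * Π)
      ≈⟨ solve 3 (λ w a p → w :* (p :+ a :* p) := w :* (con (1 , 0) :+ a) :* p) refl _ _ _ ⟩
    w * (1# + y * ψ 1) * Π
      ≈⟨ *-congʳ w-eq ⟩
    y * Π ∎)
    where
    open import Relation.Binary.Reasoning.Setoid setoid
    Π = prodR (map ψ st)

  steps-total : ∀ n st → steps n total st ≈ w * (steps n weight st + steps (suc n) total st)
  steps-total zero st = total-fixed st
  steps-total (suc n) st = trans (step-cong (steps-total n) st) (step-linear w _ _ st)

  -- The fixed point equation unrolled N times. In the application w has order 1, so the remainder
  -- does not affect the coefficients below N.
  expansion : ∀ N → total [] ≈ Σ< N (λ n → pow w (suc n) * steps n weight []) + pow w N * steps N total []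
  expansion zero = solve 1 (λ t → t := con (0 , 0) :+ con (1 , 0) :* t) refl _
  expansion (suc N) = begin
    total [] ≈⟨ expansion N ⟩
    Σ< N a + pow w N * steps N total []
      ≈⟨ +-congˡ (*-congˡ (steps-total N [])) ⟩
    Σ< N a + pow w N * (w * (steps N weight [] + steps (suc N) total []))
      ≈⟨ solve 5 (λ s p w a b → s :+ p :* (w :* (a :+ b)) := (s :+ w :* p :* a) :+ w :* p :* b) refl _ _ _ _ _ ⟩
    (Σ< N a + a N) + pow w (suc N) * steps (suc N) total []
      ≈⟨ +-congʳ (sym (Σ<-last N a)) ⟩
    Σ< (suc N) a + pow w (suc N) * steps (suc N) total [] ∎
    where
    open import Relation.Binary.Reasoning.Setoid setoid
    a : ℕ → Carrier
    a n = pow w (suc n) * steps n weight []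

module PointedMoments {c ℓ : Level} (R : CommutativeRing c ℓ)
 (κ v : ℕ → CommutativeRing.Carrier R) where
 open CommutativeRing R hiding (zero)
 open Over R
 open SumProperties R
 open PowerSeries R
 private
   module P = CommutativeRing PSRing
   module PSol = Solver PSRing
   module RSol = Solver R
   module D = CommutativeRing (Dual.DualRing PSRing)
 open PSol using (_:=_; _:+_; _:*_; _:-_; :-_; con)

 -- f = y X(y) and K = f - y f′ = -y²X′(y), while g = Σ vₙ yⁿ is the direction of the derivative.
 f K g : PS1
 f = Xt κ
 K = λ n → - Xp κ n
 g zero = 0#
 g (suc n) = v (suc n)

 ψ ψᵛ : ℕ → PS1
 ψ s e = κ (s ℕ.+ e)
 ψᵛ s e = v (s ℕ.+ e)

 tail-rec : ∀ (u : ℕ → Carrier) s → (λ e → u (s ℕ.+ e)) ≋ (λ e → const (u s) e + (X *₁ (λ e → u (suc s ℕ.+ e))) e)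
 tail-rec u s zero = trans (reflexive (cong u (ℕP.+-identityʳ s))) (sym (trans (+-congˡ (X*-zero (λ e → u (suc s ℕ.+ e)))) (+-identityʳ _)))
 tail-rec u s (suc e) = trans (reflexive (cong u (ℕP.+-suc s e))) (sym (trans (+-identityˡ _) (X*-suc (λ e → u (suc s ℕ.+ e)) e)))

 f≋ : f ≋ (one1 P.+ X *₁ ψ 1)
 f≋ zero = sym (trans (+-congˡ (X*-zero (ψ 1))) (+-identityʳ _))
 f≋ (suc n) = sym (trans (+-identityˡ _) (X*-suc (ψ 1) n))

 g≋ : g ≋ X *₁ ψᵛ 1
 g≋ zero = sym (X*-zero (ψᵛ 1))
 g≋ (suc n) = sym (X*-suc (ψᵛ 1) n)

 θX : θ X ≋ X
 θX zero = refl
 θX (suc zero) = +-identityʳ 1#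
 θX (suc (suc n)) = natMul-0 (suc (suc n))

 θ-const : ∀ k → θ (const k) ≋ P.0#
 θ-const k zero = refl
 θ-const k (suc n) = natMul-0 (suc n)

 K≋ : K P.+ θ f ≋ f
 K≋ zero = RSol.solve 0 (RSol.:- (RSol.:- RSol.con (1 , 0)) RSol.:+ RSol.con (0 , 0) RSol.:= RSol.con (1 , 0)) refl
 K≋ (suc n) = RSol.solve 2 (λ a b → (RSol.:- b) RSol.:+ (a RSol.:+ b) RSol.:= a) refl _ _

 θ-X* : ∀ h → θ (X *₁ h) ≋ (X *₁ h) P.+ X *₁ θ h
 θ-X* h = P.trans (θ-* X h) (P.+-congʳ {x = X *₁ θ h} (P.*-congʳ {x = h} θX))

 θψ : ∀ s → θ (ψ s) ≋ (X *₁ ψ (suc s)) P.+ X *₁ θ (ψ (suc s))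
 θψ s n = begin
   natMul n (ψ s n)
     ≈⟨ natMul-cong n (tail-rec κ s n) ⟩
   natMul n (const (κ s) n + (X *₁ ψ (suc s)) n)
     ≈⟨ natMul-+ n _ _ ⟩
   natMul n (const (κ s) n) + natMul n ((X *₁ ψ (suc s)) n)
     ≈⟨ +-cong (θ-const (κ s) n) (θ-X* (ψ (suc s)) n) ⟩
   0# + ((X *₁ ψ (suc s)) n + (X *₁ θ (ψ (suc s))) n)
     ≈⟨ +-identityˡ _ ⟩
   (X *₁ ψ (suc s)) n + (X *₁ θ (ψ (suc s))) n ∎
   where open import Relation.Binary.Reasoning.Setoid setoid

 θf : θ f ≋ (X *₁ ψ 1) P.+ X *₁ θ (ψ 1)
 θf n = trans (natMul-cong n (f≋ n)) (trans (natMul-+ n _ _)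
   (trans (+-cong (θ-one n) (θ-X* (ψ 1) n)) (+-identityˡ _)))
   where
   θ-one : ∀ n → natMul n (one1 n) ≈ 0#
   θ-one zero = refl
   θ-one (suc n) = natMul-0 (suc n)

 Xrec*f : Xrec κ *₁ f ≋ X
 Xrec*f = P.trans (P.*-congʳ {x = f} Xrec≋) (P.trans (P.*-assoc X (inv1 f) f)
   (P.trans (P.*-congˡ {x = X} (P.trans (P.*-comm (inv1 f) f) (*-inv1 f refl))) (P.*-identityʳ X)))
   where
   Xrec≋ : Xrec κ ≋ X *₁ inv1 f
   Xrec≋ zero = sym (X*-zero (inv1 f))
   Xrec≋ (suc n) = sym (X*-suc (inv1 f) n)

 -- First-order perturbation κ + ε K v: the series y must be perturbed by ε y g in order to
 -- keep w = y / f(y) fixed. The factor K avoids a division by K = f − y f′.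
 κᵉ ψᵉ : ℕ → D.Carrier
 κᵉ s = const (κ s) , K *₁ const (v s)
 ψᵉ s = ψ s , (K *₁ ψᵛ s) P.+ g *₁ θ (ψ s)

 yᵉ wᵉ : D.Carrier
 yᵉ = X , X *₁ g
 wᵉ = Xrec κ , P.0#

 ψᵉ-rec : ∀ s → ψᵉ s D.≈ κᵉ s D.+ yᵉ D.* ψᵉ (suc s)
 ψᵉ-rec s = tail-rec κ s , (begin
   (K *₁ ψᵛ s) P.+ g *₁ θ (ψ s)
     ≈⟨ P.+-cong (P.*-congˡ {x = K} (tail-rec v s)) (P.*-congˡ {x = g} (θψ s)) ⟩
   (K *₁ (const (v s) P.+ X *₁ ψᵛ (suc s))) P.+ g *₁ ((X *₁ ψ (suc s)) P.+ X *₁ θ (ψ (suc s)))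
     ≈⟨ PSol.solve 7 (λ k c x u g p q → k :* (c :+ x :* u) :+ g :* (x :* p :+ x :* q) :=
       k :* c :+ (x :* (k :* u :+ g :* q) :+ (x :* g) :* p)) (λ {_} → P.refl)
       K (const (v s)) X (ψᵛ (suc s)) g (ψ (suc s)) (θ (ψ (suc s))) ⟩
   (K *₁ const (v s)) P.+ ((X *₁ ((K *₁ ψᵛ (suc s)) P.+ g *₁ θ (ψ (suc s)))) P.+ (X *₁ g) *₁ ψ (suc s)) ∎)
   where open import Relation.Binary.Reasoning.Setoid P.setoid

 wᵉ-eq : wᵉ D.* (D.1# D.+ yᵉ D.* ψᵉ 1) D.≈ yᵉ
 wᵉ-eq = P.trans (P.*-congˡ {x = w} (P.sym f≋)) Xrec*f , (begin
   (w *₁ (P.0# P.+ ((X *₁ ((K *₁ ψᵛ 1) P.+ g *₁ θ (ψ 1))) P.+ (X *₁ g) *₁ ψ 1))) P.+ P.0# *₁ (one1 P.+ X *₁ ψ 1)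
     ≈⟨ PSol.solve 8 (λ w x k u g q p o → w :* (con (0 , 0) :+ (x :* (k :* u :+ g :* q) :+ (x :* g) :* p)) :+ con (0 , 0) :* (o :+ x :* p)
       := w :* (k :* (x :* u) :+ g :* (x :* p :+ x :* q))) (λ {_} → P.refl) w X K (ψᵛ 1) g (θ (ψ 1)) (ψ 1) one1 ⟩
   w *₁ ((K *₁ (X *₁ ψᵛ 1)) P.+ g *₁ ((X *₁ ψ 1) P.+ X *₁ θ (ψ 1)))
     ≈⟨ P.*-congˡ {x = w} (P.+-cong (P.*-congˡ {x = K} (P.sym g≋)) (P.*-congˡ {x = g} (P.sym θf))) ⟩
   w *₁ ((K *₁ g) P.+ g *₁ θ f)
     ≈⟨ PSol.solve 4 (λ w k g t → w :* (k :* g :+ g :* t) := w :* (k :+ t) :* g) (λ {_} → P.refl) w K g (θ f) ⟩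
   (w *₁ (K P.+ θ f)) *₁ g
     ≈⟨ P.*-congʳ {x = g} (P.*-congˡ {x = w} K≋) ⟩
   (w *₁ f) *₁ g
     ≈⟨ P.*-congʳ {x = g} Xrec*f ⟩
   X *₁ g ∎)
   where
   open import Relation.Binary.Reasoning.Setoid P.setoid
   w = Xrec κ

 module Sᵉ = Stack (Dual.DualRing PSRing) κᵉ
 open Sᵉ.ClosedForm yᵉ wᵉ ψᵉ ψᵉ-rec wᵉ-eq using (total; expansion)

 module _ (N : ℕ → Carrier)
  (N-eq : ∀ n → proj₂ (Sᵉ.steps n Sᵉ.weight []) ≋ K *₁ const (N n)) where

  private
    module ΣP = SumProperties PSRing
    module ΣD = SumProperties (Dual.DualRing PSRing)
    w = Xrec κ
    term : ℕ → PS1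
    term n = pow1 w (suc n) *₁ const (N n)

    ΣP-eval : ∀ m F b → ΣP.Σ< m F b ≈ Σ< m (λ k → F k b)
    ΣP-eval zero F b = refl
    ΣP-eval (suc m) F b = +-congˡ (ΣP-eval m (F ∘ suc) b)

    proj₂-Σ : ∀ m F → proj₂ (ΣD.Σ< m F) ≋ ΣP.Σ< m (proj₂ ∘ F)
    proj₂-Σ zero F = P.refl
    proj₂-Σ (suc m) F = P.+-congˡ {x = proj₂ (F 0)} (proj₂-Σ m (F ∘ suc))

    pow-wᵉ : ∀ n → Sᵉ.pow wᵉ n D.≈ (pow1 w n , P.0#)
    pow-wᵉ zero = D.refl
    pow-wᵉ (suc n) = D.trans (D.*-congˡ {x = wᵉ} (pow-wᵉ n))
      (P.refl , P.trans (P.+-cong (P.zeroʳ w) (P.zeroˡ (pow1 w n))) (P.+-identityˡ P.0#))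

    proj₂-pow* : ∀ n A → proj₂ (Sᵉ.pow wᵉ n D.* A) ≋ pow1 w n *₁ proj₂ A
    proj₂-pow* n A = P.trans (proj₂ (D.*-congʳ {x = A} (pow-wᵉ n)))
      (P.trans (P.+-congˡ {x = pow1 w n *₁ proj₂ A} (P.zeroˡ (proj₁ A))) (P.+-identityʳ _))

    w-Ord : Ord 1 w
    w-Ord zero _ = refl
    w-Ord (suc m) (s≤s ())

    total₂ : proj₂ (total []) ≋ X *₁ g
    total₂ = PSol.solve 2 (λ x y → x :* con (0 , 0) :+ y :* con (1 , 0) := y) (λ {_} → P.refl) X (X *₁ g)

    expansion₂ : ∀ m → X *₁ g ≋ (K *₁ ΣP.Σ< m term) P.+ pow1 w m *₁ proj₂ (Sᵉ.steps m total [])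
    expansion₂ m = P.trans (P.sym total₂) (P.trans (proj₂ (expansion m))
      (P.+-cong (P.trans (proj₂-Σ m F) (P.trans (ΣP.Σ<-cong m (λ k _ → term≋ k)) (P.sym (ΣP.Σ<-*ˡ m K term))))
        (proj₂-pow* m (Sᵉ.steps m total []))))
      where
      F : ℕ → D.Carrier
      F n = Sᵉ.pow wᵉ (suc n) D.* Sᵉ.steps n Sᵉ.weight []
      term≋ : ∀ n → proj₂ (F n) ≋ K *₁ term n
      term≋ n = P.trans (proj₂-pow* (suc n) (Sᵉ.steps n Sᵉ.weight [])) (P.trans (P.*-congˡ {x = pow1 w (suc n)} (N-eq n))
        (PSol.solve 3 (λ p k c → p :* (k :* c) := k :* (p :* c)) (λ {_} → P.refl) (pow1 w (suc n)) K (const (N n))))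

  -- The ε-part of `expansion` on the empty stack: the closed form there is y, whose perturbation is
  -- y g, and every coefficient of the sum carries the common factor K.
  pointed-moments : K *₁ (λ b → Σ< b (λ n → pow1 w (suc n) b * N n)) ≋ X *₁ g
  pointed-moments a = begin
    (K *₁ Z) a ≈⟨ *₁-cong-≤ a (λ _ _ → refl) (λ b b≤a → Z≈ (a ∸ b) b (ℕP.m∸n+n≡m b≤a)) ⟩
    (K *₁ ΣP.Σ< (suc a) term) a ≈⟨ +-identityʳ _ ⟨
    (K *₁ ΣP.Σ< (suc a) term) a + 0# ≈⟨ +-congˡ (Ord-* (suc a) 0 {g = proj₂ (Sᵉ.steps (suc a) total [])} (Ord-pow w-Ord (suc a)) (λ _ ()) a
      (ℕP.≤-reflexive (≡.sym (ℕP.+-identityʳ (suc a))))) ⟨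
    (K *₁ ΣP.Σ< (suc a) term) a + (pow1 w (suc a) *₁ proj₂ (Sᵉ.steps (suc a) total [])) a
      ≈⟨ expansion₂ (suc a) a ⟨
    (X *₁ g) a ∎
    where
    open import Relation.Binary.Reasoning.Setoid setoid
    Z : PS1
    Z b = Σ< b (λ n → pow1 w (suc n) b * N n)
    term-eval : ∀ n b → term n b ≈ pow1 w (suc n) b * N n
    term-eval n b = trans (P.*-comm (pow1 w (suc n)) (const (N n)) b) (trans (const* (N n) (pow1 w (suc n)) b) (*-comm _ _))
    Z≈ : ∀ d b → d ℕ.+ b ≡ a → Z b ≈ ΣP.Σ< (suc a) term b
    Z≈ d b ≡.refl = sym (trans (ΣP-eval (suc (d ℕ.+ b)) term b)
      (trans (Σ<-cong (suc (d ℕ.+ b)) (λ k _ → term-eval k b)) (vanish (suc d))))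
      where
      -- The power of index n has order n + 1, so terms with n ≥ b do not reach the coefficient b,
      -- and the bound b may be raised to a common one.
      vanish : ∀ e → Σ< (e ℕ.+ b) (λ n → pow1 w (suc n) b * N n) ≈ Z b
      vanish zero = refl
      vanish (suc e) = trans (Σ<-last (e ℕ.+ b) _) (trans (+-cong (vanish e)
        (trans (*-congʳ (Ord-pow w-Ord (suc (e ℕ.+ b)) b (s≤s (ℕP.m≤n+m b e)))) (zeroˡ _))) (+-identityʳ _))

-- Summing over non-crossing partitions with a stack

module NonCrossingPartitions where
 open BooleanReflection

 Disj : List ℕ → List ℕ → Set
 Disj b b' = ∀ {y} → y ∈ b → y ∈ b' → ⊥

 Disj-sym : ∀ {b b'} → Disj b b' → Disj b' b
 Disj-sym d y∈ y∈' = d y∈' y∈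

 data Add (x : ℕ) : Blocks → Blocks → Set where
   here : ∀ {b bs} → Add x (b ∷ bs) ((x ∷ b) ∷ bs)
   there : ∀ {b bs bs'} → Add x bs bs' → Add x (b ∷ bs) (b ∷ bs')

 Add-old : ∀ {x π π' b} → Add x π π' → b ∈ π → ∃[ b' ] (b' ∈ π' × (b' ≡ b ⊎ b' ≡ x ∷ b))
 Add-old here (here ≡.refl) = _ , here ≡.refl , inj₂ ≡.refl
 Add-old here (there b∈) = _ , there b∈ , inj₁ ≡.refl
 Add-old (there a) (here ≡.refl) = _ , here ≡.refl , inj₁ ≡.refl
 Add-old (there a) (there b∈) with Add-old a b∈
 ... | b' , b'∈ , e = b' , there b'∈ , e

 Add-new : ∀ {x π π' b'} → Add x π π' → b' ∈ π' → ∃[ b ] (b ∈ π × (b' ≡ b ⊎ b' ≡ x ∷ b))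
 Add-new here (here ≡.refl) = _ , here ≡.refl , inj₂ ≡.refl
 Add-new here (there b∈) = _ , there b∈ , inj₁ ≡.refl
 Add-new (there a) (here ≡.refl) = _ , here ≡.refl , inj₁ ≡.refl
 Add-new (there a) (there b∈) with Add-new a b∈
 ... | b , b∈' , e = b , there b∈' , e

 Add-disj : ∀ {x π π'} → Add x π π' → (∀ {b} → b ∈ π → x ∉ b) → AllPairs Disj π → AllPairs Disj π'
 Add-disj here x∉ (d ∷ ds) = All.tabulate (λ { b∈ (here ≡.refl) x∈ → x∉ (there b∈) x∈
   ; b∈ (there y∈) y∈' → All.lookup d b∈ y∈ y∈' }) ∷ ds
 Add-disj {x} (there a) x∉ (d ∷ ds) = All.tabulate lem ∷ Add-disj a (x∉ ∘ there) ds
   where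
   lem : ∀ {b'} → b' ∈ _ → Disj _ b'
   lem b'∈ y∈ y∈' with Add-new a b'∈
   lem b'∈ y∈ y∈' | b , b∈ , inj₁ ≡.refl = All.lookup d b∈ y∈ y∈'
   lem b'∈ y∈ (here ≡.refl) | b , b∈ , inj₂ ≡.refl = x∉ (here ≡.refl) y∈
   lem b'∈ y∈ (there y∈') | b , b∈ , inj₂ ≡.refl = All.lookup d b∈ y∈ y∈'

 disj-same : ∀ {π b b' y} → AllPairs Disj π → b ∈ π → b' ∈ π → y ∈ b → y ∈ b' → b ≡ b'
 disj-same (d ∷ ds) (here ≡.refl) (here ≡.refl) y∈ y∈' = ≡.refl
 disj-same (d ∷ ds) (here ≡.refl) (there b'∈) y∈ y∈' = ⊥-elim (All.lookup d b'∈ y∈ y∈')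
 disj-same (d ∷ ds) (there b∈) (here ≡.refl) y∈ y∈' = ⊥-elim (All.lookup d b∈ y∈' y∈)
 disj-same (d ∷ ds) (there b∈) (there b'∈) y∈ y∈' = disj-same ds b∈ b'∈ y∈ y∈'

 Add-at : ∀ {x} α b ρ → Add x (α ++ b ∷ ρ) (α ++ (x ∷ b) ∷ ρ)
 Add-at [] b ρ = here
 Add-at (a ∷ α) b ρ = there (Add-at α b ρ)

 module PartitionSums {c ℓ : Level} (R : CommutativeRing c ℓ) where
  open CommutativeRing R hiding (zero)
  open Over R
  open SumProperties R
  open Solver R

  addSum : ℕ → Blocks → (Blocks → Carrier) → Carrier
  addSum x [] F = 0#
  addSum x (b ∷ bs) F = F ((x ∷ b) ∷ bs) + addSum x bs (λ bs' → F (b ∷ bs'))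

  -- The summand is transformed instead of listing partitions: it absorbs the possible positions of
  -- the first element of the list. Inductions then run over the list with an arbitrary summand.
  spSum : List ℕ → (Blocks → Carrier) → Carrier
  spSum [] F = F []
  spSum (x ∷ L) F = spSum L (λ π → F ([ x ] ∷ π) + addSum x π F)

  private
    foldr-map : ∀ {a b} {A : Set a} {B : Set b} (F : B → Carrier) (f : A → B) xs →
      sumR (map F (map f xs)) ≡ sumR (map (F ∘ f) xs)
    foldr-map F f [] = ≡.refl
    foldr-map F f (x ∷ xs) = cong (F (f x) +_) (foldr-map F f xs)

  sumR-concatMap-map : ∀ {a b} {A : Set a} {B : Set b} (F : B → Carrier) (f : A → List B) xs →
    sumR (map F (concatMap f xs)) ≈ sumR (map (λ x → sumR (map F (f x))) xs)
  sumR-concatMap-map F f [] = refl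
  sumR-concatMap-map F f (x ∷ xs) = trans (reflexive (cong sumR (map-++ F (f x) _)))
    (trans (sumR-++ (map F (f x)) _) (+-congˡ (sumR-concatMap-map F f xs)))

  addSum-sum : ∀ x π F → sumR (map F (addToEach x π)) ≈ addSum x π F
  addSum-sum x [] F = refl
  addSum-sum x (b ∷ bs) F = +-congˡ (trans (reflexive (foldr-map F (b ∷_) (addToEach x bs))) (addSum-sum x bs _))

  spSum-sum : ∀ L F → sumR (map F (setPartitions L)) ≈ spSum L F
  spSum-sum [] F = +-identityʳ _
  spSum-sum (x ∷ L) F = trans (sumR-concatMap-map F _ (setPartitions L))
    (trans (sumR-cong _ _ (setPartitions L) (λ π → +-congˡ (addSum-sum x π F))) (spSum-sum L _))

  sum-filter : ∀ {a} {A : Set a} (p : A → Bool) (F : A → Carrier) xs →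
    sumR (map F (filterᵇ p xs)) ≈ sumR (map (λ x → if p x then F x else 0#) xs)
  sum-filter p F [] = refl
  sum-filter p F (x ∷ xs) with p x
  ... | true = +-congˡ (sum-filter p F xs)
  ... | false = trans (sum-filter p F xs) (sym (+-identityˡ _))

  addSum-cong : ∀ {x} π {F G} → (∀ {π'} → Add x π π' → F π' ≈ G π') → addSum x π F ≈ addSum x π G
  addSum-cong [] e = refl
  addSum-cong (b ∷ bs) e = +-cong (e here) (addSum-cong bs (λ a → e (there a)))

  addSum-0 : ∀ {x} π F → (∀ {π'} → Add x π π' → F π' ≈ 0#) → addSum x π F ≈ 0#
  addSum-0 [] F h = refl
  addSum-0 (b ∷ bs) F h = trans (+-cong (h here) (addSum-0 bs _ (λ a → h (there a)))) (+-identityˡ 0#)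

  addSum-++ : ∀ x π ρ F → addSum x (π ++ ρ) F ≈ addSum x π (λ π' → F (π' ++ ρ)) + addSum x ρ (λ ρ' → F (π ++ ρ'))
  addSum-++ x [] ρ F = sym (+-identityˡ _)
  addSum-++ x (b ∷ π) ρ F = trans (+-congˡ (addSum-++ x π ρ (λ bs → F (b ∷ bs)))) (sym (+-assoc _ _ _))

  PermInvariant : (Blocks → Carrier) → Set ℓ
  PermInvariant F = ∀ {π π'} → π ↭ π' → F π ≈ F π'

  addSum-↭ : ∀ x {F} → PermInvariant F → ∀ {π π'} → π ↭ π' → addSum x π F ≈ addSum x π' F
  addSum-↭ x inv Perm.refl = refl
  addSum-↭ x inv (Perm.prep b p) = +-cong (inv (Perm.prep _ p)) (addSum-↭ x (λ q → inv (Perm.prep b q)) p)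
  addSum-↭ x {F} inv (Perm.swap {xs} {ys} b b' p) = begin
    F ((x ∷ b) ∷ b' ∷ xs) + (F (b ∷ (x ∷ b') ∷ xs) + addSum x xs (λ bs → F (b ∷ b' ∷ bs)))
      ≈⟨ +-cong (inv (Perm.swap _ _ p)) (+-cong (inv (Perm.swap _ _ p)) (trans
        (addSum-cong xs (λ _ → inv (Perm.swap b b' Perm.refl)))
        (addSum-↭ x (λ q → inv (Perm.prep b' (Perm.prep b q))) p))) ⟩
    F (b' ∷ (x ∷ b) ∷ ys) + (F ((x ∷ b') ∷ b ∷ ys) + addSum x ys (λ bs → F (b' ∷ b ∷ bs)))
      ≈⟨ solve 3 (λ a b c → a :+ (b :+ c) := b :+ (a :+ c)) refl _ _ _ ⟩
    F ((x ∷ b') ∷ b ∷ ys) + (F (b' ∷ (x ∷ b) ∷ ys) + addSum x ys (λ bs → F (b' ∷ b ∷ bs))) ∎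
    where open import Relation.Binary.Reasoning.Setoid setoid
  addSum-↭ x inv (Perm.trans p q) = trans (addSum-↭ x inv p) (addSum-↭ x inv q)

  prodR-↭ : ∀ {xs ys} → xs ↭ ys → prodR xs ≈ prodR ys
  prodR-↭ Perm.refl = refl
  prodR-↭ (Perm.prep x p) = *-congˡ (prodR-↭ p)
  prodR-↭ (Perm.swap x y p) = trans (*-congˡ (*-congˡ (prodR-↭ p)))
    (solve 3 (λ a b c → a :* (b :* c) := b :* (a :* c)) refl _ _ _)
  prodR-↭ (Perm.trans p q) = trans (prodR-↭ p) (prodR-↭ q)

  prodR-++ : ∀ xs ys → prodR (xs ++ ys) ≈ prodR xs * prodR ys
  prodR-++ [] ys = sym (*-identityˡ _)
  prodR-++ (x ∷ xs) ys = trans (*-congˡ (prodR-++ xs ys)) (sym (*-assoc _ _ _))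

 -- Adding to the partition a new element x below all others keeps it non-crossing exactly
 -- when the block which receives x is not enclosed by another block.
 module Open (el : List ℕ) where

  record Cross (π : Blocks) : Set where
    constructor cross
    field {b b'} : List ℕ
          {p q r s} : ℕ
          b∈ : b ∈ π
          b'∈ : b' ∈ π
          p∈ : p ∈ b
          r∈ : r ∈ b
          q∈ : q ∈ b'
          s∈ : s ∈ b'
          p<q : p < q
          q<r : q < r
          r<s : r < s
          q∉ : q ∉ b

  record Enclosed (π : Blocks) (b : List ℕ) : Set where
    constructor enclosed
    field {b'} : List ℕ
          {q r s} : ℕ
          b'∈ : b' ∈ π
          q∈ : q ∈ b'
          s∈ : s ∈ b'
          r∈ : r ∈ b
          q<r : q < r
          r<s : r < s
          q∉ : q ∉ b

  -- No other block has elements on both sides of an element of b. The conclusion `q ∈ b` rather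
  -- than equality of blocks lets b itself pass.
  Joinable : Blocks → List ℕ → Set
  Joinable π b = ∀ {b' q r s} → b' ∈ π → q ∈ b' → s ∈ b' → r ∈ b → q < r → r < s → q ∈ b

  record Within (lo : ℕ) (π : Blocks) : Set where
    constructor within
    field disj : AllPairs Disj π
          elems : ∀ {b y} → b ∈ π → y ∈ b → lo ≤ y × y ∈ el

  -- One pair of elements suffices as comparison, because two joinable disjoint blocks cannot
  -- interleave.
  Before : List ℕ → List ℕ → Set
  Before b b' = ∃[ q ] ∃[ r ] (q ∈ b × r ∈ b' × q < r)

  -- Invariant of the insertion of elements in decreasing order: `st` is the stack of blocks that a
  -- smaller element may still join, leftmost first, and every block of `cl` is enclosed by another
  -- block.
  record State (lo : ℕ) (st cl : Blocks) : Set where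
    constructor state
    field wf : Within lo (st ++ cl)
          nonempty : ∀ {b} → b ∈ st → ∃[ y ] (y ∈ b)
          joinable : ∀ {b} → b ∈ st → Joinable (st ++ cl) b
          closed : ∀ {b} → b ∈ cl → Enclosed (st ++ cl) b
          ordered : AllPairs Before st
          nc : ¬ Cross (st ++ cl)

  within-new : ∀ {x π} → x ∈ el → Within (suc x) π → Within x ([ x ] ∷ π)
  within-new x∈ (within d e) = within
    (All.tabulate (λ { b∈ (here ≡.refl) y∈ → ℕP.<-irrefl ≡.refl (proj₁ (e b∈ y∈)) }) ∷ d)
    (λ { (here ≡.refl) (here ≡.refl) → ℕP.≤-refl , x∈
      ; (there b∈) y∈ → ℕP.<⇒≤ (proj₁ (e b∈ y∈)) , proj₂ (e b∈ y∈) })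

  within-add : ∀ {x π π'} → x ∈ el → Add x π π' → Within (suc x) π → Within x π'
  within-add {x} {π} {π'} x∈ a (within d e) = within
    (Add-disj a (λ b∈ x∈b → ℕP.<-irrefl ≡.refl (proj₁ (e b∈ x∈b))) d) lem
    where
    lem : ∀ {b y} → b ∈ π' → y ∈ b → x ≤ y × y ∈ el
    lem b∈ y∈ with Add-new a b∈
    lem b∈ y∈ | b , b∈' , inj₁ ≡.refl = ℕP.<⇒≤ (proj₁ (e b∈' y∈)) , proj₂ (e b∈' y∈)
    lem b∈ (here ≡.refl) | b , b∈' , inj₂ ≡.refl = ℕP.≤-refl , x∈
    lem b∈ (there y∈) | b , b∈' , inj₂ ≡.refl = ℕP.<⇒≤ (proj₁ (e b∈' y∈)) , proj₂ (e b∈' y∈)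

  within-↭ : ∀ {lo π π'} → π ↭ π' → Within lo π → Within lo π'
  within-↭ p (within d e) = within (PermS.AllPairs-resp-↭ (≡.setoid _) Disj-sym (≡.resp₂ Disj) (Perm.↭⇒↭ₛ p) d)
    (λ b∈ → e (PermP.∈-resp-↭ (↭-sym p) b∈))

  cross-new : ∀ {x π} → Cross π → Cross ([ x ] ∷ π)
  cross-new (cross b∈ b'∈ p∈ r∈ q∈ s∈ l₁ l₂ l₃ q∉) = cross (there b∈) (there b'∈) p∈ r∈ q∈ s∈ l₁ l₂ l₃ q∉

  cross-add : ∀ {x π π'} → Within (suc x) π → Add x π π' → Cross π → Cross π'
  cross-add W a (cross b∈ b'∈ p∈ r∈ q∈ s∈ l₁ l₂ l₃ q∉) with Add-old a b∈ | Add-old a b'∈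
  ... | c , c∈ , inj₁ ≡.refl | c' , c'∈ , inj₁ ≡.refl = cross c∈ c'∈ p∈ r∈ q∈ s∈ l₁ l₂ l₃ q∉
  ... | c , c∈ , inj₁ ≡.refl | c' , c'∈ , inj₂ ≡.refl = cross c∈ c'∈ p∈ r∈ (there q∈) (there s∈) l₁ l₂ l₃ q∉
  ... | c , c∈ , inj₂ ≡.refl | c' , c'∈ , e = cross c∈ c'∈ (there p∈) (there r∈) (up e q∈) (up e s∈) l₁ l₂ l₃
    (λ { (here ≡.refl) → ℕP.<-irrefl ≡.refl (proj₁ (Within.elems W b'∈ q∈)) ; (there q∈b) → q∉ q∈b })
    where
    up : ∀ {x b b' y} → b' ≡ b ⊎ b' ≡ x ∷ b → y ∈ b → y ∈ b'
    up (inj₁ ≡.refl) y∈ = y∈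
    up (inj₂ ≡.refl) y∈ = there y∈

  enclosed-cross : ∀ {x b} α β → Within (suc x) (α ++ b ∷ β) → Enclosed (α ++ b ∷ β) b → Cross (α ++ (x ∷ b) ∷ β)
  enclosed-cross {x} {b} α β W (enclosed {b'} b'∈ q∈ s∈ r∈ l₁ l₂ q∉) =
    cross (∈-++⁺ʳ α (here ≡.refl)) (mv (∈-++⁻ α b'∈)) (here ≡.refl) (there r∈) q∈ s∈
      x<q l₁ l₂ (λ { (here ≡.refl) → ℕP.<-irrefl ≡.refl x<q ; (there q∈b) → q∉ q∈b })
    where
    x<q = proj₁ (Within.elems W b'∈ q∈)
    mv : b' ∈ α ⊎ b' ∈ b ∷ β → b' ∈ α ++ (x ∷ b) ∷ β
    mv (inj₁ h) = ∈-++⁺ˡ h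
    mv (inj₂ (here ≡.refl)) = ⊥-elim (q∉ q∈)
    mv (inj₂ (there h)) = ∈-++⁺ʳ α (there h)

  state-new : ∀ {x st cl} → x ∈ el → State (suc x) st cl → State x ([ x ] ∷ st) cl
  state-new {x} {st} {cl} x∈ (state wf ne jn clo ord nc) = state (within-new x∈ wf) ne' jn' clo' ord' nc'
    where
    above : ∀ {b y} → b ∈ st ++ cl → y ∈ b → x < y
    above b∈ y∈ = proj₁ (Within.elems wf b∈ y∈)
    ≥x : ∀ {b y} → b ∈ [ x ] ∷ st ++ cl → y ∈ b → x ≤ y
    ≥x b∈ y∈ = proj₁ (Within.elems (within-new x∈ wf) b∈ y∈)
    ne' : ∀ {b} → b ∈ [ x ] ∷ st → ∃[ y ] (y ∈ b)
    ne' (here ≡.refl) = x , here ≡.refl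
    ne' (there b∈) = ne b∈
    jn' : ∀ {b} → b ∈ [ x ] ∷ st → Joinable ([ x ] ∷ st ++ cl) b
    jn' (here ≡.refl) b'∈ q∈ s∈ (here ≡.refl) l₁ l₂ = ⊥-elim (ℕP.<⇒≱ l₁ (≥x b'∈ q∈))
    jn' (there b∈) (here ≡.refl) (here ≡.refl) (here ≡.refl) r∈ l₁ l₂ = ⊥-elim (ℕP.<-asym l₁ l₂)
    jn' (there b∈) (there b'∈) q∈ s∈ r∈ l₁ l₂ = jn b∈ b'∈ q∈ s∈ r∈ l₁ l₂
    clo' : ∀ {b} → b ∈ cl → Enclosed ([ x ] ∷ st ++ cl) b
    clo' b∈ with clo b∈
    ... | enclosed b'∈ q∈ s∈ r∈ l₁ l₂ q∉ = enclosed (there b'∈) q∈ s∈ r∈ l₁ l₂ q∉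
    ord' : AllPairs Before ([ x ] ∷ st)
    ord' = All.tabulate (λ b∈ → let (y , y∈) = ne b∈ in x , y , here ≡.refl , y∈ , above (∈-++⁺ˡ b∈) y∈) ∷ ord
    nc' : ¬ Cross ([ x ] ∷ st ++ cl)
    nc' (cross (here ≡.refl) b'∈ (here ≡.refl) (here ≡.refl) q∈ s∈ l₁ l₂ l₃ q∉) = ℕP.<-asym l₁ l₂
    nc' (cross (there b∈) (here ≡.refl) p∈ r∈ (here ≡.refl) (here ≡.refl) l₁ l₂ l₃ q∉) = ℕP.<-asym l₂ l₃
    nc' (cross (there b∈) (there b'∈) p∈ r∈ q∈ s∈ l₁ l₂ l₃ q∉) = nc (cross b∈ b'∈ p∈ r∈ q∈ s∈ l₁ l₂ l₃ q∉)

  rotate-join : ∀ (α : Blocks) c β cl → α ++ c ∷ β ++ cl ↭ (c ∷ β) ++ (α ++ cl)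
  rotate-join α c β cl = begin
    α ++ c ∷ β ++ cl ≡⟨ ++-assoc α (c ∷ β) cl ⟨
    (α ++ c ∷ β) ++ cl ↭⟨ PermP.++⁺ʳ cl (PermP.++-comm α (c ∷ β)) ⟩
    ((c ∷ β) ++ α) ++ cl ≡⟨ ++-assoc (c ∷ β) α cl ⟩
    (c ∷ β) ++ α ++ cl ∎
    where open Perm.PermutationReasoning

  -- A block of α has by `Before` an element to the left of some element of b, so x and that element
  -- of b enclose it; hence all of α is closed.
  state-join : ∀ {x} α b β {cl} → x ∈ el → State (suc x) (α ++ b ∷ β) cl → State x ((x ∷ b) ∷ β) (α ++ cl)
  state-join {x} α b β {cl} x∈ (state wf ne jn clo ord nc) = state wf' ne' jn' clo' ord' nc'
    where
    π = (α ++ b ∷ β) ++ cl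
    π' = (x ∷ b) ∷ β ++ α ++ cl
    π-eq : π ≡ α ++ b ∷ β ++ cl
    π-eq = ++-assoc α (b ∷ β) cl
    wf₁ : Within (suc x) (α ++ b ∷ β ++ cl)
    wf₁ = subst (Within (suc x)) π-eq wf
    wf' : Within x π'
    wf' = within-↭ (rotate-join α (x ∷ b) β cl) (within-add x∈ (Add-at α b (β ++ cl)) wf₁)
    ↭π : π ↭ b ∷ β ++ α ++ cl
    ↭π = ↭-trans (↭-reflexive π-eq) (rotate-join α b β cl)
    old : ∀ {c} → c ∈ β ++ α ++ cl → c ∈ π
    old c∈ = PermP.∈-resp-↭ (↭-sym ↭π) (there c∈)
    b∈π : b ∈ π
    b∈π = PermP.∈-resp-↭ (↭-sym ↭π) (here ≡.refl)
    b∈st : b ∈ α ++ b ∷ β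
    b∈st = ∈-++⁺ʳ α (here ≡.refl)
    β⊆st : ∀ {c} → c ∈ β → c ∈ α ++ b ∷ β
    β⊆st c∈ = ∈-++⁺ʳ α (there c∈)
    ≥x : ∀ {c y} → c ∈ π' → y ∈ c → x ≤ y
    ≥x c∈ y∈ = proj₁ (Within.elems wf' c∈ y∈)
    above : ∀ {c y} → c ∈ π → y ∈ c → x < y
    above c∈ y∈ = proj₁ (Within.elems wf c∈ y∈)
    disj-tail : ∀ γ {δ} → AllPairs Disj (γ ++ δ) → AllPairs Disj δ
    disj-tail [] d = d
    disj-tail (_ ∷ γ) (_ ∷ d) = disj-tail γ d
    bβ-disj : ∀ {c} → c ∈ β → Disj b c
    bβ-disj c∈ with disj-tail α (Within.disj wf₁)
    ... | d ∷ _ = All.lookup d (∈-++⁺ˡ c∈)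
    strict : ∀ {y z} → y ∈ x ∷ b → x ≤ z → z < y → y ∈ b
    strict (here ≡.refl) l l' = ⊥-elim (ℕP.<⇒≱ l' l)
    strict (there y∈) _ _ = y∈
    ord-tail : ∀ γ {δ} → AllPairs Before (γ ++ δ) → AllPairs Before δ
    ord-tail [] o = o
    ord-tail (_ ∷ γ) (_ ∷ o) = ord-tail γ o
    ne' : ∀ {c} → c ∈ (x ∷ b) ∷ β → ∃[ y ] (y ∈ c)
    ne' (here ≡.refl) = x , here ≡.refl
    ne' (there c∈) = ne (β⊆st c∈)
    jn' : ∀ {c} → c ∈ (x ∷ b) ∷ β → Joinable π' c
    jn' (here ≡.refl) c'∈ q∈ s∈ (here ≡.refl) l₁ l₂ = ⊥-elim (ℕP.<⇒≱ l₁ (≥x c'∈ q∈))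
    jn' (here ≡.refl) (here ≡.refl) q∈ s∈ (there r∈) l₁ l₂ = q∈
    jn' (here ≡.refl) (there c'∈) q∈ s∈ (there r∈) l₁ l₂ = there (jn b∈st (old c'∈) q∈ s∈ r∈ l₁ l₂)
    jn' (there c∈) (there c'∈) q∈ s∈ r∈ l₁ l₂ = jn (β⊆st c∈) (old c'∈) q∈ s∈ r∈ l₁ l₂
    jn' (there c∈) (here ≡.refl) (there q∈) s∈ r∈ l₁ l₂ =
      jn (β⊆st c∈) b∈π q∈ (strict s∈ (ℕP.<⇒≤ (above b∈π q∈)) (ℕP.<-trans l₁ l₂)) r∈ l₁ l₂
    -- Here x and an element s of b would enclose an element r of c. Comparing r with the pair q′ <
    -- r′ that puts b before c, one of the two blocks already encloses an element of the other,
    -- although both are joinable.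
    jn' {c} (there c∈) (here ≡.refl) (here ≡.refl) s∈ r∈ l₁ l₂ = ⊥-elim (contra (ord-tail α ord))
      where
      s∈b = strict s∈ ℕP.≤-refl (ℕP.<-trans l₁ l₂)
      contra : AllPairs Before (b ∷ β) → ⊥
      contra (o ∷ _) with All.lookup o c∈
      ... | q' , r' , q'∈ , r'∈ , q'<r' with ℕP.<-cmp q' _
      ... | tri< l _ _ = bβ-disj c∈ q'∈ (jn (β⊆st c∈) b∈π q'∈ s∈b r∈ l l₂)
      ... | tri≈ _ ≡.refl _ = bβ-disj c∈ q'∈ r∈
      ... | tri> _ _ l = bβ-disj c∈ (jn b∈st (old (∈-++⁺ˡ c∈)) r∈ r'∈ q'∈ l q'<r') r∈
    α-before : ∀ γ {c} → c ∈ γ → AllPairs Before (γ ++ b ∷ β) → Before c b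
    α-before (_ ∷ γ) (here ≡.refl) (o ∷ _) = All.lookup o (∈-++⁺ʳ γ (here ≡.refl))
    α-before (_ ∷ γ) (there c∈) (_ ∷ o) = α-before γ c∈ o
    clo' : ∀ {c} → c ∈ α ++ cl → Enclosed π' c
    clo' c∈ with ∈-++⁻ α c∈
    clo' c∈ | inj₁ c∈α with α-before α c∈α ord
    ... | q' , r' , q'∈ , r'∈ , l = enclosed (here ≡.refl) (here ≡.refl) (there r'∈) q'∈ (above c∈π q'∈) l
      (λ x∈c → ℕP.<-irrefl ≡.refl (above c∈π x∈c))
      where c∈π = ∈-++⁺ˡ (∈-++⁺ˡ c∈α)
    clo' c∈ | inj₂ c∈cl with clo c∈cl
    ... | enclosed b'∈ q∈ s∈ r∈ l₁ l₂ q∉ with PermP.∈-resp-↭ ↭π b'∈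
    ... | here ≡.refl = enclosed (here ≡.refl) (there q∈) (there s∈) r∈ l₁ l₂ q∉
    ... | there b'∈' = enclosed (there b'∈') q∈ s∈ r∈ l₁ l₂ q∉
    ord' : AllPairs Before ((x ∷ b) ∷ β)
    ord' with ord-tail α ord
    ... | o ∷ os = All.map (λ { (q , r , q∈ , r∈ , l) → q , r , there q∈ , r∈ , l }) o ∷ os
    nc' : ¬ Cross π'
    nc' (cross (here ≡.refl) (here ≡.refl) p∈ r∈ q∈ s∈ l₁ l₂ l₃ q∉) = q∉ q∈
    -- A crossing that starts at x has an element of b between two elements of another block, which
    -- the joinability of b excludes.
    nc' (cross (here ≡.refl) (there b'∈) (here ≡.refl) r∈ q∈ s∈ l₁ l₂ l₃ q∉) =
      q∉ (there (jn b∈st (old b'∈) q∈ s∈ (strict r∈ (≥x (there b'∈) q∈) l₂) l₂ l₃))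
    nc' (cross (here ≡.refl) (there b'∈) (there p∈) r∈ q∈ s∈ l₁ l₂ l₃ q∉) =
      nc (cross b∈π (old b'∈) p∈ (strict r∈ (≥x (there b'∈) q∈) l₂) q∈ s∈ l₁ l₂ l₃ (q∉ ∘ there))
    nc' (cross (there b∈) (here ≡.refl) p∈ r∈ q∈ s∈ l₁ l₂ l₃ q∉) =
      nc (cross (old b∈) b∈π p∈ r∈ (strict q∈ (≥x (there b∈) p∈) l₁)
        (strict s∈ (≥x (there b∈) r∈) l₃) l₁ l₂ l₃ q∉)
    nc' (cross (there b∈) (there b'∈) p∈ r∈ q∈ s∈ l₁ l₂ l₃ q∉) =
      nc (cross (old b∈) (old b'∈) p∈ r∈ q∈ s∈ l₁ l₂ l₃ q∉)

  cross⇒crossing : ∀ {lo π} → Within lo π → Cross π → Crossing el (SameBlock π)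
  cross⇒crossing (within d e) (cross b∈ b'∈ p∈ r∈ q∈ s∈ l₁ l₂ l₃ q∉) =
    _ , _ , _ , _ , proj₂ (e b∈ p∈) , proj₂ (e b'∈ q∈) , proj₂ (e b∈ r∈) , proj₂ (e b'∈ s∈) , l₁ , l₂ , l₃ ,
    (_ , b∈ , p∈ , r∈) , (_ , b'∈ , q∈ , s∈) ,
    λ { (c , c∈ , p∈c , q∈c) → q∉ (subst (_ ∈_) (disj-same d c∈ b∈ p∈c p∈) q∈c) }

  crossing⇒cross : ∀ {π} → Crossing el (SameBlock π) → Cross π
  crossing⇒cross (p , q , r , s , _ , _ , _ , _ , l₁ , l₂ , l₃ , (b , b∈ , p∈ , r∈) , (b' , b'∈ , q∈ , s∈) , h) =
    cross b∈ b'∈ p∈ r∈ q∈ s∈ l₁ l₂ l₃ (λ q∈b → h (b , b∈ , p∈ , q∈b))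

 data Increasing : ℕ → List ℕ → Set where
   [] : ∀ {lo} → Increasing lo []
   _∷_ : ∀ {lo x L} → lo ≤ x → Increasing (suc x) L → Increasing lo (x ∷ L)

 module NonCrossingSum {c ℓ : Level} (S : CommutativeRing c ℓ) (κ : ℕ → CommutativeRing.Carrier S) (el : List ℕ) where
  open CommutativeRing S hiding (zero)
  open Over S
  open Solver S
  open SumProperties S
  open PartitionSums S
  open Stack S κ
  open Open el

  wt : Blocks → Carrier
  wt π = prodR (map (λ V → κ (length V)) π)

  -- `F π` stands for the sum over all insertions of the k smallest elements into π. On a
  -- non-crossing π it depends only on the weight of the closed blocks and on the sizes in the
  -- stack.
  record Good (k lo : ℕ) (F : Blocks → Carrier) : Set ℓ where
    field perm : PermInvariant F
          value : ∀ {st cl} → State lo st cl → F (st ++ cl) ≈ wt cl * steps k weight (map length st)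
          vanish : ∀ {π} → Within lo π → Cross π → F π ≈ 0#

  wt-++ : ∀ α β → wt (α ++ β) ≈ wt α * wt β
  wt-++ α β = trans (reflexive (cong prodR (map-++ _ α β))) (prodR-++ (map _ α) _)

  good-step : ∀ {k x F} → x ∈ el → Good k x F → Good (suc k) (suc x) (λ π → F ([ x ] ∷ π) + addSum x π F)
  good-step {k} {x} {F} x∈ G = record
    { perm = λ p → +-cong (G.perm (Perm.prep _ p)) (addSum-↭ x G.perm p)
    ; value = λ {st} {cl} s → begin
      F ([ x ] ∷ st ++ cl) + addSum x (st ++ cl) F
        ≈⟨ +-cong (G.value (state-new x∈ s)) (trans (addSum-++ x st cl F) (+-cong (joined [] st s) (never s))) ⟩
      wt cl * steps k weight (1 ∷ map length st) + (wt cl * (1# * joins (steps k weight) (map length st)) + 0#)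
        ≈⟨ solve 3 (λ w a b → w :* a :+ (w :* (con (1 , 0) :* b) :+ con (0 , 0)) := w :* (a :+ b)) refl _ _ _ ⟩
      wt cl * steps (suc k) weight (map length st) ∎
    ; vanish = λ {π} W X → trans (+-cong (G.vanish (within-new x∈ W) (cross-new X))
      (addSum-0 π F (λ a → G.vanish (within-add x∈ a W) (cross-add W a X)))) (+-identityˡ 0#) }
    where
    open import Relation.Binary.Reasoning.Setoid setoid
    module G = Good G
    -- α collects the blocks passed over so far; they are closed as soon as x joins a deeper block,
    -- which is the factor `wt α`.
    joined : ∀ α β {cl} → State (suc x) (α ++ β) cl →
      addSum x β (λ β' → F ((α ++ β') ++ cl)) ≈ wt cl * (wt α * joins (steps k weight) (map length β))
    joined α [] {cl} s = solve 2 (λ a b → con (0 , 0) := a :* (b :* con (0 , 0))) refl (wt cl) (wt α)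
    joined α (b ∷ β) {cl} s = begin
      F ((α ++ (x ∷ b) ∷ β) ++ cl) + addSum x β (λ β' → F ((α ++ b ∷ β') ++ cl))
        ≈⟨ +-cong (trans (G.perm (↭-trans (↭-reflexive (++-assoc α _ cl)) (rotate-join α (x ∷ b) β cl)))
          (trans (G.value (state-join α b β x∈ s)) (*-congʳ (wt-++ α cl))))
          (trans (reflexive-addSum β) (trans (joined (α ++ [ b ]) β (subst (λ γ → State (suc x) γ cl) (≡.sym (++-assoc α [ b ] β)) s))
            (*-congˡ (*-congʳ (wt-++ α [ b ]))))) ⟩
      wt α * wt cl * steps k weight (suc (length b) ∷ map length β) + wt cl * (wt α * (κ (length b) * 1#) * joins (steps k weight) (map length β))
        ≈⟨ solve 5 (λ a c s k j → a :* c :* s :+ c :* (a :* (k :* con (1 , 0)) :* j) := c :* (a :* (s :+ k :* j))) refl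
          (wt α) (wt cl) _ _ _ ⟩
      wt cl * (wt α * joins (steps k weight) (map length (b ∷ β))) ∎
      where
      reflexive-addSum : ∀ β → addSum x β (λ β' → F ((α ++ b ∷ β') ++ cl)) ≈ addSum x β (λ β' → F (((α ++ [ b ]) ++ β') ++ cl))
      reflexive-addSum β = addSum-cong β (λ {β'} _ → reflexive (cong (λ γ → F (γ ++ cl)) (≡.sym (++-assoc α [ b ] β'))))
    -- A closed block is enclosed by a block to the right of x, so joining x to it creates a
    -- crossing.
    never : ∀ {st cl} → State (suc x) st cl → addSum x cl (λ cl' → F (st ++ cl')) ≈ 0#
    never {st} {cl} s = addSum-0 cl _ (λ a → G.vanish (within-add x∈ (lift st a) (State.wf s)) (cr st a))
      where
      lift : ∀ st {cl cl'} → Add x cl cl' → Add x (st ++ cl) (st ++ cl')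
      lift [] a = a
      lift (_ ∷ st) a = there (lift st a)
      split : ∀ {cl cl'} → Add x cl cl' → ∃[ α ] ∃[ b ] ∃[ β ] (cl ≡ α ++ b ∷ β × cl' ≡ α ++ (x ∷ b) ∷ β)
      split (here {b} {bs}) = [] , b , bs , ≡.refl , ≡.refl
      split (there {b} a) with split a
      ... | α , c , β , e , e' = b ∷ α , c , β , cong (b ∷_) e , cong (b ∷_) e'
      cr : ∀ st' {cl'} → Add x cl cl' → Cross (st ++ cl')
      cr _ a with split a
      ... | α , b , β , ≡.refl , ≡.refl = subst Cross (++-assoc st α _)
        (enclosed-cross (st ++ α) β (subst (Within (suc x)) (≡.sym (++-assoc st α _)) (State.wf s))
          (subst (λ γ → Enclosed γ b) (≡.sym (++-assoc st α _)) (State.closed s (∈-++⁺ʳ α (here ≡.refl)))))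

  ncTerm : Blocks → Carrier
  ncTerm π = if hasCrossing el π then 0# else wt π

  SameBlock-↭ : ∀ {π π' k l} → π ↭ π' → SameBlock π k l → SameBlock π' k l
  SameBlock-↭ p (b , b∈ , h) = b , PermP.∈-resp-↭ p b∈ , h

  good-start : Good 0 0 ncTerm
  good-start = record
    { perm = λ {π} {π'} p → if-cong (hasCrossing-cong el (SameBlock-↭ p) (SameBlock-↭ (↭-sym p)))
      (prodR-↭ (PermP.map⁺ _ p))
    ; value = λ {st} {cl} s → trans (reflexive (cong (λ b → if b then 0# else wt (st ++ cl))
      (≡false (λ e → State.nc s (crossing⇒cross (hasCrossing-sound el _ e))))))
      (trans (wt-++ st cl) (trans (*-comm _ _) (*-congˡ (reflexive (cong prodR (map-∘′ st))))))
    ; vanish = λ {π} W X → reflexive (cong (λ b → if b then 0# else wt π) (hasCrossing-complete el π (cross⇒crossing W X))) }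
    where
    if-cong : ∀ {b b' : Bool} {x y : Carrier} → b ≡ b' → x ≈ y → (if b then 0# else x) ≈ (if b' then 0# else y)
    if-cong {true} ≡.refl e = refl
    if-cong {false} ≡.refl e = e
    map-∘′ : ∀ st → map (λ V → κ (length V)) st ≡ map κ (map length st)
    map-∘′ [] = ≡.refl
    map-∘′ (b ∷ st) = cong (κ (length b) ∷_) (map-∘′ st)

  good-lower : ∀ {k lo lo' F} → lo ≤ lo' → Good k lo F → Good k lo' F
  good-lower {lo = lo} {lo'} l G = record
    { perm = Good.perm G
    ; value = λ { (state wf ne jn clo ord nc) → Good.value G (state (low wf) ne jn clo ord nc) }
    ; vanish = λ W → Good.vanish G (low W) }
    where
    low : ∀ {π} → Within lo' π → Within lo π
    low (within d e) = within d (λ b∈ y∈ → ℕP.≤-trans l (proj₁ (e b∈ y∈)) , proj₂ (e b∈ y∈))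

  spSum-good : ∀ L {k lo F} → Increasing lo L → (∀ {x} → x ∈ L → x ∈ el) → Good k lo F →
    spSum L F ≈ steps (length L ℕ.+ k) weight []
  spSum-good [] inc sub G = trans (Good.value G (state (within [] (λ ())) (λ ()) (λ ()) (λ ()) [] (λ { (cross () _ _ _ _ _ _ _ _ _) })))
    (*-identityˡ _)
  spSum-good (x ∷ L) {k} (l ∷ inc) sub G =
    trans (spSum-good L inc (sub ∘ there) (good-step (sub (here ≡.refl)) (good-lower l G)))
      (reflexive (cong (λ n → steps n weight []) (ℕP.+-suc (length L) k)))

  nc-sum : Increasing 0 el → sumR (map wt (ncPartitions el)) ≈ steps (length el) weight []
  nc-sum inc = begin
    sumR (map wt (ncPartitions el)) ≈⟨ sum-filter _ wt (setPartitions el) ⟩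
    sumR (map (λ π → if not (hasCrossing el π) then wt π else 0#) (setPartitions el))
      ≈⟨ sumR-cong _ _ (setPartitions el) (λ π → if-not (hasCrossing el π)) ⟩
    sumR (map ncTerm (setPartitions el)) ≈⟨ spSum-sum el ncTerm ⟩
    spSum el ncTerm ≈⟨ spSum-good el inc id good-start ⟩
    steps (length el ℕ.+ 0) weight [] ≡⟨ cong (λ n → steps n weight []) (ℕP.+-identityʳ (length el)) ⟩
    steps (length el) weight [] ∎
    where
    open import Relation.Binary.Reasoning.Setoid setoid
    if-not : ∀ b {x : Carrier} → (if not b then x else 0#) ≈ (if b then 0# else x)
    if-not true = refl
    if-not false = refl

-- Separating the through blocks of a partition

module PartitionSplitting where
 open import Data.List.Relation.Binary.Sublist.Propositional using (_⊆_; _∷ʳ_; _∷_; [])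
 open BooleanReflection
 open NonCrossingPartitions

 -- Allows summands to be compared at the partitions of L only; see `spSum-cong`.
 data IsPartition : List ℕ → Blocks → Set where
   nil : IsPartition [] []
   new : ∀ {x L π} → IsPartition L π → IsPartition (x ∷ L) ([ x ] ∷ π)
   add : ∀ {x L π π'} → IsPartition L π → Add x π π' → IsPartition (x ∷ L) π'

 -- A partition of L with a distinguished, possibly empty, block V.
 data IsPartition• : List ℕ → List ℕ → Blocks → Set where
   nil : IsPartition• [] [] []
   dist : ∀ {x L V r} → IsPartition• L V r → IsPartition• (x ∷ L) (x ∷ V) r
   new : ∀ {x L V r} → IsPartition• L V r → IsPartition• (x ∷ L) V ([ x ] ∷ r)
   add : ∀ {x L V r r'} → IsPartition• L V r → Add x r r' → IsPartition• (x ∷ L) V r'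

 Add-↭ : ∀ {x π π'} → Add x π π' → concat π' ↭ x ∷ concat π
 Add-↭ here = ↭-refl
 Add-↭ {x} (there {b} {bs} a) = ↭-trans (PermP.++⁺ˡ b (Add-↭ a)) (PermP.shift x b (concat bs))

 partition-↭ : ∀ {L π} → IsPartition L π → concat π ↭ L
 partition-↭ nil = ↭-refl
 partition-↭ (new p) = Perm.prep _ (partition-↭ p)
 partition-↭ (add p a) = ↭-trans (Add-↭ a) (Perm.prep _ (partition-↭ p))

 partition•-↭ : ∀ {L V r} → IsPartition• L V r → V ++ concat r ↭ L
 partition•-↭ nil = ↭-refl
 partition•-↭ (dist p) = Perm.prep _ (partition•-↭ p)
 partition•-↭ {V = V} (new {x} p) = ↭-trans (PermP.shift x V _) (Perm.prep _ (partition•-↭ p))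
 partition•-↭ {V = V} (add {x} p a) = ↭-trans (PermP.++⁺ˡ V (Add-↭ a)) (↭-trans (PermP.shift x V _) (Perm.prep _ (partition•-↭ p)))

 partition•-⊆ : ∀ {L V r} → IsPartition• L V r → V ⊆ L
 partition•-⊆ nil = []
 partition•-⊆ (dist p) = ≡.refl ∷ partition•-⊆ p
 partition•-⊆ (new {x} p) = x ∷ʳ partition•-⊆ p
 partition•-⊆ (add {x} p a) = x ∷ʳ partition•-⊆ p

 NonEmptyBlocks : Blocks → Set
 NonEmptyBlocks π = ∀ {b} → b ∈ π → ∃[ y ] (y ∈ b)

 nonEmpty-new : ∀ {x π} → NonEmptyBlocks π → NonEmptyBlocks ([ x ] ∷ π)
 nonEmpty-new h (here ≡.refl) = _ , here ≡.refl
 nonEmpty-new h (there b∈) = h b∈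

 nonEmpty-add : ∀ {x π π'} → Add x π π' → NonEmptyBlocks π → NonEmptyBlocks π'
 nonEmpty-add a h b'∈ with Add-new a b'∈
 ... | b , b∈ , inj₁ ≡.refl = h b∈
 ... | b , b∈ , inj₂ ≡.refl = _ , here ≡.refl

 partition-nonEmpty : ∀ {L π} → IsPartition L π → NonEmptyBlocks π
 partition-nonEmpty nil ()
 partition-nonEmpty (new p) = nonEmpty-new (partition-nonEmpty p)
 partition-nonEmpty (add p a) = nonEmpty-add a (partition-nonEmpty p)

 partition•-nonEmpty : ∀ {L V r} → IsPartition• L V r → NonEmptyBlocks r
 partition•-nonEmpty nil ()
 partition•-nonEmpty (dist p) = partition•-nonEmpty p
 partition•-nonEmpty (new p) = nonEmpty-new (partition•-nonEmpty p)
 partition•-nonEmpty (add p a) = nonEmpty-add a (partition•-nonEmpty p)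

 ∈-block⇒∈-concat : ∀ {π : Blocks} {b y} → b ∈ π → y ∈ b → y ∈ concat π
 ∈-block⇒∈-concat b∈ y∈ = ∈-concat⁺′ y∈ b∈

 ∈-concat⇒∈-block : ∀ (π : Blocks) {y} → y ∈ concat π → ∃[ b ] (b ∈ π × y ∈ b)
 ∈-concat⇒∈-block π y∈ = let (b , y∈b , b∈) = ∈-concat⁻′ π y∈ in b , b∈ , y∈b

 module SplitSums {c ℓ : Level} (R : CommutativeRing c ℓ) where
  open CommutativeRing R hiding (zero)
  open Over R
  open Solver R
  open SumProperties R
  open PartitionSums R
  open import Relation.Binary.Reasoning.Setoid setoid

  spSum• : List ℕ → (List ℕ → Blocks → Carrier) → Carrier
  spSum• [] F = F [] []
  spSum• (x ∷ L) F = spSum• L (λ V r → F (x ∷ V) r + (F V ([ x ] ∷ r) + addSum x r (F V)))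

  splitSum : Blocks → (Blocks → Blocks → Carrier) → Carrier
  splitSum [] F = F [] []
  splitSum (b ∷ bs) F = splitSum bs (λ S r → F (b ∷ S) r + F S (b ∷ r))

  pointSum : Blocks → (List ℕ → Blocks → Carrier) → Carrier
  pointSum [] F = 0#
  pointSum (b ∷ bs) F = F b bs + pointSum bs (λ V r → F V (b ∷ r))

  spSum-cong : ∀ L {F G} → (∀ {π} → IsPartition L π → F π ≈ G π) → spSum L F ≈ spSum L G
  spSum-cong [] e = e nil
  spSum-cong (x ∷ L) e = spSum-cong L (λ {π} p → +-cong (e (new p)) (addSum-cong π (λ a → e (add p a))))

  spSum•-cong : ∀ L {F G} → (∀ {V r} → IsPartition• L V r → F V r ≈ G V r) → spSum• L F ≈ spSum• L G
  spSum•-cong [] e = e nil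
  spSum•-cong (x ∷ L) e = spSum•-cong L (λ {V} {r} p → +-cong (e (dist p)) (+-cong (e (new p)) (addSum-cong r (λ a → e (add p a)))))

  splitSum-cong : ∀ π {F G} → (∀ S r → F S r ≈ G S r) → splitSum π F ≈ splitSum π G
  splitSum-cong [] e = e [] []
  splitSum-cong (b ∷ bs) e = splitSum-cong bs (λ S r → +-cong (e _ _) (e _ _))

  pointSum-cong : ∀ π {F G} → (∀ V r → F V r ≈ G V r) → pointSum π F ≈ pointSum π G
  pointSum-cong [] e = refl
  pointSum-cong (b ∷ bs) e = +-cong (e _ _) (pointSum-cong bs (λ V r → e V (b ∷ r)))

  private
    medial : ∀ a b c d → (a + b) + (c + d) ≈ (a + c) + (b + d)
    medial = solve 4 (λ a b c d → (a :+ b) :+ (c :+ d) := (a :+ c) :+ (b :+ d)) refl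

  addSum-+ : ∀ x π F G → addSum x π (λ π' → F π' + G π') ≈ addSum x π F + addSum x π G
  addSum-+ x [] F G = sym (+-identityˡ _)
  addSum-+ x (b ∷ bs) F G = trans (+-congˡ (addSum-+ x bs _ _)) (medial _ _ _ _)

  spSum-+ : ∀ L F G → spSum L (λ π → F π + G π) ≈ spSum L F + spSum L G
  spSum-+ [] F G = refl
  spSum-+ (x ∷ L) F G = trans (spSum-cong L (λ {π} _ → trans (+-congˡ (addSum-+ x π F G)) (medial _ _ _ _))) (spSum-+ L _ _)

  spSum•-+ : ∀ L F G → spSum• L (λ V r → F V r + G V r) ≈ spSum• L F + spSum• L G
  spSum•-+ [] F G = refl
  spSum•-+ (x ∷ L) F G = trans (spSum•-cong L (λ {V} {r} _ →
    trans (+-congˡ (trans (+-congˡ (addSum-+ x r (F V) (G V))) (medial _ _ _ _))) (medial _ _ _ _))) (spSum•-+ L _ _)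

  spSum•-0 : ∀ L → spSum• L (λ _ _ → 0#) ≈ 0#
  spSum•-0 [] = refl
  spSum•-0 (z ∷ L) = trans (spSum•-cong L (λ {V} {r} _ → trans (+-identityˡ _) (trans (+-identityˡ _) (addSum-0 r _ (λ _ → refl))))) (spSum•-0 L)

  splitSum-+ : ∀ π F G → splitSum π (λ S r → F S r + G S r) ≈ splitSum π F + splitSum π G
  splitSum-+ [] F G = refl
  splitSum-+ (b ∷ bs) F G = trans (splitSum-cong bs (λ S r → medial _ _ _ _)) (splitSum-+ bs _ _)

  pointSum-+ : ∀ π F G → pointSum π (λ S r → F S r + G S r) ≈ pointSum π F + pointSum π G
  pointSum-+ [] F G = sym (+-identityˡ _)
  pointSum-+ (b ∷ bs) F G = trans (+-congˡ (pointSum-+ bs _ _)) (medial _ _ _ _)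

  spSum-*ˡ : ∀ L k F → k * spSum L F ≈ spSum L (λ π → k * F π)
  spSum-*ˡ [] k F = refl
  spSum-*ˡ (x ∷ L) k F = trans (spSum-*ˡ L k _) (spSum-cong L (λ {π} _ → trans (distribˡ k _ _) (+-congˡ (add* π F))))
    where
    add* : ∀ π F → k * addSum x π F ≈ addSum x π (λ π' → k * F π')
    add* [] F = zeroʳ k
    add* (b ∷ bs) F = trans (distribˡ k _ _) (+-congˡ (add* bs _))

  spSum-0 : ∀ L {F} → (∀ {π} → IsPartition L π → F π ≈ 0#) → spSum L F ≈ 0#
  spSum-0 L {F} e = trans (spSum-cong L (λ p → trans (e p) (sym (zeroˡ 0#)))) (trans (sym (spSum-*ˡ L 0# (λ _ → 0#))) (zeroˡ _))

  addSum-spSum : ∀ x r L (F : Blocks → Blocks → Carrier) →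
    addSum x r (λ r' → spSum L (λ ρ → F ρ r')) ≈ spSum L (λ ρ → addSum x r (F ρ))
  addSum-spSum x [] L F = sym (spSum-0 L (λ _ → refl))
  addSum-spSum x (b ∷ bs) L F = trans (+-congˡ (addSum-spSum x bs L (λ ρ bs' → F ρ (b ∷ bs')))) (sym (spSum-+ L _ _))

  addSum-splitSum : ∀ x π F → addSum x π (λ π' → splitSum π' F) ≈
    splitSum π (λ S r → addSum x S (λ S' → F S' r) + addSum x r (F S))
  addSum-splitSum x [] F = sym (+-identityˡ _)
  addSum-splitSum x (b ∷ bs) F = begin
    splitSum bs (λ S r → F ((x ∷ b) ∷ S) r + F S ((x ∷ b) ∷ r)) + addSum x bs (λ bs' → splitSum bs' (λ S r → F (b ∷ S) r + F S (b ∷ r)))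
      ≈⟨ +-congˡ (addSum-splitSum x bs _) ⟩
    _ ≈⟨ splitSum-+ bs _ _ ⟨
    _ ≈⟨ splitSum-cong bs (λ S r → trans (+-congˡ (+-cong (addSum-+ x S _ _) (addSum-+ x r _ _)))
      (solve 6 (λ a b c d e f → (a :+ b) :+ ((c :+ d) :+ (e :+ f)) := ((a :+ c) :+ e) :+ (d :+ (b :+ f))) refl _ _ _ _ _ _)) ⟩
    splitSum (b ∷ bs) (λ S r → addSum x S (λ S' → F S' r) + addSum x r (F S)) ∎

  -- Selecting some blocks of a partition of L amounts to choosing their union V, a partition of V
  -- and a partition of the rest.
  spSum-splitSum : ∀ L F → spSum L (λ π → splitSum π F) ≈ spSum• L (λ V r → spSum V (λ ρ → F ρ r))
  spSum-splitSum [] F = refl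
  spSum-splitSum (x ∷ L) F = begin
    spSum L (λ π → splitSum ([ x ] ∷ π) F + addSum x π (λ π' → splitSum π' F))
      ≈⟨ spSum-cong L (λ {π} _ → trans (+-congˡ (addSum-splitSum x π F)) (sym (splitSum-+ π _ _))) ⟩
    spSum L (λ π → splitSum π (λ S r → (F ([ x ] ∷ S) r + F S ([ x ] ∷ r)) + (addSum x S (λ S' → F S' r) + addSum x r (F S))))
      ≈⟨ spSum-splitSum L _ ⟩
    spSum• L (λ V r → spSum V (λ ρ → (F ([ x ] ∷ ρ) r + F ρ ([ x ] ∷ r)) + (addSum x ρ (λ S' → F S' r) + addSum x r (F ρ))))
      ≈⟨ spSum•-cong L (λ {V} {r} _ → trans (spSum-cong V (λ _ → solve 4 (λ a b c d → (a :+ b) :+ (c :+ d) := (a :+ c) :+ (b :+ d)) refl _ _ _ _))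
        (trans (spSum-+ V _ _) (+-congˡ (trans (spSum-+ V _ _) (+-congˡ (sym (addSum-spSum x r V F))))))) ⟩
    spSum• (x ∷ L) (λ V r → spSum V (λ ρ → F ρ r)) ∎

  -- The distinguished set V is either empty or a block of the partition formed by V and the other
  -- blocks.
  spSum•-point : ∀ L F → spSum• L F ≈ spSum L (λ π → F [] π + pointSum π F)
  spSum•-point [] F = sym (+-identityʳ _)
  spSum•-point (x ∷ L) F = trans (spSum•-point L _) (spSum-cong L (λ {π} _ → begin
    (F [ x ] π + (F [] ([ x ] ∷ π) + addSum x π (F []))) + pointSum π (λ V r → F (x ∷ V) r + (F V ([ x ] ∷ r) + addSum x r (F V)))
      ≈⟨ +-congˡ (trans (pointSum-cong π (λ V r → solve 3 (λ a b c → a :+ (b :+ c) := b :+ (a :+ c)) refl _ _ _)) (pointSum-+ π _ _)) ⟩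
    _ ≈⟨ solve 5 (λ a b c d e → (a :+ (b :+ c)) :+ (d :+ e) := (b :+ (a :+ d)) :+ (c :+ e)) refl _ _ _ _ _ ⟩
    (F [] ([ x ] ∷ π) + pointSum ([ x ] ∷ π) F) + (addSum x π (F []) + pointSum π (λ V r → F (x ∷ V) r + addSum x r (F V)))
      ≈⟨ +-congˡ (+-congˡ (sym (add-point π F))) ⟩
    _ ≈⟨ +-congˡ (sym (addSum-+ x π _ _)) ⟩
    (F [] ([ x ] ∷ π) + pointSum ([ x ] ∷ π) F) + addSum x π (λ π' → F [] π' + pointSum π' F) ∎))
    where
    add-point : ∀ π F → addSum x π (λ π' → pointSum π' F) ≈ pointSum π (λ V r → F (x ∷ V) r + addSum x r (F V))
    add-point [] F = refl
    add-point (b ∷ bs) F = begin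
      (F (x ∷ b) bs + pointSum bs (λ V r → F V ((x ∷ b) ∷ r))) + addSum x bs (λ bs' → F b bs' + pointSum bs' (λ V r → F V (b ∷ r)))
        ≈⟨ +-congˡ (trans (addSum-+ x bs _ _) (+-congˡ (add-point bs _))) ⟩
      (F (x ∷ b) bs + pointSum bs (λ V r → F V ((x ∷ b) ∷ r))) + (addSum x bs (F b) + pointSum bs (λ V r → F (x ∷ V) (b ∷ r) + addSum x r (λ r' → F V (b ∷ r'))))
        ≈⟨ solve 4 (λ a b c d → (a :+ b) :+ (c :+ d) := (a :+ c) :+ (b :+ d)) refl _ _ _ _ ⟩
      _ ≈⟨ +-congˡ (trans (sym (pointSum-+ bs _ _)) (pointSum-cong bs (λ V r → solve 3 (λ a b c → a :+ (b :+ c) := b :+ (a :+ c)) refl _ _ _))) ⟩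
      pointSum (b ∷ bs) (λ V r → F (x ∷ V) r + addSum x r (F V)) ∎

  pointSum-sum : ∀ π (f : List ℕ × Blocks → Carrier) → sumR (map f (pointings π)) ≈ pointSum π (λ V r → f (V , r))
  pointSum-sum [] f = refl
  pointSum-sum (b ∷ bs) f = +-congˡ (trans (reflexive (cong sumR (map-∘′ (pointings bs)))) (pointSum-sum bs (λ p → f (proj₁ p , b ∷ proj₂ p))))
    where
    map-∘′ : ∀ xs → map f (map (λ p → proj₁ p , b ∷ proj₂ p) xs) ≡ map (λ p → f (proj₁ p , b ∷ proj₂ p)) xs
    map-∘′ [] = ≡.refl
    map-∘′ (x ∷ xs) = cong (_ ∷_) (map-∘′ xs)

  module Select (p : List ℕ → Bool) where
   select : Blocks → Blocks → Bool
   select S r = all p S ∧ all (not ∘ p) r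

   -- Exactly one splitting puts the blocks satisfying p on one side and the remaining ones on the
   -- other; invariance of F repairs their order.
   splitSum-select : ∀ (F : Blocks → Carrier) → PermInvariant F → ∀ π →
     splitSum π (λ S r → if select S r then F (S ++ r) else 0#) ≈ F π
   splitSum-select F inv [] = refl
   splitSum-select F inv (b ∷ bs) with p b
   ... | true = trans (splitSum-cong bs (λ S r → trans (+-congˡ (drop S {F (S ++ b ∷ r)})) (+-identityʳ _)))
     (splitSum-select (λ π → F (b ∷ π)) (λ q → inv (Perm.prep b q)) bs)
     where
     drop : ∀ S {u} → (if all p S ∧ false then u else 0#) ≈ 0#
     drop S with all p S
     ... | true = refl
     ... | false = refl
   ... | false = trans (splitSum-cong bs (λ S r → trans (+-identityˡ _) (move S r)))
     (splitSum-select (λ π → F (b ∷ π)) (λ q → inv (Perm.prep b q)) bs)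
     where
     move : ∀ S r → (if select S r then F (S ++ b ∷ r) else 0#) ≈ (if select S r then F (b ∷ S ++ r) else 0#)
     move S r with select S r
     ... | true = inv (PermP.shift b S r)
     ... | false = refl

  module Through (isA isB : ℕ → Bool) where
   through : List ℕ → Bool
   through b = any isA b ∧ any isB b

   open Select through public using (select; splitSum-select)

   partition-by-through : ∀ L F → PermInvariant F →
     spSum L F ≈ spSum• L (λ V r → spSum V (λ ρ → if select ρ r then F (ρ ++ r) else 0#))
   partition-by-through L F inv = trans (spSum-cong L (λ {π} _ → sym (splitSum-select F inv π))) (spSum-splitSum L _)

   private
     any-add : ∀ {x r r'} → Add x r r' → any through r ≡ true → any through r' ≡ true
     any-add {x} a e with any-sound through _ e
     ... | b , b∈ , h with Add-old a b∈
     ... | .b , b'∈ , inj₁ ≡.refl = any-complete through b'∈ h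
     ... | .(x ∷ b) , b'∈ , inj₂ ≡.refl = any-complete through b'∈ (grow (∧-sound h))
       where
       grow : any isA b ≡ true × any isB b ≡ true → through (x ∷ b) ≡ true
       grow (p , q) = ∧-complete (∨-right (isA x) p) (∨-right (isB x) q)

   -- Only terms without a through block among the non-distinguished blocks contribute.
   spSum•-++ : ∀ A B F → (∀ {x} → x ∈ A → isA x ≡ true) → (∀ {x} → x ∈ B → isB x ≡ true) →
     (∀ V r → any through r ≡ true → F V r ≈ 0#) →
     spSum• (A ++ B) F ≈ spSum• A (λ V₁ r₁ → spSum• B (λ V₂ r₂ → F (V₁ ++ V₂) (r₁ ++ r₂)))
   spSum•-++ [] B F hA hB h0 = refl
   spSum•-++ (x ∷ A) B F hA hB h0 = trans (spSum•-++ A B F' (hA ∘ there) hB h0')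
     (spSum•-cong A (λ {V₁} {r₁} _ → begin
       spSum• B (λ V₂ r₂ → F' (V₁ ++ V₂) (r₁ ++ r₂))
         ≈⟨ spSum•-cong B (λ {V₂} {r₂} p → +-congˡ (+-congˡ (trans (addSum-++ x r₁ r₂ (F (V₁ ++ V₂)))
           (trans (+-congˡ (crossover V₁ V₂ r₁ r₂ p)) (+-identityʳ _))))) ⟩
       spSum• B (λ V₂ r₂ → F (x ∷ V₁ ++ V₂) (r₁ ++ r₂) + (F (V₁ ++ V₂) ([ x ] ∷ r₁ ++ r₂) + addSum x r₁ (λ r₁' → F (V₁ ++ V₂) (r₁' ++ r₂))))
         ≈⟨ trans (spSum•-+ B _ _) (+-congˡ (trans (spSum•-+ B _ _) (+-congˡ (sym (addSum-spSum• r₁ (λ r₁' V₂ r₂ → F (V₁ ++ V₂) (r₁' ++ r₂))))))) ⟩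
       _ ∎))
     where
     F' : List ℕ → Blocks → Carrier
     F' V r = F (x ∷ V) r + (F V ([ x ] ∷ r) + addSum x r (F V))
     h0' : ∀ V r → any through r ≡ true → F' V r ≈ 0#
     h0' V r e = trans (+-cong (h0 _ r e) (trans (+-cong (h0 V _ (∨-right (through [ x ]) e))
       (addSum-0 r (F V) (λ a → h0 V _ (any-add a e)))) (+-identityˡ 0#))) (+-identityˡ 0#)
     -- Adding x from A to a block of elements of B produces a through block outside V, where F
     -- vanishes.
     crossover : ∀ V₁ V₂ r₁ r₂ → IsPartition• B V₂ r₂ → addSum x r₂ (λ r₂' → F (V₁ ++ V₂) (r₁ ++ r₂')) ≈ 0#
     crossover V₁ V₂ r₁ r₂ p = addSum-0 r₂ _ (λ {r'} a → h0 _ _ (bad a))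
       where
       bad-block : ∀ {r r'} → NonEmptyBlocks r → (∀ {b y} → b ∈ r → y ∈ b → y ∈ B) → Add x r r' → ∃[ b ] (b ∈ r' × through b ≡ true)
       bad-block ne sub (here {b}) with ne (here ≡.refl)
       ... | y , y∈ = x ∷ b , here ≡.refl , ∧-complete (any-complete isA {x ∷ b} (here ≡.refl) (hA (here ≡.refl)))
         (any-complete isB (there y∈) (hB (sub (here ≡.refl) y∈)))
       bad-block ne sub (there a) with bad-block (ne ∘ there) (λ b∈ → sub (there b∈)) a
       ... | b , b∈ , h = b , there b∈ , h
       bad : ∀ {r'} → Add x r₂ r' → any through (r₁ ++ r') ≡ true
       bad a with bad-block (partition•-nonEmpty p)
         (λ b∈ y∈ → PermP.∈-resp-↭ (partition•-↭ p) (∈-++⁺ʳ V₂ (∈-block⇒∈-concat b∈ y∈))) a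
       ... | b , b∈ , h = any-complete through (∈-++⁺ʳ r₁ b∈) h
     addSum-spSum• : ∀ r (G : Blocks → List ℕ → Blocks → Carrier) →
       addSum x r (λ r' → spSum• B (G r')) ≈ spSum• B (λ V₂ r₂ → addSum x r (λ r' → G r' V₂ r₂))
     addSum-spSum• [] G = sym (spSum•-0 B)
     addSum-spSum• (b ∷ bs) G = trans (+-congˡ (addSum-spSum• bs (λ r' → G (b ∷ r')))) (sym (spSum•-+ B _ _))

-- Normal forms of spoke diagrams

module SpokeDiagrams where
 open import Data.Nat using (_+_)
 open import Data.List using (take; drop)
 open ≡ using (refl; sym; trans)
 open SpokeWords
 open PermutationLists using (∈-concatMap⁺; ∈-concatMap⁻)

 Size : Set
 Size = ℕ × ℕ

 -- A size (p , q) is stored with both entries decreased by one, as in Run.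
 number : ℕ → List Size → List Run
 number k [] = []
 number k ((p , q) ∷ ss) = (k , p , q) ∷ number (suc k) ss

 rotl : ℕ → List ℕ → List ℕ
 rotl r w = drop r w ++ take r w

 -- `Headed` with its colours renumbered by the order of the runs: e and o are the two parts of the
 -- first run on the first circle, and r is the rotation of the second circle.
 record Diagram : Set where
   constructor diagram
   field e o q₀ : ℕ
         rest : List Size
         r : ℕ

   runs : List Run
   runs = (0 , e + o , q₀) ∷ number 1 rest

   wordA wordB : List ℕ
   wordA = replicate (suc e) 0 ++ asc (number 1 rest) ++ replicate o 0
   wordB = rotl r (desc runs)

 open Diagram

 widthA widthB : List Size → ℕ
 widthA [] = 0
 widthA ((p , q) ∷ ss) = suc p + widthA ss
 widthB [] = 0
 widthB ((p , q) ∷ ss) = suc q + widthB ss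

 -- All lists of sizes of total width (p , q); the fuel bounds their length.
 comps : ℕ → ℕ → ℕ → List (List Size)
 comps f zero zero = [ [] ]
 comps zero (suc p) q = []
 comps zero zero (suc q) = []
 comps (suc f) zero (suc q) = []
 comps (suc f) (suc p) q = concatMap (λ a → concatMap (λ b → map ((a , b) ∷_) (comps f (p ∸ a) (q ∸ suc b))) (upTo q)) (upTo (suc p))

 nonNil : List (List Size) → List (List Size)
 nonNil [] = []
 nonNil ([] ∷ xs) = nonNil xs
 nonNil ((s ∷ ss) ∷ xs) = (s ∷ ss) ∷ nonNil xs

 -- A single run gives constant words, for which all cuts and rotations coincide, so it is listed
 -- once with o = r = 0. From two runs on, every cut and every rotation gives a different diagram.
 diagrams⁺ diagrams : ℕ → ℕ → List Diagram
 diagrams⁺ p q =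
   concatMap (λ t → concatMap (λ b → concatMap (λ rest → concatMap (λ o → map (λ r → diagram (t ∸ o) o b rest r)
     (upTo q)) (upTo (suc t))) (nonNil (comps p (p ∸ suc t) (q ∸ suc b)))) (upTo q)) (upTo p)
 diagrams p q = diagram (p ∸ 1) 0 (q ∸ 1) [] 0 ∷ diagrams⁺ p q

 unique-concatMap : ∀ {a b} {A : Set a} {B : Set b} (f : A → List B) {xs} → Unique xs → (∀ x → Unique (f x)) →
   (∀ {x x' y} → y ∈ f x → y ∈ f x' → x ≡ x') → Unique (concatMap f xs)
 unique-concatMap f [] h d = []
 unique-concatMap f {x ∷ xs} (n ∷ u) h d = APP.++⁺ (h x) (unique-concatMap f u h d)
   (All.tabulate (λ y∈ → All.tabulate (λ z∈ e → let (x' , x'∈ , z∈') = ∈-concatMap⁻ f xs z∈ in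
     All.lookup n x'∈ (d y∈ (subst (_∈ f x') (sym e) z∈')))))

 comps-unique : ∀ f p q → Unique (comps f p q)
 comps-unique zero zero zero = [] ∷ []
 comps-unique (suc f) zero zero = [] ∷ []
 comps-unique zero (suc p) q = []
 comps-unique zero zero (suc q) = []
 comps-unique (suc f) zero (suc q) = []
 comps-unique (suc f) (suc p) q = unique-concatMap _ (UP.upTo⁺ (suc p))
   (λ a → unique-concatMap _ (UP.upTo⁺ q) (λ b → UP.map⁺ (λ e → proj₂ (∷-injective e)) (comps-unique f (p ∸ a) (q ∸ suc b)))
     (λ {b} {b'} y∈ y∈' → cong proj₂ (trans (sym (head a b y∈)) (head a b' y∈'))))
   (λ {a} {a'} y∈ y∈' → let (b , _ , h) = ∈-concatMap⁻ _ (upTo q) y∈ ; (b' , _ , h') = ∈-concatMap⁻ _ (upTo q) y∈' in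
     cong proj₁ (trans (sym (head a b h)) (head a' b' h')))
   where
   first : List Size → Size
   first [] = 0 , 0
   first (s ∷ _) = s
   head : ∀ a b {y} → y ∈ map ((a , b) ∷_) (comps f (p ∸ a) (q ∸ suc b)) → first y ≡ (a , b)
   head a b y∈ with ∈-map⁻ ((a , b) ∷_) y∈
   ... | _ , _ , refl = refl

 nonNil-∈⁻ : ∀ xs {y} → y ∈ nonNil xs → y ∈ xs × y ≢ []
 nonNil-∈⁻ ([] ∷ xs) y∈ = let (h , k) = nonNil-∈⁻ xs y∈ in there h , k
 nonNil-∈⁻ ((s ∷ ss) ∷ xs) (here refl) = here refl , λ ()
 nonNil-∈⁻ ((s ∷ ss) ∷ xs) (there y∈) = let (h , k) = nonNil-∈⁻ xs y∈ in there h , k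

 nonNil-∈⁺ : ∀ {xs y} → y ∈ xs → y ≢ [] → y ∈ nonNil xs
 nonNil-∈⁺ {[] ∷ xs} (here refl) h = ⊥-elim (h refl)
 nonNil-∈⁺ {(s ∷ ss) ∷ xs} (here refl) h = here refl
 nonNil-∈⁺ {[] ∷ xs} (there y∈) h = nonNil-∈⁺ y∈ h
 nonNil-∈⁺ {(s ∷ ss) ∷ xs} (there y∈) h = there (nonNil-∈⁺ y∈ h)

 nonNil-unique : ∀ {xs} → Unique xs → Unique (nonNil xs)
 nonNil-unique {[]} u = []
 nonNil-unique {[] ∷ xs} (_ ∷ u) = nonNil-unique u
 nonNil-unique {(s ∷ ss) ∷ xs} (h ∷ u) = All.tabulate (λ y∈ → All.lookup h (proj₁ (nonNil-∈⁻ xs y∈))) ∷ nonNil-unique u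

 comps-width : ∀ f p q {ss} → ss ∈ comps f p q → widthA ss ≡ p × widthB ss ≡ q
 comps-width zero zero zero (here refl) = refl , refl
 comps-width (suc f) zero zero (here refl) = refl , refl
 comps-width (suc f) (suc p) q ss∈ with ∈-concatMap⁻ _ (upTo (suc p)) ss∈
 ... | a , a∈ , h with ∈-concatMap⁻ _ (upTo q) h
 ... | b , b∈ , h' with ∈-map⁻ ((a , b) ∷_) h'
 ... | ss , ss∈' , refl with comps-width f (p ∸ a) (q ∸ suc b) ss∈'
 ... | e , e' = cong suc (trans (cong (a +_) e) (ℕP.m+[n∸m]≡n (ℕP.≤-pred (∈-upTo⁻ a∈)))) ,
   trans (cong (suc b +_) e') (ℕP.m+[n∸m]≡n (∈-upTo⁻ b∈))

 record Member (p q : ℕ) (d : Diagram) : Set where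
   constructor member
   field t≡ : e d + o d < p
         b<q : q₀ d < q
         rest∈ : rest d ∈ comps p (p ∸ suc (e d + o d)) (q ∸ suc (q₀ d))
         rest≢[] : rest d ≢ []
         r<q : r d < q

   rest-width : widthA (rest d) ≡ p ∸ suc (e d + o d) × widthB (rest d) ≡ q ∸ suc (q₀ d)
   rest-width = comps-width p (p ∸ suc (e d + o d)) (q ∸ suc (q₀ d)) rest∈

 diagrams⁺-∈⁻ : ∀ p q {d} → d ∈ diagrams⁺ p q → Member p q d
 diagrams⁺-∈⁻ p q d∈ with ∈-concatMap⁻ _ (upTo p) d∈
 ... | t , t∈ , d∈ with ∈-concatMap⁻ _ (upTo q) d∈
 ... | b , b∈ , d∈ with ∈-concatMap⁻ _ (nonNil (comps p (p ∸ suc t) (q ∸ suc b))) d∈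
 ... | rest , rest∈ , d∈ with ∈-concatMap⁻ _ (upTo (suc t)) d∈
 ... | o , o∈ , d∈ with ∈-map⁻ (λ r → diagram (t ∸ o) o b rest r) d∈
 ... | r , r∈ , refl with ℕP.m∸n+n≡m (ℕP.≤-pred (∈-upTo⁻ o∈))
 ... | e = member (subst (_< p) (sym e) (∈-upTo⁻ t∈)) (∈-upTo⁻ b∈)
   (subst (λ t → rest ∈ comps p (p ∸ suc t) (q ∸ suc b)) (sym e) (proj₁ rest-ok)) (proj₂ rest-ok) (∈-upTo⁻ r∈)
   where rest-ok = nonNil-∈⁻ (comps p (p ∸ suc t) (q ∸ suc b)) rest∈

 diagrams⁺-∈⁺ : ∀ p q {d} → Member p q d → d ∈ diagrams⁺ p q
 diagrams⁺-∈⁺ p q {diagram e o b rest r} (member t< b< rest∈ ne r<) =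
   ∈-concatMap⁺ _ {upTo p} (∈-upTo⁺ t<) (∈-concatMap⁺ _ {upTo q} (∈-upTo⁺ b<) (∈-concatMap⁺ _ (nonNil-∈⁺ rest∈ ne)
     (∈-concatMap⁺ _ {upTo (suc (e + o))} (∈-upTo⁺ (s≤s (ℕP.m≤n+m o e)))
       (subst (λ e' → diagram e o b rest r ∈ map (λ r → diagram e' o b rest r) (upTo q)) (sym (ℕP.m+n∸n≡m e o)) (∈-map⁺ (diagram e o b rest) (∈-upTo⁺ r<))))))

 diagrams⁺-unique : ∀ p q → Unique (diagrams⁺ p q)
 diagrams⁺-unique p q = unique-concatMap _ (UP.upTo⁺ p)
   (λ t → unique-concatMap _ (UP.upTo⁺ q)
     (λ b → unique-concatMap _ (nonNil-unique (comps-unique p (p ∸ suc t) (q ∸ suc b)))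
       (λ rest → unique-concatMap _ (UP.upTo⁺ (suc t))
         (λ o → UP.map⁺ (cong Diagram.r) (UP.upTo⁺ q))
         (λ {o'} {o''} h h' → trans (sym (o-of o' h)) (o-of o'' h')))
       (λ {x} {x'} h h' → trans (sym (rest-of x h)) (rest-of x' h')))
     (λ {x} {x'} h h' → trans (sym (b-of x h)) (b-of x' h')))
   (λ {x} {x'} h h' → trans (sym (t-of x h)) (t-of x' h'))
   where
   o-of : ∀ {t b rest} o' {y} → y ∈ map (λ r → diagram (t ∸ o') o' b rest r) (upTo q) → Diagram.o y ≡ o'
   o-of o' h with ∈-map⁻ _ h
   ... | _ , _ , refl = refl
   rest-of : ∀ {t b} x {y} → y ∈ concatMap (λ o → map (λ r → diagram (t ∸ o) o b x r) (upTo q)) (upTo (suc t)) → Diagram.rest y ≡ x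
   rest-of {t} x h with ∈-concatMap⁻ _ (upTo (suc t)) h
   ... | _ , _ , h' with ∈-map⁻ _ h'
   ... | _ , _ , refl = refl
   b-of : ∀ {t} x {y} → y ∈ concatMap (λ rest → concatMap (λ o → map (λ r → diagram (t ∸ o) o x rest r) (upTo q)) (upTo (suc t)))
     (nonNil (comps p (p ∸ suc t) (q ∸ suc x))) → Diagram.q₀ y ≡ x
   b-of {t} x h with ∈-concatMap⁻ _ (nonNil (comps p (p ∸ suc t) (q ∸ suc x))) h
   ... | _ , _ , h' with ∈-concatMap⁻ _ (upTo (suc t)) h'
   ... | _ , _ , h'' with ∈-map⁻ _ h''
   ... | _ , _ , refl = refl
   t-of : ∀ t {y} → y ∈ concatMap (λ b → concatMap (λ rest → concatMap (λ o → map (λ r → diagram (t ∸ o) o b rest r) (upTo q)) (upTo (suc t)))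
     (nonNil (comps p (p ∸ suc t) (q ∸ suc b)))) (upTo q) → Diagram.e y + Diagram.o y ≡ t
   t-of t h with ∈-concatMap⁻ _ (upTo q) h
   ... | b , _ , h' with ∈-concatMap⁻ _ (nonNil (comps p (p ∸ suc t) (q ∸ suc b))) h'
   ... | _ , _ , h'' with ∈-concatMap⁻ _ (upTo (suc t)) h''
   ... | o , o∈ , h''' with ∈-map⁻ _ h'''
   ... | _ , _ , refl = ℕP.m∸n+n≡m (ℕP.≤-pred (∈-upTo⁻ o∈))

 diagrams-unique : ∀ p q → Unique (diagrams p q)
 diagrams-unique p q = All.tabulate (λ {d} d∈ e → Member.rest≢[] (diagrams⁺-∈⁻ p q d∈) (cong Diagram.rest (sym e)))
   ∷ diagrams⁺-unique p q

 ∈-comps : ∀ f ss → widthA ss ≤ f → ss ∈ comps f (widthA ss) (widthB ss)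
 ∈-comps zero [] l = here refl
 ∈-comps (suc f) [] l = here refl
 ∈-comps (suc f) ((a , b) ∷ ss) (s≤s l) = ∈-concatMap⁺ _ {upTo (suc (a + widthA ss))} (∈-upTo⁺ (s≤s (ℕP.m≤m+n a (widthA ss))))
   (∈-concatMap⁺ _ {upTo (suc b + widthB ss)} (∈-upTo⁺ (s≤s (ℕP.m≤m+n b (widthB ss))))
     (∈-map⁺ ((a , b) ∷_) (subst₂ (λ x y → ss ∈ comps f x y) (sym (ℕP.m+n∸m≡n a (widthA ss))) (sym (ℕP.m+n∸m≡n b (widthB ss)))
       (∈-comps f ss (ℕP.≤-trans (ℕP.m≤n+m (widthA ss) a) l)))))

 length-asc : ∀ k ss → length (asc (number k ss)) ≡ widthA ss
 length-asc k [] = refl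
 length-asc k ((p , q) ∷ ss) = trans (length-++ (replicate (suc p) k)) (cong₂ _+_ (length-replicate (suc p)) (length-asc (suc k) ss))

 length-desc : ∀ k ss → length (desc (number k ss)) ≡ widthB ss
 length-desc k [] = refl
 length-desc k ((p , q) ∷ ss) = trans (length-++ (desc (number (suc k) ss)))
   (trans (ℕP.+-comm (length (desc (number (suc k) ss))) _) (cong₂ _+_ (length-replicate (suc q)) (length-desc (suc k) ss)))

 rotl-rot : ∀ r w → Rot (rotl r w) w
 rotl-rot r w = subst (Rot (rotl r w)) (take++drop≡id r w) (rot-++ (drop r w) (take r w))

 length-wordA : ∀ d → length (wordA d) ≡ suc (e d + o d) + widthA (rest d)
 length-wordA (diagram e o q₀ rest r) = trans (length-++ (replicate (suc e) 0))
   (trans (cong₂ _+_ (length-replicate (suc e)) (trans (length-++ (asc (number 1 rest))) (cong₂ _+_ (length-asc 1 rest) (length-replicate o))))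
     (cong suc (trans (cong (e +_) (ℕP.+-comm (widthA rest) o)) (sym (ℕP.+-assoc e o _)))))

 length-wordB : ∀ d → length (wordB d) ≡ suc (q₀ d) + widthB (rest d)
 length-wordB (diagram e o q₀ rest r) = trans (PermP.↭-length (rot-↭ (rotl-rot r (desc ((0 , e + o , q₀) ∷ number 1 rest)))))
   (trans (length-++ (desc (number 1 rest))) (trans (ℕP.+-comm (length (desc (number 1 rest))) _)
     (cong₂ _+_ (length-replicate (suc q₀)) (length-desc 1 rest))))

 diagrams-length : ∀ p q {d} → d ∈ diagrams (suc p) (suc q) → length (wordA d) ≡ suc p × length (wordB d) ≡ suc q
 diagrams-length p q (here refl) =
   trans (length-wordA (diagram p 0 q [] 0)) (cong suc (trans (ℕP.+-identityʳ (p + 0)) (ℕP.+-identityʳ p))) ,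
   trans (length-wordB (diagram p 0 q [] 0)) (cong suc (ℕP.+-identityʳ q))
 diagrams-length p q {d} (there d∈) = by (diagrams⁺-∈⁻ (suc p) (suc q) d∈)
   where
   by : Member (suc p) (suc q) d → length (wordA d) ≡ suc p × length (wordB d) ≡ suc q
   by M = trans (length-wordA d) (trans (cong (suc (e d + o d) +_) (proj₁ (Member.rest-width M))) (ℕP.m+[n∸m]≡n (Member.t≡ M))) ,
     trans (length-wordB d) (trans (cong (suc (q₀ d) +_) (proj₂ (Member.rest-width M))) (ℕP.m+[n∸m]≡n (Member.b<q M)))

 -- Restricted growth: every letter is one of the m letters seen so far or the next one.
 data RG : ℕ → List ℕ → Set where
   nil : ∀ {m} → RG m []
   old : ∀ {m a w} → a < m → RG m w → RG m (a ∷ w)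
   new : ∀ {m w} → RG (suc m) w → RG m (m ∷ w)

 rg-bounded : ∀ {m} w → (∀ {a} → a ∈ w → a < m) → RG m w
 rg-bounded [] h = nil
 rg-bounded (a ∷ w) h = old (h (here refl)) (rg-bounded w (h ∘ there))

 rg-replicate : ∀ {m} p {a w} → a < m → RG m w → RG m (replicate p a ++ w)
 rg-replicate zero l r = r
 rg-replicate (suc p) l r = old l (rg-replicate p l r)

 rg-asc : ∀ k ss {w} → RG (k + length ss) w → RG k (asc (number k ss) ++ w)
 rg-asc k [] {w} r = subst (λ m → RG m w) (ℕP.+-identityʳ k) r
 rg-asc k ((p , q) ∷ ss) {w} r = new (subst (RG (suc k)) (sym (++-assoc (replicate p k) _ w))
   (rg-replicate p (ℕP.n<1+n k) (rg-asc (suc k) ss (subst (λ m → RG m w) (ℕP.+-suc k (length ss)) r))))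

 replicate-∈ : ∀ n {a b : ℕ} → a ∈ replicate n b → a ≡ b
 replicate-∈ (suc n) (here e) = e
 replicate-∈ (suc n) (there h) = replicate-∈ n h

 desc-bounded : ∀ k ss {a} → a ∈ desc (number k ss) → k ≤ a × a < k + length ss
 desc-bounded k ((p , q) ∷ ss) {a} a∈ with ∈-++⁻ (desc (number (suc k) ss)) a∈
 ... | inj₁ h = let (l , l') = desc-bounded (suc k) ss h in ℕP.<⇒≤ l , subst (a <_) (sym (ℕP.+-suc k (length ss))) l'
 ... | inj₂ h = subst (λ z → k ≤ z × z < k + suc (length ss)) (sym (replicate-∈ (suc q) h)) (ℕP.≤-refl , ℕP.m<m+n k (s≤s z≤n))

 rg-diagram : ∀ d → RG 0 (wordA d ++ wordB d)
 rg-diagram d@(diagram e o q₀ rest r) = new (subst (RG 1) (trans (cong (replicate e 0 ++_) (sym (++-assoc (asc (number 1 rest)) (replicate o 0) (wordB d))))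
   (sym (++-assoc (replicate e 0) _ (wordB d))))
   (rg-replicate e (s≤s z≤n) (rg-asc 1 rest (rg-replicate o (s≤s z≤n) (rg-bounded (wordB d) bounded)))))
   where
   bounded : ∀ {a} → a ∈ wordB d → a < 1 + length rest
   bounded a∈ with desc-bounded 0 ((e + o , q₀) ∷ rest) (PermP.∈-resp-↭ (rot-↭ (rotl-rot r (desc (Diagram.runs d)))) a∈)
   ... | _ , l = l

 invert : ∀ {m a w} → RG m (a ∷ w) → (a < m × RG m w) ⊎ (a ≡ m × RG (suc m) w)
 invert (old l r) = inj₁ (l , r)
 invert (new r) = inj₂ (refl , r)

 SamePattern : List ℕ → (ℕ → ℕ) → (ℕ → ℕ) → Set
 SamePattern L c c' = ∀ {k l} → k ∈ L → l ∈ L → (c k ≡ c l → c' k ≡ c' l) × (c' k ≡ c' l → c k ≡ c l)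

 -- Such a word names its letters in the order of first occurrence, so it is determined by which
 -- positions carry equal letters. The induction keeps the prefix P, in which exactly the letters
 -- below m have been seen.
 rg-unique : ∀ L {c c'} → SamePattern L c c' → RG 0 (map c L) → RG 0 (map c' L) → map c L ≡ map c' L
 rg-unique L {c} {c'} pat r r' = go [] L (λ ()) (λ ()) (λ ()) pat r r'
   where
   go : ∀ {m} P L → (∀ {k} → k ∈ P → c k ≡ c' k) → (∀ {a} → a < m → ∃[ k ] (k ∈ P × c k ≡ a)) → (∀ {k} → k ∈ P → c k < m) →
     SamePattern (P ++ L) c c' → RG m (map c L) → RG m (map c' L) → map c L ≡ map c' L
   go P [] same seen bound pat r r' = refl
   go {m} P (x ∷ L) same seen bound pat r r' = extend (invert r) (invert r')
     where
     x∈ : x ∈ P ++ x ∷ L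
     x∈ = ∈-++⁺ʳ P (here refl)
     P∈ : ∀ {k} → k ∈ P → k ∈ P ++ x ∷ L
     P∈ = ∈-++⁺ˡ
     next : ∀ {m'} → c x ≡ c' x → (∀ {a} → a < m' → ∃[ k ] (k ∈ x ∷ P × c k ≡ a)) → (∀ {k} → k ∈ x ∷ P → c k < m') →
       RG m' (map c L) → RG m' (map c' L) → map c (x ∷ L) ≡ map c' (x ∷ L)
     next e seen' bound' s s' = cong₂ _∷_ e (go (x ∷ P) L (λ { (here refl) → e ; (there h) → same h }) seen' bound'
       (λ k∈ l∈ → pat (mv k∈) (mv l∈)) s s')
       where
       mv : ∀ {k} → k ∈ x ∷ P ++ L → k ∈ P ++ x ∷ L
       mv (here refl) = x∈
       mv (there h) with ∈-++⁻ P h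
       ... | inj₁ h' = P∈ h'
       ... | inj₂ h' = ∈-++⁺ʳ P (there h')
     same⇒≡ : ∀ {k} → k ∈ P → c k ≡ c x → c x ≡ c' x
     same⇒≡ k∈ e = trans (sym e) (trans (same k∈) (proj₁ (pat (P∈ k∈) x∈) e))
     extend : (c x < m × RG m (map c L)) ⊎ (c x ≡ m × RG (suc m) (map c L)) →
       (c' x < m × RG m (map c' L)) ⊎ (c' x ≡ m × RG (suc m) (map c' L)) → map c (x ∷ L) ≡ map c' (x ∷ L)
     extend (inj₁ (l , s)) s' with seen l
     extend (inj₁ (l , s)) (inj₁ (_ , s')) | k , k∈ , e =
       next (same⇒≡ k∈ e) (λ b → let (j , j∈ , e') = seen b in j , there j∈ , e') (λ { (here refl) → l ; (there h) → bound h }) s s'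
     extend (inj₁ (l , s)) (inj₂ (e' , _)) | k , k∈ , e = ⊥-elim (ℕP.<-irrefl (trans (same⇒≡ k∈ e) e') l)
     extend (inj₂ (e , s)) (inj₁ (l' , _)) with seen l'
     ... | k , k∈ , e' = ⊥-elim (ℕP.<-irrefl (trans (proj₂ (pat (P∈ k∈) x∈) (trans (sym (same k∈)) e')) e) (bound k∈))
     extend (inj₂ (e , s)) (inj₂ (e' , s')) = next (trans e (sym e')) seen'
       (λ { (here refl) → subst (_< suc m) (sym e) (ℕP.n<1+n m) ; (there h) → ℕP.m<n⇒m<1+n (bound h) }) s s'
       where
       seen' : ∀ {b} → b < suc m → ∃[ k ] (k ∈ x ∷ P × c k ≡ b)
       seen' {b} lb with b ℕP.≟ m
       ... | yes refl = x , here refl , e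
       ... | no h = let (j , j∈ , e'') = seen (ℕP.≤∧≢⇒< (ℕP.≤-pred lb) h) in j , there j∈ , e''

 replicate-parse : ∀ (k : ℕ) m m' {X X'} → (∀ {Y} → X ≢ k ∷ Y) → (∀ {Y} → X' ≢ k ∷ Y) →
   replicate m k ++ X ≡ replicate m' k ++ X' → m ≡ m' × X ≡ X'
 replicate-parse k zero zero h h' e = refl , e
 replicate-parse k zero (suc m') h h' e = ⊥-elim (h e)
 replicate-parse k (suc m) zero h h' e = ⊥-elim (h' (sym e))
 replicate-parse k (suc m) (suc m') h h' e with replicate-parse k m m' h h' (proj₂ (∷-injective e))
 ... | e₁ , e₂ = cong suc e₁ , e₂

 asc-parse : ∀ k rest rest' o o' → asc (number (suc k) rest) ++ replicate o 0 ≡ asc (number (suc k) rest') ++ replicate o' 0 →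
   map proj₁ rest ≡ map proj₁ rest' × o ≡ o'
 asc-parse k [] [] o o' e = refl , trans (sym (length-replicate o)) (trans (cong length e) (length-replicate o'))
 asc-parse k [] (s ∷ rest') zero o' ()
 asc-parse k [] (s ∷ rest') (suc o) o' ()
 asc-parse k (s ∷ rest) [] o zero ()
 asc-parse k (s ∷ rest) [] o (suc o') ()
 asc-parse k ((p , q) ∷ rest) ((p' , q') ∷ rest') o o' e
   with replicate-parse (suc k) (suc p) (suc p') (start k rest o) (start k rest' o')
     (trans (sym (++-assoc (replicate (suc p) (suc k)) _ _)) (trans e (++-assoc (replicate (suc p') (suc k)) _ _)))
   where
   start : ∀ k rest o {Y} → asc (number (suc (suc k)) rest) ++ replicate o 0 ≢ suc k ∷ Y
   start k [] zero ()
   start k [] (suc o) ()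
   start k (s ∷ rest) o e = ℕP.<-irrefl (sym (proj₁ (∷-injective e))) (ℕP.n<1+n (suc k))
 ... | e₁ , e₂ with asc-parse (suc k) rest rest' o o' e₂
 ... | e₃ , e₄ = cong₂ _∷_ (ℕP.suc-injective e₁) e₃ , e₄

 hit : ℕ → ℕ → ℕ
 hit s a with a ℕP.≟ s
 ... | yes _ = 1
 ... | no _ = 0

 hit-yes : ∀ s → hit s s ≡ 1
 hit-yes s with s ℕP.≟ s
 ... | yes _ = refl
 ... | no h = ⊥-elim (h refl)

 hit-no : ∀ {s a} → a ≢ s → hit s a ≡ 0
 hit-no {s} {a} h with a ℕP.≟ s
 ... | yes e = ⊥-elim (h e)
 ... | no _ = refl

 count : ℕ → List ℕ → ℕ
 count s [] = 0
 count s (a ∷ w) = hit s a + count s w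

 count-++ : ∀ s u w → count s (u ++ w) ≡ count s u + count s w
 count-++ s [] w = refl
 count-++ s (a ∷ u) w = trans (cong (hit s a +_) (count-++ s u w)) (sym (ℕP.+-assoc (hit s a) _ _))

 count-↭ : ∀ s {u w} → u ↭ w → count s u ≡ count s w
 count-↭ s Perm.refl = refl
 count-↭ s (Perm.prep a p) = cong (hit s a +_) (count-↭ s p)
 count-↭ s (Perm.swap a b p) = trans (sym (ℕP.+-assoc (hit s a) _ _))
   (trans (cong₂ _+_ (ℕP.+-comm (hit s a) (hit s b)) (count-↭ s p)) (ℕP.+-assoc (hit s b) _ _))
 count-↭ s (Perm.trans p q) = trans (count-↭ s p) (count-↭ s q)

 count-replicate : ∀ n s → count s (replicate n s) ≡ n
 count-replicate zero s = refl
 count-replicate (suc n) s = cong₂ _+_ (hit-yes s) (count-replicate n s)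

 count-none : ∀ s w → s ∉ w → count s w ≡ 0
 count-none s [] h = refl
 count-none s (a ∷ w) h = cong₂ _+_ (hit-no (λ e → h (here (sym e)))) (count-none s w (h ∘ there))

 -- The second word is known only up to rotation at this point, so the widths are recovered from the
 -- letter counts, which a rotation preserves.
 desc-parse : ∀ k ss ss' → length ss ≡ length ss' → (∀ s → count s (desc (number k ss)) ≡ count s (desc (number k ss'))) →
   map proj₂ ss ≡ map proj₂ ss'
 desc-parse k [] [] e h = refl
 desc-parse k ((p , q) ∷ ss) ((p' , q') ∷ ss') e h = cong₂ _∷_ q≡ (desc-parse (suc k) ss ss' (ℕP.suc-injective e) rest≡)
   where
   split : ∀ q ss s → count s (desc (number k ((p , q) ∷ ss))) ≡ count s (desc (number (suc k) ss)) + count s (replicate (suc q) k)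
   split q ss s = count-++ s (desc (number (suc k) ss)) (replicate (suc q) k)
   k∉ : ∀ ss → k ∉ desc (number (suc k) ss)
   k∉ ss h = ℕP.<-irrefl refl (proj₁ (desc-bounded (suc k) ss h))
   at-k : ∀ q ss → count k (desc (number k ((p , q) ∷ ss))) ≡ suc q
   at-k q ss = trans (split q ss k) (cong₂ _+_ (count-none k _ (k∉ ss)) (count-replicate (suc q) k))
   q≡ : q ≡ q'
   q≡ = ℕP.suc-injective (trans (sym (at-k q ss)) (trans (h k) (at-k q' ss')))
   rest≡ : ∀ s → count s (desc (number (suc k) ss)) ≡ count s (desc (number (suc k) ss'))
   rest≡ s = ℕP.+-cancelʳ-≡ (count s (replicate (suc q) k)) _ _ (trans (sym (split q ss s)) (trans (h s)
     (trans (split q' ss' s) (cong (λ z → count s (desc (number (suc k) ss')) + count s (replicate (suc z) k)) (sym q≡)))))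

 Descending : List ℕ → Set
 Descending = AllPairs (λ a b → b ≤ a)

 descending-replicate : ∀ n b → Descending (replicate n b)
 descending-replicate zero b = []
 descending-replicate (suc n) b = All.tabulate (λ h → ℕP.≤-reflexive (replicate-∈ n h)) ∷ descending-replicate n b

 descending-desc : ∀ k ss → Descending (desc (number k ss))
 descending-desc k [] = []
 descending-desc k ((p , q) ∷ ss) = APP.++⁺ (descending-desc (suc k) ss) (descending-replicate (suc q) k)
   (All.tabulate (λ a∈ → All.tabulate (λ b∈ → subst (_≤ _) (sym (replicate-∈ (suc q) b∈)) (ℕP.<⇒≤ (proj₁ (desc-bounded (suc k) ss a∈))))))

 ++-compare : ∀ (a b a' b' : List ℕ) → a ++ b ≡ a' ++ b' →
   (∃[ z ] (a' ≡ a ++ z × b ≡ z ++ b')) ⊎ (∃[ z ] (a ≡ a' ++ z × b' ≡ z ++ b))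
 ++-compare [] b a' b' e = inj₁ (a' , refl , e)
 ++-compare (x ∷ a) b [] b' e = inj₂ (x ∷ a , refl , sym e)
 ++-compare (x ∷ a) b (y ∷ a') b' e with ∷-injective e
 ... | refl , e' with ++-compare a b a' b' e'
 ... | inj₁ (z , f , g) = inj₁ (z , cong (x ∷_) f , g)
 ... | inj₂ (z , f , g) = inj₂ (z , cong (x ∷_) f , g)

 -- By the second factorisation x starts with a positive letter and z ends with 0; by the first,
 -- that 0 stands before the positive letter in a descending word.
 no-descending-rotation : ∀ {w K} (z x : List ℕ) → Descending w → w ≡ z ++ x → w ≡ x ++ z → z ≢ [] → x ≢ [] →
   (∃[ w' ] (w ≡ suc K ∷ w')) → (∃[ w' ] (w ≡ w' ++ [ 0 ])) → ⊥
 no-descending-rotation [] x d e e' h h' _ _ = h refl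
 no-descending-rotation z [] d e e' h h' _ _ = h' refl
 no-descending-rotation {w} {K} (a ∷ z) (b ∷ x) d e e' _ _ (w₁ , f) (w₂ , g) = contra (subst Descending e d) 0∈
   where
   b≡ : b ≡ suc K
   b≡ = proj₁ (∷-injective (trans (sym e') f))
   0∈ : 0 ∈ a ∷ z
   0∈ = last-∈ (b ∷ x) (a ∷ z) (λ ()) (trans (sym e') g)
     where
     last-∈ : ∀ u v {w} → v ≢ [] → u ++ v ≡ w ++ [ 0 ] → 0 ∈ v
     last-∈ u [] h e = ⊥-elim (h refl)
     last-∈ (_ ∷ u) v {[]} h e with v | proj₂ (∷-injective e)
     ... | [] | _ = ⊥-elim (h refl)
     ... | y ∷ v' | e' with u
     last-∈ (_ ∷ u) v {[]} h e | y ∷ v' | () | []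
     last-∈ (_ ∷ u) v {[]} h e | y ∷ v' | () | _ ∷ _
     last-∈ (_ ∷ u) v {_ ∷ w} h e = last-∈ u v h (proj₂ (∷-injective e))
     last-∈ [] (y ∷ v) {[]} h e = here (sym (proj₁ (∷-injective e)))
     last-∈ [] (y ∷ []) {_ ∷ []} h e with proj₂ (∷-injective e)
     ... | ()
     last-∈ [] (y ∷ []) {_ ∷ _ ∷ _} h e with proj₂ (∷-injective e)
     ... | ()
     last-∈ [] (y ∷ y' ∷ v) {_ ∷ w} h e = there (last-∈ [] (y' ∷ v) (λ ()) (proj₂ (∷-injective e)))
   contra : Descending ((a ∷ z) ++ b ∷ x) → 0 ∈ a ∷ z → ⊥
   contra d 0∈ = go (a ∷ z) d 0∈
     where
     go : ∀ z → Descending (z ++ b ∷ x) → 0 ∈ z → ⊥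
     go (y ∷ z) (h ∷ _) (here refl) = ℕP.n≮0 (subst (_≤ 0) b≡ (All.lookup h (∈-++⁺ʳ z (here refl))))
     go (y ∷ z) (_ ∷ d) (there k) = go z d k

 -- Two equal rotations with different offsets would exhibit w as a proper rotation of itself, which
 -- `no-descending-rotation` excludes.
 rotl-unique : ∀ {w K r r'} → Descending w → (∃[ w' ] (w ≡ suc K ∷ w')) → (∃[ w' ] (w ≡ w' ++ [ 0 ])) →
   r < length w → r' < length w → rotl r w ≡ rotl r' w → r ≡ r'
 rotl-unique {w} {K} {r} {r'} d h₁ h₂ l l' e = go (++-compare (drop r w) (take r w) (drop r' w) (take r' w) e)
   where
   take-len : ∀ r → r < length w → length (take r w) ≡ r
   take-len r l = trans (length-take r w) (ℕP.m≤n⇒m⊓n≡m (ℕP.<⇒≤ l))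
   drop-ne : ∀ r → r < length w → drop r w ≢ []
   drop-ne r l e = ℕP.<-irrefl (trans (sym (take-len r l)) (trans (cong length (sym (++-identityʳ (take r w))))
     (trans (cong (λ v → length (take r w ++ v)) (sym e)) (cong length (take++drop≡id r w))))) l
   compare : ∀ z {r r'} → r < length w → r' < length w → drop r' w ≡ drop r w ++ z → take r w ≡ z ++ take r' w → r ≡ r'
   compare [] l l' f g = trans (sym (take-len _ l)) (trans (cong length g) (take-len _ l'))
   compare (y ∷ z) {r} {r'} l l' f g = ⊥-elim (no-descending-rotation (y ∷ z) (take r' w ++ drop r w) d
     (trans (sym (take++drop≡id r w)) (trans (cong (_++ drop r w) g) (++-assoc (y ∷ z) _ _)))
     (trans (sym (take++drop≡id r' w)) (trans (cong (take r' w ++_) f) (sym (++-assoc (take r' w) _ _))))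
     (λ ()) (λ k → drop-ne r l (++-conicalʳ (take r' w) _ k)) h₁ h₂)
   go : _ → r ≡ r'
   go (inj₁ (z , f , g)) = compare z l l' f g
   go (inj₂ (z , f , g)) = sym (compare z l' l f g)

 ++-split : ∀ (u u' : List ℕ) {v v'} → length u ≡ length u' → u ++ v ≡ u' ++ v' → u ≡ u' × v ≡ v'
 ++-split [] [] l e = refl , e
 ++-split (x ∷ u) (y ∷ u') l e with ∷-injective e
 ... | refl , e' with ++-split u u' (ℕP.suc-injective l) e'
 ... | f , g = cong (x ∷_) f , g

 zip-≡ : ∀ (ss ss' : List Size) → map proj₁ ss ≡ map proj₁ ss' → map proj₂ ss ≡ map proj₂ ss' → ss ≡ ss'
 zip-≡ [] [] _ _ = refl
 zip-≡ (s ∷ ss) (s' ∷ ss') e e' with ∷-injective e | ∷-injective e'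
 ... | f , g | f' , g' = cong₂ _∷_ (cong₂ _,_ f f') (zip-≡ ss ss' g g')

 desc-snoc : ∀ q₀ E rest → ∃[ w ] (desc ((0 , E , q₀) ∷ number 1 rest) ≡ w ++ [ 0 ])
 desc-snoc q₀ E rest = desc (number 1 rest) ++ replicate q₀ 0 ,
   trans (cong (desc (number 1 rest) ++_) (sym (replicate-snoc q₀ 0))) (sym (++-assoc (desc (number 1 rest)) _ _))

 desc-head : ∀ k s rest {w} → ∃[ K ] ∃[ w' ] (desc (number (suc k) (s ∷ rest)) ++ w ≡ suc K ∷ w')
 desc-head k (p , q) [] {w} = k , _ , refl
 desc-head k (p , q) (s ∷ rest) {w} with desc-head (suc k) s rest {replicate (suc q) (suc k) ++ w}
 ... | K , w' , e = K , w' , trans (++-assoc (desc (number (suc (suc k)) (s ∷ rest))) _ w) e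

 -- The leading zeros give e, the remainder of the first word gives o and the widths on A, the
 -- letter counts give the widths on B, and only then can the rotation be compared.
 words-determine : ∀ p q {d d'} → Member p q d → Member p q d' → wordA d ≡ wordA d' → wordB d ≡ wordB d' → d ≡ d'
 words-determine p q {diagram e o q₀ rest r} {diagram e' o' q₀' rest' r'} M M' eA eB
   with replicate-parse 0 (suc e) (suc e') (start rest o (ne M)) (start rest' o' (ne M')) eA
   where
   ne : ∀ {d} → Member p q d → Diagram.rest d ≢ []
   ne = Member.rest≢[]
   start : ∀ rest o → rest ≢ [] → ∀ {Y} → asc (number 1 rest) ++ replicate o 0 ≢ 0 ∷ Y
   start [] o h = ⊥-elim (h refl)
   start (_ ∷ _) o h ()
 ... | e₁ , e₂ with ℕP.suc-injective e₁ | asc-parse 0 rest rest' o o' e₂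
 ... | refl | e₃ , refl with desc-parse 0 ((e + o , q₀) ∷ rest) ((e + o , q₀') ∷ rest')
   (cong suc (trans (sym (length-map proj₁ rest)) (trans (cong length e₃) (length-map proj₁ rest'))))
   (λ s → trans (sym (count-↭ s (rot-↭ (rotl-rot r (desc ((0 , e + o , q₀) ∷ number 1 rest))))))
     (trans (cong (count s) eB) (count-↭ s (rot-↭ (rotl-rot r' (desc ((0 , e + o , q₀') ∷ number 1 rest')))))))
 ... | e₄ with ∷-injective e₄
 ... | refl , e₅ with zip-≡ rest rest' e₃ e₅
 ... | refl = cong (diagram e o q₀ rest) (r≡ rest (Member.rest≢[] M) eB (len M) (len M'))
   where
   len : ∀ {d} → Member p q d → Diagram.r d < length (desc (Diagram.runs d))
   len {d} M = subst (Diagram.r d <_) (sym (trans (length-desc 0 ((Diagram.e d + Diagram.o d , Diagram.q₀ d) ∷ Diagram.rest d))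
     (trans (cong (suc (Diagram.q₀ d) +_) (proj₂ (Member.rest-width M))) (ℕP.m+[n∸m]≡n (Member.b<q M)))))
     (Member.r<q M)
   r≡ : ∀ rest → rest ≢ [] → rotl r (desc ((0 , e + o , q₀) ∷ number 1 rest)) ≡ rotl r' (desc ((0 , e + o , q₀) ∷ number 1 rest)) →
     r < length (desc ((0 , e + o , q₀) ∷ number 1 rest)) → r' < length (desc ((0 , e + o , q₀) ∷ number 1 rest)) → r ≡ r'
   r≡ [] h _ _ _ = ⊥-elim (h refl)
   r≡ (s ∷ rest) h eB l l' with desc-head 0 s rest {replicate (suc q₀) 0}
   ... | K , w' , f = rotl-unique (descending-desc 0 ((e + o , q₀) ∷ s ∷ rest)) (w' , f) (desc-snoc q₀ (e + o) (s ∷ rest)) l l' eB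

 diagrams-determined : ∀ p q {d d'} → d ∈ diagrams (suc p) (suc q) → d' ∈ diagrams (suc p) (suc q) →
   wordA d ≡ wordA d' → wordB d ≡ wordB d' → d ≡ d'
 diagrams-determined p q (here refl) (here refl) _ _ = refl
 diagrams-determined p q (there d∈) (there d'∈) e e' = words-determine (suc p) (suc q) (diagrams⁺-∈⁻ _ _ d∈) (diagrams⁺-∈⁻ _ _ d'∈) e e'
 diagrams-determined p q (here refl) (there d'∈) e _ = ⊥-elim (mixed p (diagrams⁺-∈⁻ _ _ d'∈) e)
   where
   mixed : ∀ m {d'} → Member (suc p) (suc q) d' → wordA (diagram m 0 q [] 0) ≢ wordA d'
   mixed m {diagram e o q₀ [] r} M eq = Member.rest≢[] M refl
   mixed m {diagram e o q₀ (s ∷ rest) r} M eq with replicate-∈ (suc m) (subst (1 ∈_) (trans (sym eq) (++-identityʳ _)) (∈-++⁺ʳ (replicate (suc e) 0) (here refl)))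
   ... | ()
 diagrams-determined p q (there d∈) (here refl) e e' = sym (diagrams-determined p q (here refl) (there d∈) (sym e) (sym e'))

-- Colour patterns and the diagrams that describe them

module DiagramPatterns where
 open import Data.Nat using (_+_; _*_)
 open import Data.List using (take; drop)
 open ≡ using (refl; sym; trans)
 open BooleanReflection
 open CycleCounting
 open SpokeWords
 open NonCrossingPartitions using (Disj; disj-same)
 open PartitionSplitting using (NonEmptyBlocks; ∈-block⇒∈-concat)
 open AnnularCharacterisation using (rot-map; unique-map-inj)
 open SpokeDiagrams

 open Diagram using (wordA; wordB; runs)

 assoc : List ℕ → List ℕ → ℕ → ℕ
 assoc [] W y = 0
 assoc (x ∷ L) [] y = 0
 assoc (x ∷ L) (w ∷ W) y with y ℕP.≟ x
 ... | yes _ = w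
 ... | no _ = assoc L W y

 assoc-here : ∀ x L w W → assoc (x ∷ L) (w ∷ W) x ≡ w
 assoc-here x L w W with x ℕP.≟ x
 ... | yes _ = refl
 ... | no h = ⊥-elim (h refl)

 assoc-there : ∀ {x y} L w W → y ≢ x → assoc (x ∷ L) (w ∷ W) y ≡ assoc L W y
 assoc-there {x} {y} L w W h with y ℕP.≟ x
 ... | yes e = ⊥-elim (h e)
 ... | no _ = refl

 map-cong-∈ : ∀ {f g : ℕ → ℕ} L → (∀ {x} → x ∈ L → f x ≡ g x) → map f L ≡ map g L
 map-cong-∈ L h = map-cong-local (All.tabulate h)

 map-≡-∈ : ∀ {f g : ℕ → ℕ} L → map f L ≡ map g L → ∀ {x} → x ∈ L → f x ≡ g x
 map-≡-∈ (y ∷ L) e (here refl) = proj₁ (∷-injective e)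
 map-≡-∈ (y ∷ L) e (there x∈) = map-≡-∈ L (proj₂ (∷-injective e)) x∈

 map-assoc : ∀ L W → Unique L → length L ≡ length W → map (assoc L W) L ≡ W
 map-assoc [] [] u e = refl
 map-assoc (x ∷ L) (w ∷ W) (h ∷ u) e = cong₂ _∷_ (assoc-here x L w W)
   (trans (map-cong-∈ L (λ y∈ → assoc-there L w W (λ k → All.lookup h y∈ (sym k)))) (map-assoc L W u (ℕP.suc-injective e)))

 colour : List ℕ → List ℕ → Diagram → ℕ → ℕ
 colour V₁ V₂ d = assoc (V₁ ++ V₂) (wordA d ++ wordB d)

 colour-words : ∀ V₁ V₂ d → Unique (V₁ ++ V₂) → length V₁ ≡ length (wordA d) → length V₂ ≡ length (wordB d) →
   map (colour V₁ V₂ d) V₁ ≡ wordA d × map (colour V₁ V₂ d) V₂ ≡ wordB d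
 colour-words V₁ V₂ d u l l' = ++-split _ _ (trans (length-map _ V₁) l)
   (trans (sym (map-++ (colour V₁ V₂ d) V₁ V₂)) (map-assoc (V₁ ++ V₂) (wordA d ++ wordB d) u
     (trans (length-++ V₁) (trans (cong₂ _+_ l l') (sym (length-++ (wordA d)))))))

 relabel : (ℕ → ℕ) → List Run → List Run
 relabel f = map (λ { (c , p , q) → f c , p , q })

 asc-relabel : ∀ f rs → asc (relabel f rs) ≡ map f (asc rs)
 asc-relabel f [] = refl
 asc-relabel f ((c , p , q) ∷ rs) = trans (cong₂ _++_ (sym (map-replicate f (suc p) c)) (asc-relabel f rs))
   (sym (map-++ f (replicate (suc p) c) (asc rs)))

 desc-relabel : ∀ f rs → desc (relabel f rs) ≡ map f (desc rs)
 desc-relabel f [] = refl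
 desc-relabel f ((c , p , q) ∷ rs) = trans (cong₂ _++_ (desc-relabel f rs) (sym (map-replicate f (suc q) c)))
   (sym (map-++ f (desc rs) (replicate (suc q) c)))

 cols-relabel : ∀ f rs → cols (relabel f rs) ≡ map f (cols rs)
 cols-relabel f [] = refl
 cols-relabel f (r ∷ rs) = cong (f (proj₁ r) ∷_) (cols-relabel f rs)

 cols-asc : ∀ rs {a} → a ∈ cols rs → a ∈ asc rs
 cols-asc ((c , p , q) ∷ rs) (here refl) = here refl
 cols-asc ((c , p , q) ∷ rs) (there a∈) = ∈-++⁺ʳ (replicate (suc p) c) (cols-asc rs a∈)

 asc-cols : ∀ rs {a} → a ∈ asc rs → a ∈ cols rs
 asc-cols ((c , p , q) ∷ rs) a∈ with ∈-++⁻ (replicate (suc p) c) a∈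
 ... | inj₁ h = here (replicate-∈ (suc p) h)
 ... | inj₂ h = there (asc-cols rs h)

 desc-cols : ∀ rs {a} → a ∈ desc rs → a ∈ cols rs
 desc-cols ((c , p , q) ∷ rs) a∈ with ∈-++⁻ (desc rs) a∈
 ... | inj₁ h = there (desc-cols rs h)
 ... | inj₂ h = here (replicate-∈ (suc q) h)

 spokes-map : ∀ (f : ℕ → ℕ) {U V} → (∀ {a b} → a ∈ U → b ∈ U → f a ≡ f b → a ≡ b) → Spokes U V → Spokes (map f U) (map f V)
 spokes-map f inj (spokes rs ne u rU rV) = spokes (relabel f rs) (λ e → ne (map-[] rs e))
   (subst Unique (sym (cols-relabel f rs)) (unique-map-inj f u (λ a∈ b∈ → inj (back a∈) (back b∈))))
   (subst (Rot _) (sym (asc-relabel f rs)) (rot-map f rU)) (subst (Rot _) (sym (desc-relabel f rs)) (rot-map f rV))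
   where
   map-[] : ∀ rs → relabel f rs ≡ [] → rs ≡ []
   map-[] [] _ = refl
   back : ∀ {a} → a ∈ cols rs → a ∈ _
   back a∈ = PermP.∈-resp-↭ (↭-sym (rot-↭ rU)) (cols-asc rs a∈)

 cols-number : ∀ k ss → Unique (cols (number k ss)) × (∀ {a} → a ∈ cols (number k ss) → k ≤ a)
 cols-number k [] = [] , λ ()
 cols-number k ((p , q) ∷ ss) with cols-number (suc k) ss
 ... | u , h = All.tabulate (λ a∈ e → ℕP.<-irrefl e (h a∈)) ∷ u , λ { (here refl) → ℕP.≤-refl ; (there a∈) → ℕP.<⇒≤ (h a∈) }

 diagram-spokes : ∀ d → Spokes (wordA d) (wordB d)
 diagram-spokes (diagram e o q₀ rest r) = headed⇒spokes (headed 0 e o q₀ (number 1 rest)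
   (proj₁ (cols-number 0 ((e + o , q₀) ∷ rest))) refl (rotl-rot r _))

 pattern⇒spokes : ∀ {V₁ V₂ c d} → Unique (V₁ ++ V₂) → length V₁ ≡ length (wordA d) → length V₂ ≡ length (wordB d) →
   SamePattern (V₁ ++ V₂) c (colour V₁ V₂ d) → Spokes (map c V₁) (map c V₂)
 pattern⇒spokes {V₁} {V₂} {c} {d} u l l' pat = subst₂ Spokes (image V₁ wA ∈-++⁺ˡ) (image V₂ wB (∈-++⁺ʳ V₁))
   (spokes-map h inj (diagram-spokes d))
   where
   L = V₁ ++ V₂
   e : ℕ → ℕ
   e = colour V₁ V₂ d
   wA = proj₁ (colour-words V₁ V₂ d u l l')
   wB = proj₂ (colour-words V₁ V₂ d u l l')
   -- Translates a letter of the diagram into the colour under c of the first element of the list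
   -- that carries it; equality of patterns makes the choice irrelevant.
   pick : List ℕ → ℕ → ℕ
   pick [] s = 0
   pick (x ∷ L) s with e x ℕP.≟ s
   ... | yes _ = c x
   ... | no _ = pick L s
   h : ℕ → ℕ
   h = pick L
   pick-spec : ∀ L' {x} → (∀ {y} → y ∈ L' → y ∈ L) → x ∈ L' → pick L' (e x) ≡ c x
   pick-spec (y ∷ L') {x} sub x∈ with e y ℕP.≟ e x
   ... | yes k = proj₂ (pat (sub (here refl)) (sub x∈)) k
   pick-spec (y ∷ L') sub (here refl) | no k = ⊥-elim (k refl)
   pick-spec (y ∷ L') sub (there x∈) | no k = pick-spec L' (sub ∘ there) x∈
   image : ∀ V {W} → map e V ≡ W → (∀ {x} → x ∈ V → x ∈ L) → map h W ≡ map c V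
   image V refl sub = trans (sym (map-∘ V)) (map-cong-∈ V (λ x∈ → pick-spec L id (sub x∈)))
   inj : ∀ {a b} → a ∈ wordA d → b ∈ wordA d → h a ≡ h b → a ≡ b
   inj {a} {b} a∈ b∈ k with ∈-map⁻ e (subst (a ∈_) (sym wA) a∈) | ∈-map⁻ e (subst (b ∈_) (sym wA) b∈)
   ... | x , x∈ , refl | y , y∈ , refl = proj₁ (pat (∈-++⁺ˡ x∈) (∈-++⁺ˡ y∈))
     (trans (sym (pick-spec L id (∈-++⁺ˡ x∈))) (trans k (pick-spec L id (∈-++⁺ˡ y∈))))

 -- The renumbering of colours: the position of a colour in the list of runs, hence injective on the
 -- colours that occur.
 index : List ℕ → ℕ → ℕ
 index [] a = 0
 index (c ∷ cs) a with a ℕP.≟ c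
 ... | yes _ = 0
 ... | no _ = suc (index cs a)

 index-here : ∀ c cs → index (c ∷ cs) c ≡ 0
 index-here c cs with c ℕP.≟ c
 ... | yes _ = refl
 ... | no h = ⊥-elim (h refl)

 index-there : ∀ {c a} cs → a ≢ c → index (c ∷ cs) a ≡ suc (index cs a)
 index-there {c} {a} cs h with a ℕP.≟ c
 ... | yes e = ⊥-elim (h e)
 ... | no _ = refl

 index-inj : ∀ cs {a b} → a ∈ cs → b ∈ cs → index cs a ≡ index cs b → a ≡ b
 index-inj (c ∷ cs) {a} {b} a∈ b∈ e with a ℕP.≟ c | b ℕP.≟ c
 ... | yes k | yes k' = trans k (sym k')
 index-inj (c ∷ cs) (here k) b∈ e | no h | no h' = ⊥-elim (h k)
 index-inj (c ∷ cs) (there a∈) (here k) e | no h | no h' = ⊥-elim (h' k)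
 index-inj (c ∷ cs) (there a∈) (there b∈) e | no h | no h' = index-inj cs a∈ b∈ (ℕP.suc-injective e)

 strip : List Run → List Size
 strip = map proj₂

 relabel-index : ∀ k rs → Unique (cols rs) → relabel (λ a → k + index (cols rs) a) rs ≡ number k (strip rs)
 relabel-index k [] u = refl
 relabel-index k ((c , p , q) ∷ rs) (h ∷ u) = cong₂ _∷_
   (cong (_, p , q) (trans (cong (k +_) (index-here c (cols rs))) (ℕP.+-identityʳ k)))
   (trans (relabel-cong rs (λ a∈ → trans (cong (k +_) (index-there (cols rs) (λ e → All.lookup h a∈ (sym e)))) (ℕP.+-suc k _))) (relabel-index (suc k) rs u))
   where
   relabel-cong : ∀ {f g} rs → (∀ {a} → a ∈ cols rs → f a ≡ g a) → relabel f rs ≡ relabel g rs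
   relabel-cong [] h = refl
   relabel-cong ((c , p , q) ∷ rs) h = cong₂ _∷_ (cong (_, p , q) (h (here refl))) (relabel-cong rs (h ∘ there))

 rot⇒rotl : ∀ {v w} → Rot v w → w ≢ [] → ∃[ r ] (r < length w × v ≡ rotl r w)
 rot⇒rotl {v} {w} r ne with split r
   where
   unsnoc : ∀ (β : List ℕ) → β ≡ [] ⊎ (∃[ β' ] ∃[ y ] (β ≡ β' ++ [ y ]))
   unsnoc [] = inj₁ refl
   unsnoc (b ∷ β) with unsnoc β
   ... | inj₁ refl = inj₂ ([] , b , refl)
   ... | inj₂ (β' , y , refl) = inj₂ (b ∷ β' , y , refl)
   split : ∀ {v w} → Rot v w → ∃[ α ] ∃[ β ] (v ≡ α ++ β × w ≡ β ++ α)
   split {v} done = v , [] , sym (++-identityʳ v) , refl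
   split (step {x} {u} r) with split r
   ... | α , β , e , refl with unsnoc β
   ... | inj₁ refl = [ x ] , u , refl , trans (sym (++-identityʳ α)) (sym e)
   ... | inj₂ (β' , y , refl) with ∷ʳ-injective u (α ++ β') (trans e (sym (++-assoc α β' [ y ])))
   ... | refl , refl = x ∷ α , β' , refl , ++-assoc β' [ x ] α
 -- When α is empty, `length β` is the full length and exceeds the admissible offsets, so the offset
 -- 0 is taken.
 ... | [] , β , refl , refl = 0 , nonzero (β ++ []) ne , trans (sym (++-identityʳ β)) (sym (++-identityʳ (β ++ [])))
   where
   nonzero : ∀ (w : List ℕ) → w ≢ [] → 0 < length w
   nonzero [] h = ⊥-elim (h refl)
   nonzero (_ ∷ _) h = s≤s z≤n
 ... | x ∷ α , β , refl , refl = length β , subst (length β <_) (sym (length-++ β)) (ℕP.m<m+n (length β) (s≤s z≤n)) ,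
   sym (cong₂ _++_ (drop-length β) (take-length β))
   where
   drop-length : ∀ β {α : List ℕ} → drop (length β) (β ++ α) ≡ α
   drop-length [] = refl
   drop-length (_ ∷ β) = drop-length β
   take-length : ∀ β {α : List ℕ} → take (length β) (β ++ α) ≡ β
   take-length [] = refl
   take-length (b ∷ β) = cong (b ∷_) (take-length β)

 -- The headed form already is a diagram up to the names of its colours, which `index` replaces by
 -- run numbers.
 spokes⇒diagram : ∀ {p q U V} → Spokes U V → length U ≡ suc p → length V ≡ suc q →
   ∃[ d ] ∃[ f ] (d ∈ diagrams (suc p) (suc q) × map f U ≡ wordA d × map f V ≡ wordB d ×
     (∀ {a b} → a ∈ U ++ V → b ∈ U ++ V → f a ≡ f b → a ≡ b))
 spokes⇒diagram {p} {q} {U} {V} s lU lV with spokes⇒headed s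
 ... | headed b e o q₀ rest u refl rV = conclude
   where
   rs = (b , e + o , q₀) ∷ rest
   f : ℕ → ℕ
   f = index (b ∷ cols rest)
   relabelled : relabel f rs ≡ number 0 (strip rs)
   relabelled = relabel-index 0 rs u
   f-b : f b ≡ 0
   f-b = index-here b (cols rest)
   tail≡ : relabel f rest ≡ number 1 (strip rest)
   tail≡ = proj₂ (∷-injective {x = (f b , e + o , q₀)} relabelled)
     where open import Data.List.Properties using (∷-injective)
   fU : map f U ≡ replicate (suc e) 0 ++ asc (number 1 (strip rest)) ++ replicate o 0
   fU = trans (map-++ f (replicate (suc e) b) _) (cong₂ _++_ (trans (map-replicate f (suc e) b) (cong (replicate (suc e)) f-b))
     (trans (map-++ f (asc rest) _) (cong₂ _++_ (trans (sym (asc-relabel f rest)) (cong asc tail≡))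
       (trans (map-replicate f o b) (cong (replicate o) f-b)))))
   w : List ℕ
   w = desc ((0 , e + o , q₀) ∷ number 1 (strip rest))
   fV : Rot (map f V) w
   fV = subst (Rot (map f V)) (trans (sym (desc-relabel f rs)) (cong desc relabelled)) (rot-map f rV)
   inj : ∀ {a b'} → a ∈ U ++ V → b' ∈ U ++ V → f a ≡ f b' → a ≡ b'
   inj a∈ b∈ = index-inj (b ∷ cols rest) (col a∈) (col b∈)
     where
     col : ∀ {a} → a ∈ U ++ V → a ∈ b ∷ cols rest
     col a∈ with ∈-++⁻ U a∈
     ... | inj₂ h = desc-cols rs (PermP.∈-resp-↭ (rot-↭ rV) h)
     ... | inj₁ h with ∈-++⁻ (replicate (suc e) b) h
     ... | inj₁ h' = here (replicate-∈ (suc e) h')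
     ... | inj₂ h' with ∈-++⁻ (asc rest) h'
     ... | inj₁ h'' = there (asc-cols rest h'')
     ... | inj₂ h'' = here (replicate-∈ o h'')
   lenA : ∀ r → suc (e + o) + widthA (strip rest) ≡ suc p
   lenA r = trans (sym (length-wordA (diagram e o q₀ (strip rest) r))) (trans (sym (cong length fU)) (trans (length-map f U) lU))
   lenB : suc q₀ + widthB (strip rest) ≡ suc q
   lenB = trans (sym (length-wordB (diagram e o q₀ (strip rest) 0))) (trans (PermP.↭-length (rot-↭ (rotl-rot 0 w)))
     (trans (sym (PermP.↭-length (rot-↭ fV))) (trans (length-map f V) lV)))
   w≢[] : w ≢ []
   w≢[] k with trans (sym (length-wordB (diagram e o q₀ (strip rest) 0))) (trans (PermP.↭-length (rot-↭ (rotl-rot 0 w))) (cong length k))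
   ... | ()
   Goal : Set
   Goal = ∃[ d ] ∃[ f ] (d ∈ diagrams (suc p) (suc q) × map f U ≡ wordA d × map f V ≡ wordB d ×
     (∀ {a b} → a ∈ U ++ V → b ∈ U ++ V → f a ≡ f b → a ≡ b))
   conclude : Goal
   conclude with rot⇒rotl fV w≢[]
   ... | r , r< , vr = build rest refl
     where
     build : ∀ ρ → rest ≡ ρ → Goal
     -- With one run both words are constant, so cut and rotation are normalised to the single
     -- listed diagram.
     build [] refl = diagram p 0 q [] 0 , f , here refl ,
       trans fU (trans (replicate-+ (suc e) o 0) (trans (cong (λ k → replicate k 0) (trans (sym (ℕP.+-identityʳ _)) (lenA 0))) (sym (++-identityʳ _)))) ,
       trans vr (trans (all-zero r) (trans (cong (λ k → replicate k 0) (trans (sym (ℕP.+-identityʳ _)) lenB)) (sym (++-identityʳ _)))) ,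
       inj
       where
       all-zero : ∀ r → rotl r (replicate (suc q₀) 0) ≡ replicate (suc q₀) 0
       all-zero r = const-≡ (rotl r (replicate (suc q₀) 0)) (suc q₀)
         (λ a∈ → replicate-∈ (suc q₀) (PermP.∈-resp-↭ (rot-↭ (rotl-rot r (replicate (suc q₀) 0))) a∈))
         (trans (PermP.↭-length (rot-↭ (rotl-rot r (replicate (suc q₀) 0)))) (length-replicate (suc q₀)))
         where
         const-≡ : ∀ (u : List ℕ) n → (∀ {a} → a ∈ u → a ≡ 0) → length u ≡ n → u ≡ replicate n 0
         const-≡ [] zero h k = refl
         const-≡ (a ∷ u) (suc n) h k = cong₂ _∷_ (h (here refl)) (const-≡ u n (h ∘ there) (ℕP.suc-injective k))
     build (run ∷ ρ) refl = diagram e o q₀ (strip rest) r , f ,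
       there (diagrams⁺-∈⁺ (suc p) (suc q) {diagram e o q₀ (strip rest) r} (member
         (subst (suc (e + o) ≤_) (lenA 0) (ℕP.m≤m+n (suc (e + o)) _))
         (subst (suc q₀ ≤_) lenB (ℕP.m≤m+n (suc q₀) _))
         (subst₂ (λ x y → strip rest ∈ comps (suc p) x y)
           (trans (sym (ℕP.m+n∸m≡n (suc (e + o)) (widthA (strip rest)))) (cong (_∸ suc (e + o)) (lenA 0)))
           (trans (sym (ℕP.m+n∸m≡n (suc q₀) (widthB (strip rest)))) (cong (_∸ suc q₀) lenB))
           (∈-comps (suc p) (strip rest) (subst (widthA (strip rest) ≤_) (lenA 0) (ℕP.m≤n+m _ (suc (e + o))))))
         (λ ())
         (subst (r <_) (trans (sym (PermP.↭-length (rot-↭ fV))) (trans (length-map f V) lV)) r<))) ,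
       fU , vr , inj

 spokes⇒pattern : ∀ {p q V₁ V₂ c} → Unique (V₁ ++ V₂) → length V₁ ≡ suc p → length V₂ ≡ suc q → Spokes (map c V₁) (map c V₂) →
   ∃[ d ] (d ∈ diagrams (suc p) (suc q) × SamePattern (V₁ ++ V₂) c (colour V₁ V₂ d))
 spokes⇒pattern {p} {q} {V₁} {V₂} {c} u l l' s with spokes⇒diagram s (trans (length-map c V₁) l) (trans (length-map c V₂) l')
 ... | d , f , d∈ , eA , eB , inj = d , d∈ , λ k∈ l∈ →
   (λ e → trans (sym (fc k∈)) (trans (cong f e) (fc l∈))) ,
   (λ e → inj (in-words k∈) (in-words l∈) (trans (fc k∈) (trans e (sym (fc l∈)))))
   where
   lens = diagrams-length p q d∈
   words = colour-words V₁ V₂ d u (trans l (sym (proj₁ lens))) (trans l' (sym (proj₂ lens)))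
   fc : ∀ {x} → x ∈ V₁ ++ V₂ → f (c x) ≡ colour V₁ V₂ d x
   fc x∈ with ∈-++⁻ V₁ x∈
   ... | inj₁ h = map-≡-∈ {f ∘ c} V₁ (trans (map-∘ V₁) (trans eA (sym (proj₁ words)))) h
   ... | inj₂ h = map-≡-∈ {f ∘ c} V₂ (trans (map-∘ V₂) (trans eB (sym (proj₂ words)))) h
   in-words : ∀ {x} → x ∈ V₁ ++ V₂ → c x ∈ map c V₁ ++ map c V₂
   in-words x∈ with ∈-++⁻ V₁ x∈
   ... | inj₁ h = ∈-++⁺ˡ (∈-map⁺ c h)
   ... | inj₂ h = ∈-++⁺ʳ (map c V₁) (∈-map⁺ c h)

 -- Both diagrams spell restricted growth words with the same pattern, hence the same words, and the
 -- words determine the diagram.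
 pattern-unique : ∀ {p q V₁ V₂ c d d'} → Unique (V₁ ++ V₂) → length V₁ ≡ suc p → length V₂ ≡ suc q →
   d ∈ diagrams (suc p) (suc q) → d' ∈ diagrams (suc p) (suc q) →
   SamePattern (V₁ ++ V₂) c (colour V₁ V₂ d) → SamePattern (V₁ ++ V₂) c (colour V₁ V₂ d') → d ≡ d'
 pattern-unique {p} {q} {V₁} {V₂} {c} {d} {d'} u l l' d∈ d'∈ pat pat' =
   diagrams-determined p q d∈ d'∈ (proj₁ split) (proj₂ split)
   where
   lens : ∀ {d} → d ∈ diagrams (suc p) (suc q) → length V₁ ≡ length (wordA d) × length V₂ ≡ length (wordB d)
   lens d∈ = let (a , b) = diagrams-length p q d∈ in trans l (sym a) , trans l' (sym b)
   whole : ∀ {d} → d ∈ diagrams (suc p) (suc q) → map (colour V₁ V₂ d) (V₁ ++ V₂) ≡ wordA d ++ wordB d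
   whole {d} d∈ = let (a , b) = colour-words V₁ V₂ d u (proj₁ (lens d∈)) (proj₂ (lens d∈)) in
     trans (map-++ (colour V₁ V₂ d) V₁ V₂) (cong₂ _++_ a b)
   both : SamePattern (V₁ ++ V₂) (colour V₁ V₂ d) (colour V₁ V₂ d')
   both k∈ l∈ = (λ e → proj₁ (pat' k∈ l∈) (proj₂ (pat k∈ l∈) e)) , (λ e → proj₁ (pat k∈ l∈) (proj₂ (pat' k∈ l∈) e))
   split = ++-split (wordA d) (wordA d') (trans (sym (proj₁ (lens d∈))) (proj₁ (lens d'∈)))
     (trans (sym (whole d∈)) (trans (rg-unique (V₁ ++ V₂) both (subst (RG 0) (sym (whole d∈)) (rg-diagram d)) (subst (RG 0) (sym (whole d'∈)) (rg-diagram d'))) (whole d'∈)))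

 -- Lists of (colour , size) with distinct colours are determined by their total sizes per colour.
 total : ℕ → List (ℕ × ℕ) → ℕ
 total s [] = 0
 total s ((a , n) ∷ ps) = hit s a * n + total s ps

 total-↭ : ∀ s {ps ps'} → ps ↭ ps' → total s ps ≡ total s ps'
 total-↭ s Perm.refl = refl
 total-↭ s (Perm.prep (a , n) p) = cong (hit s a * n +_) (total-↭ s p)
 total-↭ s (Perm.swap (a , n) (b , m) p) = trans (sym (ℕP.+-assoc (hit s a * n) _ _))
   (trans (cong₂ _+_ (ℕP.+-comm (hit s a * n) (hit s b * m)) (total-↭ s p)) (ℕP.+-assoc (hit s b * m) _ _))
 total-↭ s (Perm.trans p q) = trans (total-↭ s p) (total-↭ s q)

 total-none : ∀ s ps → s ∉ map proj₁ ps → total s ps ≡ 0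
 total-none s [] h = refl
 total-none s ((a , n) ∷ ps) h = cong₂ _+_ (cong (_* n) (hit-no (λ e → h (here (sym e))))) (total-none s ps (h ∘ there))

 total-head : ∀ s n ps → s ∉ map proj₁ ps → total s ((s , n) ∷ ps) ≡ n
 total-head s n ps h = trans (cong₂ _+_ (trans (cong (_* n) (hit-yes s)) (ℕP.*-identityˡ n)) (total-none s ps h)) (ℕP.+-identityʳ n)

 total-find : ∀ s ps → Unique (map proj₁ ps) → total s ps ≢ 0 → (s , total s ps) ∈ ps
 total-find s [] u h = ⊥-elim (h refl)
 total-find s ((a , n) ∷ ps) u@(_ ∷ u') h = go (a ℕP.≟ s)
   where
   go : Dec (a ≡ s) → (s , total s ((a , n) ∷ ps)) ∈ (a , n) ∷ ps
   go (yes refl) = here (cong (s ,_) (total-head s n ps (unique-∉ u)))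
   go (no k) = there (subst (λ z → (s , z) ∈ ps) (sym e) (total-find s ps u' (λ z → h (trans e z))))
     where
     e : total s ((a , n) ∷ ps) ≡ total s ps
     e = cong (λ z → z * n + total s ps) (hit-no k)

 sizes-↭ : ∀ ps ps' → Unique (map proj₁ ps) → Unique (map proj₁ ps') → (∀ {p} → p ∈ ps → proj₂ p ≢ 0) → (∀ {p} → p ∈ ps' → proj₂ p ≢ 0) →
   (∀ s → total s ps ≡ total s ps') → ps ↭ ps'
 sizes-↭ [] [] u u' h h' e = ↭-refl
 sizes-↭ [] ((a , n) ∷ ps') u u' h h' e = ⊥-elim (h' (here refl) (trans (sym (total-head a n ps' (unique-∉ u'))) (sym (e a))))
 sizes-↭ ((a , n) ∷ ps) ps' u@(_ ∷ us) u' h h' e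
   with bring-front (total-find a ps' u' (λ k → h (here refl) (trans (sym (total-head a n ps (unique-∉ u))) (trans (e a) k))))
 ... | ps'' , p = ↭-trans (subst (λ z → (a , n) ∷ ps ↭ (a , z) ∷ ps'') n≡ (Perm.prep (a , n) rest)) (↭-sym p)
   where
   n≡ : n ≡ total a ps'
   n≡ = trans (sym (total-head a n ps (unique-∉ u))) (e a)
   u'' : Unique (map proj₁ ps'')
   u'' with unique-↭ (PermP.map⁺ proj₁ p) u'
   ... | _ ∷ v = v
   rest : ps ↭ ps''
   rest = sizes-↭ ps ps'' us u'' (h ∘ there) (λ q∈ → h' (PermP.∈-resp-↭ (↭-sym p) (there q∈)))
     (λ s → ℕP.+-cancelˡ-≡ (hit s a * n) _ _ (trans (e s) (trans (total-↭ s p) (cong (λ z → hit s a * z + total s ps'') (sym n≡)))))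

 runSizes : List Run → List (ℕ × ℕ)
 runSizes = map (λ { (c , p , q) → c , suc p + suc q })

 count-replicate′ : ∀ s n a → count s (replicate n a) ≡ hit s a * n
 count-replicate′ s zero a = sym (ℕP.*-zeroʳ (hit s a))
 count-replicate′ s (suc n) a = trans (cong (hit s a +_) (count-replicate′ s n a)) (sym (ℕP.*-suc (hit s a) n))

 total-runs : ∀ s rs → total s (runSizes rs) ≡ count s (asc rs) + count s (desc rs)
 total-runs s [] = refl
 total-runs s ((c , p , q) ∷ rs) = begin
   hit s c * (suc p + suc q) + total s (runSizes rs)
     ≡⟨ cong₂ _+_ (ℕP.*-distribˡ-+ (hit s c) (suc p) (suc q)) (total-runs s rs) ⟩
   (hit s c * suc p + hit s c * suc q) + (count s (asc rs) + count s (desc rs))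
     ≡⟨ cong₂ (λ x y → (x + y) + (count s (asc rs) + count s (desc rs))) (sym (count-replicate′ s (suc p) c)) (sym (count-replicate′ s (suc q) c)) ⟩
   (count s (replicate (suc p) c) + count s (replicate (suc q) c)) + (count s (asc rs) + count s (desc rs))
     ≡⟨ solve 4 (λ a b x y → (a :+ b) :+ (x :+ y) := (a :+ x) :+ (y :+ b)) refl
       (count s (replicate (suc p) c)) (count s (replicate (suc q) c)) (count s (asc rs)) (count s (desc rs)) ⟩
   (count s (replicate (suc p) c) + count s (asc rs)) + (count s (desc rs) + count s (replicate (suc q) c))
     ≡⟨ cong₂ _+_ (count-++ s (replicate (suc p) c) (asc rs)) (count-++ s (desc rs) (replicate (suc q) c)) ⟨
   count s (asc ((c , p , q) ∷ rs)) + count s (desc ((c , p , q) ∷ rs)) ∎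
   where
   open ≡.≡-Reasoning
   open import Data.Nat.Solver using (module +-*-Solver)
   open +-*-Solver

 headOf : List ℕ → ℕ
 headOf [] = 0
 headOf (x ∷ _) = x

 blockSizes : (ℕ → ℕ) → Blocks → List (ℕ × ℕ)
 blockSizes e = map (λ b → e (headOf b) , length b)

 MatchesOn : List ℕ → Blocks → (ℕ → ℕ) → Set
 MatchesOn L π e = ∀ {k l} → k ∈ L → l ∈ L → (SameBlock π k l → e k ≡ e l) × (e k ≡ e l → SameBlock π k l)

 module _ {π : Blocks} {e : ℕ → ℕ} (disj : AllPairs Disj π) (ne : NonEmptyBlocks π) (m : MatchesOn (concat π) π e) where

  private
    head-∈ : ∀ {b} → b ∈ π → headOf b ∈ b
    head-∈ {[]} b∈ with ne b∈
    ... | _ , ()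
    head-∈ {x ∷ b} b∈ = here refl

    mono : ∀ {b y} → b ∈ π → y ∈ b → e y ≡ e (headOf b)
    mono b∈ y∈ = proj₁ (m (∈-block⇒∈-concat b∈ y∈) (∈-block⇒∈-concat b∈ (head-∈ b∈))) (_ , b∈ , y∈ , head-∈ b∈)

    colours-distinct : ∀ ρ → (∀ {b} → b ∈ ρ → b ∈ π) → AllPairs Disj ρ → Unique (map proj₁ (blockSizes e ρ))
    colours-distinct [] sub d = []
    colours-distinct (b ∷ ρ) sub (h ∷ d) = All.tabulate lem ∷ colours-distinct ρ (sub ∘ there) d
      where
      lem : ∀ {a} → a ∈ map proj₁ (blockSizes e ρ) → e (headOf b) ≢ a
      lem a∈ k with ∈-map⁻ proj₁ a∈
      ... | _ , p∈ , refl with ∈-map⁻ _ p∈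
      ... | b' , b'∈ , refl with proj₂ (m (∈-block⇒∈-concat (sub (here refl)) (head-∈ (sub (here refl)))) (∈-block⇒∈-concat (sub (there b'∈)) (head-∈ (sub (there b'∈))))) k
      ... | b'' , b''∈ , h₁ , h₂ with disj-same disj b''∈ (sub (here refl)) h₁ (head-∈ (sub (here refl))) | disj-same disj b''∈ (sub (there b'∈)) h₂ (head-∈ (sub (there b'∈)))
      ... | refl | refl = All.lookup h b'∈ (head-∈ (sub (here refl))) (head-∈ (sub (here refl)))

    total-blocks : ∀ s ρ → (∀ {b} → b ∈ ρ → b ∈ π) → total s (blockSizes e ρ) ≡ count s (map e (concat ρ))
    total-blocks s [] sub = refl
    total-blocks s (b ∷ ρ) sub = trans (cong₂ _+_ (sym (count-mono b (λ y∈ → mono (sub (here refl)) y∈))) (total-blocks s ρ (sub ∘ there)))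
      (sym (trans (cong (count s) (map-++ e b (concat ρ))) (count-++ s (map e b) _)))
      where
      count-mono : ∀ b {a} → (∀ {y} → y ∈ b → e y ≡ a) → count s (map e b) ≡ hit s a * length b
      count-mono [] {a} h = sym (ℕP.*-zeroʳ (hit s a))
      count-mono (y ∷ b) {a} h = trans (cong₂ _+_ (cong (hit s) (h (here refl))) (count-mono b (h ∘ there))) (sym (ℕP.*-suc (hit s a) (length b)))

  block-sizes-↭ : ∀ {rs} → Unique (cols rs) → (∀ s → count s (map e (concat π)) ≡ count s (asc rs) + count s (desc rs)) →
    blockSizes e π ↭ runSizes rs
  block-sizes-↭ {rs} u h = sizes-↭ _ _ (colours-distinct π id disj) (subst Unique (cols≡ rs) u) nz nz' (λ s → trans (total-blocks s π id) (trans (h s) (sym (total-runs s rs))))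
    where
    cols≡ : ∀ rs → cols rs ≡ map proj₁ (runSizes rs)
    cols≡ [] = refl
    cols≡ (r ∷ rs) = cong (proj₁ r ∷_) (cols≡ rs)
    nz : ∀ {p} → p ∈ blockSizes e π → proj₂ p ≢ 0
    nz p∈ k with ∈-map⁻ _ p∈
    ... | [] , b∈ , refl with ne b∈
    ... | _ , ()
    nz' : ∀ {p} → p ∈ runSizes rs → proj₂ p ≢ 0
    nz' p∈ k with ∈-map⁻ _ p∈
    nz' p∈ () | (c , p , q) , _ , refl

 -- Makes the weight of a partition readable from its diagram: the number of elements of each colour
 -- is the size of the block and also the total width of the run.
 diagram-sizes : ∀ {V₁ V₂ d π} → Unique (V₁ ++ V₂) → length V₁ ≡ length (wordA d) → length V₂ ≡ length (wordB d) →
   AllPairs Disj π → NonEmptyBlocks π → concat π ↭ V₁ ++ V₂ → MatchesOn (V₁ ++ V₂) π (colour V₁ V₂ d) →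
   map length π ↭ map proj₂ (runSizes (runs d))
 diagram-sizes {V₁} {V₂} {d@(diagram e o q₀ rest r)} {π} u l l' disj ne p m = ↭-trans (↭-reflexive (map-∘ π))
   (PermP.map⁺ proj₂ (block-sizes-↭ disj ne (λ k∈ l∈ → m (PermP.∈-resp-↭ p k∈) (PermP.∈-resp-↭ p l∈)) {runs d}
     (proj₁ (cols-number 0 ((e + o , q₀) ∷ rest))) counts))
   where
   words = colour-words V₁ V₂ d u l l'
   colouring = colour V₁ V₂ d
   counts : ∀ s → count s (map colouring (concat π)) ≡ count s (asc (runs d)) + count s (desc (runs d))
   counts s = trans (count-↭ s (PermP.map⁺ colouring p)) (trans (cong (count s) (map-++ colouring V₁ V₂))
     (trans (count-++ s (map colouring V₁) _) (cong₂ _+_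
       (trans (cong (count s) (proj₁ words)) (count-↭ s rotA))
       (trans (cong (count s) (proj₂ words)) (count-↭ s (rot-↭ (rotl-rot r (desc (runs d)))))))))
     where
     rotA : wordA d ↭ asc (runs d)
     rotA = ↭-trans (↭-reflexive (sym (++-assoc (replicate (suc e) 0) _ _))) (↭-trans (PermP.++-comm (replicate (suc e) 0 ++ asc (number 1 rest)) (replicate o 0))
       (↭-reflexive (trans (sym (++-assoc (replicate o 0) _ _)) (cong (_++ asc (number 1 rest))
         (trans (replicate-+ o (suc e) 0) (cong (λ k → replicate k 0) (ℕP.+-comm o (suc e))))))))

-- Sums over spoke partitions as sums over diagrams

module DiagramSums where
 open BooleanReflection
 open CycleCounting using (unique-↭; unique-∉)
 open SpokeWords using (Run)
 open NonCrossingPartitions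
 open AnnularCharacterisation using (unique-++-disjoint; unique-++ʳ)
 open PartitionSplitting
 open SpokeDiagrams
 open DiagramPatterns

 open Diagram using (wordA; wordB; runs)

 module _ {x : ℕ} where
  same-new⁻ : ∀ {ρ k l} → k ≢ x → SameBlock ([ x ] ∷ ρ) k l → SameBlock ρ k l
  same-new⁻ h (_ , here ≡.refl , here e , _) = ⊥-elim (h e)
  same-new⁻ h (b , there b∈ , k∈ , l∈) = b , b∈ , k∈ , l∈

  same-new⁺ : ∀ {ρ k l} → SameBlock ρ k l → SameBlock ([ x ] ∷ ρ) k l
  same-new⁺ (b , b∈ , k∈ , l∈) = b , there b∈ , k∈ , l∈

  same-add⁻ : ∀ {ρ ρ' k l} → Add x ρ ρ' → k ≢ x → l ≢ x → SameBlock ρ' k l → SameBlock ρ k l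
  same-add⁻ a h h' (b , b∈ , k∈ , l∈) with Add-new a b∈
  ... | b' , b'∈ , inj₁ ≡.refl = b , b'∈ , k∈ , l∈
  ... | b' , b'∈ , inj₂ ≡.refl = b' , b'∈ , Any.tail h k∈ , Any.tail h' l∈

  same-add⁺ : ∀ {ρ ρ' k l} → Add x ρ ρ' → SameBlock ρ k l → SameBlock ρ' k l
  same-add⁺ a (b , b∈ , k∈ , l∈) with Add-old a b∈
  ... | .b , b'∈ , inj₁ ≡.refl = b , b'∈ , k∈ , l∈
  ... | .(x ∷ b) , b'∈ , inj₂ ≡.refl = x ∷ b , b'∈ , there k∈ , there l∈

 blocks-disj : ∀ π → Unique (concat π) → AllPairs Disj π
 blocks-disj [] u = []
 blocks-disj (b ∷ π) u = All.tabulate (λ b'∈ y∈ y∈' → unique-++-disjoint u y∈ (∈-block⇒∈-concat b'∈ y∈')) ∷ blocks-disj π (unique-++ʳ b u)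

 partition-disj : ∀ {L π} → Unique L → IsPartition L π → AllPairs Disj π
 partition-disj {π = π} u p = blocks-disj π (unique-↭ (↭-sym (partition-↭ p)) u)

 matches : List ℕ → Blocks → (ℕ → ℕ) → Bool
 matches L ρ e = all (λ k → all (λ l → boolEq (sameBlock ρ k l) (e k ≡ᵇ e l)) L) L

 matches-sound : ∀ L {ρ e} → matches L ρ e ≡ true → MatchesOn L ρ e
 matches-sound L {ρ} {e} h {k} {l} k∈ l∈ = (λ s → ≡ᵇ-sound (≡.trans (≡.sym eq) (sameBlock-complete s))) ,
   (λ s → sameBlock-sound ρ (≡.trans eq (≡ᵇ-complete s)))
   where
   eq : sameBlock ρ k l ≡ (e k ≡ᵇ e l)
   eq = boolEq-sound (all-sound _ {L} (all-sound (λ k → all (λ l → boolEq (sameBlock ρ k l) (e k ≡ᵇ e l)) L) {L} h k∈) l∈)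

 matches-complete : ∀ L {ρ e} → MatchesOn L ρ e → matches L ρ e ≡ true
 matches-complete L {ρ} {e} m = all-complete _ L (λ k∈ → all-complete _ L (λ l∈ → boolEq-complete (bool-ext
   (λ h → ≡ᵇ-complete (proj₁ (m k∈ l∈) (sameBlock-sound ρ h))) (λ h → sameBlock-complete (proj₂ (m k∈ l∈) (≡ᵇ-sound h))))))

 isSpoke : List ℕ → List ℕ → Blocks → Bool
 isSpoke V₁ V₂ ρ = any (λ d → matches (V₁ ++ V₂) ρ (colour V₁ V₂ d)) (diagrams (length V₁) (length V₂))

 module MatchSum {c ℓ : Level} (R : CommutativeRing c ℓ) where
  open CommutativeRing R hiding (zero)
  open Over R
  open Solver R
  open SumProperties R
  open PartitionSums R
  open SplitSums R

  if-true : ∀ {b : Bool} {x y : Carrier} → b ≡ true → (if b then x else y) ≈ x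
  if-true ≡.refl = refl

  if-false : ∀ {b : Bool} {x y : Carrier} → ¬ b ≡ true → (if b then x else y) ≈ y
  if-false {true} h = ⊥-elim (h ≡.refl)
  if-false {false} h = refl

  private
    add-block : ∀ {x π π'} → Add x π π' → ∃[ b ] (b ∈ π × (x ∷ b) ∈ π')
    add-block here = _ , here ≡.refl , here ≡.refl
    add-block (there a) with add-block a
    ... | b , b∈ , b'∈ = b , there b∈ , there b'∈

  -- A partition of L is determined by the equality pattern of a colouring e of L.
  module _ (e : ℕ → ℕ) (X : Carrier) where

   private
     term : List ℕ → Blocks → Carrier
     term L ρ = if matches L ρ e then X else 0#

     module Step {x : ℕ} {L : List ℕ} (u : Unique (x ∷ L)) {ρ : Blocks} (p : IsPartition L ρ) where
      x∉L : x ∉ L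
      x∉L = unique-∉ u
      in-L : ∀ {b y} → b ∈ ρ → y ∈ b → y ∈ L
      in-L b∈ y∈ = PermP.∈-resp-↭ (partition-↭ p) (∈-block⇒∈-concat b∈ y∈)
      ≢x : ∀ {y} → y ∈ L → y ≢ x
      ≢x y∈ ≡.refl = x∉L y∈
      uL : Unique L
      uL = AP.tail u
      disj = partition-disj uL p
      ne = partition-nonEmpty p

      restrict-new : MatchesOn (x ∷ L) ([ x ] ∷ ρ) e → MatchesOn L ρ e
      restrict-new m k∈ l∈ = (λ s → proj₁ (m (there k∈) (there l∈)) (same-new⁺ s)) ,
        (λ s → same-new⁻ (≢x k∈) (proj₂ (m (there k∈) (there l∈)) s))

      restrict-add : ∀ {ρ'} → Add x ρ ρ' → MatchesOn (x ∷ L) ρ' e → MatchesOn L ρ e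
      restrict-add a m k∈ l∈ = (λ s → proj₁ (m (there k∈) (there l∈)) (same-add⁺ a s)) ,
        (λ s → same-add⁻ a (≢x k∈) (≢x l∈) (proj₂ (m (there k∈) (there l∈)) s))

      no-match : ¬ MatchesOn L ρ e → term (x ∷ L) ([ x ] ∷ ρ) + addSum x ρ (term (x ∷ L)) ≈ 0#
      no-match h = trans (+-cong (if-false (λ k → h (restrict-new (matches-sound (x ∷ L) k))))
        (addSum-0 ρ _ (λ a → if-false (λ k → h (restrict-add a (matches-sound (x ∷ L) k)))))) (+-identityˡ 0#)

      match-new : MatchesOn L ρ e → (∀ {y} → y ∈ L → e x ≢ e y) → term (x ∷ L) ([ x ] ∷ ρ) + addSum x ρ (term (x ∷ L)) ≈ X
      match-new m h = trans (+-cong (if-true (matches-complete (x ∷ L) m')) (addSum-0 ρ _ never)) (+-identityʳ X)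
        where
        m' : MatchesOn (x ∷ L) ([ x ] ∷ ρ) e
        m' (here ≡.refl) (here ≡.refl) = (λ _ → ≡.refl) , (λ _ → [ x ] , here ≡.refl , here ≡.refl , here ≡.refl)
        m' (here ≡.refl) (there l∈) = (λ { (_ , here ≡.refl , _ , here k) → ⊥-elim (≢x l∈ k)
          ; (b , there b∈ , x∈ , _) → ⊥-elim (x∉L (in-L b∈ x∈)) }) , (λ k → ⊥-elim (h l∈ k))
        m' (there k∈) (here ≡.refl) = (λ { (_ , here ≡.refl , here k , _) → ⊥-elim (≢x k∈ k)
          ; (b , there b∈ , _ , x∈) → ⊥-elim (x∉L (in-L b∈ x∈)) }) , (λ k → ⊥-elim (h k∈ (≡.sym k)))
        m' (there k∈) (there l∈) = (λ s → proj₁ (m k∈ l∈) (same-new⁻ (≢x k∈) s)) , (λ k → same-new⁺ (proj₂ (m k∈ l∈) k))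
        never : ∀ {ρ'} → Add x ρ ρ' → term (x ∷ L) ρ' ≈ 0#
        never a with add-block a
        ... | b , b∈ , xb∈ with ne b∈
        ... | y , y∈ = if-false (λ k → h (in-L b∈ y∈) (proj₁ (matches-sound (x ∷ L) k (here ≡.refl) (there (in-L b∈ y∈)))
          (x ∷ b , xb∈ , here ≡.refl , there y∈)))

      match-old : ∀ {y} → MatchesOn L ρ e → y ∈ L → e x ≡ e y → term (x ∷ L) ([ x ] ∷ ρ) + addSum x ρ (term (x ∷ L)) ≈ X
      match-old {y} m y∈L exy with ∈-concat⇒∈-block ρ (PermP.∈-resp-↭ (↭-sym (partition-↭ p)) y∈L)
      ... | b , b∈ , y∈b with ∈-∃++ b∈
      ... | α , β , ≡.refl = trans (+-cong not-new (trans (addSum-++ x α (b ∷ β) _) (+-cong left (+-cong here-X right))))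
        (solve 1 (λ X → con (0 , 0) :+ (con (0 , 0) :+ (X :+ con (0 , 0))) := X) refl X)
        where
        not-new : term (x ∷ L) ([ x ] ∷ ρ) ≈ 0#
        not-new = if-false (λ k → absurd (proj₂ (matches-sound (x ∷ L) k (here ≡.refl) (there y∈L)) exy))
          where
          absurd : SameBlock ([ x ] ∷ ρ) x y → ⊥
          absurd (_ , here ≡.refl , _ , here k) = ≢x y∈L k
          absurd (b' , there b'∈ , x∈ , _) = x∉L (in-L b'∈ x∈)
        other : ∀ {b' ρ'} → b' ∈ ρ → (x ∷ b') ∈ ρ' → b' ≢ b → term (x ∷ L) ρ' ≈ 0#
        other {b'} b'∈ xb'∈ h with ne b'∈
        ... | z , z∈ = if-false (λ k → clash (proj₁ (matches-sound (x ∷ L) k (here ≡.refl) (there (in-L b'∈ z∈))) (x ∷ b' , xb'∈ , here ≡.refl , there z∈)))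
          where
          clash : e x ≡ e z → ⊥
          clash exz with proj₂ (m (in-L b'∈ z∈) y∈L) (≡.trans (≡.sym exz) exy)
          ... | b'' , b''∈ , z∈'' , y∈'' = h (≡.trans (≡.sym (disj-same disj b''∈ b'∈ z∈'' z∈)) (disj-same disj b''∈ b∈ y∈'' y∈b))
        split-disj : ∀ α {β} → AllPairs Disj (α ++ b ∷ β) → (∀ {b'} → b' ∈ α → Disj b' b) × (∀ {b'} → b' ∈ β → Disj b b')
        split-disj [] (h ∷ _) = (λ ()) , λ b'∈ → All.lookup h b'∈
        split-disj (a ∷ α) (h ∷ d) with split-disj α d
        ... | f , g = (λ { (here ≡.refl) → All.lookup h (∈-++⁺ʳ α (here ≡.refl)) ; (there k) → f k }) , g
        left : addSum x α (λ α' → term (x ∷ L) (α' ++ b ∷ β)) ≈ 0#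
        left = addSum-0 α _ (λ a → let (b' , b'∈ , xb'∈) = add-block a in
          other (∈-++⁺ˡ b'∈) (∈-++⁺ˡ xb'∈) (λ { ≡.refl → proj₁ (split-disj α disj) b'∈ y∈b y∈b }))
        right : addSum x β (λ β' → term (x ∷ L) (α ++ b ∷ β')) ≈ 0#
        right = addSum-0 β _ (λ a → let (b' , b'∈ , xb'∈) = add-block a in
          other (∈-++⁺ʳ α (there b'∈)) (∈-++⁺ʳ α (there xb'∈)) (λ { ≡.refl → proj₂ (split-disj α disj) b'∈ y∈b y∈b }))
        ρ' : Blocks
        ρ' = α ++ (x ∷ b) ∷ β
        a₀ : Add x ρ ρ'
        a₀ = Add-at α b β
        xb∈ : (x ∷ b) ∈ ρ'
        xb∈ = ∈-++⁺ʳ α (here ≡.refl)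
        x-block : ∀ {l} → l ∈ L → SameBlock ρ' x l → SameBlock ρ y l
        x-block l∈ (b' , b'∈ , x∈ , l∈b') with ∈-++⁻ α b'∈
        ... | inj₁ h = ⊥-elim (x∉L (in-L (∈-++⁺ˡ h) x∈))
        ... | inj₂ (there h) = ⊥-elim (x∉L (in-L (∈-++⁺ʳ α (there h)) x∈))
        x-block l∈ (_ , b'∈ , x∈ , here k) | inj₂ (here ≡.refl) = ⊥-elim (≢x l∈ k)
        x-block l∈ (_ , b'∈ , x∈ , there l∈b) | inj₂ (here ≡.refl) = b , b∈ , y∈b , l∈b
        block-x : ∀ {l} → SameBlock ρ y l → SameBlock ρ' x l
        block-x (b' , b'∈ , y∈' , l∈) with disj-same disj b'∈ b∈ y∈' y∈b
        ... | ≡.refl = x ∷ b , xb∈ , here ≡.refl , there l∈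
        flip : ∀ {π k l} → SameBlock π k l → SameBlock π l k
        flip (b , b∈ , k∈ , l∈) = b , b∈ , l∈ , k∈
        m' : MatchesOn (x ∷ L) ρ' e
        m' (here ≡.refl) (here ≡.refl) = (λ _ → ≡.refl) , (λ _ → x ∷ b , xb∈ , here ≡.refl , here ≡.refl)
        m' (here ≡.refl) (there l∈) = (λ s → ≡.trans exy (proj₁ (m y∈L l∈) (x-block l∈ s))) ,
          (λ k → block-x (proj₂ (m y∈L l∈) (≡.trans (≡.sym exy) k)))
        m' (there k∈) (here ≡.refl) = (λ s → ≡.trans (≡.sym (proj₁ (m y∈L k∈) (x-block k∈ (flip s)))) (≡.sym exy)) ,
          (λ k → flip (block-x (proj₂ (m y∈L k∈) (≡.trans (≡.sym exy) (≡.sym k)))))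
        m' (there k∈) (there l∈) = (λ s → proj₁ (m k∈ l∈) (same-add⁻ a₀ (≢x k∈) (≢x l∈) s)) , (λ k → same-add⁺ a₀ (proj₂ (m k∈ l∈) k))
        here-X : term (x ∷ L) ρ' ≈ X
        here-X = if-true (matches-complete (x ∷ L) m')

      colour-dec : ∀ L' → (∃[ y ] (y ∈ L' × e x ≡ e y)) ⊎ (∀ {y} → y ∈ L' → e x ≢ e y)
      colour-dec [] = inj₂ (λ ())
      colour-dec (y ∷ L') with e x ℕP.≟ e y | colour-dec L'
      ... | yes k | _ = inj₁ (y , here ≡.refl , k)
      ... | no _ | inj₁ (z , z∈ , k) = inj₁ (z , there z∈ , k)
      ... | no h | inj₂ h' = inj₂ (λ { (here ≡.refl) → h ; (there z∈) → h' z∈ })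

      -- A matching partition of L extends to x in exactly one matching way: by a new block if the
      -- colour of x is new, and otherwise by the block of that colour. A partition that fails on L
      -- has no matching extension.
      combined : term (x ∷ L) ([ x ] ∷ ρ) + addSum x ρ (term (x ∷ L)) ≈ term L ρ
      combined with matches L ρ e in eq
      ... | false = no-match (λ m → true≢false (≡.trans (≡.sym (matches-complete L m)) eq))
      ... | true with colour-dec L
      ... | inj₁ (y , y∈ , k) = match-old (matches-sound L eq) y∈ k
      ... | inj₂ h = match-new (matches-sound L eq) h

   match-sum : ∀ L → Unique L → spSum L (λ ρ → if matches L ρ e then X else 0#) ≈ X
   match-sum [] u = refl
   match-sum (x ∷ L) u@(_ ∷ uL) = trans (spSum-cong L (λ p → Step.combined u p)) (match-sum L uL)

  module SpokeSum (κ : ℕ → Carrier) where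

   wt : Blocks → Carrier
   wt π = prodR (map (λ V → κ (length V)) π)

   runWeight : List Run → Carrier
   runWeight rs = prodR (map (λ s → κ (proj₂ s)) (runSizes rs))

   private
     -- At most one d satisfies m, so the indicator of existence is the sum of the indicators.
     sum-any : ∀ (m : Diagram → Bool) (w : Diagram → Carrier) X (D : List Diagram) → Unique D →
       (∀ {d d'} → d ∈ D → d' ∈ D → m d ≡ true → m d' ≡ true → d ≡ d') → (∀ {d} → d ∈ D → m d ≡ true → X ≈ w d) →
       (if any m D then X else 0#) ≈ sumR (map (λ d → if m d then w d else 0#) D)
     sum-any m w X [] u inj h = refl
     sum-any m w X (d ∷ D) (d∉ ∷ u) inj h with m d in eq
     ... | true = trans (h (here ≡.refl) eq) (sym (trans (+-congˡ (zeros D id)) (+-identityʳ _)))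
       where
       zeros : ∀ D' → (∀ {d'} → d' ∈ D' → d' ∈ D) → sumR (map (λ d → if m d then w d else 0#) D') ≈ 0#
       zeros [] sub = refl
       zeros (d' ∷ D') sub = trans (+-cong (if-false (λ k → All.lookup d∉ (sub (here ≡.refl)) (inj (here ≡.refl) (there (sub (here ≡.refl))) eq k))) (zeros D' (sub ∘ there))) (+-identityˡ 0#)
     ... | false = trans (sum-any m w X D u (λ d∈ d'∈ → inj (there d∈) (there d'∈)) (λ d∈ → h (there d∈))) (sym (+-identityˡ _))

     spSum-sumR : ∀ {a} {A : Set a} L (F : Blocks → A → Carrier) D → spSum L (λ ρ → sumR (map (F ρ) D)) ≈ sumR (map (λ d → spSum L (λ ρ → F ρ d)) D)
     spSum-sumR L F [] = spSum-0 L (λ _ → refl)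
     spSum-sumR L F (d ∷ D) = trans (spSum-+ L _ _) (+-congˡ (spSum-sumR L F D))

   -- A spoke partition matches exactly one diagram; after exchanging the sums, each diagram is
   -- matched by exactly one partition.
   spoke-sum : ∀ V₁ V₂ {p q} → Unique (V₁ ++ V₂) → length V₁ ≡ suc p → length V₂ ≡ suc q →
     spSum (V₁ ++ V₂) (λ ρ → if isSpoke V₁ V₂ ρ then wt ρ else 0#) ≈ sumR (map (runWeight ∘ runs) (diagrams (suc p) (suc q)))
   spoke-sum V₁ V₂ {p} {q} u l l' = trans (spSum-cong L pointwise) (trans (spSum-sumR L _ D)
     (trans (sumR-cong _ _ D (λ d → match-sum (colour V₁ V₂ d) (runWeight (runs d)) L u))
       (reflexive (cong₂ (λ x y → sumR (map (runWeight ∘ runs) (diagrams x y))) l l'))))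
     where
     L = V₁ ++ V₂
     D = diagrams (length V₁) (length V₂)
     to : ∀ {d} → d ∈ D → d ∈ diagrams (suc p) (suc q)
     to {d} = subst₂ (λ x y → d ∈ diagrams x y) l l'
     pointwise : ∀ {ρ} → IsPartition L ρ → (if isSpoke V₁ V₂ ρ then wt ρ else 0#) ≈
       sumR (map (λ d → if matches L ρ (colour V₁ V₂ d) then runWeight (runs d) else 0#) D)
     pointwise {ρ} P = sum-any (λ d → matches L ρ (colour V₁ V₂ d)) (runWeight ∘ runs) (wt ρ) D (subst₂ (λ x y → Unique (diagrams x y)) (≡.sym l) (≡.sym l') (diagrams-unique (suc p) (suc q)))
       (λ {d} {d'} d∈ d'∈ m m' → pattern-unique {V₁ = V₁} {V₂} {colour V₁ V₂ d} {d} {d'} u l l' (to d∈) (to d'∈) (λ _ _ → id , id)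
         (λ k∈ l∈ → (λ e → proj₁ (sound d' m' k∈ l∈) (proj₂ (sound d m k∈ l∈) e)) ,
           (λ e → proj₁ (sound d m k∈ l∈) (proj₂ (sound d' m' k∈ l∈) e))))
       (λ {d} d∈ m → weights d∈ (sound d m))
       where
       sound : ∀ d → matches L ρ (colour V₁ V₂ d) ≡ true → MatchesOn L ρ (colour V₁ V₂ d)
       sound d = matches-sound L {ρ} {colour V₁ V₂ d}
       weights : ∀ {d} → d ∈ D → MatchesOn L ρ (colour V₁ V₂ d) → wt ρ ≈ runWeight (runs d)
       weights {d} d∈ m = trans (reflexive (cong prodR (map-∘ ρ)))
         (trans (prodR-↭ (PermP.map⁺ κ (diagram-sizes {V₁} {V₂} {d} u (≡.trans l (≡.sym (proj₁ len))) (≡.trans l' (≡.sym (proj₂ len)))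
           (partition-disj u P) (partition-nonEmpty P) (partition-↭ P) m)))
           (reflexive (cong prodR (≡.sym (map-∘ (runSizes (runs d)))))))
         where
         len : length (wordA d) ≡ suc p × length (wordB d) ≡ suc q
         len = diagrams-length p q (to d∈)

-- From annular words to annular partitions

module BridgePatterns where
 open import Data.List.Relation.Binary.Sublist.Propositional as Sub using (_⊆_; _∷ʳ_; _∷_; [])
 open ≡ using (refl; sym; trans)
 open BooleanReflection
 open CycleCounting using (unique-∉)
 open SpokeWords
 open NonCrossingPartitions using (Disj)
 open PartitionSplitting
 open DiagramPatterns

 Increasing : List ℕ → Set
 Increasing = AllPairs _<_

 allPairs-⊆ : ∀ {R : ℕ → ℕ → Set} {u w} → u ⊆ w → AllPairs R w → AllPairs R u
 allPairs-⊆ [] [] = []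
 allPairs-⊆ (_ ∷ʳ s) (h ∷ i) = allPairs-⊆ s i
 allPairs-⊆ (refl ∷ s) (h ∷ i) = All.tabulate (λ y∈ → All.lookup h (Sub.lookup s y∈)) ∷ allPairs-⊆ s i

 -- Turns the four positions p < q < r < s of a crossing into a subword of the increasing list.
 increasing-sub : ∀ {u w} → Increasing u → Increasing w → (∀ {x} → x ∈ u → x ∈ w) → u ⊆ w
 increasing-sub {[]} _ _ _ = SubP.[]⊆-universal _
 increasing-sub {x ∷ u} {[]} _ _ h with h (here refl)
 ... | ()
 increasing-sub {x ∷ u} {y ∷ w} (a ∷ i) (b ∷ j) h with h (here refl)
 ... | here refl = refl ∷ increasing-sub i j (λ z∈ → Any.tail (λ { refl → ℕP.<-irrefl refl (All.lookup a z∈) }) (h (there z∈)))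
 ... | there x∈w = y ∷ʳ increasing-sub (a ∷ i) j (λ z∈ → Any.tail (λ { refl → ℕP.<-irrefl refl (below z∈) }) (h z∈))
   where
   below : ∀ {z} → z ∈ x ∷ u → y < z
   below (here refl) = All.lookup b x∈w
   below (there z∈) = ℕP.<-trans (All.lookup b x∈w) (All.lookup a z∈)

 ⊆-map⁻ : ∀ (h : ℕ → ℕ) w {u} → u ⊆ map h w → ∃[ u' ] (u' ⊆ w × map h u' ≡ u)
 ⊆-map⁻ h [] [] = [] , [] , refl
 ⊆-map⁻ h (x ∷ w) (_ ∷ʳ s) with ⊆-map⁻ h w s
 ... | u' , s' , e = u' , x ∷ʳ s' , e
 ⊆-map⁻ h (x ∷ w) (refl ∷ s) with ⊆-map⁻ h w s
 ... | u' , s' , e = x ∷ u' , refl ∷ s' , cong (h x ∷_) e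

 module _ {A : List ℕ} {h : ℕ → ℕ} {R : ℕ → ℕ → Set} (inc : Increasing A)
  (h⇒R : ∀ {x y} → x ∈ A → y ∈ A → h x ≡ h y → R x y) (R⇒h : ∀ {x y} → x ∈ A → y ∈ A → R x y → h x ≡ h y) where

  ncword⇒noncrossing : NCWord (map h A) → ¬ Crossing A R
  ncword⇒noncrossing nc (p , q , r , s , p∈ , q∈ , r∈ , s∈ , l₁ , l₂ , l₃ , pr , qs , pq) =
    nc (h p) (h q) (λ e → pq (h⇒R p∈ q∈ e))
      (subst₂ (λ a b → h p ∷ h q ∷ a ∷ b ∷ [] ⊆ map h A) (sym (R⇒h p∈ r∈ pr)) (sym (R⇒h q∈ s∈ qs))
        (SubP.map⁺ h (increasing-sub sorted inc (λ { (here refl) → p∈ ; (there (here refl)) → q∈ ; (there (there (here refl))) → r∈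
          ; (there (there (there (here refl)))) → s∈ }))))
    where
    sorted : Increasing (p ∷ q ∷ r ∷ s ∷ [])
    sorted = (l₁ ∷ ℕP.<-trans l₁ l₂ ∷ ℕP.<-trans l₁ (ℕP.<-trans l₂ l₃) ∷ []) ∷ (l₂ ∷ ℕP.<-trans l₂ l₃ ∷ []) ∷ (l₃ ∷ []) ∷ [] ∷ []

  noncrossing⇒ncword : ¬ Crossing A R → NCWord (map h A)
  noncrossing⇒ncword nc a b a≢b s with ⊆-map⁻ h A s
  ... | p ∷ q ∷ r ∷ t ∷ [] , s' , e with allPairs-⊆ s' inc | ∷-injective e
  ... | (l₁ ∷ _) ∷ (l₂ ∷ _) ∷ (l₃ ∷ []) ∷ _ | e₁ , e' with ∷-injective e'
  ... | e₂ , e'' with ∷-injective e''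
  ... | e₃ , e''' = nc (p , q , r , t , p∈ , q∈ , r∈ , t∈ , l₁ , l₂ , l₃ , h⇒R p∈ r∈ (trans e₁ (sym e₃)) ,
    h⇒R q∈ t∈ (trans e₂ (sym (proj₁ (∷-injective e''')))) , λ k → a≢b (trans (sym e₁) (trans (R⇒h p∈ q∈ k) e₂)))
    where
    p∈ = Sub.lookup s' (here refl)
    q∈ = Sub.lookup s' (there (here refl))
    r∈ = Sub.lookup s' (there (there (here refl)))
    t∈ = Sub.lookup s' (there (there (there (here refl))))

 -- The index of the first block containing x. For disjoint blocks it is a colouring whose classes
 -- are exactly the blocks.
 colouring : Blocks → ℕ → ℕ
 colouring [] x = 0
 colouring (b ∷ π) x = if memb x b then 0 else suc (colouring π x)

 colouring-in : ∀ {b π x} → x ∈ b → colouring (b ∷ π) x ≡ 0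
 colouring-in {b} {π} {x} x∈ = cong (λ t → if t then 0 else suc (colouring π x)) (memb-complete x∈)

 colouring-out : ∀ {b π x} → x ∉ b → colouring (b ∷ π) x ≡ suc (colouring π x)
 colouring-out {b} {π} {x} x∉ = cong (λ t → if t then 0 else suc (colouring π x)) (≡false (λ e → x∉ (memb-sound b e)))

 colouring⇒same : ∀ π {x y} → x ∈ concat π → y ∈ concat π → colouring π x ≡ colouring π y → SameBlock π x y
 colouring⇒same (b ∷ π) {x} {y} x∈ y∈ e with memb-dec x b | memb-dec y b
 ... | inj₁ h | inj₁ h' = b , here refl , h , h'
 ... | inj₁ h | inj₂ h' = ⊥-elim (ℕP.0≢1+n (trans (sym (colouring-in {b} {π} h)) (trans e (colouring-out {b} {π} h'))))
 ... | inj₂ h | inj₁ h' = ⊥-elim (ℕP.0≢1+n (trans (sym (colouring-in {b} {π} h')) (trans (sym e) (colouring-out {b} {π} h))))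
 ... | inj₂ h | inj₂ h' with colouring⇒same π (later h x∈) (later h' y∈) (ℕP.suc-injective (trans (sym (colouring-out {b} {π} h)) (trans e (colouring-out {b} {π} h'))))
   where
   later : ∀ {z} → z ∉ b → z ∈ concat (b ∷ π) → z ∈ concat π
   later h z∈ with ∈-++⁻ b z∈
   ... | inj₁ k = ⊥-elim (h k)
   ... | inj₂ k = k
 ... | b' , b'∈ , k , k' = b' , there b'∈ , k , k'

 same⇒colouring : ∀ {π x y} → AllPairs Disj π → SameBlock π x y → colouring π x ≡ colouring π y
 same⇒colouring {b ∷ π} (d ∷ ds) (.b , here refl , h , h') = trans (colouring-in {b} {π} h) (sym (colouring-in {b} {π} h'))
 same⇒colouring {b ∷ π} (d ∷ ds) (b' , there b'∈ , h , h') =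
   trans (colouring-out {b} {π} (λ k → All.lookup d b'∈ k h)) (trans (cong suc (same⇒colouring ds (b' , b'∈ , h , h')))
     (sym (colouring-out {b} {π} (λ k → All.lookup d b'∈ k h'))))

 -- One boundary circle: A with the partition V ∷ r, where V is the union of the through blocks
 -- and W lists the colours used on the other circle.
 module Side {A V : List ℕ} {r : Blocks} {c : ℕ → ℕ} {W : List ℕ} (inc : Increasing A) (uA : Unique A) (P : IsPartition• A V r)
  (W⇒V : ∀ {x} → x ∈ A → c x ∈ W → x ∈ V) (V⇒W : ∀ {x} → x ∈ V → c x ∈ W)
  (c⇒same : ∀ {x y} → x ∈ A → x ∉ V → y ∈ A → y ∉ V → c x ≡ c y → SameBlock r x y)
  (same⇒c : ∀ {x y} → SameBlock r x y → c x ≡ c y) where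

  private
    h : ℕ → ℕ
    h x = merge W (c x)
    h⇒R : ∀ {x y} → x ∈ A → y ∈ A → h x ≡ h y → SameBlock (V ∷ r) x y
    h⇒R {x} {y} x∈ y∈ e with memb-dec x V | memb-dec y V
    ... | inj₁ k | inj₁ k' = V , here refl , k , k'
    ... | inj₁ k | inj₂ k' = ⊥-elim (ℕP.0≢1+n (trans (sym (merge-in W (V⇒W k))) (trans e (merge-out W (λ w → k' (W⇒V y∈ w))))))
    ... | inj₂ k | inj₁ k' = ⊥-elim (ℕP.0≢1+n (trans (sym (merge-in W (V⇒W k'))) (trans (sym e) (merge-out W (λ w → k (W⇒V x∈ w))))))
    ... | inj₂ k | inj₂ k' with c⇒same x∈ k y∈ k' (ℕP.suc-injective (trans (sym (merge-out W (λ w → k (W⇒V x∈ w)))) (trans e (merge-out W (λ w → k' (W⇒V y∈ w))))))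
    ... | b , b∈ , m , m' = b , there b∈ , m , m'
    R⇒h : ∀ {x y} → x ∈ A → y ∈ A → SameBlock (V ∷ r) x y → h x ≡ h y
    R⇒h x∈ y∈ (.V , here refl , k , k') = trans (merge-in W (V⇒W k)) (sym (merge-in W (V⇒W k')))
    R⇒h x∈ y∈ (b , there b∈ , k , k') = cong (merge W) (same⇒c (b , b∈ , k , k'))

  restrict-V : restrict W (map c A) ≡ map c V
  restrict-V = go (partition•-⊆ P) uA W⇒V V⇒W
    where
    keep : ∀ {a} u → a ∈ W → restrict W (a ∷ u) ≡ a ∷ restrict W u
    keep {a} u a∈ = cong (λ t → if t then a ∷ restrict W u else restrict W u) (memb-complete a∈)
    go : ∀ {V' A'} → V' ⊆ A' → Unique A' → (∀ {x} → x ∈ A' → c x ∈ W → x ∈ V') → (∀ {x} → x ∈ V' → c x ∈ W) → restrict W (map c A') ≡ map c V'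
    go [] u f g = refl
    go (_∷ʳ_ {ys = A'} y s) u f g = trans (restrict-skip (map c A') (λ w → unique-∉ u (Sub.lookup s (f (here refl) w))))
      (go s (AP.tail u) (λ x∈ → f (there x∈)) g)
    go (_∷_ {x = x} {xs = V'} {y = y} {ys = A'} refl s) u f g = trans (keep (map c A') (g (here refl)))
      (cong (c x ∷_) (go s (AP.tail u) (λ z∈ w → Any.tail (λ { refl → unique-∉ u z∈ }) (f (there z∈) w)) (g ∘ there)))

  ncword⇒hasCrossing : NCWord (map (merge W) (map c A)) → hasCrossing A (V ∷ r) ≡ false
  ncword⇒hasCrossing nc = ≡false (λ e → ncword⇒noncrossing inc h⇒R R⇒h (subst NCWord (sym (map-∘ A)) nc) (hasCrossing-sound A (V ∷ r) e))

  hasCrossing⇒ncword : hasCrossing A (V ∷ r) ≡ false → NCWord (map (merge W) (map c A))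
  hasCrossing⇒ncword e = subst NCWord (map-∘ A) (noncrossing⇒ncword inc h⇒R R⇒h
    (λ k → true≢false (trans (sym (hasCrossing-complete A (V ∷ r) k)) e)))

module BridgePartitions where
 import Data.List.Relation.Binary.Sublist.Propositional as Sub
 open ≡ using (refl; sym; trans)
 open BooleanReflection
 open CycleCounting using (unique-↭)
 open SpokeWords
 open NonCrossingPartitions using (Disj; disj-same)
 open PartitionSplitting
 open AnnularCharacterisation using (unique-++-disjoint; unique-++ˡ; unique-++ʳ)
 open PermutationLists
 open SpokeDiagrams using (diagrams; diagrams-length)
 open DiagramPatterns
 open DiagramSums using (matches; matches-sound; matches-complete; isSpoke; blocks-disj)
 open BridgePatterns

 -- Opaque copies: unfolding the Boolean predicates makes goals intractable.
 opaque
   annular? : ℕ → ℕ → Blocks → Bool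
   annular? = isAnnNCPartition

   annular?≡ : ∀ i j π → annular? i j π ≡ isAnnNCPartition i j π
   annular?≡ i j π = refl

   crossing? : List ℕ → Blocks → Bool
   crossing? = hasCrossing

   crossing?≡ : ∀ el π → crossing? el π ≡ hasCrossing el π
   crossing?≡ el π = refl

 -- The candidate partition is assembled from ρ, a partition of V₁ ++ V₂ intended as the set of
 -- through blocks, and from the blocks of r₁ and r₂, each of which stays on its own circle.
 module Bridge (i j : ℕ) .{{_ : ℕ.NonZero i}} .{{_ : ℕ.NonZero j}} {V₁ V₂ : List ℕ} {r₁ r₂ ρ : Blocks}
  (P₁ : IsPartition• (setA i) V₁ r₁) (P₂ : IsPartition• (setB i j) V₂ r₂)
  (Pρ : IsPartition (V₁ ++ V₂) ρ) where
  open Tau i j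

  isA isB : ℕ → Bool
  isA x = x <ᵇ i
  isB x = not (x <ᵇ i)

  through : List ℕ → Bool
  through b = any isA b ∧ any isB b

  A B : List ℕ
  A = setA i
  B = setB i j

  π : Blocks
  π = ρ ++ r₁ ++ r₂

  c : ℕ → ℕ
  c = colouring π

  private
    V₁⊆A : ∀ {x} → x ∈ V₁ → x ∈ A
    V₁⊆A x∈ = Sub.lookup (partition•-⊆ P₁) x∈
    V₂⊆B : ∀ {x} → x ∈ V₂ → x ∈ B
    V₂⊆B x∈ = Sub.lookup (partition•-⊆ P₂) x∈
    r₁⊆A : ∀ {b x} → b ∈ r₁ → x ∈ b → x ∈ A
    r₁⊆A b∈ x∈ = PermP.∈-resp-↭ (partition•-↭ P₁) (∈-++⁺ʳ V₁ (∈-block⇒∈-concat b∈ x∈))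
    r₂⊆B : ∀ {b x} → b ∈ r₂ → x ∈ b → x ∈ B
    r₂⊆B b∈ x∈ = PermP.∈-resp-↭ (partition•-↭ P₂) (∈-++⁺ʳ V₂ (∈-block⇒∈-concat b∈ x∈))
    ρ⊆V : ∀ {b x} → b ∈ ρ → x ∈ b → x ∈ V₁ ++ V₂
    ρ⊆V b∈ x∈ = PermP.∈-resp-↭ (partition-↭ Pρ) (∈-block⇒∈-concat b∈ x∈)
    A∩B : ∀ {x} → x ∈ A → x ∉ B
    A∩B = unique-++-disjoint uniqueAB
    isA-A : ∀ {x} → x ∈ A → isA x ≡ true
    isA-A x∈ = <ᵇ-complete (∈A⇒< x∈)
    isB-B : ∀ {x} → x ∈ B → isB x ≡ true
    isB-B x∈ = not-complete (λ e → ℕP.<⇒≱ (<ᵇ-sound e) (∈B⇒≥ x∈))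

    covers : concat π ↭ A ++ B
    covers = begin
      concat (ρ ++ r₁ ++ r₂) ≡⟨ trans (sym (concat-++ ρ (r₁ ++ r₂))) (cong (concat ρ ++_) (sym (concat-++ r₁ r₂))) ⟩
      concat ρ ++ concat r₁ ++ concat r₂ ↭⟨ PermP.++⁺ʳ _ (partition-↭ Pρ) ⟩
      (V₁ ++ V₂) ++ concat r₁ ++ concat r₂ ≡⟨ ++-assoc V₁ V₂ _ ⟩
      V₁ ++ V₂ ++ concat r₁ ++ concat r₂ ≡⟨ cong (V₁ ++_) (++-assoc V₂ (concat r₁) (concat r₂)) ⟨
      V₁ ++ (V₂ ++ concat r₁) ++ concat r₂ ↭⟨ PermP.++⁺ˡ V₁ (PermP.++⁺ʳ (concat r₂) (PermP.++-comm V₂ (concat r₁))) ⟩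
      V₁ ++ (concat r₁ ++ V₂) ++ concat r₂ ≡⟨ cong (V₁ ++_) (++-assoc (concat r₁) V₂ (concat r₂)) ⟩
      V₁ ++ concat r₁ ++ V₂ ++ concat r₂ ≡⟨ ++-assoc V₁ (concat r₁) _ ⟨
      (V₁ ++ concat r₁) ++ V₂ ++ concat r₂ ↭⟨ PermP.++⁺ (partition•-↭ P₁) (partition•-↭ P₂) ⟩
      A ++ B ∎
      where open Perm.PermutationReasoning

    disj : AllPairs Disj π
    disj = blocks-disj π (unique-↭ (↭-sym covers) uniqueAB)

    covered : ∀ {x} → x ∈ A ++ B → x ∈ concat π
    covered x∈ = PermP.∈-resp-↭ (↭-sym covers) x∈

    c⇒same : ∀ {x y} → x ∈ A ++ B → y ∈ A ++ B → c x ≡ c y → SameBlock π x y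
    c⇒same x∈ y∈ = colouring⇒same π (covered x∈) (covered y∈)

    same⇒c : ∀ {x y} → SameBlock π x y → c x ≡ c y
    same⇒c = same⇒colouring disj

    in-AB : ∀ {k} → k ℕ.< n → k ∈ A ++ B
    in-AB {k} l = subst (k ∈_) (upTo-+ i j) (∈-upTo⁺ l)
      where open import Data.List.Membership.Propositional.Properties using (∈-upTo⁺)

    uA : Unique A
    uA = unique-++ˡ uniqueAB
    uB : Unique B
    uB = unique-++ʳ A uniqueAB
    uV : Unique (V₁ ++ V₂)
    uV = APP.++⁺ (allPairs-⊆ (partition•-⊆ P₁) uA) (allPairs-⊆ (partition•-⊆ P₂) uB) (All.tabulate (λ x∈ → All.tabulate (λ y∈ e →
      A∩B (V₁⊆A x∈) (subst (_∈ B) (sym e) (V₂⊆B y∈)))))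

    data Where (b : List ℕ) : Set where
      inρ : b ∈ ρ → Where b
      in₁ : b ∈ r₁ → Where b
      in₂ : b ∈ r₂ → Where b

    locate : ∀ {b} → b ∈ π → Where b
    locate b∈ with ∈-++⁻ ρ b∈
    ... | inj₁ h = inρ h
    ... | inj₂ h with ∈-++⁻ r₁ h
    ... | inj₁ h' = in₁ h'
    ... | inj₂ h' = in₂ h'

    π∋ρ : ∀ {b} → b ∈ ρ → b ∈ π
    π∋ρ = ∈-++⁺ˡ
    π∋r₁ : ∀ {b} → b ∈ r₁ → b ∈ π
    π∋r₁ b∈ = ∈-++⁺ʳ ρ (∈-++⁺ˡ b∈)
    π∋r₂ : ∀ {b} → b ∈ r₂ → b ∈ π
    π∋r₂ b∈ = ∈-++⁺ʳ ρ (∈-++⁺ʳ r₁ b∈)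

    V₁-side : ∀ {x} → x ∈ V₁ ++ V₂ → x ∈ A → x ∈ V₁
    V₁-side x∈ x∈A with ∈-++⁻ V₁ x∈
    ... | inj₁ h = h
    ... | inj₂ h = ⊥-elim (A∩B x∈A (V₂⊆B h))

    V₂-side : ∀ {x} → x ∈ V₁ ++ V₂ → x ∈ B → x ∈ V₂
    V₂-side x∈ x∈B with ∈-++⁻ V₁ x∈
    ... | inj₂ h = h
    ... | inj₁ h = ⊥-elim (A∩B (V₁⊆A h) x∈B)

    meeting : ∀ {x y} → x ∈ A → y ∈ B → c x ≡ c y → ∃[ b ] (b ∈ ρ × x ∈ b × y ∈ b)
    meeting x∈ y∈ e with c⇒same (∈-++⁺ˡ x∈) (∈-++⁺ʳ A y∈) e
    ... | b , b∈ , h , h' with locate b∈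
    ... | inρ k = b , k , h , h'
    ... | in₁ k = ⊥-elim (A∩B (r₁⊆A k h') y∈)
    ... | in₂ k = ⊥-elim (A∩B x∈ (r₂⊆B k h))

    nonThrough : ∀ {b} → b ∈ r₁ ++ r₂ → not (through b) ≡ true
    nonThrough {b} b∈ = not-complete (λ e → let (h , h') = ∧-sound {any isA b} e in clash (any-sound isA b h) (any-sound isB b h'))
      where
      clash : (∃[ x ] (x ∈ b × isA x ≡ true)) → (∃[ y ] (y ∈ b × isB y ≡ true)) → ⊥
      clash (x , x∈ , ex) (y , y∈ , ey) with ∈-++⁻ r₁ b∈
      ... | inj₁ h = not-sound ey (isA-A (r₁⊆A h y∈))
      ... | inj₂ h = ℕP.<⇒≱ (<ᵇ-sound ex) (∈B⇒≥ (r₂⊆B h x∈))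

    incA : Increasing A
    incA = APP.applyUpTo⁺₁ id i (λ l _ → l)
    incB : Increasing B
    incB = APP.map⁺ (AP.map (ℕP.+-monoʳ-< i) (APP.applyUpTo⁺₁ id j (λ l _ → l)))

    isAnn⇒ : annular? i j π ≡ true → AnnularNC (map c A) (map c B)
    isAnn⇒ h = isAnn⇒annular {π} {c} (λ _ _ e → same⇒c (sameBlock-sound π e)) (λ k l e → sameBlock-complete (c⇒same (in-AB k) (in-AB l) e)) (trans (sym (annular?≡ i j π)) h)

    ⇒isAnn : AnnularNC (map c A) (map c B) → annular? i j π ≡ true
    ⇒isAnn h = trans (annular?≡ i j π) (annular⇒isAnn {π} {c} (λ _ _ e → same⇒c (sameBlock-sound π e)) (λ k l e → sameBlock-complete (c⇒same (in-AB k) (in-AB l) e)) h)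

  module _ (thr : ∀ {b} → b ∈ ρ → through b ≡ true) where
   private
     A-end : ∀ {b} → b ∈ ρ → ∃[ x ] (x ∈ b × x ∈ V₁)
     A-end {b} b∈ with any-sound isA b (proj₁ (∧-sound {any isA b} (thr b∈)))
     ... | x , x∈ , e with ∈-++⁻ V₁ (ρ⊆V b∈ x∈)
     ... | inj₁ h = x , x∈ , h
     ... | inj₂ h = ⊥-elim (ℕP.<⇒≱ (<ᵇ-sound e) (∈B⇒≥ (V₂⊆B h)))

     B-end : ∀ {b} → b ∈ ρ → ∃[ x ] (x ∈ b × x ∈ V₂)
     B-end {b} b∈ with any-sound isB b (proj₂ (∧-sound {any isA b} (thr b∈)))
     ... | x , x∈ , e with ∈-++⁻ V₁ (ρ⊆V b∈ x∈)
     ... | inj₂ h = x , x∈ , h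
     ... | inj₁ h = ⊥-elim (not-sound e (isA-A (V₁⊆A h)))

     block-of : ∀ {x} → x ∈ V₁ ++ V₂ → ∃[ b ] (b ∈ ρ × x ∈ b)
     block-of x∈ = ∈-concat⇒∈-block ρ (PermP.∈-resp-↭ (↭-sym (partition-↭ Pρ)) x∈)

     -- Colours of B occurring in A are exactly those of V₁, and symmetrically.
     V₁⇒W : ∀ {x} → x ∈ V₁ → c x ∈ map c B
     V₁⇒W x∈ with block-of (∈-++⁺ˡ x∈)
     ... | b , b∈ , h with B-end b∈
     ... | y , y∈ , y∈V = subst (_∈ map c B) (same⇒c (b , π∋ρ b∈ , y∈ , h)) (∈-map⁺ c (V₂⊆B y∈V))

     V₂⇒W : ∀ {x} → x ∈ V₂ → c x ∈ map c A
     V₂⇒W x∈ with block-of (∈-++⁺ʳ V₁ x∈)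
     ... | b , b∈ , h with A-end b∈
     ... | y , y∈ , y∈V = subst (_∈ map c A) (same⇒c (b , π∋ρ b∈ , y∈ , h)) (∈-map⁺ c (V₁⊆A y∈V))

     W⇒V₁ : ∀ {x} → x ∈ A → c x ∈ map c B → x ∈ V₁
     W⇒V₁ x∈ w with ∈-map⁻ c w
     ... | y , y∈ , e with meeting x∈ y∈ e
     ... | b , b∈ , h , _ = V₁-side (ρ⊆V b∈ h) x∈

     W⇒V₂ : ∀ {x} → x ∈ B → c x ∈ map c A → x ∈ V₂
     W⇒V₂ x∈ w with ∈-map⁻ c w
     ... | y , y∈ , e with meeting y∈ x∈ (sym e)
     ... | b , b∈ , _ , h = V₂-side (ρ⊆V b∈ h) x∈

     same₁ : ∀ {x y} → x ∈ A → x ∉ V₁ → y ∈ A → y ∉ V₁ → c x ≡ c y → SameBlock r₁ x y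
     same₁ x∈ x∉ y∈ y∉ e with c⇒same (∈-++⁺ˡ x∈) (∈-++⁺ˡ y∈) e
     ... | b , b∈ , h , h' with locate b∈
     ... | inρ k = ⊥-elim (x∉ (V₁-side (ρ⊆V k h) x∈))
     ... | in₁ k = b , k , h , h'
     ... | in₂ k = ⊥-elim (A∩B x∈ (r₂⊆B k h))

     same₂ : ∀ {x y} → x ∈ B → x ∉ V₂ → y ∈ B → y ∉ V₂ → c x ≡ c y → SameBlock r₂ x y
     same₂ x∈ x∉ y∈ y∉ e with c⇒same (∈-++⁺ʳ A x∈) (∈-++⁺ʳ A y∈) e
     ... | b , b∈ , h , h' with locate b∈
     ... | inρ k = ⊥-elim (x∉ (V₂-side (ρ⊆V k h) x∈))
     ... | in₁ k = ⊥-elim (A∩B (r₁⊆A k h) x∈)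
     ... | in₂ k = b , k , h , h'

     same-r₁⇒c : ∀ {x y} → SameBlock r₁ x y → c x ≡ c y
     same-r₁⇒c (b , b∈ , h) = same⇒c (b , π∋r₁ b∈ , h)
     same-r₂⇒c : ∀ {x y} → SameBlock r₂ x y → c x ≡ c y
     same-r₂⇒c (b , b∈ , h) = same⇒c (b , π∋r₂ b∈ , h)

     module SA = Side {c = c} {W = map c B} incA uA P₁ W⇒V₁ V₁⇒W same₁ same-r₁⇒c
     module SB = Side {c = c} {W = map c A} incB uB P₂ W⇒V₂ V₂⇒W same₂ same-r₂⇒c

   annular⇒parts : annular? i j π ≡ true →
     crossing? A (V₁ ∷ r₁) ≡ false × crossing? B (V₂ ∷ r₂) ≡ false × Spokes (map c V₁) (map c V₂)
   annular⇒parts e = trans (crossing?≡ A (V₁ ∷ r₁)) (SA.ncword⇒hasCrossing (AnnularNC.ncU Q)) ,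
     trans (crossing?≡ B (V₂ ∷ r₂)) (SB.ncword⇒hasCrossing (AnnularNC.ncV Q)) ,
     subst₂ Spokes SA.restrict-V SB.restrict-V (AnnularNC.through Q)
     where
     Q : AnnularNC (map c A) (map c B)
     Q = isAnn⇒ e

   parts⇒annular : crossing? A (V₁ ∷ r₁) ≡ false → crossing? B (V₂ ∷ r₂) ≡ false → Spokes (map c V₁) (map c V₂) →
     annular? i j π ≡ true
   parts⇒annular u v s = ⇒isAnn (annularNC (SA.hasCrossing⇒ncword (trans (sym (crossing?≡ A (V₁ ∷ r₁))) u))
     (SB.hasCrossing⇒ncword (trans (sym (crossing?≡ B (V₂ ∷ r₂))) v))
     (subst₂ Spokes (sym SA.restrict-V) (sym SB.restrict-V) s))

  spokes-nonempty : ∀ {U W} → Spokes U W → U ≢ [] × W ≢ []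
  spokes-nonempty (spokes [] ne _ _ _) = ⊥-elim (ne refl)
  spokes-nonempty (spokes ((a , p , q) ∷ rs) _ _ rU rV) =
    (λ { refl → ¬∈[] (PermP.∈-resp-↭ (↭-sym (rot-↭ rU)) (here refl)) }) ,
    (λ { refl → ¬∈[] (PermP.∈-resp-↭ (↭-sym (rot-↭ rV)) (∈-++⁺ʳ (desc rs) (here refl))) })
    where
    ¬∈[] : ∀ {x : ℕ} → x ∈ [] → ⊥
    ¬∈[] ()

  private
    concat-ρ : ∀ {x} → x ∈ V₁ ++ V₂ → x ∈ A ++ B
    concat-ρ x∈ with ∈-++⁻ V₁ x∈
    ... | inj₁ h = ∈-++⁺ˡ (V₁⊆A h)
    ... | inj₂ h = ∈-++⁺ʳ A (V₂⊆B h)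

    ρ-same : ∀ {k l} → k ∈ V₁ ++ V₂ → c k ≡ c l → l ∈ V₁ ++ V₂ → SameBlock ρ k l
    ρ-same k∈ e l∈ with c⇒same (concat-ρ k∈) (concat-ρ l∈) e
    ... | b , b∈ , h , h' with locate b∈ | ∈-++⁻ V₁ k∈
    ... | inρ m | _ = b , m , h , h'
    ... | in₁ m | inj₁ k∈V = ⊥-elim (unique-++-disjoint (unique-↭ (↭-sym (partition•-↭ P₁)) uA) k∈V (∈-block⇒∈-concat m h))
    ... | in₁ m | inj₂ k∈V = ⊥-elim (A∩B (r₁⊆A m h) (V₂⊆B k∈V))
    ... | in₂ m | inj₁ k∈V = ⊥-elim (A∩B (V₁⊆A k∈V) (r₂⊆B m h))
    ... | in₂ m | inj₂ k∈V = ⊥-elim (unique-++-disjoint (unique-↭ (↭-sym (partition•-↭ P₂)) uB) k∈V (∈-block⇒∈-concat m h))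

    same-ρ : ∀ {k l} → SameBlock ρ k l → c k ≡ c l
    same-ρ (b , b∈ , h) = same⇒c (b , π∋ρ b∈ , h)

  module _ {p q : ℕ} (l₁ : length V₁ ≡ suc p) (l₂ : length V₂ ≡ suc q) where

   spokes⇒isSpoke : Spokes (map c V₁) (map c V₂) → isSpoke V₁ V₂ ρ ≡ true
   spokes⇒isSpoke s with spokes⇒pattern {c = c} uV l₁ l₂ s
   ... | d , d∈ , pat = any-complete (λ d → matches (V₁ ++ V₂) ρ (colour V₁ V₂ d)) {diagrams (length V₁) (length V₂)} {d}
     (subst₂ (λ x y → d ∈ diagrams x y) (sym l₁) (sym l₂) d∈)
     (matches-complete (V₁ ++ V₂) {ρ} {colour V₁ V₂ d} (λ k∈ l∈ → (λ s → proj₁ (pat k∈ l∈) (same-ρ s)) , (λ e → ρ-same k∈ (proj₂ (pat k∈ l∈) e) l∈)))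

   isSpoke⇒spokes : isSpoke V₁ V₂ ρ ≡ true → Spokes (map c V₁) (map c V₂)
   isSpoke⇒spokes e with any-sound _ (diagrams (length V₁) (length V₂)) e
   ... | d , d∈ , m = pattern⇒spokes {V₁} {V₂} {c} {d} uV (trans l₁ (sym (proj₁ len))) (trans l₂ (sym (proj₂ len)))
     (λ k∈ l∈ → (λ e → proj₁ (sound k∈ l∈) (ρ-same k∈ e l∈)) , (λ e → same-ρ (proj₂ (sound k∈ l∈) e)))
     where
     len = diagrams-length p q (subst₂ (λ x y → d ∈ diagrams x y) l₁ l₂ d∈)
     sound : MatchesOn (V₁ ++ V₂) ρ (colour V₁ V₂ d)
     sound = matches-sound (V₁ ++ V₂) {ρ} {colour V₁ V₂ d} m

   -- Every colour of a spoke diagram occurs in both words, so the block of that colour has an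
   -- element on either circle.
   spokes⇒through : Spokes (map c V₁) (map c V₂) → ∀ {b} → b ∈ ρ → through b ≡ true
   spokes⇒through (spokes rs _ _ rU rV) {b} b∈ with partition-nonEmpty Pρ b∈
   ... | y , y∈ = ∧-complete (endA colour∈) (endB colour∈)
     where
     colour∈ : c y ∈ cols rs
     colour∈ with ∈-++⁻ V₁ (ρ⊆V b∈ y∈)
     ... | inj₁ h = asc-cols rs (PermP.∈-resp-↭ (rot-↭ rU) (∈-map⁺ c h))
     ... | inj₂ h = desc-cols rs (PermP.∈-resp-↭ (rot-↭ rV) (∈-map⁺ c h))
     cols-desc : ∀ rs {a} → a ∈ cols rs → a ∈ desc rs
     cols-desc ((a , p , q) ∷ rs) (here refl) = ∈-++⁺ʳ (desc rs) (here refl)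
     cols-desc ((a , p , q) ∷ rs) (there a∈) = ∈-++⁺ˡ (cols-desc rs a∈)
     same-b : ∀ {x} → x ∈ V₁ ++ V₂ → c y ≡ c x → x ∈ b
     same-b x∈ e with ρ-same (ρ⊆V b∈ y∈) e x∈
     ... | b' , b'∈ , h , h' with disj-same disj (π∋ρ b'∈) (π∋ρ b∈) h y∈
     ... | refl = h'
     endA : c y ∈ cols rs → any isA b ≡ true
     endA k with ∈-map⁻ c (PermP.∈-resp-↭ (↭-sym (rot-↭ rU)) (cols-asc rs k))
     ... | x , x∈ , e = any-complete isA (same-b (∈-++⁺ˡ x∈) e) (isA-A (V₁⊆A x∈))
     endB : c y ∈ cols rs → any isB b ≡ true
     endB k with ∈-map⁻ c (PermP.∈-resp-↭ (↭-sym (rot-↭ rV)) (cols-desc rs k))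
     ... | x , x∈ , e = any-complete isB (same-b (∈-++⁺ʳ V₁ x∈) e) (isB-B (V₂⊆B x∈))

  selected : Bool
  selected = all through ρ ∧ all (not ∘ through) (r₁ ++ r₂)

  selected-sound : selected ≡ true → ∀ {b} → b ∈ ρ → through b ≡ true
  selected-sound e = all-sound through {ρ} (proj₁ (∧-sound {all through ρ} e))

  selected-complete : (∀ {b} → b ∈ ρ → through b ≡ true) → selected ≡ true
  selected-complete h = ∧-complete (all-complete through ρ h) (all-complete (not ∘ through) (r₁ ++ r₂) nonThrough)

  -- The factorisation behind the counting: the annular condition becomes one disc condition for
  -- each circle, with V₁ and V₂ as blocks, and a condition on ρ alone. Being selected is implied on
  -- the right because spokes meet both circles.
  annular-split : ∀ {p q} → length V₁ ≡ suc p → length V₂ ≡ suc q →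
    selected ∧ annular? i j π ≡ (not (crossing? A (V₁ ∷ r₁)) ∧ not (crossing? B (V₂ ∷ r₂))) ∧ isSpoke V₁ V₂ ρ
  annular-split l₁ l₂ = bool-ext fwd bwd
    where
    fwd : selected ∧ annular? i j π ≡ true → (not (crossing? A (V₁ ∷ r₁)) ∧ not (crossing? B (V₂ ∷ r₂))) ∧ isSpoke V₁ V₂ ρ ≡ true
    fwd e = ∧-complete (∧-complete (cong not (proj₁ parts)) (cong not (proj₁ (proj₂ parts)))) (spokes⇒isSpoke l₁ l₂ (proj₂ (proj₂ parts)))
      where
      es : selected ≡ true × annular? i j π ≡ true
      es = ∧-sound {selected} e
      parts : crossing? A (V₁ ∷ r₁) ≡ false × crossing? B (V₂ ∷ r₂) ≡ false × Spokes (map c V₁) (map c V₂)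
      parts = annular⇒parts (selected-sound (proj₁ es)) (proj₂ es)
    bwd : (not (crossing? A (V₁ ∷ r₁)) ∧ not (crossing? B (V₂ ∷ r₂))) ∧ isSpoke V₁ V₂ ρ ≡ true → selected ∧ annular? i j π ≡ true
    bwd e = ∧-complete (selected-complete (spokes⇒through l₁ l₂ s)) (parts⇒annular (spokes⇒through l₁ l₂ s)
      (≡false (not-sound (proj₁ nc))) (≡false (not-sound (proj₂ nc))) s)
      where
      es : not (crossing? A (V₁ ∷ r₁)) ∧ not (crossing? B (V₂ ∷ r₂)) ≡ true × isSpoke V₁ V₂ ρ ≡ true
      es = ∧-sound {not (crossing? A (V₁ ∷ r₁)) ∧ not (crossing? B (V₂ ∷ r₂))} e
      nc : not (crossing? A (V₁ ∷ r₁)) ≡ true × not (crossing? B (V₂ ∷ r₂)) ≡ true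
      nc = ∧-sound {not (crossing? A (V₁ ∷ r₁))} (proj₁ es)
      s : Spokes (map c V₁) (map c V₂)
      s = isSpoke⇒spokes l₁ l₂ (proj₂ es)

  -- Without elements of through blocks on one of the circles there is no spoke at all.
  annular-empty : V₁ ≡ [] ⊎ V₂ ≡ [] → ¬ (selected ∧ annular? i j π ≡ true)
  annular-empty h e = contra h
    where
    es : selected ≡ true × annular? i j π ≡ true
    es = ∧-sound {selected} e
    s : Spokes (map c V₁) (map c V₂)
    s = proj₂ (proj₂ (annular⇒parts (selected-sound (proj₁ es)) (proj₂ es)))
    contra : V₁ ≡ [] ⊎ V₂ ≡ [] → ⊥
    contra (inj₁ h) = proj₁ (spokes-nonempty s) (cong (map c) h)
    contra (inj₂ h) = proj₂ (spokes-nonempty s) (cong (map c) h)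

-- Absorbing the annular sum into the cylinder weights

module CylinderMoments where
 open BooleanReflection
 open NonCrossingPartitions
 open PartitionSplitting
 open PermutationLists using (upTo-+; module Tau)
 open SpokeDiagrams using (diagrams; module Diagram)
 open DiagramSums
 open BridgePatterns using (allPairs-⊆)
 open BridgePartitions

 any-cong : ∀ {a} {A : Set a} {p q : A → Bool} → (∀ x → p x ≡ q x) → ∀ xs → any p xs ≡ any q xs
 any-cong e [] = ≡.refl
 any-cong e (x ∷ xs) = cong₂ _∨_ (e x) (any-cong e xs)

 all-cong : ∀ {a} {A : Set a} {p q : A → Bool} → (∀ x → p x ≡ q x) → ∀ xs → all p xs ≡ all q xs
 all-cong e [] = ≡.refl
 all-cong e (x ∷ xs) = cong₂ _∧_ (e x) (all-cong e xs)

 same-↭ : ∀ {π π' k l} → π ↭ π' → SameBlock π k l → SameBlock π' k l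
 same-↭ p (b , b∈ , h) = b , PermP.∈-resp-↭ p b∈ , h

 annular?-↭ : ∀ i j {π π'} → π ↭ π' → annular? i j π ≡ annular? i j π'
 annular?-↭ i j {π} {π'} p = ≡.trans (annular?≡ i j π) (≡.trans (any-cong (λ σ → cong (isAnnNCPerm i j σ ∧_)
   (all-cong (λ k → all-cong (λ l → cong (λ b → boolEq b (inOrbit (i ℕ.+ j) (app σ) k l))
     (sameBlock-cong {π} {π'} (same-↭ p) (same-↭ (↭-sym p)) k l)) (upTo (i ℕ.+ j))) (upTo (i ℕ.+ j)))) (allPerms (i ℕ.+ j))) (≡.sym (annular?≡ i j π')))

 crossing?-↭ : ∀ el {π π'} → π ↭ π' → crossing? el π ≡ crossing? el π'
 crossing?-↭ el {π} {π'} p = ≡.trans (crossing?≡ el π) (≡.trans (hasCrossing-cong el (same-↭ p) (same-↭ (↭-sym p))) (≡.sym (crossing?≡ el π')))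

 module PointedSums {c ℓ : Level} (R : CommutativeRing c ℓ) (κ : ℕ → CommutativeRing.Carrier R) where
  open CommutativeRing R hiding (zero)
  open Over R
  open Solver R
  open SumProperties R
  open PartitionSums R
  open SplitSums R
  open MatchSum R
  open SpokeSum κ using (wt; runWeight; spoke-sum)
  open import Relation.Binary.Reasoning.Setoid setoid

  nc-if : Bool → Carrier → Carrier
  nc-if b x = if b then 0# else x

  nc-if-cong : ∀ {b b' x y} → b ≡ b' → x ≈ y → nc-if b x ≈ nc-if b' y
  nc-if-cong {true} ≡.refl e = refl
  nc-if-cong {false} ≡.refl e = e

  -- The derivative along κ + εv of the moment of order |L|; the values v of the distinguished block
  -- may themselves be such sums over the other circle.
  pointedSum : List ℕ → (ℕ → Carrier) → Carrier
  pointedSum L v = spSum L (λ π → nc-if (crossing? L π) (pointSum π (λ V r → v (length V) * wt r)))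

  pointedSum-cong : ∀ L {v v'} → (∀ p → v p ≈ v' p) → pointedSum L v ≈ pointedSum L v'
  pointedSum-cong L e = spSum-cong L (λ {π} _ → nc-if-cong {crossing? L π} ≡.refl (pointSum-cong π (λ V r → *-congʳ (e (length V)))))

  pointedSum-+ : ∀ L v v' → pointedSum L (λ p → v p + v' p) ≈ pointedSum L v + pointedSum L v'
  pointedSum-+ L v v' = trans (spSum-cong L (λ {π} _ → trans (nc-if-cong {crossing? L π} ≡.refl
    (trans (pointSum-cong π (λ V r → distribʳ _ _ _)) (pointSum-+ π _ _))) (split (crossing? L π)))) (spSum-+ L _ _)
    where
    split : ∀ b {x y} → nc-if b (x + y) ≈ nc-if b x + nc-if b y
    split true = sym (+-identityˡ 0#)
    split false = refl

  pointSum-0 : ∀ π {F} → (∀ V r → F V r ≈ 0#) → pointSum π F ≈ 0#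
  pointSum-0 [] e = refl
  pointSum-0 (b ∷ π) e = trans (+-cong (e _ _) (pointSum-0 π (λ V r → e V (b ∷ r)))) (+-identityˡ 0#)

  pointedSum-0 : ∀ L {v} → (∀ p → v p ≈ 0#) → pointedSum L v ≈ 0#
  pointedSum-0 L e = spSum-0 L (λ {π} _ → trans (nc-if-cong {crossing? L π} ≡.refl (pointSum-0 π (λ V r → trans (*-congʳ (e (length V))) (zeroˡ _)))) (none (crossing? L π)))
    where
    none : ∀ b → nc-if b 0# ≈ 0#
    none true = refl
    none false = refl

  pointSum-cong-↭ : ∀ π {F G : List ℕ → Blocks → Carrier} → (∀ {V r} → V ∷ r ↭ π → F V r ≈ G V r) → pointSum π F ≈ pointSum π G
  pointSum-cong-↭ [] e = refl
  pointSum-cong-↭ (b ∷ π) e = +-cong (e ↭-refl) (pointSum-cong-↭ π (λ {V} {r} p → e (↭-trans (Perm.swap V b ↭-refl) (Perm.prep b p))))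

  -- The hypothesis on v 0 discards the terms whose distinguished set is empty; what remains are
  -- partitions with a distinguished block.
  spSum•-pointed : ∀ L v → v 0 ≈ 0# →
    spSum• L (λ V r → nc-if (crossing? L (V ∷ r)) (v (length V) * wt r)) ≈ pointedSum L v
  spSum•-pointed L v v0 = trans (spSum•-point L _) (spSum-cong L (λ {π} _ → trans (+-cong (empty π) (points π)) (+-identityˡ _)))
    where
    none : ∀ b {x} → x ≈ 0# → nc-if b x ≈ 0#
    none true e = refl
    none false e = e
    empty : ∀ π → nc-if (crossing? L ([] ∷ π)) (v 0 * wt π) ≈ 0#
    empty π = none (crossing? L ([] ∷ π)) (trans (*-congʳ v0) (zeroˡ _))
    pull : ∀ b π → pointSum π (λ V r → nc-if b (v (length V) * wt r)) ≈ nc-if b (pointSum π (λ V r → v (length V) * wt r))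
    pull true π = pointSum-0 π (λ _ _ → refl)
    pull false π = refl
    points : ∀ π → pointSum π (λ V r → nc-if (crossing? L (V ∷ r)) (v (length V) * wt r)) ≈
      nc-if (crossing? L π) (pointSum π (λ V r → v (length V) * wt r))
    points π = trans (pointSum-cong-↭ π (λ p → nc-if-cong (crossing?-↭ L p) refl)) (pull (crossing? L π) π)

  spSum•-*ʳ : ∀ L F k → spSum• L F * k ≈ spSum• L (λ V r → F V r * k)
  spSum•-*ʳ [] F k = refl
  spSum•-*ʳ (x ∷ L) F k = trans (spSum•-*ʳ L _ k) (spSum•-cong L (λ {V} {r} _ →
    trans (distribʳ k _ _) (+-congˡ (trans (distribʳ k _ _) (+-congˡ (add* r (F V)))))))
    where
    add* : ∀ r F → addSum x r F * k ≈ addSum x r (λ r' → F r' * k)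
    add* [] F = zeroˡ k
    add* (b ∷ bs) F = trans (distribʳ k _ _) (+-congˡ (add* bs _))

  -- The weight s_{p,q} of the overview. It is 0 when a side is empty, which both matches the
  -- absence of spokes and supplies the hypothesis of `spSum•-pointed`.
  spoke : ℕ → ℕ → Carrier
  spoke zero q = 0#
  spoke (suc p) zero = 0#
  spoke (suc p) (suc q) = sumR (map (runWeight ∘ Diagram.runs) (diagrams (suc p) (suc q)))

  wt-++ : ∀ α β → wt (α ++ β) ≈ wt α * wt β
  wt-++ α β = trans (reflexive (cong prodR (map-++ _ α β))) (prodR-++ (map _ α) _)

  module Annular (i j : ℕ) .{{_ : ℕ.NonZero i}} .{{_ : ℕ.NonZero j}} where
   open Tau i j using (uniqueAB; ∈A⇒<; ∈B⇒≥)

   private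
     A = setA i
     B = setB i j
     isA isB : ℕ → Bool
     isA x = x <ᵇ i
     isB x = not (x <ᵇ i)
     open Through isA isB using (select; partition-by-through; spSum•-++; through)

   term : Blocks → Carrier
   term π = if annular? i j π then wt π else 0#

   term-↭ : PermInvariant term
   term-↭ {π} {π'} p = lem (annular?-↭ i j p)
     where
     lem : annular? i j π ≡ annular? i j π' → term π ≈ term π'
     lem e with annular? i j π | annular? i j π' | e
     ... | true | true | ≡.refl = prodR-↭ (PermP.map⁺ _ p)
     ... | false | false | ≡.refl = refl

   inner : List ℕ → Blocks → List ℕ → Blocks → Carrier
   inner V₁ r₁ V₂ r₂ = spSum (V₁ ++ V₂) (λ ρ → if select ρ (r₁ ++ r₂) then term (ρ ++ r₁ ++ r₂) else 0#)

   merge-if : ∀ a b {x : Carrier} → (if a then (if b then x else 0#) else 0#) ≈ (if a ∧ b then x else 0#)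
   merge-if true b = refl
   merge-if false b = refl

   split-if : ∀ u v s {x y : Carrier} → x ≈ y → (if (not u ∧ not v) ∧ s then x else 0#) ≈ nc-if u (nc-if v (if s then y else 0#))
   split-if true v s e = refl
   split-if false true s e = refl
   split-if false false true e = e
   split-if false false false e = refl

   pull-if : ∀ b L {F} → spSum L (λ ρ → nc-if b (F ρ)) ≈ nc-if b (spSum L F)
   pull-if true L = spSum-0 L (λ _ → refl)
   pull-if false L = refl

   factor-if : ∀ s {x y} → (if s then x * y else 0#) ≈ y * (if s then x else 0#)
   factor-if true = *-comm _ _
   factor-if false = sym (zeroʳ _)

   inner-empty : ∀ {V₁ r₁ V₂ r₂} → IsPartition• A V₁ r₁ → IsPartition• B V₂ r₂ → V₁ ≡ [] ⊎ V₂ ≡ [] → inner V₁ r₁ V₂ r₂ ≈ 0#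
   inner-empty {V₁} {r₁} {V₂} {r₂} P₁ P₂ h = spSum-0 (V₁ ++ V₂) (λ {ρ} Pρ →
     trans (merge-if (select ρ (r₁ ++ r₂)) (annular? i j (ρ ++ r₁ ++ r₂))) (if-false (Bridge.annular-empty i j P₁ P₂ Pρ h)))

   vanish : ∀ u v {x} → x ≈ 0# → nc-if u (nc-if v x) ≈ 0#
   vanish true v e = refl
   vanish false true e = refl
   vanish false false e = e

   -- By `annular-split` the sum over ρ no longer sees r₁ and r₂ except through their weights, and
   -- `spoke-sum` shows that it depends only on the sizes of V₁ and V₂.
   inner-value : ∀ {V₁ r₁ V₂ r₂} → IsPartition• A V₁ r₁ → IsPartition• B V₂ r₂ →
     inner V₁ r₁ V₂ r₂ ≈ nc-if (crossing? A (V₁ ∷ r₁)) (nc-if (crossing? B (V₂ ∷ r₂)) (spoke (length V₁) (length V₂) * wt r₂)) * wt r₁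
   inner-value {[]} {r₁} {V₂} {r₂} P₁ P₂ = trans (inner-empty P₁ P₂ (inj₁ ≡.refl))
     (sym (trans (*-congʳ (vanish (crossing? A ([] ∷ r₁)) (crossing? B (V₂ ∷ r₂)) (trans (*-congʳ refl) (zeroˡ (wt r₂))))) (zeroˡ _)))
   inner-value {V₁@(_ ∷ _)} {r₁} {[]} {r₂} P₁ P₂ = trans (inner-empty P₁ P₂ (inj₂ ≡.refl))
     (sym (trans (*-congʳ (vanish (crossing? A (V₁ ∷ r₁)) (crossing? B ([] ∷ r₂)) (zeroˡ (wt r₂)))) (zeroˡ _)))
   inner-value {V₁@(_ ∷ V₁')} {r₁} {V₂@(_ ∷ V₂')} {r₂} P₁ P₂ = begin
     inner V₁ r₁ V₂ r₂
       ≈⟨ spSum-cong (V₁ ++ V₂) (λ {ρ} Pρ → trans (merge-if (select ρ (r₁ ++ r₂)) (annular? i j (ρ ++ r₁ ++ r₂)))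
         (trans (reflexive (cong (λ b → if b then wt (ρ ++ r₁ ++ r₂) else 0#) (Bridge.annular-split i j P₁ P₂ Pρ ≡.refl ≡.refl)))
           (split-if u v (isSpoke V₁ V₂ ρ) (wt-++ ρ (r₁ ++ r₂))))) ⟩
     spSum (V₁ ++ V₂) (λ ρ → nc-if u (nc-if v (if isSpoke V₁ V₂ ρ then wt ρ * wt (r₁ ++ r₂) else 0#)))
       ≈⟨ trans (pull-if u (V₁ ++ V₂)) (nc-if-cong {u} ≡.refl (pull-if v (V₁ ++ V₂))) ⟩
     nc-if u (nc-if v (spSum (V₁ ++ V₂) (λ ρ → if isSpoke V₁ V₂ ρ then wt ρ * wt (r₁ ++ r₂) else 0#)))
       ≈⟨ nc-if-cong {u} ≡.refl (nc-if-cong {v} ≡.refl (trans (spSum-cong (V₁ ++ V₂) (λ {ρ} _ → factor-if (isSpoke V₁ V₂ ρ)))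
         (sym (spSum-*ˡ (V₁ ++ V₂) (wt (r₁ ++ r₂)) _)))) ⟩
     nc-if u (nc-if v (wt (r₁ ++ r₂) * spSum (V₁ ++ V₂) (λ ρ → if isSpoke V₁ V₂ ρ then wt ρ else 0#)))
       ≈⟨ nc-if-cong {u} ≡.refl (nc-if-cong {v} ≡.refl (*-cong (wt-++ r₁ r₂) (spoke-sum V₁ V₂ uV ≡.refl ≡.refl))) ⟩
     nc-if u (nc-if v ((wt r₁ * wt r₂) * spoke (length V₁) (length V₂)))
       ≈⟨ out u v ⟩
     nc-if u (nc-if v (spoke (length V₁) (length V₂) * wt r₂)) * wt r₁ ∎
     where
     u = crossing? A (V₁ ∷ r₁)
     v = crossing? B (V₂ ∷ r₂)
     out : ∀ u v {a b s} → nc-if u (nc-if v ((a * b) * s)) ≈ nc-if u (nc-if v (s * b)) * a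
     out true v {a} = sym (zeroˡ a)
     out false true {a} = sym (zeroˡ a)
     out false false {a} {b} {s} = solve 3 (λ a b s → a :* b :* s := s :* b :* a) refl a b s
     uV : Unique (V₁ ++ V₂)
     uV = allPairs-⊆ (++⁺ (partition•-⊆ P₁) (partition•-⊆ P₂)) uniqueAB

   annular-sum : sumR (map wt (filterᵇ (isAnnNCPartition i j) (setPartitions (upTo (i ℕ.+ j))))) ≈
     pointedSum A (λ p → pointedSum B (λ q → spoke p q))
   annular-sum = begin
     sumR (map wt (filterᵇ (isAnnNCPartition i j) (setPartitions (upTo (i ℕ.+ j)))))
       ≈⟨ sum-filter (isAnnNCPartition i j) wt (setPartitions (upTo (i ℕ.+ j))) ⟩
     sumR (map (λ π → if isAnnNCPartition i j π then wt π else 0#) (setPartitions (upTo (i ℕ.+ j))))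
       ≈⟨ sumR-cong _ term (setPartitions (upTo (i ℕ.+ j))) (λ π → reflexive (cong (λ b → if b then wt π else 0#) (≡.sym (annular?≡ i j π)))) ⟩
     sumR (map term (setPartitions (upTo (i ℕ.+ j))))
       ≈⟨ spSum-sum (upTo (i ℕ.+ j)) term ⟩
     spSum (upTo (i ℕ.+ j)) term
       ≡⟨ cong (λ L → spSum L term) (upTo-+ i j) ⟩
     spSum (A ++ B) term
       ≈⟨ partition-by-through (A ++ B) term term-↭ ⟩
     spSum• (A ++ B) (λ V r → spSum V (λ ρ → if select ρ r then term (ρ ++ r) else 0#))
       -- A through block among the blocks that were not selected contradicts the selection, so
       -- these terms vanish and the two circles can be summed separately.
       ≈⟨ spSum•-++ A B _ (λ x∈ → <ᵇ-complete (∈A⇒< x∈)) (λ x∈ → not-complete (λ e → ℕP.<⇒≱ (<ᵇ-sound e) (∈B⇒≥ x∈)))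
         (λ V r h → spSum-0 V (λ {ρ} _ → if-false (λ e → unselected ρ r h e))) ⟩
     spSum• A (λ V₁ r₁ → spSum• B (λ V₂ r₂ → inner V₁ r₁ V₂ r₂))
       ≈⟨ spSum•-cong A (λ {V₁} {r₁} P₁ → trans (spSum•-cong B (λ P₂ → inner-value P₁ P₂)) (trans (sym (spSum•-*ʳ B _ (wt r₁)))
         (trans (*-congʳ (pull• (crossing? A (V₁ ∷ r₁)))) (trans (*-congʳ (nc-if-cong {crossing? A (V₁ ∷ r₁)} ≡.refl
           (spSum•-pointed B (spoke (length V₁)) (spoke-0 (length V₁))))) (nc-if-* (crossing? A (V₁ ∷ r₁))))))) ⟩
     spSum• A (λ V₁ r₁ → nc-if (crossing? A (V₁ ∷ r₁)) (pointedSum B (spoke (length V₁)) * wt r₁))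
       ≈⟨ spSum•-pointed A (λ p → pointedSum B (spoke p)) (pointedSum-0 B (λ _ → refl)) ⟩
     pointedSum A (λ p → pointedSum B (spoke p)) ∎
     where
     spoke-0 : ∀ p → spoke p 0 ≈ 0#
     spoke-0 zero = refl
     spoke-0 (suc p) = refl
     pull• : ∀ b {F} → spSum• B (λ V r → nc-if b (F V r)) ≈ nc-if b (spSum• B F)
     pull• true = spSum•-0 B
     pull• false = refl
     nc-if-* : ∀ b {x y} → nc-if b x * y ≈ nc-if b (x * y)
     nc-if-* true = zeroˡ _
     nc-if-* false = refl
     unselected : ∀ ρ r → any through r ≡ true → ¬ select ρ r ≡ true
     unselected ρ r h e with any-sound through r h
     ... | b , b∈ , hb = not-sound (all-sound (not ∘ through) {r} (proj₂ (∧-sound {all through ρ} e)) b∈) hb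

  nc-pointed : ∀ L v → sumR (map (λ π → sumR (map (λ P → v (length (proj₁ P)) * wt (proj₂ P)) (pointings π))) (ncPartitions L)) ≈ pointedSum L v
  nc-pointed L v = begin
    sumR (map f (ncPartitions L))
      ≈⟨ sum-filter (λ π → not (hasCrossing L π)) f (setPartitions L) ⟩
    sumR (map (λ π → if not (hasCrossing L π) then f π else 0#) (setPartitions L))
      ≈⟨ sumR-cong _ _ (setPartitions L) (λ π → trans (if-not (hasCrossing L π)) (nc-if-cong (≡.sym (crossing?≡ L π)) (pointSum-sum π _))) ⟩
    sumR (map (λ π → nc-if (crossing? L π) (pointSum π (λ V r → v (length V) * wt r))) (setPartitions L))
      ≈⟨ spSum-sum L _ ⟩
    pointedSum L v ∎
    where
    f : Blocks → Carrier
    f π = sumR (map (λ P → v (length (proj₁ P)) * wt (proj₂ P)) (pointings π))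
    if-not : ∀ b {x : Carrier} → (if not b then x else 0#) ≈ nc-if b x
    if-not true = refl
    if-not false = refl

  cylinder-sum : ∀ (κ₂ : ℕ → ℕ → Carrier) A B →
    sumR (concatMap (λ π₁ → concatMap (λ π₂ → concatMap (λ P₁ → map (λ P₂ →
      κ₂ (length (proj₁ P₁)) (length (proj₁ P₂))
      * prodR (map (λ V → κ (length V)) (proj₂ P₁))
      * prodR (map (λ V → κ (length V)) (proj₂ P₂)))
      (pointings π₂)) (pointings π₁)) (ncPartitions B)) (ncPartitions A))
    ≈ pointedSum A (λ p → pointedSum B (κ₂ p))
  cylinder-sum κ₂ A B = begin
    sumR (concatMap (λ π₁ → concatMap (λ π₂ → concatMap (λ P₁ → map (λ P₂ → t P₁ P₂) (pointings π₂)) (pointings π₁)) (ncPartitions B)) (ncPartitions A))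
      ≈⟨ sumR-concatMap _ (ncPartitions A) ⟩
    sumR (map (λ π₁ → sumR (concatMap (λ π₂ → concatMap (λ P₁ → map (λ P₂ → t P₁ P₂) (pointings π₂)) (pointings π₁)) (ncPartitions B))) (ncPartitions A))
      ≈⟨ sumR-cong _ _ (ncPartitions A) (λ π₁ → trans (sumR-concatMap _ (ncPartitions B))
        (trans (sumR-cong _ _ (ncPartitions B) (λ π₂ → sumR-concatMap _ (pointings π₁)))
          (trans (sumR-swap (λ π₂ P₁ → sumR (map (t P₁) (pointings π₂))) (ncPartitions B) (pointings π₁))
            (sumR-cong _ _ (pointings π₁) (λ P₁ → inner P₁))))) ⟩
    sumR (map (λ π₁ → sumR (map (λ P₁ → pointedSum B (κ₂ (length (proj₁ P₁))) * wt (proj₂ P₁)) (pointings π₁))) (ncPartitions A))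
      ≈⟨ nc-pointed A (λ p → pointedSum B (κ₂ p)) ⟩
    pointedSum A (λ p → pointedSum B (κ₂ p)) ∎
    where
    t : List ℕ × Blocks → List ℕ × Blocks → Carrier
    t P₁ P₂ = κ₂ (length (proj₁ P₁)) (length (proj₁ P₂)) * wt (proj₂ P₁) * wt (proj₂ P₂)
    inner : ∀ P₁ → sumR (map (λ π₂ → sumR (map (t P₁) (pointings π₂))) (ncPartitions B)) ≈ pointedSum B (κ₂ (length (proj₁ P₁))) * wt (proj₂ P₁)
    inner P₁ = trans (sumR-cong _ _ (ncPartitions B) (λ π₂ → trans (sumR-cong _ _ (pointings π₂)
      (λ P₂ → solve 3 (λ a b c → a :* b :* c := a :* c :* b) refl _ _ _)) (sym (sumR-*ʳ (wt (proj₂ P₁)) _ (pointings π₂)))))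
      (trans (sym (sumR-*ʳ (wt (proj₂ P₁)) _ (ncPartitions B))) (*-congʳ (nc-pointed B (κ₂ (length (proj₁ P₁))))))

  -- Both sums of the definition range over pairs of pointed non-crossing partitions and differ only
  -- in the weight of the two distinguished blocks.
  mCyl-pointed : ∀ κ₂ i' j' → mCyl κ κ₂ (suc i') (suc j') ≈
    pointedSum (setA (suc i')) (λ p → pointedSum (setB (suc i') (suc j')) (λ q → κ₂ p q + spoke p q))
  mCyl-pointed κ₂ i' j' = begin
    mCyl κ κ₂ (suc i') (suc j')
      ≈⟨ +-cong (Annular.annular-sum (suc i') (suc j')) (cylinder-sum κ₂ A B) ⟩
    pointedSum A (λ p → pointedSum B (spoke p)) + pointedSum A (λ p → pointedSum B (κ₂ p))
      ≈⟨ +-comm _ _ ⟩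
    pointedSum A (λ p → pointedSum B (κ₂ p)) + pointedSum A (λ p → pointedSum B (spoke p))
      ≈⟨ pointedSum-+ A (λ p → pointedSum B (κ₂ p)) (λ p → pointedSum B (spoke p)) ⟨
    pointedSum A (λ p → pointedSum B (κ₂ p) + pointedSum B (spoke p))
      ≈⟨ pointedSum-cong A (λ p → sym (pointedSum-+ B (κ₂ p) (spoke p))) ⟩
    pointedSum A (λ p → pointedSum B (λ q → κ₂ p q + spoke p q)) ∎
    where
    A = setA (suc i')
    B = setB (suc i') (suc j')

-- The algebraic identity behind the theorem

-- Δ = y₁ − y₂, G = y₂ f₁ − y₁ f₂ and H = G / Δ; t₁, t₂ are the derivatives y f′ and H₁, H₂, H₁₂
-- those of H. With S = −1/H, P is the second derivative of −log H.
module FinalAlgebra {c ℓ : Level} (Q : CommutativeRing c ℓ) where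
 open CommutativeRing Q
 open Solver Q
 open import Relation.Binary.Reasoning.Setoid setoid

 module _ {y₁ y₂ f₁ f₂ t₁ t₂ H H₁ H₂ H₁₂ S S₂ P X₂ W Θ : Carrier}
  (hG : (y₁ - y₂) * H ≈ y₂ * f₁ - y₁ * f₂)
  (e₁ : y₁ * H + (y₁ - y₂) * H₁ ≈ y₂ * t₁ - y₁ * f₂)
  (e₂ : (y₁ - y₂) * H₂ - y₂ * H ≈ y₂ * f₁ - y₁ * t₂)
  (e₁₂ : (y₁ * H₂ - y₂ * H₁) + (y₁ - y₂) * H₁₂ ≈ y₂ * t₁ - y₁ * t₂)
  (hS : H * S ≈ - 1#)
  (hS₂ : H₂ * S + H * S₂ ≈ 0#)
  (hP : P ≈ H₁₂ * S + H₁ * S₂)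
  (hW : (f₁ - t₁) * (f₂ - t₂) * W ≈ y₁ * y₂ * (y₁ * y₂ * X₂ + (Θ + P))) where

  private
    Δ = y₁ - y₂
    G = y₂ * f₁ - y₁ * f₂

  log-derivative : H * H * P ≈ H₁ * H₂ - H * H₁₂
  log-derivative = begin
    H * H * P
      ≈⟨ *-congˡ hP ⟩
    H * H * (H₁₂ * S + H₁ * S₂)
      ≈⟨ solve 6 (λ H H₁ H₂ H₁₂ S S₂ → H :* H :* (H₁₂ :* S :+ H₁ :* S₂) :=
        H :* H₁₂ :* (H :* S) :+ (H :* H₁ :* (H₂ :* S :+ H :* S₂) :- H₁ :* H₂ :* (H :* S))) refl H H₁ H₂ H₁₂ S S₂ ⟩
    H * H₁₂ * (H * S) + (H * H₁ * (H₂ * S + H * S₂) - H₁ * H₂ * (H * S))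
      ≈⟨ +-cong (*-congˡ hS) (+-cong (*-congˡ hS₂) (-‿cong (*-congˡ hS))) ⟩
    H * H₁₂ * - 1# + (H * H₁ * 0# - H₁ * H₂ * - 1#)
      ≈⟨ solve 4 (λ H H₁ H₂ H₁₂ → H :* H₁₂ :* (:- con (1 , 0)) :+ (H :* H₁ :* con (0 , 0) :- H₁ :* H₂ :* (:- con (1 , 0))) :=
        H₁ :* H₂ :- H :* H₁₂) refl H H₁ H₂ H₁₂ ⟩
    H₁ * H₂ - H * H₁₂ ∎

  -- The relation log H = log G - log Δ without logarithms. The mixed derivative of log Δ is
  -- y₁y₂/Δ², which gives the term with H²; that of log G gives the product of the two factors f -
  -- t.
  wronskian : Δ * Δ * (H₁ * H₂ - H * H₁₂) ≈ y₁ * y₂ * (H * H - (f₁ - t₁) * (f₂ - t₂))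
  wronskian = begin
    Δ * Δ * (H₁ * H₂ - H * H₁₂)
      ≈⟨ solve 6 (λ a b H H₁ H₂ H₁₂ → (a :- b) :* (a :- b) :* (H₁ :* H₂ :- H :* H₁₂) :=
        (a :* H :+ (a :- b) :* H₁) :* ((a :- b) :* H₂ :- b :* H)
          :- (a :- b) :* H :* ((a :* H₂ :- b :* H₁) :+ (a :- b) :* H₁₂) :+ a :* b :* (H :* H)) refl y₁ y₂ H H₁ H₂ H₁₂ ⟩
    (y₁ * H + Δ * H₁) * (Δ * H₂ - y₂ * H) - Δ * H * ((y₁ * H₂ - y₂ * H₁) + Δ * H₁₂) + y₁ * y₂ * (H * H)
      ≈⟨ +-congʳ (+-cong (*-cong e₁ e₂) (-‿cong (*-cong hG e₁₂))) ⟩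
    (y₂ * t₁ - y₁ * f₂) * (y₂ * f₁ - y₁ * t₂) - (y₂ * f₁ - y₁ * f₂) * (y₂ * t₁ - y₁ * t₂) + y₁ * y₂ * (H * H)
      ≈⟨ solve 7 (λ a b f g t u H → (b :* t :- a :* g) :* (b :* f :- a :* u) :- (b :* f :- a :* g) :* (b :* t :- a :* u) :+ a :* b :* (H :* H) :=
        a :* b :* (H :* H :- (f :- t) :* (g :- u))) refl y₁ y₂ f₁ f₂ t₁ t₂ H ⟩
    y₁ * y₂ * (H * H - (f₁ - t₁) * (f₂ - t₂)) ∎

  -- This is where the two double poles of the theorem come from: the summand with G² becomes 1/(y₁
  -- - y₂)² and the other becomes -1/(X(y₁) - X(y₂))².
  P-term : Δ * Δ * (G * G) * P ≈ y₁ * y₂ * (G * G - Δ * Δ * ((f₁ - t₁) * (f₂ - t₂)))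
  P-term = begin
    Δ * Δ * (G * G) * P
      ≈⟨ *-congʳ (*-congˡ (*-cong (sym hG) (sym hG))) ⟩
    Δ * Δ * (Δ * H * (Δ * H)) * P
      ≈⟨ solve 3 (λ d H P → d :* d :* (d :* H :* (d :* H)) :* P := d :* d :* (d :* d :* (H :* H :* P))) refl Δ H P ⟩
    Δ * Δ * (Δ * Δ * (H * H * P))
      ≈⟨ *-congˡ (trans (*-congˡ log-derivative) wronskian) ⟩
    Δ * Δ * (y₁ * y₂ * (H * H - (f₁ - t₁) * (f₂ - t₂)))
      ≈⟨ solve 4 (λ d e H k → d :* d :* (e :* (H :* H :- k)) := e :* ((d :* H) :* (d :* H) :- d :* d :* k)) refl Δ (y₁ * y₂) H _ ⟩
    y₁ * y₂ * (Δ * H * (Δ * H) - Δ * Δ * ((f₁ - t₁) * (f₂ - t₂)))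
      ≈⟨ *-congˡ (+-congʳ (*-cong hG hG)) ⟩
    y₁ * y₂ * (G * G - Δ * Δ * ((f₁ - t₁) * (f₂ - t₂))) ∎

  cleared : W * ((t₁ - f₁) * (t₂ - f₂) * (Δ * Δ) * (G * G)) ≈
    ((y₁ * y₂ * (y₁ * y₂)) * (G * G)) * ((Δ * Δ) * X₂ + 1#)
    - ((y₁ * y₂ * (y₁ * y₂)) * (Δ * Δ)) * ((t₁ - f₁) * (t₂ - f₂))
    + ((y₁ * y₂) * ((Δ * Δ) * (G * G))) * Θ
  cleared = begin
    W * ((t₁ - f₁) * (t₂ - f₂) * (Δ * Δ) * (G * G))
      ≈⟨ solve 7 (λ W f g t u D E → W :* ((t :- f) :* (u :- g) :* D :* E) := (f :- t) :* (g :- u) :* W :* (D :* E)) refl W f₁ f₂ t₁ t₂ (Δ * Δ) (G * G) ⟩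
    (f₁ - t₁) * (f₂ - t₂) * W * (Δ * Δ * (G * G))
      ≈⟨ *-congʳ hW ⟩
    y₁ * y₂ * (y₁ * y₂ * X₂ + (Θ + P)) * (Δ * Δ * (G * G))
      ≈⟨ solve 6 (λ e X T P D E → e :* (e :* X :+ (T :+ P)) :* (D :* E) := e :* (e :* X :+ T) :* (D :* E) :+ e :* (D :* E :* P)) refl
        (y₁ * y₂) X₂ Θ P (Δ * Δ) (G * G) ⟩
    y₁ * y₂ * (y₁ * y₂ * X₂ + Θ) * (Δ * Δ * (G * G)) + y₁ * y₂ * (Δ * Δ * (G * G) * P)
      ≈⟨ +-congˡ (*-congˡ P-term) ⟩
    y₁ * y₂ * (y₁ * y₂ * X₂ + Θ) * (Δ * Δ * (G * G)) + y₁ * y₂ * (y₁ * y₂ * (G * G - Δ * Δ * ((f₁ - t₁) * (f₂ - t₂))))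
      ≈⟨ solve 9 (λ e X T D E f g t u →
        e :* (e :* X :+ T) :* (D :* E) :+ e :* (e :* (E :- D :* ((f :- t) :* (g :- u)))) :=
        ((e :* e) :* E) :* (D :* X :+ con (1 , 0)) :- ((e :* e) :* D) :* ((t :- f) :* (u :- g)) :+ (e :* (D :* E)) :* T) refl
        (y₁ * y₂) X₂ Θ (Δ * Δ) (G * G) f₁ f₂ t₁ t₂ ⟩
    _ ∎

module Derivations {c ℓ : Level} (Q : CommutativeRing c ℓ) where
 open CommutativeRing Q
 open Solver Q
 open import Algebra.Properties.Group +-group using (identityʳ-unique)
 open import Relation.Binary.Reasoning.Setoid setoid

 record Derivation (D : Carrier → Carrier) : Set (c ⊔ ℓ) where
   field D-cong : ∀ {x y} → x ≈ y → D x ≈ D y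
         D-+ : ∀ x y → D (x + y) ≈ D x + D y
         D-neg : ∀ x → D (- x) ≈ - D x
         D-* : ∀ x y → D (x * y) ≈ D x * y + x * D y

   D-minus : ∀ x y → D (x - y) ≈ D x - D y
   D-minus x y = trans (D-+ x (- y)) (+-congˡ (D-neg y))

   D-1 : D 1# ≈ 0#
   D-1 = identityʳ-unique (D 1#) (D 1#) (trans (+-cong (sym (*-identityʳ (D 1#))) (sym (*-identityˡ (D 1#))))
     (trans (sym (D-* 1# 1#)) (D-cong (*-identityˡ 1#))))

 module _ {D₁ D₂ : Carrier → Carrier} (δ₁ : Derivation D₁) (δ₂ : Derivation D₂)
  -- The product used in the statement, which agrees with the ring product only up to `≈`. All
  -- series are kept abstract here, so the ring solver works with variables instead of unfolding
  -- coefficients.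
  {_⊛_ : Carrier → Carrier → Carrier} (⊛≈ : ∀ x y → x ⊛ y ≈ x * y)
  {y₁ y₂ f₁ f₂ t₁ t₂ H S X₂ W Θ d g p₁ p₂ m₂₂ m₁₁ m₀₀ : Carrier}
  (y₁₁ : D₁ y₁ ≈ y₁) (y₁₂ : D₂ y₁ ≈ 0#) (y₂₁ : D₁ y₂ ≈ 0#) (y₂₂ : D₂ y₂ ≈ y₂)
  (f₁₁ : D₁ f₁ ≈ t₁) (f₁₂ : D₂ f₁ ≈ 0#) (f₂₁ : D₁ f₂ ≈ 0#) (f₂₂ : D₂ f₂ ≈ t₂) (t₁₂ : D₂ t₁ ≈ 0#)
  (hG : (y₁ - y₂) * H ≈ y₂ * f₁ - y₁ * f₂)
  (hS : H * S ≈ - 1#)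
  (hW : (f₁ - t₁) * ((f₂ - t₂) * W) ≈ y₁ * (y₂ * (y₁ * (y₂ * X₂) + (Θ + D₂ (D₁ H * S)))))
  (d≈ : d ≈ y₁ - y₂) (g≈ : g ≈ y₂ * f₁ - y₁ * f₂) (p₁≈ : p₁ ≈ t₁ - f₁) (p₂≈ : p₂ ≈ t₂ - f₂)
  (m₂₂≈ : m₂₂ ≈ y₁ * y₂ * (y₁ * y₂)) (m₁₁≈ : m₁₁ ≈ y₁ * y₂) (m₀₀≈ : m₀₀ ≈ 1#) where

  private
    module δ₁ = Derivation δ₁
    module δ₂ = Derivation δ₂

    -- This equation and the next two are `hG` differentiated by `D₁`, by `D₂` and by both.
    e₁ : y₁ * H + (y₁ - y₂) * D₁ H ≈ y₂ * t₁ - y₁ * f₂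
    e₁ = begin
      y₁ * H + (y₁ - y₂) * D₁ H
        ≈⟨ +-congʳ (*-congʳ (trans (δ₁.D-minus y₁ y₂) (trans (+-cong y₁₁ (-‿cong y₂₁)) (solve 1 (λ y → y :- con (0 , 0) := y) refl y₁)))) ⟨
      D₁ (y₁ - y₂) * H + (y₁ - y₂) * D₁ H
        ≈⟨ trans (sym (δ₁.D-* (y₁ - y₂) H)) (trans (δ₁.D-cong hG) (δ₁.D-minus (y₂ * f₁) (y₁ * f₂))) ⟩
      D₁ (y₂ * f₁) - D₁ (y₁ * f₂)
        ≈⟨ +-cong (trans (δ₁.D-* y₂ f₁) (+-cong (*-congʳ y₂₁) (*-congˡ f₁₁)))
          (-‿cong (trans (δ₁.D-* y₁ f₂) (+-cong (*-congʳ y₁₁) (*-congˡ f₂₁)))) ⟩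
      (0# * f₁ + y₂ * t₁) - (y₁ * f₂ + y₁ * 0#)
        ≈⟨ solve 5 (λ y z f t g → (con (0 , 0) :* f :+ z :* t) :- (y :* g :+ y :* con (0 , 0)) := z :* t :- y :* g) refl y₁ y₂ f₁ t₁ f₂ ⟩
      y₂ * t₁ - y₁ * f₂ ∎

    e₂ : (y₁ - y₂) * D₂ H - y₂ * H ≈ y₂ * f₁ - y₁ * t₂
    e₂ = begin
      (y₁ - y₂) * D₂ H - y₂ * H
        ≈⟨ solve 4 (λ y z H H' → (y :- z) :* H' :- z :* H := (con (0 , 0) :- z) :* H :+ (y :- z) :* H') refl y₁ y₂ H (D₂ H) ⟩
      (0# - y₂) * H + (y₁ - y₂) * D₂ H
        ≈⟨ +-congʳ (*-congʳ (trans (δ₂.D-minus y₁ y₂) (+-cong y₁₂ (-‿cong y₂₂)))) ⟨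
      D₂ (y₁ - y₂) * H + (y₁ - y₂) * D₂ H
        ≈⟨ trans (sym (δ₂.D-* (y₁ - y₂) H)) (trans (δ₂.D-cong hG) (δ₂.D-minus (y₂ * f₁) (y₁ * f₂))) ⟩
      D₂ (y₂ * f₁) - D₂ (y₁ * f₂)
        ≈⟨ +-cong (trans (δ₂.D-* y₂ f₁) (+-cong (*-congʳ y₂₂) (*-congˡ f₁₂)))
          (-‿cong (trans (δ₂.D-* y₁ f₂) (+-cong (*-congʳ y₁₂) (*-congˡ f₂₂)))) ⟩
      (y₂ * f₁ + y₂ * 0#) - (0# * f₂ + y₁ * t₂)
        ≈⟨ solve 5 (λ y z f g t → (z :* f :+ z :* con (0 , 0)) :- (con (0 , 0) :* g :+ y :* t) := z :* f :- y :* t) refl y₁ y₂ f₁ f₂ t₂ ⟩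
      y₂ * f₁ - y₁ * t₂ ∎

    e₁₂ : (y₁ * D₂ H - y₂ * D₁ H) + (y₁ - y₂) * D₂ (D₁ H) ≈ y₂ * t₁ - y₁ * t₂
    e₁₂ = begin
      (y₁ * D₂ H - y₂ * D₁ H) + (y₁ - y₂) * D₂ (D₁ H)
        ≈⟨ solve 6 (λ y z H H₁ H₂ H₁₂ → (y :* H₂ :- z :* H₁) :+ (y :- z) :* H₁₂ :=
          (con (0 , 0) :* H :+ y :* H₂) :+ ((con (0 , 0) :- z) :* H₁ :+ (y :- z) :* H₁₂)) refl y₁ y₂ H (D₁ H) (D₂ H) (D₂ (D₁ H)) ⟩
      (0# * H + y₁ * D₂ H) + ((0# - y₂) * D₁ H + (y₁ - y₂) * D₂ (D₁ H))
        ≈⟨ +-cong (+-congʳ (*-congʳ y₁₂)) (+-congʳ (*-congʳ (trans (δ₂.D-minus y₁ y₂) (+-cong y₁₂ (-‿cong y₂₂))))) ⟨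
      (D₂ y₁ * H + y₁ * D₂ H) + (D₂ (y₁ - y₂) * D₁ H + (y₁ - y₂) * D₂ (D₁ H))
        ≈⟨ trans (sym (+-cong (δ₂.D-* y₁ H) (δ₂.D-* (y₁ - y₂) (D₁ H)))) (sym (δ₂.D-+ _ _)) ⟩
      D₂ (y₁ * H + (y₁ - y₂) * D₁ H)
        ≈⟨ trans (δ₂.D-cong e₁) (δ₂.D-minus (y₂ * t₁) (y₁ * f₂)) ⟩
      D₂ (y₂ * t₁) - D₂ (y₁ * f₂)
        ≈⟨ +-cong (trans (δ₂.D-* y₂ t₁) (+-cong (*-congʳ y₂₂) (*-congˡ t₁₂)))
          (-‿cong (trans (δ₂.D-* y₁ f₂) (+-cong (*-congʳ y₁₂) (*-congˡ f₂₂)))) ⟩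
      (y₂ * t₁ + y₂ * 0#) - (0# * f₂ + y₁ * t₂)
        ≈⟨ solve 5 (λ y z f g t → (z :* f :+ z :* con (0 , 0)) :- (con (0 , 0) :* g :+ y :* t) := z :* f :- y :* t) refl y₁ y₂ t₁ f₂ t₂ ⟩
      y₂ * t₁ - y₁ * t₂ ∎

    hS₂ : D₂ H * S + H * D₂ S ≈ 0#
    hS₂ = trans (sym (δ₂.D-* H S)) (trans (δ₂.D-cong hS) (trans (δ₂.D-neg 1#) (trans (-‿cong δ₂.D-1)
      (solve 0 (:- con (0 , 0) := con (0 , 0)) refl))))

    ⊛-cong : ∀ {x x' y y'} → x ≈ x' → y ≈ y' → x ⊛ y ≈ x' * y'
    ⊛-cong {x} {x'} {y} {y'} e e' = trans (⊛≈ x y) (*-cong e e')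

  cleared-⊛ : W ⊛ (((p₁ ⊛ p₂) ⊛ (d ⊛ d)) ⊛ (g ⊛ g)) ≈
    ((m₂₂ ⊛ (g ⊛ g)) ⊛ (((d ⊛ d) ⊛ X₂) + m₀₀)) - ((m₂₂ ⊛ (d ⊛ d)) ⊛ (p₁ ⊛ p₂)) + ((m₁₁ ⊛ ((d ⊛ d) ⊛ (g ⊛ g))) ⊛ Θ)
  cleared-⊛ = trans (⊛-cong refl (⊛-cong (⊛-cong pp dd) gg)) (trans
    (FinalAlgebra.cleared Q hG e₁ e₂ e₁₂ hS hS₂ (δ₂.D-* (D₁ H) S)
      (trans (*-assoc (f₁ - t₁) (f₂ - t₂) W) (trans hW (solve 4 (λ y z X T → y :* (z :* (y :* (z :* X) :+ T)) := y :* z :* (y :* z :* X :+ T)) refl y₁ y₂ X₂ _))))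
    (sym (+-cong (+-cong (⊛-cong (⊛-cong m₂₂≈ gg) (+-cong (⊛-cong dd refl) m₀₀≈)) (-‿cong (⊛-cong (⊛-cong m₂₂≈ dd) pp)))
      (⊛-cong (⊛-cong m₁₁≈ (⊛-cong dd gg)) refl))))
    where
    pp = ⊛-cong p₁≈ p₂≈
    dd = ⊛-cong d≈ d≈
    gg = ⊛-cong g≈ g≈

-- Series in two variables and the spoke series

module SpokeGeneratingSeries where
 open NonCrossingPartitions using (module PartitionSums)
 open SpokeDiagrams
 open DiagramSums
 open CylinderMoments

 -- Every size has width at least one on the first circle, so fuel p is enough and more changes
 -- nothing; sums with different fuel can then be combined.
 comps-stable : ∀ f p q → p ≤ f → comps f p q ≡ comps (suc f) p q
 comps-stable zero zero zero l = ≡.refl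
 comps-stable zero zero (suc q) l = ≡.refl
 comps-stable (suc f) zero zero l = ≡.refl
 comps-stable (suc f) zero (suc q) l = ≡.refl
 comps-stable (suc f) (suc p) q (s≤s l) = concatMap-cong (λ a → concatMap-cong (λ b →
   cong (map ((a , b) ∷_)) (comps-stable f (p ∸ a) (q ∸ suc b) (ℕP.≤-trans (ℕP.m∸n≤m p a) l))) (upTo q)) (upTo (suc p))

 comps-fuel : ∀ d p q → comps (d ℕ.+ p) p q ≡ comps p p q
 comps-fuel zero p q = ≡.refl
 comps-fuel (suc d) p q = ≡.trans (≡.sym (comps-stable (d ℕ.+ p) p q (ℕP.m≤n+m p d))) (comps-fuel d p q)

 comps-fuel-≤ : ∀ f p q → p ≤ f → comps f p q ≡ comps p p q
 comps-fuel-≤ f p q l = ≡.trans (cong (λ g → comps g p q) (≡.sym (ℕP.m∸n+n≡m l))) (comps-fuel (f ∸ p) p q)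

 nonNil-id : ∀ xs → (∀ {y} → y ∈ xs → y ≢ []) → nonNil xs ≡ xs
 nonNil-id [] h = ≡.refl
 nonNil-id ([] ∷ xs) h = ⊥-elim (h (here ≡.refl) ≡.refl)
 nonNil-id ((s ∷ ss) ∷ xs) h = cong ((s ∷ ss) ∷_) (nonNil-id xs (h ∘ there))

 module TwoVariables {c ℓ : Level} (R : CommutativeRing c ℓ) where
  open CommutativeRing R hiding (zero)
  open Over R
  open SumProperties R
  open PowerSeries R public
  module P₁ = CommutativeRing PSRing
  -- Series in y₁ whose coefficients are series in y₂. Their carrier is literally `PS2`, so only the
  -- product has to be compared with that of the statement.
  module PS₂ = PowerSeries PSRing
  P₂ : CommutativeRing c ℓ
  P₂ = PS₂.PSRing
  module P₂ = CommutativeRing P₂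
  private
    module Sol = Solver R
    module Σ₁ = SumProperties PSRing

  -- The common normal form of the two products: the flattened sum of the statement and the nested
  -- product of series over series.
  double : PS2 → PS2 → PS2
  double f g a b = Σ< (suc a) (λ k → Σ< (suc b) (λ l → f k l * g (a ∸ k) (b ∸ l)))

  *₂≈double : ∀ f g a b → (f *₂ g) a b ≈ double f g a b
  *₂≈double f g a b = trans (sumR-concatMap (λ k → map (λ l → f k l * g (a ∸ k) (b ∸ l)) (upTo (suc b))) (upTo (suc a))) (trans (sumR-upTo (λ k → sumR (map (λ l → f k l * g (a ∸ k) (b ∸ l)) (upTo (suc b)))) (suc a))
    (Σ<-cong (suc a) (λ k _ → sumR-upTo (λ l → f k l * g (a ∸ k) (b ∸ l)) (suc b))))

  Σ₁-eval : ∀ n F b → Σ₁.Σ< n F b ≈ Σ< n (λ k → F k b)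
  Σ₁-eval zero F b = refl
  Σ₁-eval (suc n) F b = +-congˡ (Σ₁-eval n (F ∘ suc) b)

  P₂*≈double : ∀ f g a b → (f P₂.* g) a b ≈ double f g a b
  P₂*≈double f g a b = trans (Σ₁.sumR-upTo (λ k → f k *₁ g (a ∸ k)) (suc a) b)
    (trans (Σ₁-eval (suc a) (λ k → f k *₁ g (a ∸ k)) b) (Σ<-cong (suc a) (λ k _ → sumR-upTo (λ l → f k l * g (a ∸ k) (b ∸ l)) (suc b))))

  *₂≈ : ∀ f g → f *₂ g P₂.≈ f P₂.* g
  *₂≈ f g a b = trans (*₂≈double f g a b) (sym (P₂*≈double f g a b))

  *₂-cong : ∀ {f f' g g'} → f P₂.≈ f' → g P₂.≈ g' → f *₂ g P₂.≈ f' P₂.* g'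
  *₂-cong {f} {f'} {g} {g'} e e' = P₂.trans {f *₂ g} {f P₂.* g} {f' P₂.* g'} (*₂≈ f g) (P₂.*-cong {f} {f'} {g} {g'} e e')

  y₁ y₂ : PS2
  y₁ = PS₂.X
  y₂ = PS₂.const X

  y₁*-zero : ∀ F b → (y₁ P₂.* F) 0 b ≈ 0#
  y₁*-zero F b = PS₂.X*-zero F b

  y₁*-suc : ∀ F a b → (y₁ P₂.* F) (suc a) b ≈ F a b
  y₁*-suc F a b = PS₂.X*-suc F a b

  y₂* : ∀ F a b → (y₂ P₂.* F) a b ≈ (X *₁ F a) b
  y₂* F a b = PS₂.const* X F a b

  y₂*-zero : ∀ F a → (y₂ P₂.* F) a 0 ≈ 0#
  y₂*-zero F a = trans (y₂* F a 0) (X*-zero (F a))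

  y₂*-suc : ∀ F a b → (y₂ P₂.* F) a (suc b) ≈ F a b
  y₂*-suc F a b = trans (y₂* F a (suc b)) (X*-suc (F a) b)

  inY₂≈ : ∀ f → inY₂ f P₂.≈ PS₂.const f
  inY₂≈ f zero b = refl
  inY₂≈ f (suc a) b = refl

  inY₂* : ∀ f F a b → (inY₂ f P₂.* F) a b ≈ (f *₁ F a) b
  inY₂* f F a b = trans (P₂.*-congʳ {x = F} (inY₂≈ f) a b) (PS₂.const* f F a b)

  inY₁* : ∀ f F a b → (inY₁ f P₂.* F) a b ≈ (f *₁ (λ k → F k b)) a
  inY₁* f F a b = trans (PS₂.*₁≈conv (inY₁ f) F a b) (trans (go f F a) (sym (*₁≈conv f _ a)))
    where
    inY₁-const : ∀ f k → inY₁ f k P₁.≈ const (f k)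
    inY₁-const f k zero = refl
    inY₁-const f k (suc m) = refl
    scale : ∀ (f : PS1) (G : PS1) k → (inY₁ f k *₁ G) b ≈ f k * G b
    scale f G k = trans (P₁.*-congʳ {x = G} (inY₁-const f k) b) (const* (f k) G b)
    tail≈ : ∀ f k → (inY₁ f ∘ suc) k P₁.≈ inY₁ (f ∘ suc) k
    tail≈ f k zero = refl
    tail≈ f k (suc m) = refl
    go : ∀ f F a → PS₂.conv (inY₁ f) F a b ≈ conv f (λ k → F k b) a
    go f F zero = scale f (F 0) 0
    go f F (suc a) = +-cong (scale f (F (suc a)) 0)
      (trans (PS₂.conv-cong a {inY₁ f ∘ suc} {inY₁ (f ∘ suc)} {F} {F} (λ m _ → tail≈ f m) (λ _ _ → P₁.refl) b) (go (f ∘ suc) F a))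

  mono00≈ : mono 0 0 P₂.≈ P₂.1#
  mono00≈ zero zero = refl
  mono00≈ zero (suc b) = refl
  mono00≈ (suc a) b = refl

  mono-suc₁ : ∀ p q → mono (suc p) q P₂.≈ y₁ P₂.* mono p q
  mono-suc₁ p q zero b = sym (y₁*-zero (mono p q) b)
  mono-suc₁ p q (suc a) b = sym (y₁*-suc (mono p q) a b)

  mono-suc₂ : ∀ p q → mono p (suc q) P₂.≈ y₂ P₂.* mono p q
  mono-suc₂ p q a zero = trans (reflexive (zero-case (a ≡ᵇ p))) (sym (y₂*-zero (mono p q) a))
    where
    zero-case : ∀ t → (if t ∧ false then 1# else 0#) ≡ 0#
    zero-case true = ≡.refl
    zero-case false = ≡.refl
  mono-suc₂ p q a (suc b) = sym (y₂*-suc (mono p q) a b)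

  d₁ d₂ : PS2 → PS2
  d₁ = PS₂.θ
  d₂ F a = θ (F a)

  natMul-eval : ∀ n (f : PS1) b → Over.natMul PSRing n f b ≡ natMul n (f b)
  natMul-eval zero f b = ≡.refl
  natMul-eval (suc n) f b = cong (f b +_) (natMul-eval n f b)

  d₁-eval : ∀ F a b → d₁ F a b ≈ natMul a (F a b)
  d₁-eval F a b = reflexive (natMul-eval a (F a) b)

  d₁-cong : ∀ {F G} → F P₂.≈ G → d₁ F P₂.≈ d₁ G
  d₁-cong {F} {G} e a b = trans (d₁-eval F a b) (trans (natMul-cong a (e a b)) (sym (d₁-eval G a b)))

  d₂-cong : ∀ {F G} → F P₂.≈ G → d₂ F P₂.≈ d₂ G
  d₂-cong e a b = natMul-cong b (e a b)

  d₁-+ : ∀ F G → d₁ (F P₂.+ G) P₂.≈ d₁ F P₂.+ d₁ G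
  d₁-+ F G a b = trans (d₁-eval (F P₂.+ G) a b) (trans (natMul-+ a _ _) (sym (+-cong (d₁-eval F a b) (d₁-eval G a b))))

  d₂-+ : ∀ F G → d₂ (F P₂.+ G) P₂.≈ d₂ F P₂.+ d₂ G
  d₂-+ F G a b = natMul-+ b _ _

  natMul-neg : ∀ n x → natMul n (- x) ≈ - natMul n x
  natMul-neg zero x = Sol.solve 0 (Sol.con (0 , 0) Sol.:= Sol.:- Sol.con (0 , 0)) refl
  natMul-neg (suc n) x = trans (+-congˡ (natMul-neg n x)) (Sol.solve 2 (λ a b → (Sol.:- a) Sol.:+ (Sol.:- b) Sol.:= Sol.:- (a Sol.:+ b)) refl _ _)

  d₁-neg : ∀ F → d₁ (P₂.- F) P₂.≈ P₂.- d₁ F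
  d₁-neg F a b = trans (d₁-eval (P₂.- F) a b) (trans (natMul-neg a _) (-‿cong (sym (d₁-eval F a b))))

  d₂-neg : ∀ F → d₂ (P₂.- F) P₂.≈ P₂.- d₂ F
  d₂-neg F a b = natMul-neg b _

  d₁-* : ∀ F G → d₁ (F P₂.* G) P₂.≈ (d₁ F P₂.* G) P₂.+ (F P₂.* d₁ G)
  d₁-* = PS₂.θ-*

  d₂-* : ∀ F G → d₂ (F P₂.* G) P₂.≈ (d₂ F P₂.* G) P₂.+ (F P₂.* d₂ G)
  d₂-* = PS₂.coeffwise-* θ (λ e n → natMul-cong n (e n)) (λ f g n → natMul-+ n _ _) θ-*

  d₁-y₁ : d₁ y₁ P₂.≈ y₁
  d₁-y₁ a b = trans (d₁-eval y₁ a b) (lem a b)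
    where
    lem : ∀ a b → natMul a (y₁ a b) ≈ y₁ a b
    lem zero b = refl
    lem (suc zero) b = +-identityʳ _
    lem (suc (suc a)) b = natMul-0 (suc (suc a))

  d₂-y₁ : d₂ y₁ P₂.≈ P₂.0#
  d₂-y₁ zero b = natMul-0 b
  d₂-y₁ (suc zero) zero = refl
  d₂-y₁ (suc zero) (suc b) = natMul-0 (suc b)
  d₂-y₁ (suc (suc a)) b = natMul-0 b

  d₁-const : ∀ f → d₁ (PS₂.const f) P₂.≈ P₂.0#
  d₁-const f a b = trans (d₁-eval (PS₂.const f) a b) (lem a)
    where
    lem : ∀ a → natMul a (PS₂.const f a b) ≈ 0#
    lem zero = refl
    lem (suc a) = natMul-0 (suc a)

  d₂-y₂ : d₂ y₂ P₂.≈ y₂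
  d₂-y₂ zero zero = refl
  d₂-y₂ zero (suc zero) = +-identityʳ _
  d₂-y₂ zero (suc (suc b)) = natMul-0 (suc (suc b))
  d₂-y₂ (suc a) b = natMul-0 b

  d₁-inY₁ : ∀ f → d₁ (inY₁ f) P₂.≈ inY₁ (θ f)
  d₁-inY₁ f a zero = d₁-eval (inY₁ f) a 0
  d₁-inY₁ f a (suc b) = trans (d₁-eval (inY₁ f) a (suc b)) (natMul-0 a)

  d₂-inY₁ : ∀ f → d₂ (inY₁ f) P₂.≈ P₂.0#
  d₂-inY₁ f a zero = refl
  d₂-inY₁ f a (suc b) = natMul-0 (suc b)

  d₁-inY₂ : ∀ f → d₁ (inY₂ f) P₂.≈ P₂.0#
  d₁-inY₂ f a b = trans (d₁-cong {inY₂ f} {PS₂.const f} (inY₂≈ f) a b) (d₁-const f a b)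

  d₂-inY₂ : ∀ f → d₂ (inY₂ f) P₂.≈ inY₂ (θ f)
  d₂-inY₂ f zero b = refl
  d₂-inY₂ f (suc a) b = natMul-0 b

 module SpokeSeries {c ℓ : Level} (R : CommutativeRing c ℓ) (κ : ℕ → CommutativeRing.Carrier R) where
  open CommutativeRing R hiding (zero)
  open Over R
  open SumProperties R
  open TwoVariables R
  open PartitionSums R using (sumR-concatMap-map)
  open MatchSum R using (module SpokeSum)
  open SpokeSum κ using (runWeight)
  open PointedSums R κ using (spoke)
  open import Relation.Binary.Reasoning.Setoid setoid
  private
    module Sol = Solver R
    module Sol₂ = Solver P₂

  compWeight : List Size → Carrier
  compWeight [] = 1#
  compWeight ((p , q) ∷ ss) = κ (suc p ℕ.+ suc q) * compWeight ss

  runWeight-number : ∀ k ss → runWeight (number k ss) ≈ compWeight ss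
  runWeight-number k [] = refl
  runWeight-number k ((p , q) ∷ ss) = *-congˡ (runWeight-number (suc k) ss)

  -- h is the series of one spoke and equals H + 1; S counts all finite sequences of spokes, so S =
  -- 1/(1 - h), and E counts the non-empty ones.
  h S E spokeSeries : PS2
  h zero b = 0#
  h (suc a) zero = 0#
  h (suc a) (suc b) = κ (suc a ℕ.+ suc b)
  S a b = sumR (map compWeight (comps a a b))
  E a b = sumR (map compWeight (nonNil (comps a a b)))
  spokeSeries a b = spoke a b

  private
    map-cons : ∀ k xs → sumR (map compWeight (map (k ∷_) xs)) ≈ κ (suc (proj₁ k) ℕ.+ suc (proj₂ k)) * sumR (map compWeight xs)
    map-cons k xs = trans (reflexive (cong sumR (≡.sym (map-∘ xs)))) (sym (sumR-*ˡ (κ (suc (proj₁ k) ℕ.+ suc (proj₂ k))) compWeight xs))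

  -- A non-empty sequence is its first spoke followed by a sequence. The remainder is listed with
  -- the fuel of the whole, which `comps-fuel-≤` adjusts.
  S-rec : S P₂.≈ P₂.1# P₂.+ h P₂.* S
  S-rec zero zero = sym (trans (+-congˡ (trans (P₂*≈double h S 0 0) (trans (+-identityʳ _) (trans (+-identityʳ _) (zeroˡ (S 0 0)))))) refl)
  S-rec zero (suc b) = sym (trans (+-identityˡ _) (trans (P₂*≈double h S 0 (suc b)) (trans (+-identityʳ _) (Σ<-0 (suc (suc b)) (λ l _ → zeroˡ (S 0 (suc b ∸ l)))))))
  S-rec (suc p) b = sym (begin
    0# + (h P₂.* S) (suc p) b
      ≈⟨ trans (+-identityˡ _) (P₂*≈double h S (suc p) b) ⟩
    Σ< (suc b) (λ l → 0# * S (suc p) (b ∸ l)) + Σ< (suc p) (λ a → Σ< (suc b) (λ l → h (suc a) l * S (p ∸ a) (b ∸ l)))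
      ≈⟨ trans (+-congʳ (Σ<-0 (suc b) (λ l _ → zeroˡ (S (suc p) (b ∸ l))))) (+-identityˡ _) ⟩
    Σ< (suc p) (λ a → Σ< (suc b) (λ l → h (suc a) l * S (p ∸ a) (b ∸ l)))
      ≈⟨ Σ<-cong (suc p) {g = λ a → Σ< b (λ l → κ (suc a ℕ.+ suc l) * S (p ∸ a) (b ∸ suc l))} (λ a _ → trans (+-congʳ (zeroˡ (S (p ∸ a) b))) (+-identityˡ _)) ⟩
    Σ< (suc p) (λ a → Σ< b (λ l → κ (suc a ℕ.+ suc l) * S (p ∸ a) (b ∸ suc l)))
      ≈⟨ Σ<-cong (suc p) {g = λ a → Σ< b (λ l → κ (suc a ℕ.+ suc l) * sumR (map compWeight (comps p (p ∸ a) (b ∸ suc l))))} (λ a _ → Σ<-cong b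
        {λ l → κ (suc a ℕ.+ suc l) * S (p ∸ a) (b ∸ suc l)} {λ l → κ (suc a ℕ.+ suc l) * sumR (map compWeight (comps p (p ∸ a) (b ∸ suc l)))} (λ l _ → *-congˡ (reflexive (cong (λ xs → sumR (map compWeight xs))
        (≡.sym (comps-fuel-≤ p (p ∸ a) (b ∸ suc l) (ℕP.m∸n≤m p a))))))) ⟩
    Σ< (suc p) (λ a → Σ< b (λ l → κ (suc a ℕ.+ suc l) * sumR (map compWeight (comps p (p ∸ a) (b ∸ suc l)))))
      ≈⟨ Σ<-cong (suc p) (λ a _ → trans (sym (sumR-upTo (λ l → κ (suc a ℕ.+ suc l) * sumR (map compWeight (comps p (p ∸ a) (b ∸ suc l)))) b)) (trans (sumR-cong (λ l → κ (suc a ℕ.+ suc l) * sumR (map compWeight (comps p (p ∸ a) (b ∸ suc l)))) (λ l → sumR (map compWeight (map ((a , l) ∷_) (comps p (p ∸ a) (b ∸ suc l))))) (upTo b) (λ l → sym (map-cons (a , l) (comps p (p ∸ a) (b ∸ suc l)))))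
        (sym (sumR-concatMap-map compWeight (λ l → map ((a , l) ∷_) (comps p (p ∸ a) (b ∸ suc l))) (upTo b))))) ⟩
    Σ< (suc p) (λ a → sumR (map compWeight (concatMap (λ l → map ((a , l) ∷_) (comps p (p ∸ a) (b ∸ suc l))) (upTo b))))
      ≈⟨ trans (sym (sumR-upTo (λ a → sumR (map compWeight (concatMap (λ l → map ((a , l) ∷_) (comps p (p ∸ a) (b ∸ suc l))) (upTo b)))) (suc p)))
        (sym (sumR-concatMap-map compWeight (λ a → concatMap (λ l → map ((a , l) ∷_) (comps p (p ∸ a) (b ∸ suc l))) (upTo b)) (upTo (suc p)))) ⟩
    S (suc p) b ∎)

  E-S : S P₂.≈ P₂.1# P₂.+ E
  E-S zero zero = refl
  E-S zero (suc b) = sym (+-identityˡ _)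
  E-S (suc a) b = sym (trans (+-identityˡ _) (reflexive (cong (λ xs → sumR (map compWeight xs)) (nonNil-id (comps (suc a) (suc a) b) λ { y∈ ≡.refl → absurd (proj₁ (comps-width (suc a) (suc a) b y∈)) }))))
    where
    absurd : zero ≡ suc a → ⊥
    absurd ()

  -- The first summand is the diagram with one run. Otherwise a first run with t + 1 letters on the
  -- first circle can be cut in t + 1 ways, which is d₁h; the other runs give E, and the second
  -- circle has `suc q` rotations.
  spoke-coeff : ∀ p q → spoke (suc p) (suc q) ≈ κ (suc p ℕ.+ suc q) + natMul (suc q) ((d₁ h P₂.* E) (suc p) (suc q))
  spoke-coeff p q = +-cong single rest
    where
    a = suc p
    b = suc q
    single : runWeight (Diagram.runs (diagram p 0 q [] 0)) ≈ κ (suc p ℕ.+ suc q)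
    single = trans (*-identityʳ _) (reflexive (cong (λ z → κ (suc z ℕ.+ suc q)) (ℕP.+-identityʳ p)))
    w : Diagram → Carrier
    w d = runWeight (Diagram.runs d)
    Σ-const : ∀ n x {F : ℕ → Carrier} → (∀ k → k < n → F k ≈ x) → Σ< n F ≈ natMul n x
    Σ-const zero x e = refl
    Σ-const (suc n) x e = +-cong (e 0 (s≤s z≤n)) (Σ-const n x (λ k l → e (suc k) (s≤s l)))
    over-r : ∀ e o b' rest → sumR (map w (map (λ r → diagram e o b' rest r) (upTo b))) ≈ natMul b (κ (suc (e ℕ.+ o) ℕ.+ suc b') * compWeight rest)
    over-r e o b' rest = trans (reflexive (cong sumR (≡.sym (map-∘ (upTo b))))) (trans (sumR-upTo (λ r → w (diagram e o b' rest r)) b) (Σ-const b _ (λ _ _ → *-congˡ (runWeight-number 1 rest))))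
    over-o : ∀ t b' rest → sumR (map w (concatMap (λ o → map (λ r → diagram (t ∸ o) o b' rest r) (upTo b)) (upTo (suc t)))) ≈
      natMul (suc t) (natMul b (κ (suc t ℕ.+ suc b') * compWeight rest))
    over-o t b' rest = trans (sumR-concatMap-map w (λ o → map (λ r → diagram (t ∸ o) o b' rest r) (upTo b)) (upTo (suc t))) (trans (sumR-upTo (λ o → sumR (map w (map (λ r → diagram (t ∸ o) o b' rest r) (upTo b)))) (suc t)) (Σ-const (suc t) (natMul b (κ (suc t ℕ.+ suc b') * compWeight rest))
      (λ o o<t → trans (over-r (t ∸ o) o b' rest) (natMul-cong b (*-congʳ (reflexive (cong (λ z → κ (suc z ℕ.+ suc b')) (ℕP.m∸n+n≡m (ℕP.≤-pred o<t)))))))))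
    inner : ℕ → ℕ → List Size → List Diagram
    inner t b' rest = concatMap (λ o → map (λ r → diagram (t ∸ o) o b' rest r) (upTo b)) (upTo (suc t))
    blocks : ℕ → ℕ → List Diagram
    blocks t b' = concatMap (inner t b') (nonNil (comps a (a ∸ suc t) (b ∸ suc b')))
    over-rest : ∀ t b' → t ≤ p → sumR (map w (blocks t b')) ≈ natMul b (natMul (suc t) (κ (suc t ℕ.+ suc b')) * E (p ∸ t) (q ∸ b'))
    over-rest t b' l = begin
      sumR (map w (concatMap (inner t b') xs)) ≈⟨ sumR-concatMap-map w (inner t b') xs ⟩
      sumR (map (λ rest → sumR (map w (inner t b' rest))) xs) ≈⟨ sumR-cong (λ rest → sumR (map w (inner t b' rest))) (λ rest → natMul b (natMul (suc t) (κ (suc t ℕ.+ suc b')) * compWeight rest)) xs (λ rest → trans (over-o t b' rest) (swap-mul rest)) ⟩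
      sumR (map (λ rest → natMul b (natMul (suc t) (κ (suc t ℕ.+ suc b')) * compWeight rest)) xs) ≈⟨ natMul-sum xs ⟩
      natMul b (natMul (suc t) (κ (suc t ℕ.+ suc b')) * sumR (map compWeight xs))
        ≈⟨ natMul-cong b (*-congˡ (reflexive (cong (λ ys → sumR (map compWeight (nonNil ys))) (comps-fuel-≤ a (p ∸ t) (q ∸ b') (ℕP.≤-trans (ℕP.m∸n≤m p t) (ℕP.n≤1+n p)))))) ⟩
      natMul b (natMul (suc t) (κ (suc t ℕ.+ suc b')) * E (p ∸ t) (q ∸ b')) ∎
      where
      xs = nonNil (comps a (a ∸ suc t) (b ∸ suc b'))
      natMul-comm : ∀ m n x → natMul m (natMul n x) ≈ natMul n (natMul m x)
      natMul-comm m n x = trans (sym (natMul-homo-* m n x)) (trans (reflexive (cong (λ z → natMul z x) (ℕP.*-comm m n))) (natMul-homo-* n m x))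
      swap-mul : ∀ rest → natMul (suc t) (natMul b (κ (suc t ℕ.+ suc b') * compWeight rest)) ≈ natMul b (natMul (suc t) (κ (suc t ℕ.+ suc b')) * compWeight rest)
      swap-mul rest = trans (natMul-comm (suc t) b _) (natMul-cong b (natMul-*ˡ (suc t) _ _))
      natMul-sum : ∀ ys → sumR (map (λ rest → natMul b (natMul (suc t) (κ (suc t ℕ.+ suc b')) * compWeight rest)) ys) ≈
        natMul b (natMul (suc t) (κ (suc t ℕ.+ suc b')) * sumR (map compWeight ys))
      natMul-sum [] = sym (trans (natMul-cong b (zeroʳ _)) (natMul-0 b))
      natMul-sum (y ∷ ys) = trans (+-congˡ (natMul-sum ys)) (trans (sym (natMul-+ b _ _)) (natMul-cong b (sym (distribˡ _ _ _))))
    term : ℕ → ℕ → Carrier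
    term t b' = natMul (suc t) (κ (suc t ℕ.+ suc b')) * E (p ∸ t) (q ∸ b')
    natMul-Σ : ∀ n m (F : ℕ → Carrier) → natMul m (Σ< n F) ≈ Σ< n (λ k → natMul m (F k))
    natMul-Σ zero m F = natMul-0 m
    natMul-Σ (suc n) m F = trans (natMul-+ m _ _) (+-congˡ (natMul-Σ n m (F ∘ suc)))
    rest : sumR (map w (diagrams⁺ a b)) ≈ natMul b ((d₁ h P₂.* E) a b)
    rest = begin
      sumR (map w (diagrams⁺ a b))
        ≈⟨ trans (sumR-concatMap-map w (λ t → concatMap (blocks t) (upTo b)) (upTo a)) (sumR-upTo (λ t → sumR (map w (concatMap (blocks t) (upTo b)))) a) ⟩
      Σ< a (λ t → sumR (map w (concatMap (blocks t) (upTo b))))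
        ≈⟨ Σ<-cong a (λ t t<a → trans (sumR-concatMap-map w (blocks t) (upTo b)) (trans (sumR-upTo (λ b' → sumR (map w (blocks t b'))) b) (Σ<-cong b (λ b' _ → over-rest t b' (ℕP.≤-pred t<a))))) ⟩
      Σ< a (λ t → Σ< b (λ b' → natMul b (natMul (suc t) (κ (suc t ℕ.+ suc b')) * E (p ∸ t) (q ∸ b'))))
        ≈⟨ trans (natMul-Σ a b (λ t → Σ< b (term t))) (Σ<-cong a (λ t _ → natMul-Σ b b (term t))) ⟨
      natMul b (Σ< a (λ t → Σ< b (λ b' → natMul (suc t) (κ (suc t ℕ.+ suc b')) * E (p ∸ t) (q ∸ b'))))
        ≈⟨ natMul-cong b (Σ<-cong a {λ t → Σ< b (term t)} {λ t → Σ< (suc b) (λ l → d₁ h (suc t) l * E (p ∸ t) (b ∸ l))} (λ t _ →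
          trans (sym (+-identityˡ _)) (+-cong (sym (trans (*-congʳ {E (p ∸ t) b} (trans (d₁-eval h (suc t) 0) (natMul-0 (suc t)))) (zeroˡ _)))
          (Σ<-cong b {term t} {λ b' → d₁ h (suc t) (suc b') * E (p ∸ t) (q ∸ b')} (λ b' _ → *-congʳ {E (p ∸ t) (q ∸ b')} (sym (d₁-eval h (suc t) (suc b')))))))) ⟩
      natMul b (Σ< a (λ t → Σ< (suc b) (λ l → d₁ h (suc t) l * E (p ∸ t) (b ∸ l))))
        ≈⟨ natMul-cong b (trans (sym (+-identityˡ _)) (+-congʳ (sym (Σ<-0 (suc b) (λ l _ → trans (*-congʳ {E a (b ∸ l)} (d₁-eval h 0 l)) (zeroˡ _)))))) ⟩
      natMul b (double (d₁ h) E a b)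
        ≈⟨ natMul-cong b (P₂*≈double (d₁ h) E a b) ⟨
      natMul b ((d₁ h P₂.* E) a b) ∎

  spoke-series-E : spokeSeries P₂.≈ h P₂.+ d₂ (d₁ h P₂.* E)
  spoke-series-E zero b = sym (trans (+-identityˡ _) (trans (natMul-cong b (trans (P₂*≈double (d₁ h) E 0 b) (trans (+-identityʳ _)
    (Σ<-0 (suc b) (λ l _ → zeroˡ (E 0 (b ∸ l))))))) (natMul-0 b)))
  spoke-series-E (suc a) zero = sym (+-identityˡ 0#)
  spoke-series-E (suc p) (suc q) = spoke-coeff p q

  -- Replacing E by S = 1 + E would also give single spokes their cuts and rotations; the subtracted
  -- term removes them.
  spoke-series : spokeSeries P₂.≈ (h P₂.- d₂ (d₁ h)) P₂.+ d₂ (d₁ h P₂.* S)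
  spoke-series a b = trans (spoke-series-E a b) (trans
    (Sol.solve 3 (λ x y z → x Sol.:+ z Sol.:= (x Sol.:- y) Sol.:+ (y Sol.:+ z)) refl _ _ _)
    (+-congˡ (trans (sym (natMul-+ b (d₁ h a b) ((d₁ h P₂.* E) a b))) (natMul-cong b (split a b)))))
    where
    split : ∀ a b → d₁ h a b + (d₁ h P₂.* E) a b ≈ (d₁ h P₂.* S) a b
    split a b = sym (trans (P₂.*-congˡ {d₁ h} {S} {P₂.1# P₂.+ E} E-S a b) (trans (P₂.distribˡ (d₁ h) P₂.1# E a b)
      (+-congʳ (P₂.*-identityʳ (d₁ h) a b))))

-- Generating series of pointed non-crossing partitions

module MomentGeneratingSeries where
 open NonCrossingPartitions
 open DiagramSums
 open CylinderMoments

 increasing-applyUpTo : ∀ (f : ℕ → ℕ) lo n → lo ≤ f 0 → (∀ k → f k < f (suc k)) → Increasing lo (applyUpTo f n)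
 increasing-applyUpTo f lo zero l m = []
 increasing-applyUpTo f lo (suc n) l m = l ∷ increasing-applyUpTo (f ∘ suc) (suc (f 0)) n (m 0) (m ∘ suc)

 increasing-setA : ∀ n → Increasing 0 (setA n)
 increasing-setA n = increasing-applyUpTo id 0 n z≤n ℕP.n<1+n

 increasing-setB : ∀ i n → Increasing 0 (setB i n)
 increasing-setB i n = subst (Increasing 0) (≡.sym (map-upTo (i ℕ.+_) n))
   (increasing-applyUpTo (i ℕ.+_) 0 n z≤n (λ k → ℕP.+-monoʳ-< i (ℕP.n<1+n k)))

 module NonCrossingMoments {c ℓ : Level} (R : CommutativeRing c ℓ) (κ v : ℕ → CommutativeRing.Carrier R) where
  open CommutativeRing R hiding (zero)
  open Over R
  open SumProperties R
  open PowerSeries R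
  open MatchSum R using (module SpokeSum)
  open SpokeSum κ using (wt)
  open PointedSums R κ using (pointedSum; nc-pointed)
  open PointedMoments R κ v
  private
    module P = CommutativeRing PSRing
    module PSol = Solver PSRing
    module D = CommutativeRing (Dual.DualRing PSRing)
    module OD = Over (Dual.DualRing PSRing)
    module NC (el : List ℕ) = NonCrossingSum (Dual.DualRing PSRing) κᵉ el
  open PSol using (_:=_; _:+_; _:*_; _:-_; :-_; con)

  const-cong : ∀ {x y} → x ≈ y → const x ≋ const y
  const-cong e zero = e
  const-cong e (suc n) = refl

  const-+ : ∀ x y → const (x + y) ≋ const x P.+ const y
  const-+ x y zero = refl
  const-+ x y (suc n) = sym (+-identityˡ 0#)

  const-0 : const 0# ≋ P.0#
  const-0 zero = refl
  const-0 (suc n) = refl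

  const-1 : const 1# ≋ one1
  const-1 zero = refl
  const-1 (suc n) = refl

  const-* : ∀ x y → const (x * y) ≋ const x *₁ const y
  const-* x y n = trans (lem n) (sym (const* x (const y) n))
    where
    lem : ∀ n → const (x * y) n ≈ x * const y n
    lem zero = refl
    lem (suc n) = sym (zeroʳ x)

  pointed : List ℕ × List (List ℕ) → Carrier
  pointed P = v (length (proj₁ P)) * wt (proj₂ P)

  points : List (List ℕ) → Carrier
  points π = sumR (map pointed (pointings π))

  points-∷ : ∀ b π → points (b ∷ π) ≈ v (length b) * wt π + κ (length b) * points π
  points-∷ b π = +-congˡ (trans (reflexive (cong sumR (≡.sym (map-∘ (pointings π)))))
    (trans (sumR-cong (λ P → v (length (proj₁ P)) * (κ (length b) * wt (proj₂ P))) (λ P → κ (length b) * pointed P) (pointings π) (λ P → swap _ _ _))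
      (sym (sumR-*ˡ (κ (length b)) pointed (pointings π)))))
    where
    module Sol = Solver R
    swap : ∀ x y z → x * (y * z) ≈ y * (x * z)
    swap = Sol.solve 3 (λ x y z → x Sol.:* (y Sol.:* z) Sol.:= y Sol.:* (x Sol.:* z)) refl

  wtᵉ : List (List ℕ) → D.Carrier
  wtᵉ π = OD.prodR (map (λ V → κᵉ (length V)) π)

  -- The Leibniz rule: the derivative of a product over blocks is a sum over a distinguished block
  -- whose weight is replaced by v, here with the common factor K.
  wtᵉ≈ : ∀ π → wtᵉ π D.≈ (const (wt π) , K *₁ const (points π))
  wtᵉ≈ [] = P.sym const-1 , P.sym (P.trans (P.*-congˡ {x = K} const-0) (P.zeroʳ K))
  wtᵉ≈ (b ∷ π) = D.trans {wtᵉ (b ∷ π)} {κᵉ (length b) D.* (const (wt π) , K *₁ const (points π))}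
    (D.*-congˡ {x = κᵉ (length b)} (wtᵉ≈ π))
    (P.sym (const-* (κ (length b)) (wt π)) , P.sym (begin
      K *₁ const (points (b ∷ π))
        ≈⟨ P.*-congˡ {x = K} (P.trans (const-cong (points-∷ b π)) (P.trans (const-+ _ _) (P.+-cong (const-* _ _) (const-* _ _)))) ⟩
      K *₁ (const (v (length b)) *₁ const (wt π) P.+ const (κ (length b)) *₁ const (points π))
        ≈⟨ PSol.solve 5 (λ k a w c p → k :* (a :* w :+ c :* p) := c :* (k :* p) :+ k :* a :* w) (λ {_} → P.refl)
          K (const (v (length b))) (const (wt π)) (const (κ (length b))) (const (points π)) ⟩
      const (κ (length b)) *₁ (K *₁ const (points π)) P.+ K *₁ const (v (length b)) *₁ const (wt π) ∎))
    where open import Relation.Binary.Reasoning.Setoid P.setoid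

  sum-wtᵉ : ∀ πs → OD.sumR (map wtᵉ πs) D.≈ (const (sumR (map wt πs)) , K *₁ const (sumR (map points πs)))
  sum-wtᵉ [] = P.sym const-0 , P.sym (P.trans (P.*-congˡ {x = K} const-0) (P.zeroʳ K))
  sum-wtᵉ (π ∷ πs) = D.trans {OD.sumR (map wtᵉ (π ∷ πs))} {(const (wt π) , K *₁ const (points π)) D.+ (const (sumR (map wt πs)) , K *₁ const (sumR (map points πs)))}
    (D.+-cong (wtᵉ≈ π) (sum-wtᵉ πs))
    (P.sym (const-+ _ _) , P.trans (P.sym (P.distribˡ K (const (points π)) (const (sumR (map points πs))))) (P.*-congˡ {x = K} (P.sym (const-+ _ _))))

  nc-steps : ∀ {L} → Increasing 0 L → proj₂ (Sᵉ.steps (length L) Sᵉ.weight []) ≋ K *₁ const (pointedSum L v)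
  nc-steps {L} inc = P.trans (P.sym (proj₂ (NC.nc-sum L inc))) (P.trans (proj₂ (sum-wtᵉ (ncPartitions L)))
    (P.*-congˡ {x = K} (const-cong (nc-pointed L v))))

  -- The constant coefficient of K is 1, so K can be cancelled over any ring.
  K*const-injective : ∀ {x y} → K *₁ const x ≋ K *₁ const y → x ≈ y
  K*const-injective {x} {y} e = trans (sym (value x)) (trans (e 0) (value y))
    where
    module Sol = Solver R
    value : ∀ x → (K *₁ const x) 0 ≈ x
    value x = trans (P.*-comm K (const x) 0) (trans (const* x K 0)
      (Sol.solve 1 (λ x → x Sol.:* (Sol.:- (Sol.:- Sol.con (1 , 0))) Sol.:= x) refl x))

  -- Both sums are, up to the factor K, the ε-part of the same `steps`, which knows only the number
  -- of elements. This moves the second circle to {0, ..., j - 1}.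
  pointedSum-length : ∀ {L L'} → Increasing 0 L → Increasing 0 L' → length L ≡ length L' → pointedSum L v ≈ pointedSum L' v
  pointedSum-length inc inc' e = K*const-injective (P.trans (P.sym (nc-steps inc))
    (P.trans (P.reflexive (cong (λ n → proj₂ (Sᵉ.steps n Sᵉ.weight [])) e)) (nc-steps inc')))

  pointedSum-setB : ∀ i j → pointedSum (setB i j) v ≈ pointedSum (setA j) v
  pointedSum-setB i j = pointedSum-length (increasing-setB i j) (increasing-setA j) (length-map (i ℕ.+_) (upTo j))

  moment-series : K *₁ (λ b → Σ< b (λ n → pow1 (Xrec κ) (suc n) b * pointedSum (setA n) v)) ≋ X *₁ g
  moment-series = pointed-moments (λ n → pointedSum (setA n) v) (λ n → P.trans
    (P.reflexive (cong (λ m → proj₂ (Sᵉ.steps m Sᵉ.weight [])) (≡.sym (length-upTo n)))) (nc-steps (increasing-setA n)))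

-- The cylinder series in both variables

module CylinderSeries where
 open NonCrossingPartitions
 open PartitionSplitting
 open DiagramSums
 open BridgePartitions using (crossing?)
 open CylinderMoments
 open SpokeGeneratingSeries
 open MomentGeneratingSeries

 module MomentSeries {c ℓ : Level} (R : CommutativeRing c ℓ)
  (κ : ℕ → CommutativeRing.Carrier R) (κ₂ : ℕ → ℕ → CommutativeRing.Carrier R) where
  open CommutativeRing R hiding (zero)
  open Over R
  open SumProperties R
  open TwoVariables R
  open PartitionSums R
  open SplitSums R
  open MatchSum R using (module SpokeSum)
  open SpokeSum κ using (wt)
  open PointedSums R κ
  private
    module Sol = Solver R

  pointSum-*ˡ : ∀ k π F → k * pointSum π F ≈ pointSum π (λ V r → k * F V r)
  pointSum-*ˡ k [] F = zeroʳ k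
  pointSum-*ˡ k (b ∷ π) F = trans (distribˡ k _ _) (+-congˡ (pointSum-*ˡ k π (λ V r → F V (b ∷ r))))

  pointedSum-*ˡ : ∀ L k v → k * pointedSum L v ≈ pointedSum L (λ p → k * v p)
  pointedSum-*ˡ L k v = trans (spSum-*ˡ L k _) (spSum-cong L (λ {π} _ → trans (scale (crossing? L π))
    (nc-if-cong {crossing? L π} ≡.refl (trans (pointSum-*ˡ k π _) (pointSum-cong π (λ V r → sym (*-assoc k _ _)))))))
    where
    scale : ∀ b {x} → k * nc-if b x ≈ nc-if b (k * x)
    scale true = zeroʳ k
    scale false = refl

  pointedSum-Σ : ∀ L N (a : ℕ → Carrier) (F : ℕ → ℕ → Carrier) →
    pointedSum L (λ p → Σ< N (λ k → a k * F k p)) ≈ Σ< N (λ k → a k * pointedSum L (F k))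
  pointedSum-Σ L zero a F = pointedSum-0 L (λ _ → refl)
  pointedSum-Σ L (suc N) a F = trans (pointedSum-+ L (λ p → a 0 * F 0 p) (λ p → Σ< N (λ k → a (suc k) * F (suc k) p)))
    (+-cong (sym (pointedSum-*ˡ L (a 0) (F 0))) (pointedSum-Σ L N (a ∘ suc) (F ∘ suc)))

  pointedSum-[] : ∀ v → pointedSum [] v ≈ 0#
  pointedSum-[] v = none (crossing? [] [])
    where
    none : ∀ b → nc-if b 0# ≈ 0#
    none true = refl
    none false = refl

  *₁-Σ : ∀ f g n → (f *₁ g) n ≈ Σ< (suc n) (λ k → f k * g (n ∸ k))
  *₁-Σ f g n = sumR-upTo (λ k → f k * g (n ∸ k)) (suc n)

  *₁-pointedSum : ∀ f L (F : ℕ → PS1) b → (f *₁ (λ b' → pointedSum L (λ p → F p b'))) b ≈ pointedSum L (λ p → (f *₁ F p) b)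
  *₁-pointedSum f L F b = trans (*₁-Σ f (λ b' → pointedSum L (λ p → F p b')) b) (trans (sym (pointedSum-Σ L (suc b) f (λ k p → F p (b ∸ k))))
    (pointedSum-cong L (λ p → sym (*₁-Σ f (F p) b))))

  *₁-comb : ∀ f N (a : ℕ → Carrier) (F : ℕ → PS1) b → (f *₁ (λ b' → Σ< N (λ n → a n * F n b'))) b ≈ Σ< N (λ n → a n * (f *₁ F n) b)
  *₁-comb f zero a F b = P₁.zeroʳ f b
  *₁-comb f (suc N) a F b = trans (P₁.distribˡ f (λ b' → a 0 * F 0 b') (λ b' → Σ< N (λ n → a (suc n) * F (suc n) b')) b)
    (+-cong scale (*₁-comb f N (a ∘ suc) (F ∘ suc) b))
    where
    scale : (f *₁ (λ b' → a 0 * F 0 b')) b ≈ a 0 * (f *₁ F 0) b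
    scale = trans (*₁-Σ f (λ b' → a 0 * F 0 b') b) (trans (Σ<-cong (suc b) {f = λ k → f k * (a 0 * F 0 (b ∸ k))} {g = λ k → a 0 * (f k * F 0 (b ∸ k))}
      (λ k _ → Sol.solve 3 (λ x y z → x Sol.:* (y Sol.:* z) Sol.:= y Sol.:* (x Sol.:* z)) refl _ _ _))
      (trans (sym (Σ<-*ˡ (suc b) (a 0) (λ k → f k * F 0 (b ∸ k)))) (*-congˡ (sym (*₁-Σ f (F 0) b)))))

  Σ<-shift : ∀ n F → F 0 ≈ 0# → F n ≈ 0# → Σ< n (F ∘ suc) ≈ Σ< n F
  Σ<-shift n F e e' = trans (sym (trans (+-congʳ e) (+-identityˡ _))) (trans (Σ<-last n F) (trans (+-congˡ e') (+-identityʳ _)))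

  κ₂ˢ : ℕ → ℕ → Carrier
  κ₂ˢ p q = κ₂ p q + spoke p q

  w : ℕ → PS1
  w n = pow1 (Xrec κ) (suc n)

  w-0 : ∀ n → w n n ≈ 0#
  w-0 n = Ord-pow {Xrec κ} ord (suc n) n (ℕP.n<1+n n)
    where
    ord : Ord 1 (Xrec κ)
    ord zero _ = refl
    ord (suc m) (s≤s ())

  M : ℕ → ℕ → Carrier
  M n m = pointedSum (setA n) (λ p → pointedSum (setA m) (κ₂ˢ p))

  mCyl≈M : ∀ n m → mCyl κ κ₂ (suc n) (suc m) ≈ M (suc n) (suc m)
  mCyl≈M n m = trans (mCyl-pointed κ₂ n m) (pointedSum-cong (setA (suc n)) (λ p →
    NonCrossingMoments.pointedSum-setB R κ (κ₂ˢ p) (suc n) (suc m)))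

  inner : ℕ → PS1
  inner p b = Σ< b (λ m → w m b * pointedSum (setA m) (κ₂ˢ p))

  W≈ : ∀ a b → Wpar2∘X κ κ₂ a b ≈ Σ< a (λ n → w n a * pointedSum (setA n) (λ p → inner p b))
  W≈ a b = begin
    Wpar2∘X κ κ₂ a b
      ≈⟨ trans (sumR-concatMap row (map suc (upTo a))) (trans (reflexive (cong sumR (≡.sym (map-∘ (upTo a))))) (sumR-upTo (λ i → sumR (row (suc i))) a)) ⟩
    Σ< a (λ i → sumR (row (suc i)))
      ≈⟨ Σ<-cong a {f = λ i → sumR (row (suc i))} {g = λ i → F (suc i)} (λ i _ → row-sum i) ⟩
    Σ< a (F ∘ suc)
      -- The statement sums over 1, ..., a and the moment series over 0, ..., a - 1. Both extra
      -- terms vanish: there is no block to point at in the empty set, and the power of index a has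
      -- order a + 1.
      ≈⟨ Σ<-shift a F (trans (*-congˡ (pointedSum-[] (λ p → inner p b))) (zeroʳ (w 0 a))) (trans (*-congʳ (w-0 a)) (zeroˡ _)) ⟩
    Σ< a F ∎
    where
    open import Relation.Binary.Reasoning.Setoid setoid
    F : ℕ → Carrier
    F n = w n a * pointedSum (setA n) (λ p → inner p b)
    entry : ℕ → ℕ → Carrier
    entry i j = mCyl κ κ₂ i j * pow1 (Xrec κ) (suc i) a * pow1 (Xrec κ) (suc j) b
    row : ℕ → List Carrier
    row i = map (entry i) (map suc (upTo b))
    G' : ℕ → ℕ → Carrier
    G' n m = w m b * M n m
    row-sum : ∀ i → sumR (row (suc i)) ≈ F (suc i)
    row-sum i = begin
      sumR (row (suc i))
        ≈⟨ trans (reflexive (cong sumR (≡.sym (map-∘ (upTo b))))) (sumR-upTo (λ j → entry (suc i) (suc j)) b) ⟩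
      Σ< b (λ j → entry (suc i) (suc j))
        ≈⟨ Σ<-cong b {f = λ j → entry (suc i) (suc j)} {g = λ j → w (suc i) a * G' (suc i) (suc j)} (λ j _ → trans (*-congʳ (*-congʳ (mCyl≈M i j)))
          (Sol.solve 3 (λ x y z → x Sol.:* y Sol.:* z Sol.:= y Sol.:* (z Sol.:* x)) refl _ _ _)) ⟩
      Σ< b (λ j → w (suc i) a * G' (suc i) (suc j))
        ≈⟨ Σ<-*ˡ b (w (suc i) a) (G' (suc i) ∘ suc) ⟨
      w (suc i) a * Σ< b (G' (suc i) ∘ suc)
        ≈⟨ *-congˡ (Σ<-shift b (G' (suc i)) (trans (*-congˡ (pointedSum-0 (setA (suc i)) (λ p → pointedSum-[] (κ₂ˢ p)))) (zeroʳ (w 0 b)))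
          (trans (*-congʳ (w-0 b)) (zeroˡ _))) ⟩
      w (suc i) a * Σ< b (G' (suc i))
        ≈⟨ *-congˡ (pointedSum-Σ (setA (suc i)) b (λ m → w m b) (λ m p → pointedSum (setA m) (κ₂ˢ p))) ⟨
      F (suc i) ∎

  K : PS1
  K n = - Xp κ n

  inner-series : ∀ p b → (K *₁ inner p) b ≈ (X *₁ PointedMoments.g R κ (κ₂ˢ p)) b
  inner-series p = NonCrossingMoments.moment-series R κ (κ₂ˢ p)

  Y : PS2
  Y zero q = 0#
  Y (suc p) zero = 0#
  Y (suc p) (suc q) = κ₂ˢ (suc p) (suc q)

  -- `moment-series` is used once for each circle: on the second with v the weights in a fixed row
  -- p, and then on the first with v the resulting coefficients.
  moments₂ : inY₁ K P₂.* (inY₂ K P₂.* Wpar2∘X κ κ₂) P₂.≈ y₁ P₂.* (y₂ P₂.* Y)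
  moments₂ a b = begin
    (inY₁ K P₂.* (inY₂ K P₂.* W)) a b
      ≈⟨ inY₁* K (inY₂ K P₂.* W) a b ⟩
    (K *₁ (λ a' → (inY₂ K P₂.* W) a' b)) a
      ≈⟨ P₁.*-congˡ {x = K} column a ⟩
    (K *₁ (λ a' → Σ< a' (λ n → w n a' * pointedSum (setA n) v))) a
      ≈⟨ NonCrossingMoments.moment-series R κ v a ⟩
    (X *₁ PointedMoments.g R κ v) a
      ≈⟨ shift a ⟩
    (y₁ P₂.* (y₂ P₂.* Y)) a b ∎
    where
    open import Relation.Binary.Reasoning.Setoid setoid
    W = Wpar2∘X κ κ₂
    -- The coefficient b of the second-circle series belonging to a distinguished block of size p on
    -- the first circle; it serves as the direction of the outer derivative.
    v : ℕ → Carrier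
    v p = (X *₁ PointedMoments.g R κ (κ₂ˢ p)) b
    column : ∀ a' → (inY₂ K P₂.* W) a' b ≈ Σ< a' (λ n → w n a' * pointedSum (setA n) v)
    column a' = begin
      (inY₂ K P₂.* W) a' b
        ≈⟨ inY₂* K W a' b ⟩
      (K *₁ W a') b
        ≈⟨ P₁.*-congˡ {x = K} (W≈ a') b ⟩
      (K *₁ (λ b' → Σ< a' (λ n → w n a' * pointedSum (setA n) (λ p → inner p b')))) b
        ≈⟨ *₁-comb K a' (λ n → w n a') (λ n b' → pointedSum (setA n) (λ p → inner p b')) b ⟩
      Σ< a' (λ n → w n a' * (K *₁ (λ b' → pointedSum (setA n) (λ p → inner p b'))) b)
        ≈⟨ Σ<-cong a' {f = λ n → w n a' * (K *₁ (λ b' → pointedSum (setA n) (λ p → inner p b'))) b} {g = λ n → w n a' * pointedSum (setA n) v}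
          (λ n _ → *-congˡ (trans (*₁-pointedSum K (setA n) inner b) (pointedSum-cong (setA n) (λ p → inner-series p b)))) ⟩
      Σ< a' (λ n → w n a' * pointedSum (setA n) v) ∎
    g≈Y : ∀ p → PointedMoments.g R κ (κ₂ˢ (suc p)) P₁.≈ Y (suc p)
    g≈Y p zero = refl
    g≈Y p (suc q) = refl
    shift : ∀ a → (X *₁ PointedMoments.g R κ v) a ≈ (y₁ P₂.* (y₂ P₂.* Y)) a b
    shift zero = trans (X*-zero (PointedMoments.g R κ v)) (sym (y₁*-zero (y₂ P₂.* Y) b))
    shift (suc a) = trans (X*-suc (PointedMoments.g R κ v) a) (sym (trans (y₁*-suc (y₂ P₂.* Y) a b) (trans (PS₂.const* X Y a b) (sym (g≈ a)))))
      where
      g≈ : ∀ a → PointedMoments.g R κ v a ≈ (X *₁ Y a) b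
      g≈ zero = sym (P₁.zeroʳ X b)
      g≈ (suc p) = P₁.*-congˡ {x = X} (g≈Y p) b

  Y≈ : Y P₂.≈ y₁ P₂.* (y₂ P₂.* X₂ κ₂) P₂.+ SpokeSeries.spokeSeries R κ
  Y≈ zero q = sym (trans (+-congʳ (y₁*-zero (y₂ P₂.* X₂ κ₂) q)) (+-identityˡ 0#))
  Y≈ (suc p) zero = sym (trans (+-congʳ (trans (y₁*-suc (y₂ P₂.* X₂ κ₂) p 0) (y₂*-zero (X₂ κ₂) p))) (+-identityˡ 0#))
  Y≈ (suc p) (suc q) = +-congʳ (sym (trans (y₁*-suc (y₂ P₂.* X₂ κ₂) p (suc q)) (y₂*-suc (X₂ κ₂) p q)))

-- Proof of the theorem

module Cylinder {c ℓ : Level} (R : CommutativeRing c ℓ)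
 (κ : ℕ → CommutativeRing.Carrier R) (κ₂ : ℕ → ℕ → CommutativeRing.Carrier R) where
 open SpokeGeneratingSeries
 open CylinderSeries
 open CommutativeRing R hiding (zero)
 open Over R
 open SumProperties R
 open TwoVariables R
 open SpokeSeries R κ
 open MomentSeries R κ κ₂ using (K; Y; Y≈; moments₂)
 open Derivations P₂
 private
   module Sol = Solver R
   module Sol₂ = Solver P₂

 f : PS1
 f = Xt κ

 d₁-derivation : Derivation d₁
 d₁-derivation = record
   { D-cong = λ {F} {G} → d₁-cong {F} {G} ; D-+ = d₁-+ ; D-neg = d₁-neg ; D-* = d₁-* }

 d₂-derivation : Derivation d₂
 d₂-derivation = record
   { D-cong = λ {F} {G} → d₂-cong {F} {G} ; D-+ = d₂-+ ; D-neg = d₂-neg ; D-* = d₂-* }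

 H≈ : ∀ a b → H κ a b + mono 0 0 a b ≈ h a b
 H≈ zero zero = -‿inverseˡ 1#
 H≈ zero (suc b) = +-identityˡ 0#
 H≈ (suc a) zero = +-identityˡ 0#
 H≈ (suc a) (suc b) = +-identityʳ _

 d₁H≈d₁h : d₁ (H κ) P₂.≈ d₁ h
 d₁H≈d₁h a b = trans (d₁-eval (H κ) a b) (trans (value a b) (sym (d₁-eval h a b)))
   where
   value : ∀ a b → natMul a (H κ a b) ≈ natMul a (h a b)
   value zero b = refl
   value (suc a) zero = refl
   value (suc a) (suc b) = refl

 -- With H = h - 1 this is the recursion S = 1 + hS, so S plays the role of -1/H.
 H*S : H κ P₂.* S P₂.≈ P₂.- P₂.1#
 H*S a b = trans (P₂.*-congʳ {S} {H κ} {h P₂.- P₂.1#} H-h a b) (trans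
   (Sol₂.solve 2 (λ h s → (h Sol₂.:- Sol₂.con (1 , 0)) Sol₂.:* s Sol₂.:= h Sol₂.:* s Sol₂.:- s) (λ {_} {_} _ _ → refl) h S a b)
   (trans (+-congˡ (-‿cong (S-rec a b))) (Sol.solve 2 (λ x y → x Sol.:- (y Sol.:+ x) Sol.:= Sol.:- y) refl _ _)))
   where
   H-h : H κ P₂.≈ h P₂.- P₂.1#
   H-h a b = trans (Sol.solve 2 (λ x y → x Sol.:= (x Sol.:+ y) Sol.:- y) refl (H κ a b) (mono 0 0 a b))
     (+-cong (H≈ a b) (-‿cong (mono00≈ a b)))

 θθ≈ : θθ-op (H κ +₂ mono 0 0) P₂.≈ h P₂.- d₂ (d₁ h)
 θθ≈ a b = +-cong (H≈ a b) (-‿cong (begin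
   natMul (a ℕ.* b) (H κ a b + mono 0 0 a b) ≈⟨ natMul-cong (a ℕ.* b) (H≈ a b) ⟩
   natMul (a ℕ.* b) (h a b) ≈⟨ reflexive (cong (λ n → natMul n (h a b)) (ℕP.*-comm a b)) ⟩
   natMul (b ℕ.* a) (h a b) ≈⟨ natMul-homo-* b a (h a b) ⟩
   natMul b (natMul a (h a b)) ≈⟨ natMul-cong b (d₁-eval h a b) ⟨
   natMul b (d₁ h a b) ∎))
   where open import Relation.Binary.Reasoning.Setoid setoid

 -- Away from the axes each coefficient on the left is a difference of two equal cumulants, since H
 -- depends only on the sum of the exponents; the survivors near the axes form G.
 ΔH : (y₁ P₂.- y₂) P₂.* H κ P₂.≈ y₂ P₂.* inY₁ f P₂.- y₁ P₂.* inY₂ f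
 ΔH a b = trans (Sol₂.solve 3 (λ y z h → (y Sol₂.:- z) Sol₂.:* h Sol₂.:= y Sol₂.:* h Sol₂.:- z Sol₂.:* h) (λ {_} {_} {_} _ _ → refl) y₁ y₂ (H κ) a b) (coeff a b)
   where
   sub : ∀ {x x' y y'} → x ≈ x' → y ≈ y' → x - y ≈ x' - y'
   sub e e' = +-cong e (-‿cong e')
   via : ∀ {x y z u x' y' z' u'} → x ≈ x' → y ≈ y' → z ≈ z' → u ≈ u' → x' - y' ≈ z' - u' → x - y ≈ z - u
   via p q r s e = trans (sub p q) (trans e (sym (sub r s)))
   inner : ∀ a b → H κ a (suc b) - H κ (suc a) b ≈ inY₁ f (suc a) b - inY₂ f a (suc b)
   inner zero zero = trans (-‿inverseʳ 0#) (sym (-‿inverseʳ _))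
   inner zero (suc b) = refl
   inner (suc a) zero = sub (reflexive (cong κ (ℕP.+-comm (suc a) 1))) refl
   inner (suc a) (suc b) = trans (sub (reflexive (cong κ (ℕP.+-suc (suc a) (suc b)))) refl) (trans (-‿inverseʳ _) (sym (-‿inverseʳ 0#)))
   coeff : ∀ a b → (y₁ P₂.* H κ) a b - (y₂ P₂.* H κ) a b ≈ (y₂ P₂.* inY₁ f) a b - (y₁ P₂.* inY₂ f) a b
   coeff zero zero = via (y₁*-zero (H κ) 0) (y₂*-zero (H κ) 0) (y₂*-zero (inY₁ f) 0) (y₁*-zero (inY₂ f) 0) refl
   -- Here the constant term -1 of H meets the constant term 1 of f.
   coeff zero (suc zero) = via (y₁*-zero (H κ) 1) (y₂*-suc (H κ) 0 0) (y₂*-suc (inY₁ f) 0 0) (y₁*-zero (inY₂ f) 1)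
     (Sol.solve 1 (λ e → Sol.con (0 , 0) Sol.:- (Sol.:- e) Sol.:= e Sol.:- Sol.con (0 , 0)) refl 1#)
   coeff zero (suc (suc b)) = via (y₁*-zero (H κ) (suc (suc b))) (y₂*-suc (H κ) 0 (suc b)) (y₂*-suc (inY₁ f) 0 (suc b)) (y₁*-zero (inY₂ f) (suc (suc b))) refl
   coeff (suc zero) zero = via (y₁*-suc (H κ) 0 0) (y₂*-zero (H κ) 1) (y₂*-zero (inY₁ f) 1) (y₁*-suc (inY₂ f) 0 0)
     (Sol.solve 1 (λ e → (Sol.:- e) Sol.:- Sol.con (0 , 0) Sol.:= Sol.con (0 , 0) Sol.:- e) refl 1#)
   coeff (suc (suc a)) zero = via (y₁*-suc (H κ) (suc a) 0) (y₂*-zero (H κ) (suc (suc a))) (y₂*-zero (inY₁ f) (suc (suc a))) (y₁*-suc (inY₂ f) (suc a) 0) refl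
   coeff (suc a) (suc b) = via (y₁*-suc (H κ) a (suc b)) (y₂*-suc (H κ) (suc a) b) (y₂*-suc (inY₁ f) (suc a) b) (y₁*-suc (inY₂ f) a (suc b)) (inner a b)

 *-mono00 : ∀ F → F P₂.* mono 0 0 P₂.≈ F
 *-mono00 F a b = trans (P₂.*-congˡ {F} {mono 0 0} {P₂.1#} mono00≈ a b) (P₂.*-identityʳ F a b)

 mono01≈ : mono 0 1 P₂.≈ y₂
 mono01≈ a b = trans (mono-suc₂ 0 0 a b) (*-mono00 y₂ a b)

 mono10≈ : mono 1 0 P₂.≈ y₁
 mono10≈ a b = trans (mono-suc₁ 0 0 a b) (*-mono00 y₁ a b)

 mono-suc₁₂ : ∀ p q → mono (suc p) (suc q) P₂.≈ y₁ P₂.* y₂ P₂.* mono p q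
 mono-suc₁₂ p q a b = trans (mono-suc₁ p (suc q) a b) (trans (P₂.*-congˡ {y₁} {mono p (suc q)} {y₂ P₂.* mono p q} (mono-suc₂ p q) a b)
   (sym (P₂.*-assoc y₁ y₂ (mono p q) a b)))

 mono11≈ : mono 1 1 P₂.≈ y₁ P₂.* y₂
 mono11≈ a b = trans (mono-suc₁₂ 0 0 a b) (*-mono00 (y₁ P₂.* y₂) a b)

 mono22≈ : mono 2 2 P₂.≈ y₁ P₂.* y₂ P₂.* (y₁ P₂.* y₂)
 mono22≈ a b = trans (mono-suc₁₂ 1 1 a b) (P₂.*-congˡ {y₁ P₂.* y₂} {mono 1 1} {y₁ P₂.* y₂} mono11≈ a b)

 minus-cong : ∀ {F F' G G' : PS2} → F P₂.≈ F' → G P₂.≈ G' → F P₂.- G P₂.≈ F' P₂.- G'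
 minus-cong e e' a b = +-cong (e a b) (-‿cong (e' a b))

 G≈ : G κ P₂.≈ y₂ P₂.* inY₁ f P₂.- y₁ P₂.* inY₂ f
 G≈ = minus-cong {mono 0 1 *₂ inY₁ f} {y₂ P₂.* inY₁ f} {mono 1 0 *₂ inY₂ f} {y₁ P₂.* inY₂ f}
   (*₂-cong {mono 0 1} {y₂} {inY₁ f} {inY₁ f} mono01≈ (λ _ _ → refl)) (*₂-cong {mono 1 0} {y₁} {inY₂ f} {inY₂ f} mono10≈ (λ _ _ → refl))

 Xp≈ : ∀ n → Xp κ n ≈ θ f n - f n
 Xp≈ zero = sym (+-identityˡ _)
 Xp≈ (suc n) = Sol.solve 2 (λ x y → y Sol.:= (x Sol.:+ y) Sol.:- x) refl _ _

 p₁≈ : inY₁ (Xp κ) P₂.≈ inY₁ (θ f) P₂.- inY₁ f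
 p₁≈ a zero = Xp≈ a
 p₁≈ a (suc b) = sym (-‿inverseʳ 0#)

 p₂≈ : inY₂ (Xp κ) P₂.≈ inY₂ (θ f) P₂.- inY₂ f
 p₂≈ zero b = Xp≈ b
 p₂≈ (suc a) b = sym (-‿inverseʳ 0#)

 K≈ : ∀ n → K n ≈ f n - θ f n
 K≈ n = trans (-‿cong (Xp≈ n)) (Sol.solve 2 (λ x y → Sol.:- (x Sol.:- y) Sol.:= y Sol.:- x) refl _ _)

 K₁≈ : inY₁ K P₂.≈ inY₁ f P₂.- inY₁ (θ f)
 K₁≈ a zero = K≈ a
 K₁≈ a (suc b) = sym (-‿inverseʳ 0#)

 K₂≈ : inY₂ K P₂.≈ inY₂ f P₂.- inY₂ (θ f)
 K₂≈ zero b = K≈ b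
 K₂≈ (suc a) b = sym (-‿inverseʳ 0#)

 -- Θ is (1 - d₁d₂)h in the form of the statement, and Q is -d₁d₂ log H, written with S = -1/H.
 W Θ Q : PS2
 W = Wpar2∘X κ κ₂
 Θ = θθ-op (H κ +₂ mono 0 0)
 Q = d₂ (d₁ (H κ) P₂.* S)

 spokeSeries≈ : spokeSeries P₂.≈ Θ P₂.+ Q
 spokeSeries≈ a b = trans (spoke-series a b) (sym (+-cong (θθ≈ a b)
   (d₂-cong {d₁ (H κ) P₂.* S} {d₁ h P₂.* S} (P₂.*-congʳ {S} {d₁ (H κ)} {d₁ h} d₁H≈d₁h) a b)))

 -- The moment identity with K = f - θf, once the spoke series has been separated into the part that
 -- appears in the statement and the logarithmic part.
 moments-cleared : (inY₁ f P₂.- inY₁ (θ f)) P₂.* ((inY₂ f P₂.- inY₂ (θ f)) P₂.* W) P₂.≈ y₁ P₂.* (y₂ P₂.* (y₁ P₂.* (y₂ P₂.* X₂ κ₂) P₂.+ (Θ P₂.+ Q)))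
 moments-cleared a b = trans
   (A-cong {inY₁ f P₂.- inY₁ (θ f)} {inY₁ K} {inY₂ f P₂.- inY₂ (θ f)} {inY₂ K} {W} {W} (P₂.sym {inY₁ K} K₁≈) (P₂.sym {inY₂ K} K₂≈) (λ _ _ → refl) a b)
   (trans (moments₂ a b) (A-cong {y₁} {y₁} {y₂} {y₂} {Y} {U} (λ _ _ → refl) (λ _ _ → refl)
     (λ a b → trans (Y≈ a b) (+-congˡ (spokeSeries≈ a b))) a b))
   where
   V U : PS2
   V = y₁ P₂.* (y₂ P₂.* X₂ κ₂)
   U = V P₂.+ (Θ P₂.+ Q)
   A : PS2 → PS2 → PS2 → PS2
   A F G H = F P₂.* (G P₂.* H)
   A-cong : ∀ {F F' G G' H H'} → F P₂.≈ F' → G P₂.≈ G' → H P₂.≈ H' → A F G H P₂.≈ A F' G' H'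
   A-cong {F} {F'} {G} {G'} {H} {H'} e e' e'' = P₂.*-cong {F} {F'} {G P₂.* H} {G' P₂.* H'} e (P₂.*-cong {G} {G'} {H} {H'} e' e'')

 cylinder : lhsCleared κ κ₂ P₂.≈ rhsCleared κ κ₂
 cylinder = cleared-⊛ d₁-derivation d₂-derivation {_⊛_ = _*₂_} *₂≈
   {y₁} {y₂} {inY₁ f} {inY₂ f} {inY₁ (θ f)} {inY₂ (θ f)} {H κ} {S} {X₂ κ₂} {W} {Θ} {Δ} {G κ}
   {inY₁ (Xp κ)} {inY₂ (Xp κ)} {mono 2 2} {mono 1 1} {mono 0 0}
   d₁-y₁ d₂-y₁ (d₁-const X) d₂-y₂ (d₁-inY₁ f) (d₂-inY₁ f) (d₁-inY₂ f) (d₂-inY₂ f) (d₂-inY₁ (θ f))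
   ΔH H*S moments-cleared (minus-cong {mono 1 0} {y₁} {mono 0 1} {y₂} mono10≈ mono01≈) G≈ p₁≈ p₂≈ mono22≈ mono11≈ mono00≈

theorem4p3 : {c ℓ : Level} (R : CommutativeRing c ℓ)
  (κ : ℕ → CommutativeRing.Carrier R)
  (κ₂ : ℕ → ℕ → CommutativeRing.Carrier R)
  (a b : ℕ) →
  CommutativeRing._≈_ R (Over.lhsCleared R κ κ₂ a b) (Over.rhsCleared R κ κ₂ a b)
theorem4p3 R κ κ₂ a b = Cylinder.cylinder R κ κ₂ a b
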